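{- Let $\Delta$ be a two-dimensional lattice polygon. Then $\mathrm{ls}_\square(\Delta) = \mathrm{ls}_\square(\Delta^{(1)})+2$, except in the following situations, where the values are as stated. 1. $\Delta \simeq \mathrm{conv}\{(0,0),(a,0),(0,1),(b,1)\}$ with $a\ge 2$ and $a\ge b\ge 0$. Then $\mathrm{ls}_\square(\Delta^{(1)}) = -1$ and $\mathrm{ls}_\square(\Delta) = a$. 2. $\Delta \simeq \mathrm{conv}\{(0,0),(2,0),(0,2)\}$. Then $\mathrm{ls}_\square(\Delta^{(1)}) = -1$ and $\mathrm{ls}_\square(\Delta) = 2$. 3. $\Delta$ is equivalent to one of - $\mathrm{conv}\{(0,0),(3,0),(0,3)\}$, - $\mathrm{conv}\{(0,0),(3,0),(0,2)\}$, - $\mathrm{conv}\{(0,0),(3,0),(2,1),(0,2)\}$, - $\mathrm{conv}\{(0,0),(3,0),(1,2),(0,2)\}$. Then $\mathrm{ls}_\square(\Delta^{(1)}) = 0$ and $\mathrm{ls}_\square(\Delta) = 3$. 4. $\Delta \simeq \mathrm{conv}\{(0,0),(4,0),(0,2)\}$. Then $\mathrm{ls}_\square(\Delta^{(1)}) = 0$ and $\mathrm{ls}_\square(\Delta) = 4$. 5. There exist an edge $\tau$ of $\Delta$ and an edge $\tau'$ of $\Delta^{(1)}$ that are parallel, whose supporting lines are at integral distance $1$ from each other, and such that $\sharp(\tau\cap\mathbb{Z}^2) - \sharp(\tau'\cap\mathbb{Z}^2) \ge 3$. Then $\mathrm{ls}_\square(\Delta^{(1)}) = \sharp(\tau'\cap\mathbb{Z}^2)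 - 1$ and $\mathrm{ls}_\square(\Delta) = \sharp(\tau\cap\mathbb{Z}^2) - 1$; that is, both lattice sizes equal the integral lengths of $\tau'$ and $\tau$ respectively.
   Context: A lattice polygon is the convex hull of finitely many points of $\mathbb{Z}^2$; it may be empty, a point or a segment. $\Delta^{(1)}$ is the convex hull of the lattice points in the interior of $\Delta$. A unimodular transformation is an affine map $v\mapsto Av+w$ with $A\in\mathrm{GL}_2(\mathbb{Z})$ and $w\in\mathbb{Z}^2$; $\Delta\simeq\Delta'$ means $\Delta'=\varphi(\Delta)$ for such a $\varphi$. Let $\square=[0,1]^2$. For a non-empty lattice polygon $\Gamma$, $\mathrm{ls}_\square(\Gamma)$ is the smallest integer $d\ge0$ with $\varphi(\Gamma)\subset d\square$ for some unimodular $\varphi$; by convention $\mathrm{ls}_\square(\emptyset)=-1$. An edge is a one-dimensional face; a one-dimensional polygon is an edge of itself. Two parallel lines $aX+bY=c$ and $aX+bY=c'$, with $a,b$ coprime integers and $c,c'\in\mathbb{Z}$, are at integral distance $|c-c'|$. -}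

module Defs where

open import Level using (0ℓ)
open import Data.Nat as ℕ using (ℕ)
open import Data.Nat.Coprimality using (Coprime)
open import Data.Integer as ℤ using (ℤ; +_; -[1+_])
open import Data.Rational as ℚ using (ℚ; 0ℚ; 1ℚ)
open import Data.Product using (Σ; ∃; ∃-syntax; _×_; _,_; proj₁; proj₂)
open import Data.Sum using (_⊎_)
open import Data.List using (List; []; _∷_; foldr; map; length)
open import Data.List.Relation.Unary.All using (All)
open import Data.List.Relation.Unary.Unique.Propositional using (Unique)
open import Data.List.Membership.Propositional using (_∈_)
open import Relation.Binary.PropositionalEquality using (_≡_; _≢_)
open import Relation.Nullary using (¬_)
open import Function.Bundles using (_⇔_)

-- Points.  Subsets of the plane are represented by their rational points
-- (every lattice polygon is the closure of its rational points).

Point : Set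
Point = ℤ × ℤ

QPoint : Set
QPoint = ℚ × ℚ

Region : Set₁
Region = QPoint → Set

toℚ : ℤ → ℚ
toℚ z = z ℚ./ 1

ι : Point → QPoint
ι (x , y) = toℚ x , toℚ y

lincomb : List (ℚ × Point) → QPoint
lincomb = foldr (λ wp acc → (proj₁ wp ℚ.* proj₁ (ι (proj₂ wp)) ℚ.+ proj₁ acc)
                          , (proj₁ wp ℚ.* proj₂ (ι (proj₂ wp)) ℚ.+ proj₂ acc))
                (0ℚ , 0ℚ)

weightSum : List (ℚ × Point) → ℚ
weightSum c = foldr ℚ._+_ 0ℚ (map proj₁ c)

Conv : (Point → Set) → Region
Conv P q = ∃[ c ] (All (λ wp → (0ℚ ℚ.≤ proj₁ wp) × P (proj₂ wp)) c
                   × weightSum c ≡ 1ℚ × lincomb c ≡ q)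

Poly : List Point → Region
Poly S = Conv (_∈ S)

Seg : Point → Point → Region
Seg u v = Poly (u ∷ v ∷ [])

InteriorPt : Region → Point → Set
InteriorPt X p = ∃[ ε ] (0ℚ ℚ.< ε) ×
  (∀ (q : QPoint) → ℚ.∣ proj₁ q ℚ.- proj₁ (ι p) ∣ ℚ.< ε
                  → ℚ.∣ proj₂ q ℚ.- proj₂ (ι p) ∣ ℚ.< ε → X q)

IntHull : Region → Region
IntHull X = Conv (InteriorPt X)

det : Point → Point → Point → ℤ
det (px , py) (qx , qy) (rx , ry) =
  (qx ℤ.- px) ℤ.* (ry ℤ.- py) ℤ.- (qy ℤ.- py) ℤ.* (rx ℤ.- px)

TwoDim : List Point → Set
TwoDim S = ∃[ p ] ∃[ q ] ∃[ r ] (p ∈ S × q ∈ S × r ∈ S × det p q r ≢ + 0)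

record Unimodular : Set where
  field
    a b c d e f : ℤ
    unimod : (a ℤ.* d ℤ.- b ℤ.* c ≡ + 1) ⊎ (a ℤ.* d ℤ.- b ℤ.* c ≡ -[1+ 0 ])

apply : Unimodular → QPoint → QPoint
apply φ (x , y) =
  (toℚ a ℚ.* x ℚ.+ toℚ b ℚ.* y ℚ.+ toℚ e) ,
  (toℚ c ℚ.* x ℚ.+ toℚ d ℚ.* y ℚ.+ toℚ f)
  where open Unimodular φ

Image : Unimodular → Region → Region
Image φ X q = ∃[ q' ] (X q' × apply φ q' ≡ q)

_≃_ : Region → Region → Set
X ≃ Y = ∃[ φ ] (∀ q → Y q ⇔ Image φ X q)

Box : ℕ → Region
Box d (x , y) = (0ℚ ℚ.≤ x) × (x ℚ.≤ toℚ (+ d)) × (0ℚ ℚ.≤ y) × (y ℚ.≤ toℚ (+ d))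

FitsIn : Region → ℕ → Set
FitsIn X d = ∃[ φ ] (∀ q → X q → Box d (apply φ q))

NonEmpty : Region → Set
NonEmpty X = ∃[ q ] X q

IsLS : Region → ℤ → Set
IsLS X n =
  ((¬ NonEmpty X) × n ≡ -[1+ 0 ])
  ⊎ (∃[ d ] (n ≡ + d × NonEmpty X × FitsIn X d × (∀ d' → d' ℕ.< d → ¬ FitsIn X d')))

lin : ℤ → ℤ → QPoint → ℚ
lin α β (x , y) = toℚ α ℚ.* x ℚ.+ toℚ β ℚ.* y

Edge : Region → Point → Point → Set
Edge X u v = u ≢ v × X (ι u) × X (ι v) ×
  ∃[ α ] ∃[ β ] (¬ (α ≡ + 0 × β ≡ + 0)
    × lin α β (ι u) ≡ lin α β (ι v)
    × (∀ q → X q → lin α β q ℚ.≤ lin α β (ι u))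
    × (∀ q → X q → lin α β q ≡ lin α β (ι u) → Seg u v q))

Parallel : Point → Point → Point → Point → Set
Parallel (ux , uy) (vx , vy) (u'x , u'y) (v'x , v'y) =
  (vx ℤ.- ux) ℤ.* (v'y ℤ.- u'y) ℤ.- (vy ℤ.- uy) ℤ.* (v'x ℤ.- u'x) ≡ + 0

LineDist1 : Point → Point → Point → Point → Set
LineDist1 (ux , uy) (vx , vy) (u'x , u'y) (v'x , v'y) =
  ∃[ α ] ∃[ β ] ∃[ γ ] ∃[ γ' ] (Coprime ℤ.∣ α ∣ ℤ.∣ β ∣
    × α ℤ.* ux ℤ.+ β ℤ.* uy ≡ γ × α ℤ.* vx ℤ.+ β ℤ.* vy ≡ γ
    × α ℤ.* u'x ℤ.+ β ℤ.* u'y ≡ γ' × α ℤ.* v'x ℤ.+ β ℤ.* v'y ≡ γ'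
    × ℤ.∣ γ ℤ.- γ' ∣ ≡ 1)

LatticeCount : Region → ℕ → Set
LatticeCount X k = ∃[ L ] (Unique L × length L ≡ k × (∀ (p : Point) → (p ∈ L) ⇔ X (ι p)))

pt : ℕ → ℕ → Point
pt x y = + x , + y

Case1 : Region → ℕ → ℕ → Set
Case1 Δ a b = (2 ℕ.≤ a) × (b ℕ.≤ a) × (Δ ≃ Poly (pt 0 0 ∷ pt a 0 ∷ pt 0 1 ∷ pt b 1 ∷ []))

Case2 : Region → Set
Case2 Δ = Δ ≃ Poly (pt 0 0 ∷ pt 2 0 ∷ pt 0 2 ∷ [])

Case3 : Region → Set
Case3 Δ = (Δ ≃ Poly (pt 0 0 ∷ pt 3 0 ∷ pt 0 3 ∷ []))
        ⊎ (Δ ≃ Poly (pt 0 0 ∷ pt 3 0 ∷ pt 0 2 ∷ []))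
        ⊎ (Δ ≃ Poly (pt 0 0 ∷ pt 3 0 ∷ pt 2 1 ∷ pt 0 2 ∷ []))
        ⊎ (Δ ≃ Poly (pt 0 0 ∷ pt 3 0 ∷ pt 1 2 ∷ pt 0 2 ∷ []))

Case4 : Region → Set
Case4 Δ = Δ ≃ Poly (pt 0 0 ∷ pt 4 0 ∷ pt 0 2 ∷ [])

Case5 : Region → Point → Point → Point → Point → ℕ → ℕ → Set
Case5 Δ u v u' v' k k' =
  Edge Δ u v × Edge (IntHull Δ) u' v' × Parallel u v u' v' × LineDist1 u v u' v'
  × LatticeCount (Seg u v) k × LatticeCount (Seg u' v') k' × (k' ℕ.+ 3 ℕ.≤ k)

{-# OPTIONS --safe #-}

-- Call a linear form on ℤ² simply a form, and let its width on a set be max − min.  A set fits in d□ iff the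
-- dual lattice has a basis of forms of width ≤ d on it; a primitive form and an independent form, both of
-- width ≤ d, can always be reduced to such a basis.  Passing to interior lattice points loses one unit at both
-- ends of every form, so ls(Δ) ≥ ls(Δ⁽¹⁾) + 2.
-- Conversely, let Δ⁽¹⁾ ≠ ∅ fit in d□, let y be a form of minimal width on Δ, and let f have minimal width on Δ
-- among the forms independent of y that have width ≤ d on Δ⁽¹⁾.  If f has width H ≥ d + 3 on Δ then, up to
-- sign, a lowest vertex v of Δ lies at least two levels below a lowest interior lattice point p.  Choose
-- coordinates X, Z with origin v such that f = X + Z and X, Z > 0 at p.  As no interior lattice point lies
-- below p, one finds X, Z ≥ 0 on Δ and that X, Z have width ≤ d on Δ⁽¹⁾.  One of them is independent of y, so by
-- minimality of f it has width ≥ H on Δ: hence Δ lies in the triangle HΣ and contains an edge of it.  Either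
-- the line next to that edge carries two interior lattice points, which is situation 5, or H ≤ 4 and Δ is one
-- of the polygons of situations 3 and 4.
-- If Δ⁽¹⁾ = ∅, let y have minimal width on Δ: width 1 gives situation 1 or a polygon inside □, and width ≥ 2
-- leaves only 2Σ because the section next to the lowest edge has no lattice point in its interior.
module Submission where

open import Defs
open import Level using (0ℓ)
import Data.Bool as Bool
open import Data.Empty using (⊥; ⊥-elim)
open import Data.Unit using (⊤; tt)
open import Data.Nat as ℕ using (ℕ; zero; suc; z≤n; s≤s)
import Data.Nat.Properties as ℕP
import Data.Nat.Divisibility as ℕDiv
open import Data.Nat.Coprimality as Cop using (Coprime)
open import Data.Nat.GCD using (module Bézout)
open import Data.Integer as ℤ using (ℤ; +_; -[1+_]; _+_; _*_; _-_; -_)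
import Data.Integer.Properties as ℤP
import Data.Integer.DivMod as ℤD
import Data.Integer.Divisibility.Signed as ℤDiv
open import Data.Integer.Tactic.RingSolver using (solve; solve-∀)
open import Data.Rational as ℚ using (ℚ; 0ℚ; 1ℚ)
import Data.Rational.Properties as ℚP
import Data.Rational.Unnormalised as ℚᵘ
import Data.Rational.Unnormalised.Properties as ℚᵘP
open import Data.Product using (∃-syntax; _×_; _,_; proj₁; proj₂)
open import Data.Sum using (_⊎_; inj₁; inj₂; [_,_]′)
open import Data.List using (List; []; _∷_; map; length; upTo)
open import Data.List.Properties using (length-map; length-upTo)
open import Data.List.Relation.Unary.All as All using (All)
open import Data.List.Relation.Unary.Any as Any using (here; there)
import Data.List.Relation.Unary.AllPairs as AllPairs
open import Data.List.Relation.Unary.Unique.Propositional using (Unique)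
import Data.List.Relation.Unary.Unique.Propositional.Properties as Unique
open import Data.List.Membership.Propositional using (_∈_; find; lose)
open import Data.List.Membership.Propositional.Properties using (∈-map⁺; ∈-map⁻; ∈-upTo⁺; ∈-upTo⁻)
open import Relation.Binary.PropositionalEquality using (_≡_; _≢_; refl; sym; trans; cong; cong₂; subst; subst₂)
open import Relation.Nullary using (¬_; Dec; yes; no)
open import Relation.Nullary.Decidable using (dec⇒maybe; map′; _×-dec_; _⊎-dec_; _→-dec_; ¬?)
open import Relation.Unary using (Decidable)
open import Function.Bundles using (mk⇔; Equivalence)
import Tactic.RingSolver as TR
import Tactic.RingSolver.Core.AlmostCommutativeRing as ACR

-- A box needs two independent short forms, and fixing `y` of minimal width reduces the search to
-- one: whatever independent form f is found, `y` is at least as short. The threshold d + 3 is the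
-- first at which some end of f must be two levels away from the interior points: they occupy at
-- most d levels, and one level at each end accounts for d + 2. Two levels are what makes a lattice
-- point strictly between v and p available. The 3 in situation 5 arises likewise: in nΣ the
-- interior points next to the bottom edge satisfy 1 ≤ x ≤ n - 2.
--
-- The obstacle is constructive. The minimal forms and lowest interior points exist only up to
-- double negation, so the core of the argument refutes that Δ fails to fit. Actual lattice sizes
-- come out because a two-dimensional set has only finitely many forms of bounded width, which makes
-- fitting decidable. Interior points, given by rational neighbourhoods, have to be decidable too;
-- they are therefore characterised by sign conditions on the finite list of generators.

infix 4 0≤_
infixl 6 _⊕_
infixl 7 _⊗_

-- Integer inequalities and Bézout coefficients

-- Inequalities are kept in the form 0≤ e, with x < y written 0≤ (y - x - + 1), so that every step is a
-- nonnegative combination of hypotheses whose value is checked by the ring solver.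
0≤_ : ℤ → Set
0≤ x = + 0 ℤ.≤ x

-- Opaque, because type checking would otherwise evaluate the ring-solver proofs passed to ≥0-cong.
abstract
  _⊕_ : ∀ {x y} → + 0 ℤ.≤ x → + 0 ℤ.≤ y → + 0 ℤ.≤ x + y
  _⊕_ = ℤP.+-mono-≤

  _⊗_ : ∀ {x y} → + 0 ℤ.≤ x → + 0 ℤ.≤ y → + 0 ℤ.≤ x * y
  _⊗_ {+ m} {+ n} _ _ = subst 0≤_ (ℤP.pos-* m n) (ℤ.+≤+ z≤n)

  nat≥0 : ∀ {n} → 0≤ + n
  nat≥0 = ℤ.+≤+ z≤n

  ≥0-cong : ∀ {x y} → + 0 ℤ.≤ x → x ≡ y → + 0 ℤ.≤ y
  ≥0-cong h refl = h

≡⇒≥0 : ∀ {x} → x ≡ + 0 → 0≤ x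
≡⇒≥0 refl = nat≥0

0≤? : ∀ x → Dec (0≤ x)
0≤? x = + 0 ℤP.≤? x

≱0⇒ : ∀ {x} → ¬ 0≤ x → 0≤ (- x - + 1)
≱0⇒ {+ n} h = ⊥-elim (h nat≥0)
≱0⇒ { -[1+ n ]} h = nat≥0

signs : ∀ x → 0≤ x ⊎ 0≤ (- x - + 1)
signs (+ n) = inj₁ nat≥0
signs -[1+ n ] = inj₂ nat≥0

¬≤-1 : ¬ (0≤ -[1+ 0 ])
¬≤-1 ()

abstract
  absurd : ∀ {x} → + 0 ℤ.≤ x → x ≡ -[1+ 0 ] → ⊥
  absurd h refl = ¬≤-1 h

  ≥0-antisym : ∀ {x} → 0≤ x → 0≤ (- x) → x ≡ + 0
  ≥0-antisym {+ zero} _ _ = refl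

clash : ∀ {x} → + 0 ℤ.≤ x → 0≤ (- x - + 1) → ⊥
clash {x} h k = absurd (k ⊕ h) (lem x)
  where
  lem : ∀ x → - x - + 1 + x ≡ -[1+ 0 ]
  lem = solve-∀

≥0-total : ∀ x y → 0≤ (x - y) ⊎ 0≤ (y - x)
≥0-total x y = [ inj₁ , (λ h → inj₂ (≥0-cong (h ⊕ nat≥0 {1}) (lem x y))) ]′ (signs (x - y))
  where
  lem : ∀ x y → - (x - y) - + 1 + + 1 ≡ y - x
  lem = solve-∀

≥0-trans : ∀ x y z → 0≤ (x - y) → 0≤ (y - z) → 0≤ (x - z)
≥0-trans x y z h k = ≥0-cong (h ⊕ k) (lem x y z)
  where
  lem : ∀ x y z → x - y + (y - z) ≡ x - z
  lem = solve-∀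

trichotomy : ∀ x → 0≤ (x - + 1) ⊎ x ≡ + 0 ⊎ 0≤ (- x - + 1)
trichotomy (+ zero) = inj₂ (inj₁ refl)
trichotomy (+ (suc n)) = inj₁ nat≥0
trichotomy -[1+ n ] = inj₂ (inj₂ nat≥0)

zero? : ∀ x → Dec (x ≡ + 0)
zero? x = x ℤP.≟ + 0

abstract
  -- Integrality replaces division: a·b > -a with a > 0 gives b > -1, hence b ≥ 0. The slack of a -
  -- 1 absorbs the roundings.
  ≥0-cancel : ∀ a b → 0≤ (a - + 1) → 0≤ (a * b + a - + 1) → 0≤ b
  ≥0-cancel a b ha h = go (signs b)
    where
    go : 0≤ b ⊎ 0≤ (- b - + 1) → 0≤ b
    go (inj₁ hb) = hb
    go (inj₂ hb) = ⊥-elim (absurd (h ⊕ ha ⊗ hb ⊕ hb) (solve (a ∷ b ∷ [])))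

≥0-nat : ∀ {x} → 0≤ x → ∃[ n ] x ≡ + n
≥0-nat {+ n} _ = n , refl

divide : ∀ a b → 0≤ (b - + 1) →
  ∃[ c ] ∃[ r ] (a ≡ c * b + r × 0≤ r × 0≤ (b - + 1 - r))
divide a (+ suc n) hb = c , r , trans (ℤD.a≡a%ℕn+[a/ℕn]*n a (suc n)) (ℤP.+-comm r (c * + suc n)) , nat≥0 ,
  ≥0-cong (ℤP.i≤j⇒0≤j-i (ℤ.+≤+ (ℕ.s≤s⁻¹ (ℤD.n%ℕd<d a (suc n))))) (lem (+ n) r)
  where
  c = a ℤD./ℕ suc n
  r = + (a ℤD.%ℕ suc n)
  lem : ∀ n r → n - r ≡ + 1 + n - + 1 - r
  lem = solve-∀
divide a (+ zero) hb = ⊥-elim (¬≤-1 hb)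
divide a -[1+ n ] ()

∣∣-cases : ∀ x → (x ≡ + ℤ.∣ x ∣) ⊎ (x ≡ - (+ ℤ.∣ x ∣))
∣∣-cases (+ n) = inj₁ refl
∣∣-cases -[1+ n ] = inj₂ refl

unsigned : ∀ x → ∃[ s ] (s * s ≡ + 1 × + ℤ.∣ x ∣ ≡ s * x)
unsigned (+ n) = + 1 , refl , sym (ℤP.*-identityˡ (+ n))
unsigned -[1+ n ] = -[1+ 0 ] , refl , sym (ℤP.-1*i≡-i -[1+ n ])

bezout-nat : ∀ m n → Coprime m n → ∃[ x ] ∃[ y ] x * + m - y * + n ≡ + 1
bezout-nat m n cop = from (Cop.coprime-Bézout cop)
  where
  lift : ∀ {x y m n} → 1 ℕ.+ y ℕ.* n ≡ x ℕ.* m → + x * + m ≡ + 1 + + y * + n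
  lift {x} {y} {m} {n} e = trans (sym (ℤP.pos-* x m)) (trans (cong +_ (sym e)) (cong (λ z → + 1 + z) (ℤP.pos-* y n)))
  fin : ∀ {u} v → u ≡ + 1 + v → u - v ≡ + 1
  fin v refl = lem v
    where
    lem : ∀ v → + 1 + v - v ≡ + 1
    lem = solve-∀
  neg : ∀ x y m n → - y * m - - x * n ≡ x * n - y * m
  neg = solve-∀
  from : Bézout.Identity 1 m n → ∃[ x ] ∃[ y ] x * + m - y * + n ≡ + 1
  from (Bézout.+- x y eq) = + x , + y , fin _ (lift {x} {y} eq)
  from (Bézout.-+ x y eq) = - (+ x) , - (+ y) , trans (neg (+ y) (+ x) (+ m) (+ n)) (fin _ (lift {y} {x} eq))

bezout : ∀ α β → Coprime ℤ.∣ α ∣ ℤ.∣ β ∣ → ∃[ γ ] ∃[ δ ] γ * β - δ * α ≡ + 1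
bezout α β cop = from (unsigned α) (unsigned β) (bezout-nat _ _ cop)
  where
  lem : ∀ x y s t α β → - (y * t) * β - - (x * s) * α ≡ x * (s * α) - y * (t * β)
  lem = solve-∀
  from : ∃[ s ] (s * s ≡ + 1 × + ℤ.∣ α ∣ ≡ s * α) → ∃[ t ] (t * t ≡ + 1 × + ℤ.∣ β ∣ ≡ t * β) →
    ∃[ x ] ∃[ y ] x * + ℤ.∣ α ∣ - y * + ℤ.∣ β ∣ ≡ + 1 → ∃[ γ ] ∃[ δ ] γ * β - δ * α ≡ + 1
  from (s , _ , sα) (t , _ , tβ) (x , y , e) = - (y * t) , - (x * s) ,
    trans (lem x y s t α β) (trans (cong₂ (λ a b → x * a - y * b) (sym sα) (sym tβ)) e)

-- Rational arithmetic and the embedding of the integers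

ℚring : ACR.AlmostCommutativeRing 0ℓ 0ℓ
ℚring = ACR.fromCommutativeRing ℚP.+-*-commutativeRing (λ x → dec⇒maybe (0ℚ ℚP.≟ x))

toℚᵘ-toℚ : ∀ z → ℚ.toℚᵘ (toℚ z) ℚᵘ.≃ ℚᵘ.mkℚᵘ z 0
toℚᵘ-toℚ z = ℚP.toℚᵘ-fromℚᵘ (ℚᵘ.mkℚᵘ z 0)

toℚ-+ : ∀ a b → toℚ (a + b) ≡ toℚ a ℚ.+ toℚ b
toℚ-+ a b = ℚP.toℚᵘ-injective (ℚᵘP.≃-trans (toℚᵘ-toℚ (a + b))
  (ℚᵘP.≃-trans (ℚᵘ.*≡* (lem a b))
  (ℚᵘP.≃-trans (ℚᵘP.≃-sym (ℚᵘP.+-cong (toℚᵘ-toℚ a) (toℚᵘ-toℚ b)))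
               (ℚᵘP.≃-sym (ℚP.toℚᵘ-homo-+ (toℚ a) (toℚ b))))))
  where
  lem : ∀ a b → (a + b) * + 1 ≡ (a * + 1 + b * + 1) * + 1
  lem = solve-∀

toℚ-* : ∀ a b → toℚ (a * b) ≡ toℚ a ℚ.* toℚ b
toℚ-* a b = ℚP.toℚᵘ-injective (ℚᵘP.≃-trans (toℚᵘ-toℚ (a * b))
  (ℚᵘP.≃-trans (ℚᵘ.*≡* refl)
  (ℚᵘP.≃-trans (ℚᵘP.≃-sym (ℚᵘP.*-cong (toℚᵘ-toℚ a) (toℚᵘ-toℚ b)))
               (ℚᵘP.≃-sym (ℚP.toℚᵘ-homo-* (toℚ a) (toℚ b))))))

toℚ-neg : ∀ a → toℚ (- a) ≡ ℚ.- toℚ a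
toℚ-neg a = ℚP.toℚᵘ-injective (ℚᵘP.≃-trans (toℚᵘ-toℚ (- a))
  (ℚᵘP.≃-trans (ℚᵘP.≃-sym (ℚᵘP.-‿cong (toℚᵘ-toℚ a)))
               (ℚᵘP.≃-sym (ℚP.toℚᵘ-homo‿- (toℚ a)))))

toℚ-sub : ∀ a b → toℚ (a - b) ≡ toℚ a ℚ.- toℚ b
toℚ-sub a b = trans (toℚ-+ a (- b)) (cong (toℚ a ℚ.+_) (toℚ-neg b))

toℚ-mono : ∀ {a b} → a ℤ.≤ b → toℚ a ℚ.≤ toℚ b
toℚ-mono {a} {b} h = ℚP.toℚᵘ-cancel-≤
  (ℚᵘP.≤-trans (ℚᵘP.≤-reflexive (toℚᵘ-toℚ a))
  (ℚᵘP.≤-trans (ℚᵘ.*≤* (ℤP.*-monoʳ-≤-nonNeg (+ 1) h))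
               (ℚᵘP.≤-reflexive (ℚᵘP.≃-sym (toℚᵘ-toℚ b)))))

toℚ-cancel : ∀ {a b} → toℚ a ℚ.≤ toℚ b → a ℤ.≤ b
toℚ-cancel {a} {b} h =
  ℤP.*-cancelʳ-≤-pos a b (+ 1) (ℚᵘP.drop-*≤*
    (ℚᵘP.≤-trans (ℚᵘP.≤-reflexive (ℚᵘP.≃-sym (toℚᵘ-toℚ a)))
    (ℚᵘP.≤-trans (ℚP.toℚᵘ-mono-≤ h) (ℚᵘP.≤-reflexive (toℚᵘ-toℚ b)))))

toℚ-injective : ∀ {a b} → toℚ a ≡ toℚ b → a ≡ b
toℚ-injective e = ℤP.≤-antisym (toℚ-cancel (ℚP.≤-reflexive e)) (toℚ-cancel (ℚP.≤-reflexive (sym e)))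

ι-injective : ∀ {p q} → ι p ≡ ι q → p ≡ q
ι-injective e = cong₂ _,_ (toℚ-injective (cong proj₁ e)) (toℚ-injective (cong proj₂ e))

≥0-*ℚ : ∀ {p q} → 0ℚ ℚ.≤ p → 0ℚ ℚ.≤ q → 0ℚ ℚ.≤ p ℚ.* q
≥0-*ℚ {p} {q} hp hq = ℚP.nonNegative⁻¹ _
  {{ℚP.nonNeg*nonNeg⇒nonNeg p {{ℚ.nonNegative hp}} q {{ℚ.nonNegative hq}}}}

≥0-+ℚ : ∀ {p q} → 0ℚ ℚ.≤ p → 0ℚ ℚ.≤ q → 0ℚ ℚ.≤ p ℚ.+ q
≥0-+ℚ = ℚP.+-mono-≤

≤⇒0≤-ℚ : ∀ {p q} → p ℚ.≤ q → 0ℚ ℚ.≤ q ℚ.- p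
≤⇒0≤-ℚ {p} {q} h = subst (ℚ._≤ q ℚ.- p) (ℚP.+-inverseʳ p) (ℚP.+-monoˡ-≤ (ℚ.- p) h)

0≤-⇒≤ℚ : ∀ {p q} → 0ℚ ℚ.≤ q ℚ.- p → p ℚ.≤ q
0≤-⇒≤ℚ {p} {q} h = subst₂ ℚ._≤_ (ℚP.+-identityˡ p) (lem q p) (ℚP.+-monoˡ-≤ p h)
  where
  lem : ∀ q p → q ℚ.- p ℚ.+ p ≡ q
  lem = TR.solve-∀ ℚring

≥0-antisymℚ : ∀ {p q} → 0ℚ ℚ.≤ p → 0ℚ ℚ.≤ q → p ℚ.+ q ≡ 0ℚ → p ≡ 0ℚ
≥0-antisymℚ {p} {q} hp hq e = ℚP.≤-antisym
  (subst (p ℚ.≤_) e (subst (ℚ._≤ p ℚ.+ q) (ℚP.+-identityʳ p) (ℚP.+-monoʳ-≤ p hq))) hp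

*≡0-ℚ : ∀ w f → w ℚ.* f ≡ 0ℚ → w ≢ 0ℚ → f ≡ 0ℚ
*≡0-ℚ w f e w≢0 = trans (sym (ℚP.*-identityˡ f))
  (trans (cong (ℚ._* f) (sym (ℚP.*-inverseˡ w {{nz}})))
  (trans (ℚP.*-assoc ((ℚ.1/ w) {{nz}}) w f)
  (trans (cong ((ℚ.1/ w) {{nz}} ℚ.*_) e) (ℚP.*-zeroʳ ((ℚ.1/ w) {{nz}})))))
  where nz = ℚ.≢-nonZero w≢0

-- Convex hulls

-- Weighted combinations of total weight W; Conv P is the case W = 1.
Cone : (Point → Set) → ℚ → QPoint → Set
Cone P W q = ∃[ c ] (All (λ wp → (0ℚ ℚ.≤ proj₁ wp) × P (proj₂ wp)) c
                   × weightSum c ≡ W × lincomb c ≡ q)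

cone-∷ : ∀ {P W x y} w {p} → 0ℚ ℚ.≤ w → P p → Cone P W (x , y) →
  Cone P (w ℚ.+ W) (w ℚ.* toℚ (proj₁ p) ℚ.+ x , w ℚ.* toℚ (proj₂ p) ℚ.+ y)
cone-∷ w {p} hw hp (c , hc , refl , refl) = (w , p) ∷ c , (hw , hp) All.∷ hc , refl , refl

cone-[] : ∀ {P} → Cone P 0ℚ (0ℚ , 0ℚ)
cone-[] = [] , All.[] , refl , refl

cone-ind : ∀ {P} (Q : ℚ → QPoint → Set) → Q 0ℚ (0ℚ , 0ℚ) →
  (∀ w p W x y → 0ℚ ℚ.≤ w → P p → Q W (x , y) →
    Q (w ℚ.+ W) (w ℚ.* toℚ (proj₁ p) ℚ.+ x , w ℚ.* toℚ (proj₂ p) ℚ.+ y)) →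
  ∀ {W q} → Cone P W q → Q W q
cone-ind Q z s ([] , _ , refl , refl) = z
cone-ind Q z s ((w , p) ∷ c , (hw , hp) All.∷ hc , refl , refl) =
  s w p _ _ _ hw hp (cone-ind Q z s (c , hc , refl , refl))

cone-cast : ∀ {P W W' x x' y y'} → W ≡ W' → x ≡ x' → y ≡ y' → Cone P W (x , y) → Cone P W' (x' , y')
cone-cast refl refl refl h = h

cone-+ : ∀ {P W x y W' x' y'} → Cone P W (x , y) → Cone P W' (x' , y') →
  Cone P (W ℚ.+ W') (x ℚ.+ x' , y ℚ.+ y')
cone-+ {P} {W} {x} {y} {W'} {x'} {y'} h h' = cone-ind
  (λ W q → Cone P (W ℚ.+ W') (proj₁ q ℚ.+ x' , proj₂ q ℚ.+ y'))
  (cone-cast (sym (ℚP.+-identityˡ W')) (sym (ℚP.+-identityˡ x')) (sym (ℚP.+-identityˡ y')) h')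
  (λ w p W x y hw hp ih → cone-cast (sym (ℚP.+-assoc w W W')) (sym (ℚP.+-assoc (w ℚ.* toℚ (proj₁ p)) x x'))
    (sym (ℚP.+-assoc (w ℚ.* toℚ (proj₂ p)) y y')) (cone-∷ w hw hp ih)) h

cone-scale : ∀ {P W x y} t → 0ℚ ℚ.≤ t → Cone P W (x , y) → Cone P (t ℚ.* W) (t ℚ.* x , t ℚ.* y)
cone-scale {P} t ht = cone-ind (λ W q → Cone P (t ℚ.* W) (t ℚ.* proj₁ q , t ℚ.* proj₂ q))
  (cone-cast (sym (ℚP.*-zeroʳ t)) (sym (ℚP.*-zeroʳ t)) (sym (ℚP.*-zeroʳ t)) cone-[])
  (λ w p W x y hw hp ih → cone-cast (sym (ℚP.*-distribˡ-+ t w W)) (lem t w (toℚ (proj₁ p)) x) (lem t w (toℚ (proj₂ p)) y)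
    (cone-∷ (t ℚ.* w) (≥0-*ℚ ht hw) hp ih))
  where
  lem : ∀ t w a x → t ℚ.* w ℚ.* a ℚ.+ t ℚ.* x ≡ t ℚ.* (w ℚ.* a ℚ.+ x)
  lem = TR.solve-∀ ℚring

form-zero : ∀ a b e → 0ℚ ≡ a ℚ.* 0ℚ ℚ.+ b ℚ.* 0ℚ ℚ.+ 0ℚ ℚ.* e
form-zero = TR.solve-∀ ℚring

-- An affine form is not additive along partial combinations, but its homogenisation a x + b y + W e
-- is, with W the weight collected so far. This is the induction step of the affine statements about
-- hulls.
form-step : ∀ a b e w u v W x y →
  w ℚ.* (a ℚ.* u ℚ.+ b ℚ.* v ℚ.+ e) ℚ.+ (a ℚ.* x ℚ.+ b ℚ.* y ℚ.+ W ℚ.* e) ≡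
  a ℚ.* (w ℚ.* u ℚ.+ x) ℚ.+ b ℚ.* (w ℚ.* v ℚ.+ y) ℚ.+ (w ℚ.+ W) ℚ.* e
form-step = TR.solve-∀ ℚring

cone-affine : ∀ {P P'} (a b e c d f : ℚ) →
  (∀ p → P p → Conv P' (a ℚ.* toℚ (proj₁ p) ℚ.+ b ℚ.* toℚ (proj₂ p) ℚ.+ e ,
                        c ℚ.* toℚ (proj₁ p) ℚ.+ d ℚ.* toℚ (proj₂ p) ℚ.+ f)) →
  ∀ {W x y} → Cone P W (x , y) →
  Cone P' W (a ℚ.* x ℚ.+ b ℚ.* y ℚ.+ W ℚ.* e , c ℚ.* x ℚ.+ d ℚ.* y ℚ.+ W ℚ.* f)
cone-affine {P} {P'} a b e c d f h = cone-ind
  (λ W q → Cone P' W (a ℚ.* proj₁ q ℚ.+ b ℚ.* proj₂ q ℚ.+ W ℚ.* e ,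
                      c ℚ.* proj₁ q ℚ.+ d ℚ.* proj₂ q ℚ.+ W ℚ.* f))
  (cone-cast refl (form-zero a b e) (form-zero c d f) cone-[])
  (λ w p W x y hw hp ih → cone-cast (cong (ℚ._+ W) (ℚP.*-identityʳ w))
    (form-step a b e w (toℚ (proj₁ p)) (toℚ (proj₂ p)) W x y) (form-step c d f w (toℚ (proj₁ p)) (toℚ (proj₂ p)) W x y) (cone-+ (cone-scale w hw (h p hp)) ih))

affℚ : ℤ → ℤ → ℤ → QPoint → ℚ
affℚ α β ε (x , y) = toℚ α ℚ.* x ℚ.+ toℚ β ℚ.* y ℚ.+ toℚ ε

aff : ℤ → ℤ → ℤ → Point → ℤ
aff α β ε (x , y) = α * x + β * y + ε

affℚ-ι : ∀ α β ε p → affℚ α β ε (ι p) ≡ toℚ (aff α β ε p)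
affℚ-ι α β ε (x , y) = sym (trans (toℚ-+ (α * x + β * y) ε)
  (cong (ℚ._+ toℚ ε) (trans (toℚ-+ (α * x) (β * y)) (cong₂ ℚ._+_ (toℚ-* α x) (toℚ-* β y)))))

hull-≥0ℚ : ∀ {P} α β ε → (∀ p → P p → 0≤ aff α β ε p) → ∀ {q} → Conv P q → 0ℚ ℚ.≤ affℚ α β ε q
hull-≥0ℚ {P} α β ε h {x , y} hq = subst (0ℚ ℚ.≤_)
  (cong (toℚ α ℚ.* x ℚ.+ toℚ β ℚ.* y ℚ.+_) (ℚP.*-identityˡ (toℚ ε)))
  (cone-ind (λ W q → 0ℚ ℚ.≤ toℚ α ℚ.* proj₁ q ℚ.+ toℚ β ℚ.* proj₂ q ℚ.+ W ℚ.* toℚ ε)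
    (ℚP.≤-reflexive (form-zero (toℚ α) (toℚ β) (toℚ ε)))
    (λ w p W x y hw hp ih → subst (0ℚ ℚ.≤_) (form-step (toℚ α) (toℚ β) (toℚ ε) w (toℚ (proj₁ p)) (toℚ (proj₂ p)) W x y)
      (≥0-+ℚ (≥0-*ℚ hw (subst (0ℚ ℚ.≤_) (sym (affℚ-ι α β ε p)) (toℚ-mono (h p hp)))) ih))
    hq)

hull-≥0 : ∀ {P} α β ε → (∀ p → P p → 0≤ aff α β ε p) → ∀ {r} → Conv P (ι r) → 0≤ aff α β ε r
hull-≥0 α β ε h {r} hr = toℚ-cancel (subst (0ℚ ℚ.≤_) (affℚ-ι α β ε r) (hull-≥0ℚ α β ε h hr))

-- A vanishing sum of nonnegative terms vanishes termwise, so a point of nonzero weight lies on the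
-- face. An entry of weight zero says nothing about its point and is dropped from the combination.
hull-face : ∀ {P} α β ε → (∀ p → P p → 0≤ aff α β ε p) → ∀ {q} → Conv P q → affℚ α β ε q ≡ 0ℚ →
  Conv (λ p → P p × aff α β ε p ≡ + 0) q
hull-face {P} α β ε h {x , y} hq e = proj₂ (cone-ind Q
    (ℚP.≤-reflexive (form-zero (toℚ α) (toℚ β) (toℚ ε)) , λ _ → cone-[]) step hq)
    (trans (cong (toℚ α ℚ.* x ℚ.+ toℚ β ℚ.* y ℚ.+_) (ℚP.*-identityˡ (toℚ ε))) e)
  where
  A = toℚ α
  B = toℚ β
  E = toℚ ε
  P₀ : Point → Set
  P₀ p = P p × aff α β ε p ≡ + 0
  val : ℚ → QPoint → ℚ
  val W q = A ℚ.* proj₁ q ℚ.+ B ℚ.* proj₂ q ℚ.+ W ℚ.* E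
  Q : ℚ → QPoint → Set
  Q W q = 0ℚ ℚ.≤ val W q × (val W q ≡ 0ℚ → Cone P₀ W q)
  drop : ∀ u x → x ≡ 0ℚ ℚ.* u ℚ.+ x
  drop = TR.solve-∀ ℚring
  step : ∀ w p W x y → 0ℚ ℚ.≤ w → P p → Q W (x , y) →
    Q (w ℚ.+ W) (w ℚ.* toℚ (proj₁ p) ℚ.+ x , w ℚ.* toℚ (proj₂ p) ℚ.+ y)
  step w p W x y hw hp (ih₁ , ih₂) = subst (0ℚ ℚ.≤_) sum (≥0-+ℚ hterm ih₁) , face
    where
    f = affℚ α β ε (ι p)
    sum = form-step A B E w (toℚ (proj₁ p)) (toℚ (proj₂ p)) W x y
    hterm : 0ℚ ℚ.≤ w ℚ.* f
    hterm = ≥0-*ℚ hw (subst (0ℚ ℚ.≤_) (sym (affℚ-ι α β ε p)) (toℚ-mono (h p hp)))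
    face : val (w ℚ.+ W) _ ≡ 0ℚ → Cone P₀ (w ℚ.+ W) _
    face e with w ℚP.≟ 0ℚ
    ... | yes refl = cone-cast (sym (ℚP.+-identityˡ W)) (drop (toℚ (proj₁ p)) x) (drop (toℚ (proj₂ p)) y)
      (ih₂ (≥0-antisymℚ ih₁ hterm (trans (ℚP.+-comm (val W (x , y)) (0ℚ ℚ.* f)) (trans sum e))))
    ... | no w≢0 = cone-∷ w hw
      (hp , toℚ-injective (trans (sym (affℚ-ι α β ε p))
        (*≡0-ℚ w f (≥0-antisymℚ hterm ih₁ (trans sum e)) w≢0)))
      (ih₂ (≥0-antisymℚ ih₁ hterm (trans (ℚP.+-comm (val W (x , y)) (w ℚ.* f)) (trans sum e))))

hull-bind : ∀ {P P'} → (∀ p → P p → Conv P' (ι p)) → ∀ {q} → Conv P q → Conv P' q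
hull-bind {P} {P'} h {x , y} hq = cone-cast refl (eq₁ x y) (eq₂ x y)
  (cone-affine 1ℚ 0ℚ 0ℚ 0ℚ 1ℚ 0ℚ
    (λ p hp → cone-cast refl (sym (eq₁ (toℚ (proj₁ p)) (toℚ (proj₂ p)))) (sym (eq₂ (toℚ (proj₁ p)) (toℚ (proj₂ p)))) (h p hp)) hq)
  where
  eq₁ : ∀ x y → 1ℚ ℚ.* x ℚ.+ 0ℚ ℚ.* y ℚ.+ 0ℚ ≡ x
  eq₁ = TR.solve-∀ ℚring
  eq₂ : ∀ x y → 0ℚ ℚ.* x ℚ.+ 1ℚ ℚ.* y ℚ.+ 0ℚ ≡ y
  eq₂ = TR.solve-∀ ℚring

hull-apply : ∀ {P P'} φ → (∀ p → P p → Conv P' (apply φ (ι p))) →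
  ∀ {q} → Conv P q → Conv P' (apply φ q)
hull-apply φ h {x , y} hq = cone-cast refl (cong (toℚ a ℚ.* x ℚ.+ toℚ b ℚ.* y ℚ.+_) (ℚP.*-identityˡ (toℚ e)))
  (cong (toℚ c ℚ.* x ℚ.+ toℚ d ℚ.* y ℚ.+_) (ℚP.*-identityˡ (toℚ f)))
  (cone-affine (toℚ a) (toℚ b) (toℚ e) (toℚ c) (toℚ d) (toℚ f) h hq)
  where open Unimodular φ

hull-generator : ∀ {P} p → P p → Conv P (ι p)
hull-generator p hp = cone-cast (ℚP.+-identityʳ 1ℚ) (lem (toℚ (proj₁ p))) (lem (toℚ (proj₂ p))) (cone-∷ 1ℚ (ℚP.nonNegative⁻¹ 1ℚ) hp cone-[])
  where
  lem : ∀ x → 1ℚ ℚ.* x ℚ.+ 0ℚ ≡ x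
  lem = TR.solve-∀ ℚring

hull-mono : ∀ {P P'} → (∀ p → P p → P' p) → ∀ {q} → Conv P q → Conv P' q
hull-mono h = hull-bind (λ p hp → hull-generator p (h p hp))

recip : ∀ D → 0ℚ ℚ.< D → ∃[ t ] (0ℚ ℚ.< t × t ℚ.* D ≡ 1ℚ)
recip D hD = (ℚ.1/ D) {{nz}} , ℚP.positive⁻¹ _ {{ℚP.1/pos⇒pos D {{ℚ.positive hD}}}} ,
  ℚP.*-inverseˡ D {{nz}}
  where nz = ℚP.pos⇒nonZero D {{ℚ.positive hD}}

-- The weights are barycentric coordinates up to a common positive factor, which is divided out
-- here. Certificates of hull membership can thus be given by integers.
combineℚ : ∀ {P} {p₀ p₁ p₂ x y} (u v w : ℚ) → P p₀ → P p₁ → P p₂ →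
  0ℚ ℚ.≤ u → 0ℚ ℚ.≤ v → 0ℚ ℚ.≤ w → 0ℚ ℚ.< u ℚ.+ v ℚ.+ w →
  u ℚ.* toℚ (proj₁ p₀) ℚ.+ v ℚ.* toℚ (proj₁ p₁) ℚ.+ w ℚ.* toℚ (proj₁ p₂) ≡ (u ℚ.+ v ℚ.+ w) ℚ.* x →
  u ℚ.* toℚ (proj₂ p₀) ℚ.+ v ℚ.* toℚ (proj₂ p₁) ℚ.+ w ℚ.* toℚ (proj₂ p₂) ≡ (u ℚ.+ v ℚ.+ w) ℚ.* y →
  Conv P (x , y)
combineℚ {p₀ = p₀} {p₁} {p₂} {x} {y} u v w h₀ h₁ h₂ hu hv hw hD ex ey with recip _ hD
... | t , ht , e = cone-cast (trans (lemW t u v w) e) (coord x (u ℚ.* toℚ (proj₁ p₀)) (v ℚ.* toℚ (proj₁ p₁)) (w ℚ.* toℚ (proj₁ p₂)) ex)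
  (coord y (u ℚ.* toℚ (proj₂ p₀)) (v ℚ.* toℚ (proj₂ p₁)) (w ℚ.* toℚ (proj₂ p₂)) ey)
  (cone-scale t (ℚP.<⇒≤ ht) (cone-∷ u hu h₀ (cone-∷ v hv h₁ (cone-∷ w hw h₂ cone-[]))))
  where
  D = u ℚ.+ v ℚ.+ w
  lemW : ∀ t u v w → t ℚ.* (u ℚ.+ (v ℚ.+ (w ℚ.+ 0ℚ))) ≡ t ℚ.* (u ℚ.+ v ℚ.+ w)
  lemW = TR.solve-∀ ℚring
  lemx : ∀ t a b c → t ℚ.* (a ℚ.+ (b ℚ.+ (c ℚ.+ 0ℚ))) ≡ t ℚ.* (a ℚ.+ b ℚ.+ c)
  lemx = TR.solve-∀ ℚring
  coord : ∀ x a b c → a ℚ.+ b ℚ.+ c ≡ D ℚ.* x → t ℚ.* (a ℚ.+ (b ℚ.+ (c ℚ.+ 0ℚ))) ≡ x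
  coord x a b c e' = trans (lemx t a b c) (trans (cong (t ℚ.*_) e')
    (trans (sym (ℚP.*-assoc t D x)) (trans (cong (ℚ._* x) e) (ℚP.*-identityˡ x))))

toℚ-pos : ∀ {a} → 0≤ (a - + 1) → 0ℚ ℚ.< toℚ a
toℚ-pos {a} h = ℚP.<-≤-trans (ℚP.positive⁻¹ 1ℚ) (toℚ-mono {+ 1} {a} (ℤP.0≤i-j⇒j≤i h))

combine : ∀ {P p₀ p₁ p₂ r} i j k → P p₀ → P p₁ → P p₂ → 0≤ i → 0≤ j → 0≤ k → 0≤ (i + j + k - + 1) →
  i * proj₁ p₀ + j * proj₁ p₁ + k * proj₁ p₂ ≡ (i + j + k) * proj₁ r →
  i * proj₂ p₀ + j * proj₂ p₁ + k * proj₂ p₂ ≡ (i + j + k) * proj₂ r →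
  Conv P (ι r)
combine {r = r} i j k h₀ h₁ h₂ hi hj hk hD ex ey = combineℚ (toℚ i) (toℚ j) (toℚ k) h₀ h₁ h₂
  (toℚ-mono hi) (toℚ-mono hj) (toℚ-mono hk) (subst (0ℚ ℚ.<_) sum (toℚ-pos {i + j + k} hD))
  (coord ex) (coord ey)
  where
  sum3 : ∀ a b c → toℚ (a + b + c) ≡ toℚ a ℚ.+ toℚ b ℚ.+ toℚ c
  sum3 a b c = trans (toℚ-+ (a + b) c) (cong (ℚ._+ toℚ c) (toℚ-+ a b))
  sum = sum3 i j k
  coord : ∀ {a b c x} → i * a + j * b + k * c ≡ (i + j + k) * x →
    toℚ i ℚ.* toℚ a ℚ.+ toℚ j ℚ.* toℚ b ℚ.+ toℚ k ℚ.* toℚ c ≡ (toℚ i ℚ.+ toℚ j ℚ.+ toℚ k) ℚ.* toℚ x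
  coord {a} {b} {c} {x} e = trans (sym (trans (sum3 (i * a) (j * b) (k * c))
      (cong₂ ℚ._+_ (cong₂ ℚ._+_ (toℚ-* i a) (toℚ-* j b)) (toℚ-* k c))))
    (trans (cong toℚ e) (trans (toℚ-* (i + j + k) x) (cong (ℚ._* toℚ x) sum)))

-- Search in finite lists

-- Transitivity and totality are asked for only on `P`: the comparisons of angles and of slopes made
-- below are orders on a half-plane but not on the whole plane.
optimum : {A : Set} (R : A → A → Set) {P : A → Set} → Decidable P →
  (∀ {a b c} → P a → P b → P c → R a b → R b c → R a c) →
  (∀ a b → P a → P b → R a b ⊎ R b a) → ∀ S →
  (∀ a → a ∈ S → ¬ P a) ⊎ (∃[ a ] (a ∈ S × P a × (∀ b → b ∈ S → P b → R a b)))
optimum R P? tr tot [] = inj₁ (λ _ ())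
optimum {A} R {P} P? tr tot (s ∷ S) = go (P? s) (optimum R P? tr tot S)
  where
  reflR : ∀ a → P a → R a a
  reflR a pa = [ (λ h → h) , (λ h → h) ]′ (tot a a pa pa)
  Best : List A → Set
  Best T = ∃[ a ] (a ∈ T × P a × (∀ b → b ∈ T → P b → R a b))
  keep : ∀ {a} → a ∈ S → P a → (∀ b → b ∈ S → P b → R a b) → (P s → R a s) → Best (s ∷ S)
  keep i pa h hs = _ , there i , pa ,
    λ { b (here refl) pb → hs pb ; b (there j) pb → h b j pb }
  go : Dec (P s) → (∀ a → a ∈ S → ¬ P a) ⊎ Best S → (∀ a → a ∈ s ∷ S → ¬ P a) ⊎ Best (s ∷ S)
  go (yes ps) (inj₁ none) = inj₂ (s , here refl , ps ,
    λ { b (here refl) pb → reflR s ps ; b (there j) pb → ⊥-elim (none b j pb) })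
  go (no ¬ps) (inj₁ none) = inj₁ (λ { a (here refl) → ¬ps ; a (there j) → none a j })
  go (no ¬ps) (inj₂ (a , i , pa , h)) = inj₂ (keep i pa h (λ ps → ⊥-elim (¬ps ps)))
  go (yes ps) (inj₂ (a , i , pa , h)) = inj₂ ([ (λ r → keep i pa h (λ _ → r)) ,
    (λ r → s , here refl , ps , λ { b (here refl) pb → reflR s ps
                                  ; b (there j) pb → tr ps pa pb r (h b j pb) }) ]′ (tot a s pa ps))

∀∈? : {A : Set} {P : A → Set} → Decidable P → ∀ S → (∀ a → a ∈ S → P a) ⊎ (∃[ a ] (a ∈ S × ¬ P a))
∀∈? P? [] = inj₁ (λ _ ())
∀∈? P? (s ∷ S) with P? s | ∀∈? P? S
... | no ¬ps | _ = inj₂ (s , here refl , ¬ps)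
... | yes ps | inj₁ h = inj₁ (λ { a (here refl) → ps ; a (there i) → h a i })
... | yes ps | inj₂ (a , i , ¬pa) = inj₂ (a , there i , ¬pa)

-- Interior points and supporting lines

lf : ℤ → ℤ → Point → ℤ
lf α β (x , y) = α * x + β * y

NonZeroForm : ℤ → ℤ → Set
NonZeroForm α β = ¬ (α ≡ + 0 × β ≡ + 0)

-- p is interior exactly when no line through p supports S.
Int : List Point → Point → Set
Int S p = ∀ α β → NonZeroForm α β → ∃[ q ] (q ∈ S × 0≤ (lf α β p - lf α β q - + 1))

-- `InteriorPt` for an arbitrary predicate, so that neighbourhoods coming from several half-planes
-- can be intersected.
Near : Point → (QPoint → Set) → Set
Near p Q = ∃[ ε ] (0ℚ ℚ.< ε) ×
  (∀ (q : QPoint) → ℚ.∣ proj₁ q ℚ.- proj₁ (ι p) ∣ ℚ.< ε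
                  → ℚ.∣ proj₂ q ℚ.- proj₂ (ι p) ∣ ℚ.< ε → Q q)

near-× : ∀ p {Q R} → Near p Q → Near p R → Near p (λ q → Q q × R q)
near-× p (ε , hε , h) (δ , hδ , k) = ε ℚ.⊓ δ , pos (ℚP.≤-total ε δ) , λ q hx hy →
  h q (ℚP.<-≤-trans hx (ℚP.p⊓q≤p ε δ)) (ℚP.<-≤-trans hy (ℚP.p⊓q≤p ε δ)) ,
  k q (ℚP.<-≤-trans hx (ℚP.p⊓q≤q ε δ)) (ℚP.<-≤-trans hy (ℚP.p⊓q≤q ε δ))
  where
  pos : ε ℚ.≤ δ ⊎ δ ℚ.≤ ε → 0ℚ ℚ.< ε ℚ.⊓ δ
  pos (inj₁ le) = subst (0ℚ ℚ.<_) (sym (ℚP.p≤q⇒p⊓q≡p le)) hε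
  pos (inj₂ le) = subst (0ℚ ℚ.<_) (sym (ℚP.p≥q⇒p⊓q≡q le)) hδ

near-mono : ∀ p {Q R} → (∀ q → Q q → R q) → Near p Q → Near p R
near-mono p f (ε , hε , h) = ε , hε , λ q hx hy → f q (h q hx hy)

∣d∣<⇒ : ∀ {d ε} → ℚ.∣ d ∣ ℚ.< ε → 0ℚ ℚ.≤ d ℚ.+ ε × 0ℚ ℚ.≤ ε ℚ.- d
∣d∣<⇒ {d} {ε} h = go (ℚP.∣p∣≡p∨∣p∣≡-p d)
  where
  0≤ε : 0ℚ ℚ.≤ ε
  0≤ε = ℚP.≤-trans (ℚP.0≤∣p∣ d) (ℚP.<⇒≤ h)
  lem₁ : ∀ d ε → ε ℚ.- ℚ.- d ≡ d ℚ.+ ε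
  lem₁ = TR.solve-∀ ℚring
  go : ℚ.∣ d ∣ ≡ d ⊎ ℚ.∣ d ∣ ≡ ℚ.- d → 0ℚ ℚ.≤ d ℚ.+ ε × 0ℚ ℚ.≤ ε ℚ.- d
  go (inj₁ e) = ≥0-+ℚ (subst (0ℚ ℚ.≤_) e (ℚP.0≤∣p∣ d)) 0≤ε ,
    ≤⇒0≤-ℚ (subst (ℚ._≤ ε) e (ℚP.<⇒≤ h))
  go (inj₂ e) = subst (0ℚ ℚ.≤_) (lem₁ d ε) (≤⇒0≤-ℚ (subst (ℚ._≤ ε) e (ℚP.<⇒≤ h))) ,
    ≥0-+ℚ 0≤ε (subst (0ℚ ℚ.≤_) e (ℚP.0≤∣p∣ d))

variation : ∀ A d ε → 0ℚ ℚ.≤ d ℚ.+ ε → 0ℚ ℚ.≤ ε ℚ.- d →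
  0ℚ ℚ.≤ toℚ A ℚ.* d ℚ.+ toℚ (+ ℤ.∣ A ∣) ℚ.* ε
variation A d ε h₁ h₂ = go (∣∣-cases A)
  where
  n = toℚ (+ ℤ.∣ A ∣)
  hn : 0ℚ ℚ.≤ n
  hn = toℚ-mono (nat≥0 {ℤ.∣ A ∣})
  lem₁ : ∀ n d ε → n ℚ.* (d ℚ.+ ε) ≡ n ℚ.* d ℚ.+ n ℚ.* ε
  lem₁ = TR.solve-∀ ℚring
  lem₂ : ∀ n d ε → n ℚ.* (ε ℚ.- d) ≡ ℚ.- n ℚ.* d ℚ.+ n ℚ.* ε
  lem₂ = TR.solve-∀ ℚring
  go : (A ≡ + ℤ.∣ A ∣) ⊎ (A ≡ - (+ ℤ.∣ A ∣)) → 0ℚ ℚ.≤ toℚ A ℚ.* d ℚ.+ n ℚ.* ε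
  go (inj₁ e) = subst (0ℚ ℚ.≤_) (trans (lem₁ n d ε) (cong (λ z → z ℚ.* d ℚ.+ n ℚ.* ε) (sym (cong toℚ e))))
    (≥0-*ℚ hn h₁)
  go (inj₂ e) = subst (0ℚ ℚ.≤_) (trans (lem₂ n d ε)
    (cong (λ z → z ℚ.* d ℚ.+ n ℚ.* ε) (sym (trans (cong toℚ e) (toℚ-neg (+ ℤ.∣ A ∣))))))
    (≥0-*ℚ hn h₂)

-- An integral form that is positive at `p` is at least 1 there and changes by at most (|A| + |B|)ε
-- on the ε-square around `p`; the choice ε = 1 / (|A| + |B| + 1) keeps it nonnegative.
near-form : ∀ A B C p → 0≤ (aff A B C p - + 1) → Near p (λ q → 0ℚ ℚ.≤ affℚ A B C q)
near-form A B C p@(px , py) hp = go (recip (a ℚ.+ b ℚ.+ 1ℚ)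
    (ℚP.<-≤-trans (ℚP.positive⁻¹ 1ℚ) (subst (ℚ._≤ a ℚ.+ b ℚ.+ 1ℚ) (ℚP.+-identityˡ 1ℚ) (ℚP.+-monoˡ-≤ 1ℚ (≥0-+ℚ ha hb)))))
  where
  a = toℚ (+ ℤ.∣ A ∣)
  b = toℚ (+ ℤ.∣ B ∣)
  ha : 0ℚ ℚ.≤ a
  ha = toℚ-mono (nat≥0 {ℤ.∣ A ∣})
  hb : 0ℚ ℚ.≤ b
  hb = toℚ-mono (nat≥0 {ℤ.∣ B ∣})
  v = affℚ A B C (ι p)
  hv : 0ℚ ℚ.≤ v ℚ.- 1ℚ
  hv = subst (0ℚ ℚ.≤_) (trans (toℚ-sub (aff A B C p) (+ 1)) (cong (ℚ._- 1ℚ) (sym (affℚ-ι A B C p)))) (toℚ-mono hp)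
  lem : ∀ A B C X Y a b ε x y →
    A ℚ.* X ℚ.+ B ℚ.* Y ℚ.+ C ℚ.- 1ℚ ℚ.+ (A ℚ.* (x ℚ.- X) ℚ.+ a ℚ.* ε) ℚ.+ (B ℚ.* (y ℚ.- Y) ℚ.+ b ℚ.* ε) ℚ.+ ε
    ≡ A ℚ.* x ℚ.+ B ℚ.* y ℚ.+ C ℚ.+ (ε ℚ.* (a ℚ.+ b ℚ.+ 1ℚ) ℚ.- 1ℚ)
  lem = TR.solve-∀ ℚring
  lem₀ : ∀ x → x ℚ.+ (1ℚ ℚ.- 1ℚ) ≡ x
  lem₀ = TR.solve-∀ ℚring
  go : ∃[ ε ] (0ℚ ℚ.< ε × ε ℚ.* (a ℚ.+ b ℚ.+ 1ℚ) ≡ 1ℚ) → Near p (λ q → 0ℚ ℚ.≤ affℚ A B C q)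
  go (ε , hε , e) = ε , hε , λ q hx hy → near q (∣d∣<⇒ hx) (∣d∣<⇒ hy)
    where
    near : ∀ q → 0ℚ ℚ.≤ proj₁ q ℚ.- toℚ px ℚ.+ ε × 0ℚ ℚ.≤ ε ℚ.- (proj₁ q ℚ.- toℚ px) →
      0ℚ ℚ.≤ proj₂ q ℚ.- toℚ py ℚ.+ ε × 0ℚ ℚ.≤ ε ℚ.- (proj₂ q ℚ.- toℚ py) → 0ℚ ℚ.≤ affℚ A B C q
    near (x , y) (h₁ , h₂) (k₁ , k₂) = subst (0ℚ ℚ.≤_)
      (trans (lem (toℚ A) (toℚ B) (toℚ C) (toℚ px) (toℚ py) a b ε x y)
        (trans (cong (λ z → affℚ A B C (x , y) ℚ.+ (z ℚ.- 1ℚ)) e) (lem₀ (affℚ A B C (x , y)))))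
      (≥0-+ℚ (≥0-+ℚ (≥0-+ℚ hv (variation A (x ℚ.- toℚ px) ε h₁ h₂)) (variation B (y ℚ.- toℚ py) ε k₁ k₂)) (ℚP.<⇒≤ hε))

unit-direction : ∀ α β → NonZeroForm α β →
  ∃[ σ ] ∃[ τ ] (ℚ.∣ toℚ σ ∣ ℚ.≤ 1ℚ × ℚ.∣ toℚ τ ∣ ℚ.≤ 1ℚ × 0≤ (α * σ + β * τ - + 1))
unit-direction α β nz = go (trichotomy α) (trichotomy β)
  where
  le : ∀ {p} → Bool.T (p ℚ.≤ᵇ 1ℚ) → p ℚ.≤ 1ℚ
  le = ℚP.≤ᵇ⇒≤
  lem₁ : ∀ α β → α - + 1 ≡ α * + 1 + β * + 0 - + 1
  lem₁ = solve-∀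
  lem₂ : ∀ α β → - α - + 1 ≡ α * -[1+ 0 ] + β * + 0 - + 1
  lem₂ = solve-∀
  lem₃ : ∀ α β → β - + 1 ≡ α * + 0 + β * + 1 - + 1
  lem₃ = solve-∀
  lem₄ : ∀ α β → - β - + 1 ≡ α * + 0 + β * -[1+ 0 ] - + 1
  lem₄ = solve-∀
  go : 0≤ (α - + 1) ⊎ α ≡ + 0 ⊎ 0≤ (- α - + 1) → 0≤ (β - + 1) ⊎ β ≡ + 0 ⊎ 0≤ (- β - + 1) →
    ∃[ σ ] ∃[ τ ] (ℚ.∣ toℚ σ ∣ ℚ.≤ 1ℚ × ℚ.∣ toℚ τ ∣ ℚ.≤ 1ℚ × 0≤ (α * σ + β * τ - + 1))
  go (inj₁ h) _ = + 1 , + 0 , le _ , le _ , ≥0-cong h (lem₁ α β)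
  go (inj₂ (inj₂ h)) _ = -[1+ 0 ] , + 0 , le _ , le _ , ≥0-cong h (lem₂ α β)
  go (inj₂ (inj₁ _)) (inj₁ h) = + 0 , + 1 , le _ , le _ , ≥0-cong h (lem₃ α β)
  go (inj₂ (inj₁ _)) (inj₂ (inj₂ h)) = + 0 , -[1+ 0 ] , le _ , le _ , ≥0-cong h (lem₄ α β)
  go (inj₂ (inj₁ e)) (inj₂ (inj₁ e')) = ⊥-elim (nz (e , e'))

-- If no generator were below `p`, the form would be at least its value at `p` on the whole hull.
-- But the hull contains `p` - t(σ, τ) for some 0 < t < ε, where the form is smaller by at least t.
interior⇒Int : ∀ {S p} → InteriorPt (Poly S) p → Int S p
interior⇒Int {S} {p@(px , py)} (ε , hε , near) α β nz = search (∀∈? (λ q → 0≤? (lf α β q - lf α β p)) S)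
  where
  sw : ∀ a b → - (b - a) - + 1 ≡ a - b - + 1
  sw = solve-∀
  search : (∀ q → q ∈ S → 0≤ (lf α β q - lf α β p)) ⊎ (∃[ q ] (q ∈ S × ¬ 0≤ (lf α β q - lf α β p))) →
    ∃[ q ] (q ∈ S × 0≤ (lf α β p - lf α β q - + 1))
  search (inj₂ (q , i , h)) = q , i , ≥0-cong (≱0⇒ h) (sw (lf α β p) (lf α β q))
  search (inj₁ all) = ⊥-elim (contra (unit-direction α β nz) (ℚP.<-dense hε))
    where
    contra : ∃[ σ ] ∃[ τ ] (ℚ.∣ toℚ σ ∣ ℚ.≤ 1ℚ × ℚ.∣ toℚ τ ∣ ℚ.≤ 1ℚ × 0≤ (α * σ + β * τ - + 1)) →
      ∃[ t ] (0ℚ ℚ.< t × t ℚ.< ε) → ⊥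
    contra (σ , τ , hσ , hτ , hv) (t , 0<t , t<ε) = ℚP.<-irrefl refl
      (ℚP.<-≤-trans 0<t (0≤-⇒≤ℚ (subst (0ℚ ℚ.≤_) eq (≥0-+ℚ final (≥0-*ℚ (ℚP.<⇒≤ 0<t) hv')))))
      where
      q : QPoint
      q = toℚ px ℚ.- t ℚ.* toℚ σ , toℚ py ℚ.- t ℚ.* toℚ τ
      small : ∀ X s → ℚ.∣ s ∣ ℚ.≤ 1ℚ → ℚ.∣ X ℚ.- t ℚ.* s ℚ.- X ∣ ℚ.< ε
      small X s hs = subst (ℚ._< ε) (sym e) (ℚP.≤-<-trans
          (subst (t ℚ.* ℚ.∣ s ∣ ℚ.≤_) (ℚP.*-identityʳ t) (ℚP.*-monoˡ-≤-nonNeg t {{ℚ.nonNegative (ℚP.<⇒≤ 0<t)}} hs)) t<ε)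
        where
        l : ∀ X t s → X ℚ.- t ℚ.* s ℚ.- X ≡ ℚ.- (t ℚ.* s)
        l = TR.solve-∀ ℚring
        e : ℚ.∣ X ℚ.- t ℚ.* s ℚ.- X ∣ ≡ t ℚ.* ℚ.∣ s ∣
        e = trans (cong ℚ.∣_∣ (l X t s)) (trans (ℚP.∣-p∣≡∣p∣ (t ℚ.* s))
          (trans (ℚP.∣p*q∣≡∣p∣*∣q∣ t s) (cong (ℚ._* ℚ.∣ s ∣) (ℚP.0≤p⇒∣p∣≡p (ℚP.<⇒≤ 0<t)))))
      final : 0ℚ ℚ.≤ affℚ α β (- lf α β p) q
      final = hull-≥0ℚ α β (- lf α β p) (λ q i → all q i) {q} (near q (small (toℚ px) (toℚ σ) hσ) (small (toℚ py) (toℚ τ) hτ))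
      hv' : 0ℚ ℚ.≤ toℚ α ℚ.* toℚ σ ℚ.+ toℚ β ℚ.* toℚ τ ℚ.- 1ℚ
      hv' = subst (0ℚ ℚ.≤_) (trans (toℚ-sub (α * σ + β * τ) (+ 1)) (cong (ℚ._- 1ℚ)
        (trans (toℚ-+ (α * σ) (β * τ)) (cong₂ ℚ._+_ (toℚ-* α σ) (toℚ-* β τ))))) (toℚ-mono hv)
      L : ∀ A B X Y s u t → A ℚ.* (X ℚ.- t ℚ.* s) ℚ.+ B ℚ.* (Y ℚ.- t ℚ.* u) ℚ.+ ℚ.- (A ℚ.* X ℚ.+ B ℚ.* Y)
        ℚ.+ t ℚ.* (A ℚ.* s ℚ.+ B ℚ.* u ℚ.- 1ℚ) ≡ 0ℚ ℚ.- t
      L = TR.solve-∀ ℚring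
      negp : toℚ (- lf α β p) ≡ ℚ.- (toℚ α ℚ.* toℚ px ℚ.+ toℚ β ℚ.* toℚ py)
      negp = trans (toℚ-neg (lf α β p)) (cong ℚ.-_ (trans (toℚ-+ (α * px) (β * py)) (cong₂ ℚ._+_ (toℚ-* α px) (toℚ-* β py))))
      eq : affℚ α β (- lf α β p) q ℚ.+ t ℚ.* (toℚ α ℚ.* toℚ σ ℚ.+ toℚ β ℚ.* toℚ τ ℚ.- 1ℚ) ≡ 0ℚ ℚ.- t
      eq = trans (cong (λ z → toℚ α ℚ.* proj₁ q ℚ.+ toℚ β ℚ.* proj₂ q ℚ.+ z ℚ.+ t ℚ.* (toℚ α ℚ.* toℚ σ ℚ.+ toℚ β ℚ.* toℚ τ ℚ.- 1ℚ)) negp)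
        (L (toℚ α) (toℚ β) (toℚ px) (toℚ py) (toℚ σ) (toℚ τ) t)

-- As a function of a third point q, twice the signed area of the triangle q, a, b.
edgeℚ : Point → Point → QPoint → ℚ
edgeℚ (ax , ay) (bx , by) = affℚ (ay - by) (bx - ax) (ax * by - bx * ay)

edge-det : ∀ a b p → aff (proj₂ a - proj₂ b) (proj₁ b - proj₁ a) (proj₁ a * proj₂ b - proj₁ b * proj₂ a) p ≡ det p a b
edge-det (ax , ay) (bx , by) (x , y) = lem ax ay bx by x y
  where
  lem : ∀ ax ay bx by x y → (ay - by) * x + (bx - ax) * y + (ax * by - bx * ay) ≡
    (ax - x) * (by - y) - (ay - y) * (bx - x)
  lem = solve-∀

edgeℚ-expand : ∀ a b q → edgeℚ a b q ≡
  (toℚ (proj₂ a) ℚ.- toℚ (proj₂ b)) ℚ.* proj₁ q ℚ.+ (toℚ (proj₁ b) ℚ.- toℚ (proj₁ a)) ℚ.* proj₂ q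
    ℚ.+ (toℚ (proj₁ a) ℚ.* toℚ (proj₂ b) ℚ.- toℚ (proj₁ b) ℚ.* toℚ (proj₂ a))
edgeℚ-expand (ax , ay) (bx , by) (x , y) = cong₂ ℚ._+_
  (cong₂ (λ u v → u ℚ.* x ℚ.+ v ℚ.* y) (toℚ-sub ay by) (toℚ-sub bx ax))
  (trans (toℚ-sub (ax * by) (bx * ay)) (cong₂ ℚ._-_ (toℚ-* ax by) (toℚ-* bx ay)))

near-edge : ∀ a b p → 0≤ (det p a b - + 1) → Near p (λ q → 0ℚ ℚ.≤ edgeℚ a b q)
near-edge a b p h = near-form (proj₂ a - proj₂ b) (proj₁ b - proj₁ a) (proj₁ a * proj₂ b - proj₁ b * proj₂ a) p
  (subst (λ z → 0≤ (z - + 1)) (sym (edge-det a b p)) h)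

edge-swap : ∀ a b q → edgeℚ a b q ≡ ℚ.- edgeℚ b a q
edge-swap a@(ax , ay) b@(bx , by) q@(x , y) = trans (edgeℚ-expand a b q)
  (trans (lem (toℚ ax) (toℚ ay) (toℚ bx) (toℚ by) x y) (cong ℚ.-_ (sym (edgeℚ-expand b a q))))
  where
  lem : ∀ ax ay bx by x y → (ay ℚ.- by) ℚ.* x ℚ.+ (bx ℚ.- ax) ℚ.* y ℚ.+ (ax ℚ.* by ℚ.- bx ℚ.* ay) ≡
    ℚ.- ((by ℚ.- ay) ℚ.* x ℚ.+ (ax ℚ.- bx) ℚ.* y ℚ.+ (bx ℚ.* ay ℚ.- ax ℚ.* by))
  lem = TR.solve-∀ ℚring

-- The signed areas that `q` forms with the three edges are its barycentric coordinates; they add up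
-- to `det a b c`.
in-triangle : ∀ {P} a b c q → P a → P b → P c → 0≤ (det a b c - + 1) →
  0ℚ ℚ.≤ edgeℚ a b q → 0ℚ ℚ.≤ edgeℚ b c q → 0ℚ ℚ.≤ edgeℚ c a q → Conv P q
in-triangle a@(ax , ay) b@(bx , by) c@(cx , cy) q@(x , y) ha hb hc hD hab hbc hca =
  combineℚ u v w ha hb hc hbc hca hab (subst (0ℚ ℚ.<_) (sym total) (toℚ-pos {det a b c} hD))
    (trans (cong₂ ℚ._+_ (cong₂ ℚ._+_ (cong (ℚ._* A) eu) (cong (ℚ._* B) ev)) (cong (ℚ._* C) ew))
      (trans (lemx A A' B B' C C' x y) (cong (ℚ._* x) (sym sum))))
    (trans (cong₂ ℚ._+_ (cong₂ ℚ._+_ (cong (ℚ._* A') eu) (cong (ℚ._* B') ev)) (cong (ℚ._* C') ew))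
      (trans (lemy A A' B B' C C' x y) (cong (ℚ._* y) (sym sum))))
  where
  A = toℚ ax
  A' = toℚ ay
  B = toℚ bx
  B' = toℚ by
  C = toℚ cx
  C' = toℚ cy
  u = edgeℚ b c q
  v = edgeℚ c a q
  w = edgeℚ a b q
  eu = edgeℚ-expand b c q
  ev = edgeℚ-expand c a q
  ew = edgeℚ-expand a b q
  lemx : ∀ A A' B B' C C' x y →
    ((B' ℚ.- C') ℚ.* x ℚ.+ (C ℚ.- B) ℚ.* y ℚ.+ (B ℚ.* C' ℚ.- C ℚ.* B')) ℚ.* A ℚ.+
    ((C' ℚ.- A') ℚ.* x ℚ.+ (A ℚ.- C) ℚ.* y ℚ.+ (C ℚ.* A' ℚ.- A ℚ.* C')) ℚ.* B ℚ.+
    ((A' ℚ.- B') ℚ.* x ℚ.+ (B ℚ.- A) ℚ.* y ℚ.+ (A ℚ.* B' ℚ.- B ℚ.* A')) ℚ.* C ≡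
    ((B ℚ.- A) ℚ.* (C' ℚ.- A') ℚ.- (B' ℚ.- A') ℚ.* (C ℚ.- A)) ℚ.* x
  lemx = TR.solve-∀ ℚring
  lemy : ∀ A A' B B' C C' x y →
    ((B' ℚ.- C') ℚ.* x ℚ.+ (C ℚ.- B) ℚ.* y ℚ.+ (B ℚ.* C' ℚ.- C ℚ.* B')) ℚ.* A' ℚ.+
    ((C' ℚ.- A') ℚ.* x ℚ.+ (A ℚ.- C) ℚ.* y ℚ.+ (C ℚ.* A' ℚ.- A ℚ.* C')) ℚ.* B' ℚ.+
    ((A' ℚ.- B') ℚ.* x ℚ.+ (B ℚ.- A) ℚ.* y ℚ.+ (A ℚ.* B' ℚ.- B ℚ.* A')) ℚ.* C' ≡
    ((B ℚ.- A) ℚ.* (C' ℚ.- A') ℚ.- (B' ℚ.- A') ℚ.* (C ℚ.- A)) ℚ.* y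
  lemy = TR.solve-∀ ℚring
  lems : ∀ A A' B B' C C' x y →
    ((B' ℚ.- C') ℚ.* x ℚ.+ (C ℚ.- B) ℚ.* y ℚ.+ (B ℚ.* C' ℚ.- C ℚ.* B')) ℚ.+
    ((C' ℚ.- A') ℚ.* x ℚ.+ (A ℚ.- C) ℚ.* y ℚ.+ (C ℚ.* A' ℚ.- A ℚ.* C')) ℚ.+
    ((A' ℚ.- B') ℚ.* x ℚ.+ (B ℚ.- A) ℚ.* y ℚ.+ (A ℚ.* B' ℚ.- B ℚ.* A')) ≡
    ((B ℚ.- A) ℚ.* (C' ℚ.- A') ℚ.- (B' ℚ.- A') ℚ.* (C ℚ.- A))
  lems = TR.solve-∀ ℚring
  sum : u ℚ.+ v ℚ.+ w ≡ ((B ℚ.- A) ℚ.* (C' ℚ.- A') ℚ.- (B' ℚ.- A') ℚ.* (C ℚ.- A))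
  sum = trans (cong₂ ℚ._+_ (cong₂ ℚ._+_ eu ev) ew) (lems A A' B B' C C' x y)
  total : u ℚ.+ v ℚ.+ w ≡ toℚ (det a b c)
  total = trans sum (sym (trans (toℚ-sub ((bx - ax) * (cy - ay)) ((by - ay) * (cx - ax)))
    (cong₂ ℚ._-_
      (trans (toℚ-* (bx - ax) (cy - ay)) (cong₂ ℚ._*_ (toℚ-sub bx ax) (toℚ-sub cy ay)))
      (trans (toℚ-* (by - ay) (cx - ax)) (cong₂ ℚ._*_ (toℚ-sub by ay) (toℚ-sub cx ax))))))

det-swap : ∀ p a b → det p b a ≡ - det p a b
det-swap (px , py) (ax , ay) (bx , by) = lem px py ax ay bx by
  where
  lem : ∀ px py ax ay bx by →
    (bx - px) * (ay - py) - (by - py) * (ax - px) ≡ - ((ax - px) * (by - py) - (ay - py) * (bx - px))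
  lem = solve-∀

det-split : ∀ p a b c → det p a b + det p b c + det p c a ≡ det a b c
det-split (px , py) (ax , ay) (bx , by) (cx , cy) = lem px py ax ay bx by cx cy
  where
  lem : ∀ px py ax ay bx by cx cy →
    (ax - px) * (by - py) - (ay - py) * (bx - px) + ((bx - px) * (cy - py) - (by - py) * (cx - px))
      + ((cx - px) * (ay - py) - (cy - py) * (ax - px)) ≡ (bx - ax) * (cy - ay) - (by - ay) * (cx - ax)
  lem = solve-∀

plücker : ∀ p a b c d → det p a b * det p c d + det p a d * det p b c ≡ det p a c * det p b d
plücker (px , py) (ax , ay) (bx , by) (cx , cy) (dx , dy) = 
  lem (ax - px) (ay - py) (bx - px) (by - py) (cx - px) (cy - py) (dx - px) (dy - py)
  where
  lem : ∀ ax ay bx by cx cy dx dy →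
    (ax * by - ay * bx) * (cx * dy - cy * dx) + (ax * dy - ay * dx) * (bx * cy - by * cx) ≡
    (ax * cy - ay * cx) * (bx * dy - by * dx)
  lem = solve-∀

det-base : ∀ p q → det p p q ≡ + 0
det-base (px , py) (qx , qy) = lem px py qx qy
  where
  lem : ∀ px py qx qy → (px - px) * (qy - py) - (py - py) * (qx - px) ≡ + 0
  lem = solve-∀

triangle-interior : ∀ {S} p a b c → a ∈ S → b ∈ S → c ∈ S →
  0≤ (det p a b - + 1) → 0≤ (det p b c - + 1) → 0≤ (det p c a - + 1) → InteriorPt (Poly S) p
triangle-interior p a b c ia ib ic hab hbc hca = near-mono p
  (λ q h → in-triangle a b c q ia ib ic D≥1 (proj₁ h) (proj₁ (proj₂ h)) (proj₂ (proj₂ h)))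
  (near-× p (near-edge a b p hab) (near-× p (near-edge b c p hbc) (near-edge c a p hca)))
  where
  lem : ∀ x y z → x - + 1 + (y - + 1) + (z - + 1) + + 2 ≡ x + y + z - + 1
  lem = solve-∀
  D≥1 : 0≤ (det a b c - + 1)
  D≥1 = subst (λ z → 0≤ (z - + 1)) (det-split p a b c)
    (≥0-cong (hab ⊕ hbc ⊕ hca ⊕ nat≥0 {2}) (lem (det p a b) (det p b c) (det p c a)))

-- The diagonal from `a` to `c` passes through `p`, so neither half of the quadrilateral has `p` in
-- its interior. Near `p` the four edge forms are nonnegative, and the sign of the diagonal's form
-- decides which half contains the point.
quadrilateral-interior : ∀ {S} p a b c d → a ∈ S → b ∈ S → c ∈ S → d ∈ S → det p c a ≡ + 0 →
  0≤ (det p a b - + 1) → 0≤ (det p b c - + 1) → 0≤ (det p c d - + 1) → 0≤ (det p d a - + 1) →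
  InteriorPt (Poly S) p
quadrilateral-interior {S} p a b c d ia ib ic id e hab hbc hcd hda = near-mono p
  (λ q h → split q h (ℚP.≤-total 0ℚ (edgeℚ c a q)))
  (near-× p (near-× p (near-edge a b p hab) (near-edge b c p hbc)) (near-× p (near-edge c d p hcd) (near-edge d a p hda)))
  where
  lem : ∀ x y → x - + 1 + (y - + 1) + + 1 ≡ x + y + + 0 - + 1
  lem = solve-∀
  lem' : ∀ x y → x - + 1 + (y - + 1) + + 1 ≡ - + 0 + x + y - + 1
  lem' = solve-∀
  Dabc : 0≤ (det a b c - + 1)
  Dabc = subst (λ z → 0≤ (z - + 1)) (trans (cong (λ z → det p a b + det p b c + z) (sym e)) (det-split p a b c))
    (≥0-cong (hab ⊕ hbc ⊕ nat≥0 {1}) (lem (det p a b) (det p b c)))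
  Dacd : 0≤ (det a c d - + 1)
  Dacd = subst (λ z → 0≤ (z - + 1))
    (trans (cong (λ z → z + det p c d + det p d a) (sym (trans (det-swap p c a) (cong -_ e)))) (det-split p a c d))
    (≥0-cong (hcd ⊕ hda ⊕ nat≥0 {1}) (lem' (det p c d) (det p d a)))
  split : ∀ q → (0ℚ ℚ.≤ edgeℚ a b q × 0ℚ ℚ.≤ edgeℚ b c q) × (0ℚ ℚ.≤ edgeℚ c d q × 0ℚ ℚ.≤ edgeℚ d a q) →
    0ℚ ℚ.≤ edgeℚ c a q ⊎ edgeℚ c a q ℚ.≤ 0ℚ → Poly S q
  split q ((h₁ , h₂) , (h₃ , h₄)) (inj₁ h) = in-triangle a b c q ia ib ic Dabc h₁ h₂ h
  split q ((h₁ , h₂) , (h₃ , h₄)) (inj₂ h) = in-triangle a c d q ia ic id Dacd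
    (subst (0ℚ ℚ.≤_) (sym (edge-swap a c q)) (ℚP.neg-antimono-≤ h)) h₃ h₄

-- No line through p and another point of S supports S.
Surrounded : List Point → Point → Set
Surrounded S p = (∃[ q ] (q ∈ S × q ≢ p)) ×
  (∀ q → q ∈ S → q ≢ p → (∃[ r ] (r ∈ S × 0≤ (det p q r - + 1))) × (∃[ r ] (r ∈ S × 0≤ (det p r q - + 1))))

-- Among the generators strictly to the left of the ray from `p` to `a`, let b be the one of
-- greatest angle, and let c be strictly to the left of the ray to b. By the choice of b, c is not
-- strictly to the left of the first ray. If it is to the right, `p` is inside the triangle a b c;
-- if it is on the opposite ray, a further point d on the right gives a quadrilateral around `p`.
surrounded⇒interior : ∀ {S p} → Surrounded S p → InteriorPt (Poly S) p
surrounded⇒interior {S} {p} ((a , ia , a≢p) , around) = start (proj₁ (around a ia a≢p))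
  where
  P : Point → Set
  P q = 0≤ (det p a q - + 1)
  total : ∀ b c → P b → P c → 0≤ det p c b ⊎ 0≤ det p b c
  total b c _ _ = [ inj₁ , (λ h → inj₂ (≥0-cong (h ⊕ nat≥0 {1}) (trans (lem (det p c b)) (sym (det-swap p c b))))) ]′ (signs (det p c b))
    where
    lem : ∀ x → - x - + 1 + + 1 ≡ - x
    lem = solve-∀
  -- On `P` all angles from the ray to `a` are less than a half-turn; the Plücker relation, whose
  -- coefficients are positive there, then gives transitivity.
  transitive : ∀ {b c d} → P b → P c → P d → 0≤ det p c b → 0≤ det p d c → 0≤ det p d b
  transitive {b} {c} {d} hb hc hd cb dc = ≥0-cancel (det p a c) (det p d b) hc
    (≥0-cong ((hb ⊕ nat≥0 {1}) ⊗ dc ⊕ (hd ⊕ nat≥0 {1}) ⊗ cb ⊕ hc)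
      (trans (lem (det p a b) (det p d c) (det p a d) (det p c b) (det p a c))
        (cong (λ z → z + det p a c - + 1) (identity b c d))))
    where
    lem : ∀ ab dc ad cb ac → (ab - + 1 + + 1) * dc + (ad - + 1 + + 1) * cb + (ac - + 1) ≡ ab * dc + ad * cb + ac - + 1
    lem = solve-∀
    lem₂ : ∀ x y z w → x * - y + z * w ≡ - (x * y + z * - w)
    lem₂ = solve-∀
    lem₃ : ∀ x y → - (x * y) ≡ x * - y
    lem₃ = solve-∀
    identity : ∀ b c d → det p a b * det p d c + det p a d * det p c b ≡ det p a c * det p d b
    identity b c d = trans (cong (λ z → det p a b * z + det p a d * det p c b) (det-swap p c d))
      (trans (lem₂ (det p a b) (det p c d) (det p a d) (det p c b))
      (trans (cong (λ z → - (det p a b * det p c d + det p a d * z)) (sym (det-swap p c b)))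
      (trans (cong -_ (plücker p a b c d))
      (trans (lem₃ (det p a c) (det p b d)) (cong (det p a c *_) (sym (det-swap p b d)))))))
  start : ∃[ r ] (r ∈ S × P r) → InteriorPt (Poly S) p
  start (r , ir , hr) = extremal (optimum (λ b c → 0≤ det p c b) (λ q → 0≤? (det p a q - + 1))
    (λ {b} {c} {d} → transitive {b} {c} {d}) total S)
    where
    extremal : (∀ b → b ∈ S → ¬ P b) ⊎ (∃[ b ] (b ∈ S × P b × (∀ c → c ∈ S → P c → 0≤ det p c b))) →
      InteriorPt (Poly S) p
    extremal (inj₁ none) = ⊥-elim (none r ir hr)
    extremal (inj₂ (b , ib , hb , most)) = next (proj₁ (around b ib b≢p))
      where
      b≢p : b ≢ p
      b≢p refl = ¬≤-1 (subst (λ z → 0≤ (z - + 1)) (trans (det-swap p p a) (cong -_ (det-base p a))) hb)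
      next : ∃[ c ] (c ∈ S × 0≤ (det p b c - + 1)) → InteriorPt (Poly S) p
      next (c , ic , hc) = go (trichotomy (det p a c))
        where
        lem : ∀ x → x - + 1 + - x ≡ -[1+ 0 ]
        lem = solve-∀
        go : 0≤ (det p a c - + 1) ⊎ det p a c ≡ + 0 ⊎ 0≤ (- det p a c - + 1) → InteriorPt (Poly S) p
        go (inj₁ h) = ⊥-elim (absurd (hc ⊕ subst 0≤_ (det-swap p b c) (most c ic h)) (lem (det p b c)))
        go (inj₂ (inj₂ h)) = triangle-interior p a b c ia ib ic hb hc
          (subst (λ z → 0≤ (z - + 1)) (sym (det-swap p a c)) h)
        go (inj₂ (inj₁ e)) = opposite (proj₂ (around a ia a≢p))
          where
          opposite : ∃[ d ] (d ∈ S × 0≤ (det p d a - + 1)) → InteriorPt (Poly S) p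
          opposite (d , id , hd) = quadrilateral-interior p a b c d ia ib ic id
            (trans (det-swap p a c) (cong -_ e)) hb hc
            -- As `det p a c` is zero, the Plücker relation becomes det p d a · det p b c = det p a
            -- b · det p c d, which fixes the sign of the last area.
            (≥0-cancel (det p a b) (det p c d - + 1) hb
              (≥0-cong (hd ⊗ hc ⊕ hd ⊕ hc)
                (trans (lem₁ (det p d a) (det p b c)) (trans (cong (_- + 1) key) (lem₃ (det p a b) (det p c d))))))
            hd
            where
            lem₁ : ∀ x y → (x - + 1) * (y - + 1) + (x - + 1) + (y - + 1) ≡ x * y - + 1
            lem₁ = solve-∀
            lem₃ : ∀ x y → x * y - + 1 ≡ x * (y - + 1) + x - + 1
            lem₃ = solve-∀
            key : det p d a * det p b c ≡ det p a b * det p c d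
            key = trans (cong (_* det p b c) (det-swap p a d))
              (fin (det p a b * det p c d) (det p a d) (det p b c) (det p b d) (trans (plücker p a b c d) (cong (_* det p b d) e)))
              where
              fin : ∀ x y z w → x + y * z ≡ + 0 * w → - y * z ≡ x
              fin x y z w h = trans (l₁ x y z) (trans (cong (λ t → x - t) h) (l₂ x w))
                where
                l₁ : ∀ x y z → - y * z ≡ x - (x + y * z)
                l₁ = solve-∀
                l₂ : ∀ x w → x - + 0 * w ≡ x
                l₂ = solve-∀

_≟ₚ_ : ∀ (p q : Point) → Dec (p ≡ q)
(a , b) ≟ₚ (c , d) = map′ (λ { (refl , refl) → refl }) (λ { refl → refl , refl }) (a ℤP.≟ c ×-dec b ℤP.≟ d)

-- The two normals of the line through `p` and `q`, fed to `Int`, yield points strictly on either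
-- side of it.
Int⇒surrounded : ∀ {S p} → Int S p → Surrounded S p
Int⇒surrounded {S} {p@(px , py)} int = other (int (+ 1) (+ 0) (λ ())) , around
  where
  other : ∃[ q ] (q ∈ S × 0≤ (lf (+ 1) (+ 0) p - lf (+ 1) (+ 0) q - + 1)) → ∃[ q ] (q ∈ S × q ≢ p)
  other (q , i , h) = q , i , λ { refl → absurd h (lem (lf (+ 1) (+ 0) q)) }
    where
    lem : ∀ x → x - x - + 1 ≡ -[1+ 0 ]
    lem = solve-∀
  around : ∀ q → q ∈ S → q ≢ p → (∃[ r ] (r ∈ S × 0≤ (det p q r - + 1))) × (∃[ r ] (r ∈ S × 0≤ (det p r q - + 1)))
  around q@(qx , qy) i q≢p = pos (int (qy - py) (- (qx - px)) nz₁) , neg (int (- (qy - py)) (qx - px) nz₂)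
    where
    nz₂ : NonZeroForm (- (qy - py)) (qx - px)
    nz₂ (e , e') = q≢p (cong₂ _,_ (ℤP.i-j≡0⇒i≡j qx px e') (ℤP.i-j≡0⇒i≡j qy py (trans (sym (ℤP.neg-involutive (qy - py))) (cong -_ e))))
    nz₁ : NonZeroForm (qy - py) (- (qx - px))
    nz₁ (e , e') = q≢p (cong₂ _,_ (ℤP.i-j≡0⇒i≡j qx px (trans (sym (ℤP.neg-involutive (qx - px))) (cong -_ e'))) (ℤP.i-j≡0⇒i≡j qy py e))
    pos : ∃[ r ] (r ∈ S × 0≤ (lf (qy - py) (- (qx - px)) p - lf (qy - py) (- (qx - px)) r - + 1)) → ∃[ r ] (r ∈ S × 0≤ (det p q r - + 1))
    pos (r@(rx , ry) , j , h) = r , j , ≥0-cong h (lem px py qx qy rx ry)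
      where
      lem : ∀ px py qx qy rx ry → (qy - py) * px + - (qx - px) * py - ((qy - py) * rx + - (qx - px) * ry) - + 1 ≡
        (qx - px) * (ry - py) - (qy - py) * (rx - px) - + 1
      lem = solve-∀
    neg : ∃[ r ] (r ∈ S × 0≤ (lf (- (qy - py)) (qx - px) p - lf (- (qy - py)) (qx - px) r - + 1)) → ∃[ r ] (r ∈ S × 0≤ (det p r q - + 1))
    neg (r@(rx , ry) , j , h) = r , j , ≥0-cong h (lem px py qx qy rx ry)
      where
      lem : ∀ px py qx qy rx ry → - (qy - py) * px + (qx - px) * py - (- (qy - py) * rx + (qx - px) * ry) - + 1 ≡
        (rx - px) * (qy - py) - (ry - py) * (qx - px) - + 1
      lem = solve-∀

Int⇒interior : ∀ {S p} → Int S p → InteriorPt (Poly S) p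
Int⇒interior {S} {p} h = surrounded⇒interior (Int⇒surrounded {S} {p} h)

∃∈? : {A : Set} {P : A → Set} → Decidable P → ∀ S → Dec (∃[ a ] (a ∈ S × P a))
∃∈? P? S = map′ find (λ { (a , i , pa) → lose i pa }) (Any.any? P? S)

surrounded? : ∀ S p → Dec (Surrounded S p)
surrounded? S p = ∃∈? (λ q → ¬? (q ≟ₚ p)) S ×-dec
  map′ (λ h q i n → All.lookup h i n) (λ h → All.tabulate (λ {q} i n → h q i n))
    (All.all? (λ q → ¬? (q ≟ₚ p) →-dec
      (∃∈? (λ r → 0≤? (det p q r - + 1)) S ×-dec ∃∈? (λ r → 0≤? (det p r q - + 1)) S)) S)

-- `Int` quantifies over all forms, `Surrounded` only over a finite list. Being interior, `Int` and
-- `Surrounded` imply one another in a circle, so the decision can be made on the list.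
Int? : ∀ S p → Dec (Int S p)
Int? S p = map′ (λ h → interior⇒Int {S} {p} (surrounded⇒interior h)) (Int⇒surrounded {S} {p}) (surrounded? S p)

-- Certificates for interior lattice points

-- Hull membership in dual form, through integral inequalities only. It passes along unimodular maps
-- and combines with `Int` without rational weights.
InHull : List Point → Point → Set
InHull S p = ∀ α β ε → (∀ s → s ∈ S → 0≤ aff α β ε s) → 0≤ aff α β ε p

∈⇒InHull : ∀ {S p} → p ∈ S → InHull S p
∈⇒InHull i α β ε h = h _ i

poly⇒InHull : ∀ {S p} → Poly S (ι p) → InHull S p
poly⇒InHull {S} {p} hp α β ε h = hull-≥0 α β ε h {p} hp

Int-strict : ∀ {S p} → Int S p → ∀ α β ε → NonZeroForm α β → (∀ s → s ∈ S → 0≤ aff α β ε s) →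
  0≤ (aff α β ε p - + 1)
Int-strict {S} {p} int α β ε nz h = go (int α β nz)
  where
  lem : ∀ a b e → a - b - + 1 + (b + e) ≡ a + e - + 1
  lem = solve-∀
  go : ∃[ q ] (q ∈ S × 0≤ (lf α β p - lf α β q - + 1)) → 0≤ (aff α β ε p - + 1)
  go (q , i , k) = ≥0-cong (k ⊕ h q i) (lem (lf α β p) (lf α β q) ε)

Int⇒InHull : ∀ {S p} → Int S p → InHull S p
Int⇒InHull {S} {p} int α β ε h = go (zero? α ×-dec zero? β)
  where
  lem : ∀ x → x - + 1 + + 1 ≡ x
  lem = solve-∀
  z : ∀ x y x' y' ε → + 0 * x + + 0 * y + ε ≡ + 0 * x' + + 0 * y' + ε
  z = solve-∀
  witness = int (+ 1) (+ 0) (λ ())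
  go : Dec (α ≡ + 0 × β ≡ + 0) → 0≤ aff α β ε p
  go (no nz) = ≥0-cong (Int-strict {S} {p} int α β ε nz h ⊕ nat≥0 {1}) (lem (aff α β ε p))
  go (yes (refl , refl)) = ≥0-cong (h (proj₁ witness) (proj₁ (proj₂ witness)))
    (z (proj₁ (proj₁ witness)) (proj₂ (proj₁ witness)) (proj₁ p) (proj₂ p) ε)

Supported : List Point → Point → ℤ → ℤ → Set
Supported S r α β = ∀ s → s ∈ S → 0≤ aff α β (- lf α β r) s

-- Since `S` is finite, a form either has a generator strictly below its value at `r` or supports
-- `S` at `r`. Refuting all supporting forms therefore produces the witnesses that `Int` asks for.
Int-refute : ∀ S r → (∀ α β → NonZeroForm α β → ¬ Supported S r α β) → Int S r
Int-refute S r h α β nz = go (∀∈? (λ s → 0≤? (aff α β (- lf α β r) s)) S)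
  where
  lem : ∀ a b → - (b + - a) - + 1 ≡ a - b - + 1
  lem = solve-∀
  go : Supported S r α β ⊎ (∃[ s ] (s ∈ S × ¬ 0≤ aff α β (- lf α β r) s)) →
    ∃[ q ] (q ∈ S × 0≤ (lf α β r - lf α β q - + 1))
  go (inj₁ all) = ⊥-elim (h α β nz all)
  go (inj₂ (s , i , k)) = s , i , ≥0-cong (≱0⇒ k) (lem (lf α β r) (lf α β s))

record Combination (i j k : ℤ) (a b c r : Point) : Set where
  constructor combination
  field
    fst-eq : i * proj₁ a + j * proj₁ b + k * proj₁ c ≡ (i + j + k) * proj₁ r
    snd-eq : i * proj₂ a + j * proj₂ b + k * proj₂ c ≡ (i + j + k) * proj₂ r

combination-form : ∀ {i j k a b c r} α β → Combination i j k a b c r →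
  i * aff α β (- lf α β r) a + j * aff α β (- lf α β r) b + k * aff α β (- lf α β r) c ≡ + 0
combination-form {i} {j} {k} {ax , ay} {bx , by} {cx , cy} {rx , ry} α β (combination ex ey) = trans
  (l₁ i j k ax ay bx by cx cy rx ry α β)
  (trans (cong₂ (λ u v → α * (u - (i + j + k) * rx) + β * (v - (i + j + k) * ry)) ex ey)
         (l₂ α β ((i + j + k) * rx) ((i + j + k) * ry)))
  where
  l₁ : ∀ i j k ax ay bx by cx cy rx ry α β →
    i * (α * ax + β * ay + - (α * rx + β * ry)) + j * (α * bx + β * by + - (α * rx + β * ry))
      + k * (α * cx + β * cy + - (α * rx + β * ry)) ≡
    α * (i * ax + j * bx + k * cx - (i + j + k) * rx) + β * (i * ay + j * by + k * cy - (i + j + k) * ry)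
  l₁ = solve-∀
  l₂ : ∀ α β x y → α * (x - x) + β * (y - y) ≡ + 0
  l₂ = solve-∀

-- A form supporting `S` at `r` is positive at the interior point `a` and nonnegative at `b` and
-- `c`, whereas the weighted mean of these values is its value 0 at `r`.
Int-combine : ∀ {S a b c r} i j k → Int S a → InHull S b → InHull S c →
  0≤ (i - + 1) → 0≤ j → 0≤ k → Combination i j k a b c r → Int S r
Int-combine {S} {a} {b} {c} {r} i j k ha hb hc hi hj hk comb = Int-refute S r λ α β nz all →
  contra i j k (val α β a) (val α β b) (val α β c) hi hj hk
    (Int-strict {S} {a} ha α β (- lf α β r) nz all)
    (hb α β (- lf α β r) all) (hc α β (- lf α β r) all) (combination-form α β comb)
  where
  val : ℤ → ℤ → Point → ℤ
  val α β = aff α β (- lf α β r)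
  contra : ∀ i j k A B C → 0≤ (i - + 1) → 0≤ j → 0≤ k → 0≤ (A - + 1) → 0≤ B → 0≤ C → i * A + j * B + k * C ≡ + 0 → ⊥
  contra i j k A B C hi hj hk hA hB hC e = absurd ((hi ⊗ hA ⊕ hi ⊕ hA) ⊕ hj ⊗ hB ⊕ hk ⊗ hC)
    (trans (lem i j k A B C) (cong (_- + 1) e))
    where
    lem : ∀ i j k A B C → (i - + 1) * (A - + 1) + (i - + 1) + (A - + 1) + j * B + k * C ≡ i * A + j * B + k * C - + 1
    lem = solve-∀

form-vanish : ∀ α β t a b c → det a b c ≢ + 0 → aff α β t a ≡ + 0 → aff α β t b ≡ + 0 → aff α β t c ≡ + 0 →
  α ≡ + 0 × β ≡ + 0
form-vanish α β t a@(ax , ay) b@(bx , by) c@(cx , cy) D≢0 ea eb ec =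
  from (ℤP.i*j≡0⇒i≡0∨j≡0 α αD) , from (ℤP.i*j≡0⇒i≡0∨j≡0 β βD)
  where
  from : ∀ {x} → x ≡ + 0 ⊎ det a b c ≡ + 0 → x ≡ + 0
  from (inj₁ e) = e
  from (inj₂ e) = ⊥-elim (D≢0 e)
  l₁ : ∀ α β ax ay bx by cx cy t → α * ((bx - ax) * (cy - ay) - (by - ay) * (cx - ax)) ≡
    ((α * bx + β * by + t) - (α * ax + β * ay + t)) * (cy - ay) - ((α * cx + β * cy + t) - (α * ax + β * ay + t)) * (by - ay)
  l₁ = solve-∀
  l₂ : ∀ α β ax ay bx by cx cy t → β * ((bx - ax) * (cy - ay) - (by - ay) * (cx - ax)) ≡
    ((α * cx + β * cy + t) - (α * ax + β * ay + t)) * (bx - ax) - ((α * bx + β * by + t) - (α * ax + β * ay + t)) * (cx - ax)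
  l₂ = solve-∀
  z : ∀ u v → (+ 0 - + 0) * u - (+ 0 - + 0) * v ≡ + 0
  z = solve-∀
  αD : α * det a b c ≡ + 0
  αD = trans (l₁ α β ax ay bx by cx cy t)
    (trans (cong₂ (λ A BC → (proj₁ BC - A) * (cy - ay) - (proj₂ BC - A) * (by - ay)) ea (cong₂ _,_ eb ec)) (z (cy - ay) (by - ay)))
  βD : β * det a b c ≡ + 0
  βD = trans (l₂ α β ax ay bx by cx cy t)
    (trans (cong₂ (λ A BC → (proj₂ BC - A) * (bx - ax) - (proj₁ BC - A) * (cx - ax)) ea (cong₂ _,_ eb ec)) (z (bx - ax) (cx - ax)))

-- With three positive weights, a form supporting `S` at `r` has to vanish at all three points. They
-- are not collinear, so the form is zero.
Int-triangle : ∀ {S a b c r} i j k → InHull S a → InHull S b → InHull S c → det a b c ≢ + 0 →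
  0≤ (i - + 1) → 0≤ (j - + 1) → 0≤ (k - + 1) → Combination i j k a b c r → Int S r
Int-triangle {S} {a@(ax , ay)} {b@(bx , by)} {c@(cx , cy)} {r@(rx , ry)} i j k ha hb hc D≢0 hi hj hk comb =
  Int-refute S r λ α β nz all → nz (form-vanish α β (- lf α β r) a b c D≢0
    (vanish i j k (val α β a) (val α β b) (val α β c) hi hj hk (ha α β _ all) (hb α β _ all) (hc α β _ all) (combination-form α β comb))
    (vanish j k i (val α β b) (val α β c) (val α β a) hj hk hi (hb α β _ all) (hc α β _ all) (ha α β _ all)
      (trans (rot i j k (val α β a) (val α β b) (val α β c)) (combination-form α β comb)))
    (vanish k i j (val α β c) (val α β a) (val α β b) hk hi hj (hc α β _ all) (ha α β _ all) (hb α β _ all)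
      (trans (sym (rot k i j (val α β c) (val α β a) (val α β b))) (combination-form α β comb))))
  where
  val : ℤ → ℤ → Point → ℤ
  val α β = aff α β (- lf α β r)
  rot : ∀ i j k A B C → j * B + k * C + i * A ≡ i * A + j * B + k * C
  rot = solve-∀
  vanish : ∀ i j k A B C → 0≤ (i - + 1) → 0≤ (j - + 1) → 0≤ (k - + 1) → 0≤ A → 0≤ B → 0≤ C →
    i * A + j * B + k * C ≡ + 0 → A ≡ + 0
  vanish i j k A B C hi hj hk hA hB hC e = ≥0-antisym hA
    (≥0-cong (hi ⊗ hA ⊕ (hj ⊗ hB ⊕ hB) ⊕ (hk ⊗ hC ⊕ hC)) (trans (lem i j k A B C) (trans (cong (_- A) e) (lem₀ A))))
    where
    lem : ∀ i j k A B C → (i - + 1) * A + ((j - + 1) * B + B) + ((k - + 1) * C + C) ≡ i * A + j * B + k * C - A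
    lem = solve-∀
    lem₀ : ∀ A → + 0 - A ≡ - A
    lem₀ = solve-∀

-- Unimodular maps

act : Unimodular → Point → Point
act φ p = aff a b e p , aff c d f p
  where open Unimodular φ

apply-ι : ∀ φ p → apply φ (ι p) ≡ ι (act φ p)
apply-ι φ p = cong₂ _,_ (affℚ-ι a b e p) (affℚ-ι c d f p)
  where open Unimodular φ

sgn : ∀ φ → let open Unimodular φ in ∃[ σ ] (σ * σ ≡ + 1 × a * d - b * c ≡ σ)
sgn φ = [ (λ h → + 1 , refl , h) , (λ h → -[1+ 0 ] , refl , h) ]′ (Unimodular.unimod φ)

σσ≡1⇒ : ∀ {σ} → σ * σ ≡ + 1 → σ ≡ + 1 ⊎ σ ≡ -[1+ 0 ]
σσ≡1⇒ {+ 1} e = inj₁ refl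
σσ≡1⇒ { -[1+ 0 ]} e = inj₂ refl

-- The determinant σ is 1 or -1, hence its own inverse, and the inverse matrix is σ times the
-- adjugate.
inv : Unimodular → Unimodular
inv φ = record
  { a = σ * d ; b = - (σ * b) ; c = - (σ * c) ; d = σ * a
  ; e = σ * (b * f - d * e) ; f = σ * (c * e - a * f)
  ; unimod = [ (λ h → inj₁ (trans eq h)) , (λ h → inj₂ (trans eq h)) ]′ (σσ≡1⇒ σσ) }
  where
  open Unimodular φ
  σ = proj₁ (sgn φ)
  σσ = proj₁ (proj₂ (sgn φ))
  lem : ∀ σ a b c d → σ * d * (σ * a) - - (σ * b) * - (σ * c) ≡ σ * σ * (a * d - b * c)
  lem = solve-∀
  eq : σ * d * (σ * a) - - (σ * b) * - (σ * c) ≡ σ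
  eq = trans (lem σ a b c d) (trans (cong₂ _*_ σσ (proj₂ (proj₂ (sgn φ)))) (ℤP.*-identityˡ σ))

affℚ-apply : ∀ α β ε ψ q → let open Unimodular ψ in
  affℚ α β ε (apply ψ q) ≡ affℚ (α * a + β * c) (α * b + β * d) (α * e + β * f + ε) q
affℚ-apply α β ε ψ (x , y) = trans (lem (toℚ α) (toℚ β) (toℚ ε) (toℚ a) (toℚ b) (toℚ c) (toℚ d) (toℚ e) (toℚ f) x y)
  (cong₂ (λ u v → proj₁ u ℚ.* x ℚ.+ proj₂ u ℚ.* y ℚ.+ v)
    (sym (cong₂ _,_ (two α a β c) (two α b β d)))
    (sym (trans (toℚ-+ (α * e + β * f) ε) (cong (ℚ._+ toℚ ε) (two α e β f)))))
  where
  open Unimodular ψ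
  two : ∀ α a β c → toℚ (α * a + β * c) ≡ toℚ α ℚ.* toℚ a ℚ.+ toℚ β ℚ.* toℚ c
  two α a β c = trans (toℚ-+ (α * a) (β * c)) (cong₂ ℚ._+_ (toℚ-* α a) (toℚ-* β c))
  lem : ∀ A B E a b c d e f x y →
    A ℚ.* (a ℚ.* x ℚ.+ b ℚ.* y ℚ.+ e) ℚ.+ B ℚ.* (c ℚ.* x ℚ.+ d ℚ.* y ℚ.+ f) ℚ.+ E ≡
    (A ℚ.* a ℚ.+ B ℚ.* c) ℚ.* x ℚ.+ (A ℚ.* b ℚ.+ B ℚ.* d) ℚ.* y ℚ.+ (A ℚ.* e ℚ.+ B ℚ.* f ℚ.+ E)
  lem = TR.solve-∀ ℚring

affℚ-x : ∀ q → affℚ (+ 1) (+ 0) (+ 0) q ≡ proj₁ q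
affℚ-x (x , y) = lem x y
  where
  lem : ∀ x y → 1ℚ ℚ.* x ℚ.+ 0ℚ ℚ.* y ℚ.+ 0ℚ ≡ x
  lem = TR.solve-∀ ℚring

affℚ-y : ∀ q → affℚ (+ 0) (+ 1) (+ 0) q ≡ proj₂ q
affℚ-y (x , y) = lem x y
  where
  lem : ∀ x y → 0ℚ ℚ.* x ℚ.+ 1ℚ ℚ.* y ℚ.+ 0ℚ ≡ y
  lem = TR.solve-∀ ℚring

module Inverse (φ : Unimodular) where
  open Unimodular φ
  open Unimodular (inv φ) renaming (a to a'; b to b'; c to c'; d to d'; e to e'; f to f'; unimod to unimod')
  private
    σ = proj₁ (sgn φ)
    D≡σ : a * d - b * c ≡ σ
    D≡σ = proj₂ (proj₂ (sgn φ))
    one : σ * (a * d - b * c) ≡ + 1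
    one = trans (cong (σ *_) D≡σ) (proj₁ (proj₂ (sgn φ)))
    aff-cong : ∀ {α α' β β' ε ε'} q → α ≡ α' → β ≡ β' → ε ≡ ε' → affℚ α β ε q ≡ affℚ α' β' ε' q
    aff-cong q refl refl refl = refl
    one-x : ∀ x → σ * (a * d - b * c) * x ≡ x
    one-x x = trans (cong (_* x) one) (ℤP.*-identityˡ x)
    l₁ : ∀ σ a b c d → a * (σ * d) + b * - (σ * c) ≡ σ * (a * d - b * c)
    l₁ = solve-∀
    l₂ : ∀ σ a b → a * - (σ * b) + b * (σ * a) ≡ + 0
    l₂ = solve-∀
    l₃ : ∀ σ a b c d e f → a * (σ * (b * f - d * e)) + b * (σ * (c * e - a * f)) + e ≡ e - σ * (a * d - b * c) * e
    l₃ = solve-∀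
    l₄ : ∀ σ c d → c * (σ * d) + d * - (σ * c) ≡ + 0
    l₄ = solve-∀
    l₅ : ∀ σ a b c d → c * - (σ * b) + d * (σ * a) ≡ σ * (a * d - b * c)
    l₅ = solve-∀
    l₆ : ∀ σ a b c d e f → c * (σ * (b * f - d * e)) + d * (σ * (c * e - a * f)) + f ≡ f - σ * (a * d - b * c) * f
    l₆ = solve-∀
    m₁ : ∀ σ a b c d → σ * d * a + - (σ * b) * c ≡ σ * (a * d - b * c)
    m₁ = solve-∀
    m₂ : ∀ σ b d → σ * d * b + - (σ * b) * d ≡ + 0
    m₂ = solve-∀
    m₃ : ∀ σ b d e f → σ * d * e + - (σ * b) * f + σ * (b * f - d * e) ≡ + 0
    m₃ = solve-∀
    m₄ : ∀ σ a c → - (σ * c) * a + σ * a * c ≡ + 0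
    m₄ = solve-∀
    m₅ : ∀ σ a b c d → - (σ * c) * b + σ * a * d ≡ σ * (a * d - b * c)
    m₅ = solve-∀
    m₆ : ∀ σ a c e f → - (σ * c) * e + σ * a * f + σ * (c * e - a * f) ≡ + 0
    m₆ = solve-∀
    cancel : ∀ x → x - σ * (a * d - b * c) * x ≡ + 0
    cancel x = ℤP.i≡j⇒i-j≡0 (sym (one-x x))

  apply-inverseʳ : ∀ q → apply φ (apply (inv φ) q) ≡ q
  apply-inverseʳ q = cong₂ _,_
    (trans (affℚ-apply a b e (inv φ) q)
      (trans (aff-cong q (trans (l₁ σ a b c d) one) (l₂ σ a b) (trans (l₃ σ a b c d e f) (cancel e))) (affℚ-x q)))
    (trans (affℚ-apply c d f (inv φ) q)
      (trans (aff-cong q (l₄ σ c d) (trans (l₅ σ a b c d) one) (trans (l₆ σ a b c d e f) (cancel f))) (affℚ-y q)))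

  apply-inverseˡ : ∀ q → apply (inv φ) (apply φ q) ≡ q
  apply-inverseˡ q = cong₂ _,_
    (trans (affℚ-apply a' b' e' φ q)
      (trans (aff-cong q (trans (m₁ σ a b c d) one) (m₂ σ b d) (m₃ σ b d e f)) (affℚ-x q)))
    (trans (affℚ-apply c' d' f' φ q)
      (trans (aff-cong q (m₄ σ a c) (trans (m₅ σ a b c d) one) (m₆ σ a c e f)) (affℚ-y q)))

  act-inverseʳ : ∀ p → act φ (act (inv φ) p) ≡ p
  act-inverseʳ p = ι-injective (trans (sym (apply-ι φ _)) (trans (cong (apply φ) (sym (apply-ι (inv φ) p))) (apply-inverseʳ (ι p))))

  act-inverseˡ : ∀ p → act (inv φ) (act φ p) ≡ p
  act-inverseˡ p = ι-injective (trans (sym (apply-ι (inv φ) _)) (trans (cong (apply (inv φ)) (sym (apply-ι φ p))) (apply-inverseˡ (ι p))))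

open Inverse public

lf-act : ∀ φ α β p → let open Unimodular φ in
  lf α β (act φ p) ≡ lf (α * a + β * c) (α * b + β * d) p + (α * e + β * f)
lf-act φ α β (x , y) = lem α β a b c d e f x y
  where
  open Unimodular φ
  lem : ∀ α β a b c d e f x y → α * (a * x + b * y + e) + β * (c * x + d * y + f) ≡
    (α * a + β * c) * x + (α * b + β * d) * y + (α * e + β * f)
  lem = solve-∀

pullback-nonzero : ∀ φ α β → NonZeroForm α β → let open Unimodular φ in
  NonZeroForm (α * a + β * c) (α * b + β * d)
pullback-nonzero φ α β nz (e₁ , e₂) = nz (zero-of α (trans (sym (l₁ α β a b c d)) (van d c)) , zero-of β (trans (sym (l₂ α β a b c d)) (van' a b)))
  where
  open Unimodular φ
  σ = proj₁ (sgn φ)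
  l₁ : ∀ α β a b c d → (α * a + β * c) * d - (α * b + β * d) * c ≡ (a * d - b * c) * α
  l₁ = solve-∀
  l₂ : ∀ α β a b c d → (α * b + β * d) * a - (α * a + β * c) * b ≡ (a * d - b * c) * β
  l₂ = solve-∀
  z : ∀ x y → + 0 * x - + 0 * y ≡ + 0
  z = solve-∀
  van : ∀ x y → (α * a + β * c) * x - (α * b + β * d) * y ≡ + 0
  van x y = trans (cong₂ (λ u v → u * x - v * y) e₁ e₂) (z x y)
  van' : ∀ x y → (α * b + β * d) * x - (α * a + β * c) * y ≡ + 0
  van' x y = trans (cong₂ (λ u v → v * x - u * y) e₁ e₂) (z x y)
  zero-of : ∀ x → (a * d - b * c) * x ≡ + 0 → x ≡ + 0
  zero-of x e = trans (sym (ℤP.*-identityˡ x)) (trans (cong (_* x) (sym (proj₁ (proj₂ (sgn φ)))))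
    (trans (ℤP.*-assoc σ σ x) (trans (cong (λ t → σ * (t * x)) (sym (proj₂ (proj₂ (sgn φ))))) (trans (cong (σ *_) e) (ℤP.*-zeroʳ σ)))))

Int-act : ∀ φ {S p} → Int S p → Int (map (act φ) S) (act φ p)
Int-act φ {S} {p} int α β nz = go (int (α * a + β * c) (α * b + β * d) (pullback-nonzero φ α β nz))
  where
  open Unimodular φ
  lem : ∀ x y k → x - y - + 1 ≡ (x + k) - (y + k) - + 1
  lem = solve-∀
  go : ∃[ q ] (q ∈ S × 0≤ (lf (α * a + β * c) (α * b + β * d) p - lf (α * a + β * c) (α * b + β * d) q - + 1)) →
    ∃[ q ] (q ∈ map (act φ) S × 0≤ (lf α β (act φ p) - lf α β q - + 1))
  go (q , i , h) = act φ q , ∈-map⁺ (act φ) i , ≥0-cong h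
    (trans (lem (lf (α * a + β * c) (α * b + β * d) p) (lf (α * a + β * c) (α * b + β * d) q) (α * e + β * f))
      (cong₂ (λ u v → u - v - + 1) (sym (lf-act φ α β p)) (sym (lf-act φ α β q))))

∀∈map : ∀ φ {S} (Q : Point → Set) → (∀ s → s ∈ S → Q (act φ s)) → ∀ q → q ∈ map (act φ) S → Q q
∀∈map φ {S} Q h q i = go (∈-map⁻ (act φ) i)
  where
  go : ∃[ s ] (s ∈ S × q ≡ act φ s) → Q q
  go (s , j , refl) = h s j

map-inverse : ∀ φ S → map (act (inv φ)) (map (act φ) S) ≡ S
map-inverse φ [] = refl
map-inverse φ (s ∷ S) = cong₂ _∷_ (act-inverseˡ φ s) (map-inverse φ S)

Int-act⁻ : ∀ φ {S} p → Int (map (act φ) S) p → Int S (act (inv φ) p)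
Int-act⁻ φ {S} p int = subst (λ T → Int T (act (inv φ) p)) (map-inverse φ S) (Int-act (inv φ) {map (act φ) S} {p} int)

polygon-≃ : ∀ φ {S T} → (∀ s → s ∈ S → Poly T (ι (act φ s))) → (∀ t → t ∈ T → t ∈ map (act φ) S) → Poly S ≃ Poly T
polygon-≃ φ {S} {T} h k = φ , λ q → mk⇔
  (λ hq → apply (inv φ) q , hull-apply (inv φ) (λ t i → back t i) {q} hq , apply-inverseʳ φ q)
  (λ { (q' , hq' , refl) → hull-apply φ (λ s i → subst (Poly T) (sym (apply-ι φ s)) (h s i)) {q'} hq' })
  where
  back : ∀ t → t ∈ T → Poly S (apply (inv φ) (ι t))
  back t i = go (∈-map⁻ (act φ) (k t i))
    where
    go : ∃[ s ] (s ∈ S × t ≡ act φ s) → Poly S (apply (inv φ) (ι t))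
    go (s , j , refl) = subst (Poly S) (sym (trans (cong (apply (inv φ)) (sym (apply-ι φ s))) (apply-inverseˡ φ (ι s))))
      (hull-generator s j)

≃-image : ∀ {S T} (e : Poly S ≃ Poly T) s → s ∈ S → Poly T (ι (act (proj₁ e) s))
≃-image (φ , h) s i = Equivalence.from (h _) (ι s , hull-generator s i , apply-ι φ s)

≃-preimage : ∀ {S T} (e : Poly S ≃ Poly T) t → t ∈ T → Poly S (ι (act (inv (proj₁ e)) t))
≃-preimage {S} (φ , h) t i = go (Equivalence.to (h (ι t)) (hull-generator t i))
  where
  go : Image φ (Poly S) (ι t) → Poly S (ι (act (inv φ) t))
  go (q , hq , eq) = subst (Poly S) (trans (sym (apply-inverseˡ φ q)) (trans (cong (apply (inv φ)) eq) (apply-ι (inv φ) t))) hq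

-- Fitting into boxes

InBox : ℤ → Point → Set
InBox d (x , y) = 0≤ x × 0≤ (d - x) × 0≤ y × 0≤ (d - y)

fits-intro : ∀ {P} φ d → (∀ p → P p → InBox (+ d) (act φ p)) → FitsIn (Conv P) d
fits-intro {P} φ d h = φ , λ q hq →
    hull-≥0ℚ a b e (λ p hp → proj₁ (h p hp)) {q} hq ,
    upper a b e (λ p hp → proj₁ (proj₂ (h p hp))) q hq ,
    hull-≥0ℚ c d' f (λ p hp → proj₁ (proj₂ (proj₂ (h p hp)))) {q} hq ,
    upper c d' f (λ p hp → proj₂ (proj₂ (proj₂ (h p hp)))) q hq
  where
  open Unimodular φ renaming (d to d')
  upper : ∀ α β ε → (∀ p → P p → 0≤ (+ d - aff α β ε p)) → ∀ q → Conv P q → affℚ α β ε q ℚ.≤ toℚ (+ d)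
  upper α β ε k q@(x , y) hq = 0≤-⇒≤ℚ (subst (0ℚ ℚ.≤_) eq
    (hull-≥0ℚ (- α) (- β) (+ d - ε) (λ { p@(x , y) hp → ≥0-cong (k p hp) (lem α β ε (+ d) x y) }) {q} hq))
    where
    lem : ∀ α β ε d x y → d - (α * x + β * y + ε) ≡ - α * x + - β * y + (d - ε)
    lem = solve-∀
    lemℚ : ∀ A B E D x y → ℚ.- A ℚ.* x ℚ.+ ℚ.- B ℚ.* y ℚ.+ (D ℚ.- E) ≡ D ℚ.- (A ℚ.* x ℚ.+ B ℚ.* y ℚ.+ E)
    lemℚ = TR.solve-∀ ℚring
    eq : affℚ (- α) (- β) (+ d - ε) q ≡ toℚ (+ d) ℚ.- affℚ α β ε q
    eq = trans (cong₂ (λ u v → proj₁ u ℚ.* x ℚ.+ proj₂ u ℚ.* y ℚ.+ v) (cong₂ _,_ (toℚ-neg α) (toℚ-neg β)) (toℚ-sub (+ d) ε))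
      (lemℚ (toℚ α) (toℚ β) (toℚ ε) (toℚ (+ d)) x y)

fits-elim : ∀ {X d} (h : FitsIn X d) p → X (ι p) → InBox (+ d) (act (proj₁ h) p)
fits-elim {X} {d} (φ , h) p hp = go (subst (Box d) (apply-ι φ p) (h (ι p) hp))
  where
  go : Box d (ι (act φ p)) → InBox (+ d) (act φ p)
  go (h₁ , h₂ , h₃ , h₄) = toℚ-cancel {+ 0} {x} h₁ , ℤP.i≤j⇒0≤j-i (toℚ-cancel {x} {+ d} h₂) ,
    toℚ-cancel {+ 0} {y} h₃ , ℤP.i≤j⇒0≤j-i (toℚ-cancel {y} {+ d} h₄)
    where
    x = proj₁ (act φ p)
    y = proj₂ (act φ p)

-- Exchanges rows and columns, so that `pullback-nonzero`, a statement about combinations of rows,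
-- also gives injectivity on vectors.
transpose : Unimodular → Unimodular
transpose φ = record { a = a ; b = c ; c = b ; d = d ; e = + 0 ; f = + 0 ;
    unimod = [ (λ h → inj₁ (trans (lem a b c d) h)) , (λ h → inj₂ (trans (lem a b c d) h)) ]′ unimod }
  where
  open Unimodular φ
  lem : ∀ a b c d → a * d - c * b ≡ a * d - b * c
  lem = solve-∀

kernel : ∀ φ x y → let open Unimodular φ in a * x + b * y ≡ + 0 → c * x + d * y ≡ + 0 → x ≡ + 0 × y ≡ + 0
kernel φ x y e₁ e₂ = decide (zero? x ×-dec zero? y)
  where
  open Unimodular φ
  comm : ∀ x y a b → x * a + y * b ≡ a * x + b * y
  comm = solve-∀
  decide : Dec (x ≡ + 0 × y ≡ + 0) → x ≡ + 0 × y ≡ + 0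
  decide (yes h) = h
  decide (no nz) = ⊥-elim (pullback-nonzero (transpose φ) x y nz (trans (comm x y a b) e₁ , trans (comm x y c d) e₂))

-- The linear part is injective, so one of the two coordinates is not constant along `w` ≠ 0. That
-- coordinate changes by at least `k` > `d` between the two ends.
not-fits : ∀ {X} u w k → X (ι u) → X (ι (proj₁ u + + k * proj₁ w , proj₂ u + + k * proj₂ w)) → w ≢ (+ 0 , + 0) →
  ∀ d → d ℕ.< k → ¬ FitsIn X d
not-fits {X} u@(ux , uy) w@(wx , wy) k hu hv w≢0 d d<k fit@(φ , _) =
  w≢0 (cong₂ _,_ (proj₁ both) (proj₂ both))
  where
  open Unimodular φ renaming (d to d')
  v : Point
  v = ux + + k * wx , uy + + k * wy
  Bu : InBox (+ d) (act φ u)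
  Bu = fits-elim {X} {d} fit u hu
  Bv : InBox (+ d) (act φ v)
  Bv = fits-elim {X} {d} fit v hv
  k>d : 0≤ (+ k - + d - + 1)
  k>d = ≥0-cong (ℤP.i≤j⇒0≤j-i (ℤ.+≤+ d<k)) (lem (+ d) (+ k))
    where
    lem : ∀ d k → k - (+ 1 + d) ≡ k - d - + 1
    lem = solve-∀
  row : ∀ α β ε → 0≤ aff α β ε u → 0≤ (+ d - aff α β ε u) → 0≤ aff α β ε v → 0≤ (+ d - aff α β ε v) → α * wx + β * wy ≡ + 0
  row α β ε h₁ h₂ h₃ h₄ = go (trichotomy (α * wx + β * wy))
    where
    up : ∀ k α β ε ux uy wx wy d → (d - (α * (ux + k * wx) + β * (uy + k * wy) + ε)) + (α * ux + β * uy + ε) + k * (α * wx + β * wy - + 1) + (k - d - + 1) ≡ -[1+ 0 ]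
    up = solve-∀
    dn : ∀ k α β ε ux uy wx wy d → (d - (α * ux + β * uy + ε)) + (α * (ux + k * wx) + β * (uy + k * wy) + ε) + k * (- (α * wx + β * wy) - + 1) + (k - d - + 1) ≡ -[1+ 0 ]
    dn = solve-∀
    go : 0≤ (α * wx + β * wy - + 1) ⊎ α * wx + β * wy ≡ + 0 ⊎ 0≤ (- (α * wx + β * wy) - + 1) → α * wx + β * wy ≡ + 0
    go (inj₂ (inj₁ e)) = e
    go (inj₁ h) = ⊥-elim (absurd (h₄ ⊕ h₁ ⊕ nat≥0 {k} ⊗ h ⊕ k>d) (up (+ k) α β ε ux uy wx wy (+ d)))
    go (inj₂ (inj₂ h)) = ⊥-elim (absurd (h₂ ⊕ h₃ ⊕ nat≥0 {k} ⊗ h ⊕ k>d) (dn (+ k) α β ε ux uy wx wy (+ d)))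
  both : wx ≡ + 0 × wy ≡ + 0
  both = kernel φ wx wy (row a b e (proj₁ Bu) (proj₁ (proj₂ Bu)) (proj₁ Bv) (proj₁ (proj₂ Bv)))
      (row c d' f (proj₁ (proj₂ (proj₂ Bu))) (proj₂ (proj₂ (proj₂ Bu))) (proj₁ (proj₂ (proj₂ Bv))) (proj₂ (proj₂ (proj₂ Bv))))

aff-act : ∀ α β ε φ p → let open Unimodular φ in
  aff (α * a + β * c) (α * b + β * d) (α * e + β * f + ε) p ≡ aff α β ε (act φ p)
aff-act α β ε φ (x , y) = lem α β ε a b c d e f x y
  where
  open Unimodular φ
  lem : ∀ α β ε a b c d e f x y →
    (α * a + β * c) * x + (α * b + β * d) * y + (α * e + β * f + ε) ≡
    α * (a * x + b * y + e) + β * (c * x + d * y + f) + ε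
  lem = solve-∀

abstract
  compose : Unimodular → Unimodular → Unimodular
  compose ρ φ = record
    { a = α * a + β * c ; b = α * b + β * d ; c = γ * a + δ * c ; d = γ * b + δ * d
    ; e = α * e + β * f + ε ; f = γ * e + δ * f + ζ
    ; unimod = prod (Unimodular.unimod ρ) (Unimodular.unimod φ) }
    where
    open Unimodular φ
    open Unimodular ρ renaming (a to α; b to β; c to γ; d to δ; e to ε; f to ζ) hiding (unimod)
    lem : ∀ α β γ δ a b c d → (α * a + β * c) * (γ * b + δ * d) - (α * b + β * d) * (γ * a + δ * c) ≡
      (α * δ - β * γ) * (a * d - b * c)
    lem = solve-∀
    eq : ∀ {s t} → α * δ - β * γ ≡ s → a * d - b * c ≡ t →
      (α * a + β * c) * (γ * b + δ * d) - (α * b + β * d) * (γ * a + δ * c) ≡ s * t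
    eq h k = trans (lem α β γ δ a b c d) (cong₂ _*_ h k)
    prod : (α * δ - β * γ ≡ + 1) ⊎ (α * δ - β * γ ≡ -[1+ 0 ]) → (a * d - b * c ≡ + 1) ⊎ (a * d - b * c ≡ -[1+ 0 ]) →
      ((α * a + β * c) * (γ * b + δ * d) - (α * b + β * d) * (γ * a + δ * c) ≡ + 1) ⊎
      ((α * a + β * c) * (γ * b + δ * d) - (α * b + β * d) * (γ * a + δ * c) ≡ -[1+ 0 ])
    prod (inj₁ h) (inj₁ k) = inj₁ (eq h k)
    prod (inj₁ h) (inj₂ k) = inj₂ (eq h k)
    prod (inj₂ h) (inj₁ k) = inj₂ (eq h k)
    prod (inj₂ h) (inj₂ k) = inj₁ (eq h k)

  act-compose : ∀ ρ φ p → act (compose ρ φ) p ≡ act ρ (act φ p)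
  act-compose ρ φ p = cong₂ _,_ (aff-act α β ε φ p) (aff-act γ δ ζ φ p)
    where open Unimodular ρ renaming (a to α; b to β; c to γ; d to δ; e to ε; f to ζ)

map-compose : ∀ ρ φ S → map (act (compose ρ φ)) S ≡ map (act ρ) (map (act φ) S)
map-compose ρ φ [] = refl
map-compose ρ φ (s ∷ S) = cong₂ _∷_ (act-compose ρ φ s) (map-compose ρ φ S)

row-coprime : ∀ φ → let open Unimodular φ in Coprime ℤ.∣ c ∣ ℤ.∣ d ∣
row-coprime φ {i} (i∣c , i∣d) = ℕDiv.∣1⇒≡1 (subst (i ℕDiv.∣_) (unit unimod) divides-det)
  where
  open Unimodular φ
  unit : (a * d - b * c ≡ + 1) ⊎ (a * d - b * c ≡ -[1+ 0 ]) → ℤ.∣ a * d - b * c ∣ ≡ 1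
  unit (inj₁ e) = cong ℤ.∣_∣ e
  unit (inj₂ e) = cong ℤ.∣_∣ e
  divides-det : i ℕDiv.∣ ℤ.∣ a * d - b * c ∣
  divides-det = ℤDiv.∣⇒∣ᵤ {+ i} {a * d - b * c} (ℤDiv.∣m∣n⇒∣m-n
    (ℤDiv.∣n⇒∣m*n a (ℤDiv.∣ᵤ⇒∣ {+ i} {d} i∣d)) (ℤDiv.∣n⇒∣m*n b (ℤDiv.∣ᵤ⇒∣ {+ i} {c} i∣c)))

-- Lattice segments as edges

module LatticeSegment (φ : Unimodular) (l m h : ℤ) (l≤m : 0≤ (m - l)) where
  open Unimodular φ
  open Unimodular (inv φ) using () renaming (a to a'; b to b'; c to c'; d to d'; e to e'; f to f')

  u v : Point
  u = act (inv φ) (l , h)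
  v = act (inv φ) (m , h)

  private
    between : ∀ a b e l m h x → (m - x) * (a * l + b * h + e) + (x - l) * (a * m + b * h + e) + + 0 * (a * l + b * h + e) ≡
      (m - x + (x - l) + + 0) * (a * x + b * h + e)
    between = solve-∀
    total : ∀ l m x → m - l - + 1 ≡ m - x + (x - l) + + 0 - + 1
    total = solve-∀

  on-segment : ∀ p → proj₂ (act φ p) ≡ h → 0≤ (proj₁ (act φ p) - l) → 0≤ (m - proj₁ (act φ p)) → Seg u v (ι p)
  on-segment p y≡h hl hm = subst (λ r → Seg u v (ι r)) (trans (cong (λ y → act (inv φ) (proj₁ (act φ p) , y)) (sym y≡h)) (act-inverseˡ φ p))
      (go (trichotomy (m - l)))
    where
    x = proj₁ (act φ p)
    same : ∀ {l m x} → m - l ≡ + 0 → 0≤ (x - l) → 0≤ (m - x) → l ≡ x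
    same {l} {m} {x} e h₁ h₂ = sym (ℤP.i-j≡0⇒i≡j x l (≥0-antisym h₁ (≥0-cong h₂ (trans (lem l m x) (trans (cong (_- (x - l)) e) (ℤP.+-identityˡ (- (x - l))))))))
      where
      lem : ∀ l m x → m - x ≡ m - l - (x - l)
      lem = solve-∀
    go : 0≤ (m - l - + 1) ⊎ m - l ≡ + 0 ⊎ 0≤ (- (m - l) - + 1) → Seg u v (ι (act (inv φ) (x , h)))
    go (inj₁ pos) = combine {p₀ = u} {v} {u} {act (inv φ) (x , h)} (m - x) (x - l) (+ 0)
      (here refl) (there (here refl)) (here refl) hm hl nat≥0 (≥0-cong pos (total l m x))
      (between a' b' e' l m h x) (between c' d' f' l m h x)
    go (inj₂ (inj₁ e)) = subst (λ t → Seg u v (ι (act (inv φ) (t , h)))) (same {l} {m} {x} e hl hm) (hull-generator u (here refl))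
    go (inj₂ (inj₂ neg)) = ⊥-elim (absurd (l≤m ⊕ neg) (lem (m - l)))
      where
      lem : ∀ x → x + (- x - + 1) ≡ -[1+ 0 ]
      lem = solve-∀

  act-u : act φ u ≡ (l , h)
  act-u = act-inverseʳ φ (l , h)

  act-v : act φ v ≡ (m , h)
  act-v = act-inverseʳ φ (m , h)

  private
    sub-ε : ∀ α β ε t p → aff α β (ε - t) p ≡ aff α β ε p - t
    sub-ε α β ε t (x , y) = lem α β ε t x y
      where
      lem : ∀ α β ε t x y → α * x + β * y + (ε - t) ≡ α * x + β * y + ε - t
      lem = solve-∀
    neg-ε : ∀ α β ε t p → aff (- α) (- β) (t - ε) p ≡ t - aff α β ε p
    neg-ε α β ε t (x , y) = lem α β ε t x y
      where
      lem : ∀ α β ε t x y → - α * x + - β * y + (t - ε) ≡ t - (α * x + β * y + ε)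
      lem = solve-∀
    0-0 : ∀ x → x - x ≡ + 0
    0-0 = solve-∀
    ends : {Q : Point → Set} → Q u → Q v → ∀ p → p ∈ u ∷ v ∷ [] → Q p
    ends qu qv p (here refl) = qu
    ends qu qv p (there (here refl)) = qv

  segment-coordinates : ∀ p → Seg u v (ι p) →
    proj₂ (act φ p) ≡ h × 0≤ (proj₁ (act φ p) - l) × 0≤ (m - proj₁ (act φ p))
  segment-coordinates p hp = ℤP.i-j≡0⇒i≡j y h (≥0-antisym y≥ (≥0-cong y≤ (flip y h))) , x≥ , x≤
    where
    x = proj₁ (act φ p)
    y = proj₂ (act φ p)
    flip : ∀ x y → y - x ≡ - (x - y)
    flip = solve-∀
    yz : ∀ {q t} → act φ q ≡ (t , h) → 0≤ (proj₂ (act φ q) - h)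
    yz e = ≡⇒≥0 (trans (cong (λ z → proj₂ z - h) e) (0-0 h))
    y≥ : 0≤ (y - h)
    y≥ = ≥0-cong (hull-≥0 c d (f - h) (ends (≥0-cong (yz act-u) (sym (sub-ε c d f h u))) (≥0-cong (yz act-v) (sym (sub-ε c d f h v)))) {p} hp) (sub-ε c d f h p)
    yz' : ∀ {q t} → act φ q ≡ (t , h) → 0≤ (h - proj₂ (act φ q))
    yz' e = ≡⇒≥0 (trans (cong (λ z → h - proj₂ z) e) (0-0 h))
    y≤ : 0≤ (h - y)
    y≤ = ≥0-cong (hull-≥0 (- c) (- d) (h - f) (ends (≥0-cong (yz' act-u) (sym (neg-ε c d f h u))) (≥0-cong (yz' act-v) (sym (neg-ε c d f h v)))) {p} hp) (neg-ε c d f h p)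
    x≥ : 0≤ (x - l)
    x≥ = ≥0-cong (hull-≥0 a b (e - l) (ends
      (≥0-cong (≡⇒≥0 (trans (cong (λ z → proj₁ z - l) act-u) (0-0 l))) (sym (sub-ε a b e l u)))
      (≥0-cong (≥0-cong l≤m (cong (λ z → proj₁ z - l) (sym act-v))) (sym (sub-ε a b e l v)))) {p} hp) (sub-ε a b e l p)
    x≤ : 0≤ (m - x)
    x≤ = ≥0-cong (hull-≥0 (- a) (- b) (m - e) (ends
      (≥0-cong (≥0-cong l≤m (cong (λ z → m - proj₁ z) (sym act-u))) (sym (neg-ε a b e m u)))
      (≥0-cong (≡⇒≥0 (trans (cong (λ z → m - proj₁ z) act-v) (0-0 m))) (sym (neg-ε a b e m v)))) {p} hp) (neg-ε a b e m p)

  private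
    nth : ℕ → Point
    nth n = act (inv φ) (l + + n , h)

    nth-injective : ∀ {i j} → nth i ≡ nth j → i ≡ j
    nth-injective {i} {j} eq = ℤP.+-injective (cancel l (+ i) (+ j)
      (cong proj₁ (trans (sym (act-inverseʳ φ (l + + i , h))) (trans (cong (act φ) eq) (act-inverseʳ φ (l + + j , h))))))
      where
      shift : ∀ l x → x ≡ - l + (l + x)
      shift = solve-∀
      cancel : ∀ l x y → l + x ≡ l + y → x ≡ y
      cancel l x y e = trans (shift l x) (trans (cong (λ z → - l + z) e) (sym (shift l y)))

  segment-points : ℕ → List Point
  segment-points k = map nth (upTo k)

  segment-count : ∀ k → + k ≡ m - l + + 1 → LatticeCount (Seg u v) k
  segment-count k ek = segment-points k , Unique.map⁺ nth-injective (Unique.upTo⁺ k) ,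
    trans (length-map nth (upTo k)) (length-upTo k) ,
    λ p → mk⇔ (λ i → to p (∈-map⁻ nth i)) (from p)
    where
    to : ∀ p → ∃[ n ] (n ∈ upTo k × p ≡ nth n) → Seg u v (ι p)
    to p (n , i , refl) = on-segment (nth n) (cong proj₂ eq) (≥0-cong (nat≥0 {n}) (trans (l₁ l (+ n)) (cong (λ z → proj₁ z - l) (sym eq))))
        (≥0-cong (ℤP.i≤j⇒0≤j-i (ℤ.+≤+ (∈-upTo⁻ i))) (trans (trans (cong (_- + (suc n)) ek) (l₂ l m (+ n))) (cong (λ z → m - proj₁ z) (sym eq))))
      where
      eq = act-inverseʳ φ (l + + n , h)
      l₁ : ∀ l n → n ≡ l + n - l
      l₁ = solve-∀
      l₂ : ∀ l m n → m - l + + 1 - (+ 1 + n) ≡ m - (l + n)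
      l₂ = solve-∀
    from : ∀ p → Seg u v (ι p) → p ∈ segment-points k
    from p hp = go (segment-coordinates p hp)
      where
      go : proj₂ (act φ p) ≡ h × 0≤ (proj₁ (act φ p) - l) × 0≤ (m - proj₁ (act φ p)) → p ∈ segment-points k
      go (ey , hl , hm) = find-n (≥0-nat hl)
        where
        x = proj₁ (act φ p)
        find-n : ∃[ n ] x - l ≡ + n → p ∈ segment-points k
        find-n (n , en) = subst (_∈ segment-points k) eq (∈-map⁺ nth (∈-upTo⁺ n<k))
          where
          l₁ : ∀ l x → l + (x - l) ≡ x
          l₁ = solve-∀
          l₂ : ∀ l m x → m - x ≡ m - l + + 1 - (+ 1 + (x - l))
          l₂ = solve-∀
          eq : nth n ≡ p
          eq = trans (cong (act (inv φ)) (cong₂ _,_ (trans (cong (λ z → l + z) (sym en)) (l₁ l x)) (sym ey))) (act-inverseˡ φ p)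
          n<k : n ℕ.< k
          n<k = ℤP.drop‿+≤+ (ℤP.0≤i-j⇒j≤i (≥0-cong hm (trans (l₂ l m x) (cong₂ (λ K N → K - (+ 1 + N)) (sym ek) en))))

  -- The second coordinate is minimal on this segment while `Edge` asks for a maximised form, hence
  -- the negated second row. By `hull-face` the face is spanned by the generators at height `h`.
  edge : ∀ {P} → 0≤ (m - l - + 1) → Conv P (ι u) → Conv P (ι v) →
    (∀ p → P p → 0≤ (proj₂ (act φ p) - h)) →
    (∀ p → P p → proj₂ (act φ p) ≡ h → 0≤ (proj₁ (act φ p) - l) × 0≤ (m - proj₁ (act φ p))) →
    Edge (Conv P) u v
  edge {P} l<m hu hv low bounds = u≢v , hu , hv , - c , - d , nz ,
    trans (lin-eq (ι u)) (trans (cong (λ z → toℚ (f - h) ℚ.- z) (trans (val-0 u act-u) (sym (val-0 v act-v)))) (sym (lin-eq (ι v)))) ,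
    (λ q hq → subst₂ ℚ._≤_ (sym (lin-eq q)) (sym (trans (lin-eq (ι u)) (cong (λ z → toℚ (f - h) ℚ.- z) (val-0 u act-u))))
      (ℚP.+-monoʳ-≤ (toℚ (f - h)) (ℚP.neg-antimono-≤ (hull-≥0ℚ c d (f - h) low' {q} hq)))) ,
    (λ q hq e → hull-bind (λ p hp → on-face p (proj₁ hp) (proj₂ hp)) {q} (hull-face c d (f - h) low' {q} hq (level q e)))
    where
    on-face : ∀ p → P p → aff c d (f - h) p ≡ + 0 → Seg u v (ι p)
    on-face p hp ep = on-segment p y≡h (proj₁ (bounds p hp y≡h)) (proj₂ (bounds p hp y≡h))
      where
      y≡h : proj₂ (act φ p) ≡ h
      y≡h = ℤP.i-j≡0⇒i≡j (proj₂ (act φ p)) h (trans (sym (sub-ε c d f h p)) ep)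
    low' : ∀ p → P p → 0≤ aff c d (f - h) p
    low' p hp = ≥0-cong (low p hp) (sym (sub-ε c d f h p))
    u≢v : u ≢ v
    u≢v eq = absurd l<m (trans (cong (λ z → z - l - + 1) (cong proj₁ (trans (sym act-v) (trans (cong (act φ) (sym eq)) act-u)))) (lem l))
      where
      lem : ∀ l → l - l - + 1 ≡ -[1+ 0 ]
      lem = solve-∀
    nz : ¬ (- c ≡ + 0 × - d ≡ + 0)
    nz (ec , ed) = pullback-nonzero φ (+ 0) (+ 1) (λ ()) (trans (one a c) (zero-c ec) , trans (one b d) (zero-c ed))
      where
      one : ∀ a c → + 0 * a + + 1 * c ≡ c
      one = solve-∀
      zero-c : ∀ {c} → - c ≡ + 0 → c ≡ + 0
      zero-c {c} e = trans (sym (ℤP.neg-involutive c)) (cong -_ e)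
    lin-eq : ∀ q → lin (- c) (- d) q ≡ toℚ (f - h) ℚ.- affℚ c d (f - h) q
    lin-eq (x , y) = trans (cong₂ (λ s t → s ℚ.* x ℚ.+ t ℚ.* y) (toℚ-neg c) (toℚ-neg d)) (lem (toℚ c) (toℚ d) (toℚ (f - h)) x y)
      where
      lem : ∀ c d g x y → ℚ.- c ℚ.* x ℚ.+ ℚ.- d ℚ.* y ≡ g ℚ.- (c ℚ.* x ℚ.+ d ℚ.* y ℚ.+ g)
      lem = TR.solve-∀ ℚring
    val-0 : ∀ p {t} → act φ p ≡ (t , h) → affℚ c d (f - h) (ι p) ≡ 0ℚ
    val-0 p e = trans (affℚ-ι c d (f - h) p) (cong toℚ (trans (sub-ε c d f h p) (trans (cong (λ z → proj₂ z - h) e) (0-0 h))))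
    level : ∀ q → lin (- c) (- d) q ≡ lin (- c) (- d) (ι u) → affℚ c d (f - h) q ≡ 0ℚ
    level q e = trans (lem (toℚ (f - h)) (affℚ c d (f - h) q)) (trans (cong (λ z → toℚ (f - h) ℚ.- z)
        (trans (sym (lin-eq q)) (trans e (trans (lin-eq (ι u)) (cong (λ z → toℚ (f - h) ℚ.- z) (val-0 u act-u)))))) (lem' (toℚ (f - h))))
      where
      lem : ∀ g x → x ≡ g ℚ.- (g ℚ.- x)
      lem = TR.solve-∀ ℚring
      lem' : ∀ g → g ℚ.- (g ℚ.- 0ℚ) ≡ 0ℚ
      lem' = TR.solve-∀ ℚring

parallel : ∀ φ l m h l' m' h' → let ψ = inv φ in
  Parallel (act ψ (l , h)) (act ψ (m , h)) (act ψ (l' , h')) (act ψ (m' , h'))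
parallel φ l m h l' m' h' = lem a b c d e f l m h l' m' h'
  where
  open Unimodular (inv φ)
  lem : ∀ a b c d e f l m h l' m' h' →
    (a * m + b * h + e - (a * l + b * h + e)) * (c * m' + d * h' + f - (c * l' + d * h' + f))
    - (c * m + d * h + f - (c * l + d * h + f)) * (a * m' + b * h' + e - (a * l' + b * h' + e)) ≡ + 0
  lem = solve-∀

lineDist1 : ∀ φ l m h l' m' → let ψ = inv φ in
  LineDist1 (act ψ (l , h)) (act ψ (m , h)) (act ψ (l' , h + + 1)) (act ψ (m' , h + + 1))
lineDist1 φ l m h l' m' = c , d , h - f , h + + 1 - f , row-coprime φ ,
  level l h , level m h , level l' (h + + 1) , level m' (h + + 1) , cong ℤ.∣_∣ (lem h f)
  where
  open Unimodular φ
  lem : ∀ h f → h - f - (h + + 1 - f) ≡ -[1+ 0 ]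
  lem = solve-∀
  lem' : ∀ s t → s ≡ s + t - t
  lem' = solve-∀
  level : ∀ x y → let p = act (inv φ) (x , y) in c * proj₁ p + d * proj₂ p ≡ y - f
  level x y = trans (lem' _ f) (cong (_- f) (cong proj₂ (act-inverseʳ φ (x , y))))

≥0-≡ : ∀ {x y} → 0≤ (x - y) → 0≤ (y - x) → x ≡ y
≥0-≡ {x} {y} h k = ℤP.i-j≡0⇒i≡j x y (≥0-antisym h (≥0-cong k (lem x y)))
  where
  lem : ∀ x y → y - x ≡ - (x - y)
  lem = solve-∀

pos⇒≢0 : ∀ {x} → 0≤ (x - + 1) → x ≢ + 0
pos⇒≢0 h refl = ¬≤-1 h

_∈?_ : ∀ (p : Point) S → Dec (p ∈ S)
p ∈? S = Any.any? (p ≟ₚ_) S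

-- Polygons in a multiple of the standard triangle

-- T ⊂ HΣ, the triangle x, y ≥ 0, x + y ≤ H.
InSimplex : ℤ → List Point → Set
InSimplex H T = ∀ q → q ∈ T → 0≤ proj₁ q × 0≤ proj₂ q × 0≤ (H - proj₁ q - proj₂ q)

x-strict : ∀ {T} p → Int T p → (∀ q → q ∈ T → 0≤ proj₁ q) → 0≤ (proj₁ p - + 1)
x-strict {T} p int h = ≥0-cong (Int-strict {T} {p} int (+ 1) (+ 0) (+ 0) (λ ()) (λ { q@(x , y) i → ≥0-cong (h q i) (lem x y) }))
  (cong (_- + 1) (sym (lem (proj₁ p) (proj₂ p))))
  where
  lem : ∀ x y → x ≡ + 1 * x + + 0 * y + + 0
  lem = solve-∀

y-strict : ∀ {T} p → Int T p → (∀ q → q ∈ T → 0≤ proj₂ q) → 0≤ (proj₂ p - + 1)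
y-strict {T} p int h = ≥0-cong (Int-strict {T} {p} int (+ 0) (+ 1) (+ 0) (λ ()) (λ { q@(x , y) i → ≥0-cong (h q i) (lem x y) }))
  (cong (_- + 1) (sym (lem (proj₁ p) (proj₂ p))))
  where
  lem : ∀ x y → y ≡ + 0 * x + + 1 * y + + 0
  lem = solve-∀

sum-strict : ∀ {T} H p → Int T p → (∀ q → q ∈ T → 0≤ (H - proj₁ q - proj₂ q)) → 0≤ (H - proj₁ p - proj₂ p - + 1)
sum-strict {T} H p int h = ≥0-cong (Int-strict {T} {p} int -[1+ 0 ] -[1+ 0 ] H (λ ()) (λ { q@(x , y) i → ≥0-cong (h q i) (lem H x y) }))
  (cong (_- + 1) (sym (lem H (proj₁ p) (proj₂ p))))
  where
  lem : ∀ H x y → H - x - y ≡ -[1+ 0 ] * x + -[1+ 0 ] * y + H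
  lem = solve-∀

NoCase5 : List Point → Set
NoCase5 S = (u v u' v' : Point) (k k' : ℕ) → ¬ Case5 (Poly S) u v u' v' k k'

preimage∈ : ∀ φ {S} t → t ∈ map (act φ) S → act (inv φ) t ∈ S
preimage∈ φ {S} = ∀∈map φ (λ t → act (inv φ) t ∈ S) (λ s j → subst (_∈ S) (sym (act-inverseˡ φ s)) j)

-- Interior points at height 1 of a polygon in nΣ satisfy 1 ≤ x ≤ n - 2, so their row is shorter
-- than the bottom edge by at least 3, as `Case5` demands. Two of them are needed for the row to be
-- an edge of the interior hull.
case5-from-simplex : ∀ S φ n i → let T = map (act φ) S in
  InSimplex (+ n) T → (+ 0 , + 0) ∈ T → (+ n , + 0) ∈ T →
  Int T (i , + 1) → Int T (i + + 1 , + 1) → NoCase5 S → ⊥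
case5-from-simplex S φ n i simplex o∈T e∈T int₁ int₂ no5 =
  go (optimum (λ p q → 0≤ (proj₁ q - proj₁ p)) (Int? T) (λ {a} {b} {c} _ _ _ h k → ≥0-trans (proj₁ c) (proj₁ b) (proj₁ a) k h) (λ a b _ _ → ≥0-total (proj₁ b) (proj₁ a)) C)
     (optimum (λ p q → 0≤ (proj₁ p - proj₁ q)) (Int? T) (λ {a} {b} {c} _ _ _ → ≥0-trans (proj₁ a) (proj₁ b) (proj₁ c)) (λ a b _ _ → ≥0-total (proj₁ a) (proj₁ b)) C)
  where
  T = map (act φ) S
  H = + n
  -- The row of interior points at height 1 lies in 0 ≤ x ≤ n, so a finite search finds its two
  -- ends.
  C : List Point
  C = map (λ k → (+ k , + 1)) (upTo (suc n))
  xs = λ q j → proj₁ (simplex q j)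
  ys = λ q j → proj₁ (proj₂ (simplex q j))
  ss = λ q j → proj₂ (proj₂ (simplex q j))
  listed : ∀ x → Int T (x , + 1) → (x , + 1) ∈ C
  listed x int = at (≥0-nat (≥0-cong (x-strict (x , + 1) int xs ⊕ nat≥0 {1}) (lem x))) (sum-strict H (x , + 1) int ss)
    where
    lem : ∀ x → x - + 1 + + 1 ≡ x
    lem = solve-∀
    lem₂ : ∀ H x → H - x - + 1 - + 1 + + 2 ≡ H - x
    lem₂ = solve-∀
    at : ∃[ k ] x ≡ + k → 0≤ (H - x - + 1 - + 1) → (x , + 1) ∈ C
    at (k , refl) h = ∈-map⁺ (λ k → (+ k , + 1)) (∈-upTo⁺ (s≤s (ℤP.drop‿+≤+ (ℤP.0≤i-j⇒j≤i (≥0-cong (h ⊕ nat≥0 {2}) (lem₂ H (+ k)))))))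
  go : (∀ a → a ∈ C → ¬ Int T a) ⊎ (∃[ a ] (a ∈ C × Int T a × (∀ b → b ∈ C → Int T b → 0≤ (proj₁ b - proj₁ a)))) →
       (∀ a → a ∈ C → ¬ Int T a) ⊎ (∃[ a ] (a ∈ C × Int T a × (∀ b → b ∈ C → Int T b → 0≤ (proj₁ a - proj₁ b)))) → ⊥
  go (inj₁ none) _ = none _ (listed i int₁) int₁
  go (inj₂ _) (inj₁ none) = none _ (listed i int₁) int₁
  go (inj₂ (pl , il , hl , minl)) (inj₂ (pm , im , hm , maxm)) = extremes (∈-map⁻ _ il) (∈-map⁻ _ im)
    where
    extremes : ∃[ k ] (k ∈ upTo (suc n) × pl ≡ (+ k , + 1)) → ∃[ k ] (k ∈ upTo (suc n) × pm ≡ (+ k , + 1)) → ⊥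
    extremes (kl , _ , refl) (km , _ , refl) = lengths (≥0-nat l≤m)
      where
      l = + kl
      m = + km
      l<m : 0≤ (m - l - + 1)
      l<m = ≥0-cong (minl _ (listed i int₁) int₁ ⊕ maxm _ (listed (i + + 1) int₂) int₂) (lem i l m)
        where
        lem : ∀ i l m → i - l + (m - (i + + 1)) ≡ m - l - + 1
        lem = solve-∀
      l≤m : 0≤ (m - l)
      l≤m = ≥0-cong (l<m ⊕ nat≥0 {1}) (lem l m)
        where
        lem : ∀ l m → m - l - + 1 + + 1 ≡ m - l
        lem = solve-∀
      H≥0 : 0≤ (H - + 0)
      H≥0 = ≥0-cong (nat≥0 {n}) (lem H)
        where
        lem : ∀ H → H ≡ H - + 0
        lem = solve-∀
      l≥1 = x-strict (l , + 1) hl xs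
      m≤H-2 = sum-strict H (m , + 1) hm ss
      module Bottom = LatticeSegment φ (+ 0) H (+ 0) H≥0
      module Top = LatticeSegment φ l m (+ 1) l≤m
      minus0 : ∀ x → x ≡ x - + 0
      minus0 = solve-∀
      edge₀ : Edge (Poly S) Bottom.u Bottom.v
      edge₀ = Bottom.edge (≥0-cong (l<m ⊕ l≥1 ⊕ m≤H-2 ⊕ nat≥0 {3}) (lem l m H))
          (hull-generator Bottom.u (preimage∈ φ _ o∈T)) (hull-generator Bottom.v (preimage∈ φ _ e∈T))
          (λ p j → ≥0-cong (ys _ (∈-map⁺ (act φ) j)) (minus0 (proj₂ (act φ p))))
          (λ p j _ → ≥0-cong (xs _ (∈-map⁺ (act φ) j)) (minus0 (proj₁ (act φ p))) ,
            ≥0-cong (ss _ (∈-map⁺ (act φ) j) ⊕ ys _ (∈-map⁺ (act φ) j)) (lem₂ H (proj₁ (act φ p)) (proj₂ (act φ p))))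
        where
        lem : ∀ l m H → m - l - + 1 + (l - + 1) + (H - m - + 1 - + 1) + + 3 ≡ H - + 0 - + 1
        lem = solve-∀
        lem₂ : ∀ H x y → H - x - y + y ≡ H - x
        lem₂ = solve-∀
      intT : ∀ p → InteriorPt (Poly S) p → Int T (act φ p)
      intT p hp = Int-act φ {S} {p} (interior⇒Int {S} {p} hp)
      edge₁ : Edge (IntHull (Poly S)) Top.u Top.v
      edge₁ = Top.edge l<m
          (hull-generator Top.u (Int⇒interior {S} {Top.u} (Int-act⁻ φ (l , + 1) hl)))
          (hull-generator Top.v (Int⇒interior {S} {Top.v} (Int-act⁻ φ (m , + 1) hm)))
          (λ p hp → y-strict (act φ p) (intT p hp) ys)
          bounds
        where
        bounds : ∀ p → InteriorPt (Poly S) p → proj₂ (act φ p) ≡ + 1 → 0≤ (proj₁ (act φ p) - l) × 0≤ (m - proj₁ (act φ p))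
        bounds p hp e = minl _ (listed _ intx) intx , maxm _ (listed _ intx) intx
          where
          intx : Int T (proj₁ (act φ p) , + 1)
          intx = subst (λ y → Int T (proj₁ (act φ p) , y)) e (intT p hp)
      lengths : ∃[ j ] m - l ≡ + j → ⊥
      lengths (j , ej) = no5 Bottom.u Bottom.v Top.u Top.v (suc n) (suc j)
        (edge₀ , edge₁ , parallel φ (+ 0) H (+ 0) l m (+ 1) , lineDist1 φ (+ 0) H (+ 0) l m ,
         Bottom.segment-count (suc n) (l₁ H) , Top.segment-count (suc j) (trans (cong (λ z → + 1 + z) (sym ej)) (l₂ (m - l))) ,
         ℤP.drop‿+≤+ (ℤP.0≤i-j⇒j≤i (≥0-cong (m≤H-2 ⊕ l≥1) (trans (l₃ l m H) (cong (λ z → + 1 + H - (+ 1 + (z + + 3))) ej)))))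
        where
        l₁ : ∀ H → + 1 + H ≡ H - + 0 + + 1
        l₁ = solve-∀
        l₂ : ∀ x → + 1 + x ≡ x + + 1
        l₂ = solve-∀
        l₃ : ∀ l m H → H - m - + 1 - + 1 + (l - + 1) ≡ + 1 + H - (+ 1 + (m - l + + 3))
        l₃ = solve-∀

≃-at : ∀ φ {S T'} → (∀ q → q ∈ map (act φ) S → Poly T' (ι q)) → (∀ t → t ∈ T' → t ∈ map (act φ) S) → Poly S ≃ Poly T'
≃-at φ h k = polygon-≃ φ (λ s i → h (act φ s) (∈-map⁺ (act φ) i)) k

all₃ : {Q : Point → Set} {a b c : Point} → Q a → Q b → Q c → ∀ t → t ∈ a ∷ b ∷ c ∷ [] → Q t
all₃ qa qb qc t (here refl) = qa
all₃ qa qb qc t (there (here refl)) = qb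
all₃ qa qb qc t (there (there (here refl))) = qc

all₄ : {Q : Point → Set} {a b c d : Point} → Q a → Q b → Q c → Q d → ∀ t → t ∈ a ∷ b ∷ c ∷ d ∷ [] → Q t
all₄ qa qb qc qd t (here refl) = qa
all₄ qa qb qc qd t (there i) = all₃ qb qc qd t i

-- The weights are the barycentric coordinates multiplied by hg.
triangle-hull : ∀ {P} h g x y → 0≤ (h - + 1) → 0≤ (g - + 1) → P (+ 0 , + 0) → P (h , + 0) → P (+ 0 , g) →
  0≤ x → 0≤ y → 0≤ (h * g - g * x - h * y) → Conv P (ι (x , y))
triangle-hull {P} h g x y hh hg p₀ p₁ p₂ hx hy hxy = combine {P} {+ 0 , + 0} {h , + 0} {+ 0 , g} {x , y}
  (h * g - g * x - h * y) (g * x) (h * y) p₀ p₁ p₂ hxy (≥0-cong ((hg ⊕ nat≥0 {1}) ⊗ hx) (l₀ g x)) (≥0-cong ((hh ⊕ nat≥0 {1}) ⊗ hy) (l₀ h y))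
  (≥0-cong (hh ⊗ hg ⊕ hh ⊕ hg) (l₁ h g x y)) (l₂ h g x y) (l₃ h g x y)
  where
  l₀ : ∀ g x → (g - + 1 + + 1) * x ≡ g * x
  l₀ = solve-∀
  l₁ : ∀ h g x y → (h - + 1) * (g - + 1) + (h - + 1) + (g - + 1) ≡ h * g - g * x - h * y + g * x + h * y - + 1
  l₁ = solve-∀
  l₂ : ∀ h g x y → (h * g - g * x - h * y) * + 0 + g * x * h + h * y * + 0 ≡ (h * g - g * x - h * y + g * x + h * y) * x
  l₂ = solve-∀
  l₃ : ∀ h g x y → (h * g - g * x - h * y) * + 0 + g * x * + 0 + h * y * g ≡ (h * g - g * x - h * y + g * x + h * y) * y
  l₃ = solve-∀

-- The symmetry of HΣ that preserves heights and exchanges the ends of the bottom edge.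
reflection : ℤ → Unimodular
reflection H = record { a = -[1+ 0 ] ; b = -[1+ 0 ] ; c = + 0 ; d = + 1 ; e = H ; f = + 0 ; unimod = inj₂ refl }

reflection-eq : ∀ H x y → act (reflection H) (x , y) ≡ (H - x - y , y)
reflection-eq H x y = cong₂ _,_ (l₁ H x y) (l₂ x y)
  where
  l₁ : ∀ H x y → -[1+ 0 ] * x + -[1+ 0 ] * y + H ≡ H - x - y
  l₁ = solve-∀
  l₂ : ∀ x y → + 0 * x + + 1 * y + + 0 ≡ y
  l₂ = solve-∀

module Reflect (S : List Point) (φ : Unimodular) (H : ℤ) where
  φ' : Unimodular
  φ' = compose (reflection H) φ

  reflect∈ : ∀ x y {x'} → (x , y) ∈ map (act φ) S → x' ≡ H - x - y → (x' , y) ∈ map (act φ') S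
  reflect∈ x y i refl = subst ((H - x - y , y) ∈_) (sym (map-compose (reflection H) φ S))
    (subst (_∈ map (act (reflection H)) (map (act φ) S)) (reflection-eq H x y) (∈-map⁺ (act (reflection H)) i))

  reflect-simplex : InSimplex H (map (act φ) S) → InSimplex H (map (act φ') S)
  reflect-simplex h q j = go (∈-map⁻ (act (reflection H)) (subst (q ∈_) (map-compose (reflection H) φ S) j))
    where
    lem : ∀ H x y → x ≡ H - (H - x - y) - y
    lem = solve-∀
    go : ∃[ p ] (p ∈ map (act φ) S × q ≡ act (reflection H) p) → 0≤ proj₁ q × 0≤ proj₂ q × 0≤ (H - proj₁ q - proj₂ q)
    go ((x , y) , i , e) = subst (λ q → 0≤ proj₁ q × 0≤ proj₂ q × 0≤ (H - proj₁ q - proj₂ q)) (sym (trans e (reflection-eq H x y)))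
      (proj₂ (proj₂ (h _ i)) , proj₁ (proj₂ (h _ i)) , ≥0-cong (proj₁ (h _ i)) (lem H x y))

-- At height 1 the triangle with base from (0, 0) to (H, 0) and apex (x₀, t) is the interval from
-- x₀/t to H - (H - x₀)/t. The last two hypotheses place `x` strictly inside it; the weights are the
-- barycentric coordinates multiplied by tH.
Int-level1 : ∀ T H x₀ t x → (+ 0 , + 0) ∈ T → (H , + 0) ∈ T → (x₀ , t) ∈ T →
  0≤ (H - + 1) → 0≤ (t - + 1) → 0≤ (t * x - x₀ - + 1) → 0≤ (t * (H - x) - (H - x₀) - + 1) → Int T (x , + 1)
Int-level1 T H x₀ t x o e q hH ht hj hi = Int-triangle {T} {+ 0 , + 0} {H , + 0} {x₀ , t} {x , + 1}
  (t * (H - x) - (H - x₀)) (t * x - x₀) H (∈⇒InHull o) (∈⇒InHull e) (∈⇒InHull q)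
  (pos⇒≢0 (≥0-cong (hH ⊗ ht ⊕ hH ⊕ ht) (l₀ H x₀ t))) hi hj hH (combination (l₁ H x₀ t x) (l₂ H x₀ t x))
  where
  l₀ : ∀ H x₀ t → (H - + 1) * (t - + 1) + (H - + 1) + (t - + 1) ≡ (H - + 0) * (t - + 0) - (+ 0 - + 0) * (x₀ - + 0) - + 1
  l₀ = solve-∀
  l₁ : ∀ H x₀ t x → (t * (H - x) - (H - x₀)) * + 0 + (t * x - x₀) * H + H * x₀ ≡ (t * (H - x) - (H - x₀) + (t * x - x₀) + H) * x
  l₁ = solve-∀
  l₂ : ∀ H x₀ t x → (t * (H - x) - (H - x₀)) * + 0 + (t * x - x₀) * + 0 + H * t ≡ (t * (H - x) - (H - x₀) + (t * x - x₀) + H) * + 1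
  l₂ = solve-∀

-- With c the integral part of x₀/t, the two points are c + 1 and c + 2. The second is strictly left
-- of the right-hand side when (t - 1)(H - 2) - 3 plus the remainder of x₀ modulo t is nonnegative;
-- the constant 3 covers remainder 0.
two-at-level1 : ∀ T H x₀ t → (+ 0 , + 0) ∈ T → (H , + 0) ∈ T → (x₀ , t) ∈ T → 0≤ (H - + 3) → 0≤ (t - + 2) →
  0≤ ((t - + 1) * (H - + 2) - + 3) → ∃[ i ] (Int T (i , + 1) × Int T (i + + 1 , + 1))
two-at-level1 T H x₀ t o e q hH ht big = go (divide x₀ t (≥0-cong (ht ⊕ nat≥0 {1}) (l₀ t)))
  where
  l₀ : ∀ t → t - + 2 + + 1 ≡ t - + 1
  l₀ = solve-∀
  l₀' : ∀ t → t - + 3 + + 2 ≡ t - + 1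
  l₀' = solve-∀
  go : ∃[ c ] ∃[ r ] (x₀ ≡ c * t + r × 0≤ r × 0≤ (t - + 1 - r)) → ∃[ i ] (Int T (i , + 1) × Int T (i + + 1 , + 1))
  go (c , r , refl , hr , hr') = c + + 1 ,
    Int-level1 T H (c * t + r) t (c + + 1) o e q H≥1 t≥1 (≥0-cong hr' (l₁ c t r)) (≥0-cong (big ⊕ hr ⊕ ht ⊕ nat≥0 {2}) (l₂ c t r H)) ,
    Int-level1 T H (c * t + r) t (c + + 1 + + 1) o e q H≥1 t≥1 (≥0-cong (hr' ⊕ ht ⊕ nat≥0 {2}) (l₃ c t r)) (≥0-cong (big ⊕ hr) (l₄ c t r H))
    where
    H≥1 = ≥0-cong (hH ⊕ nat≥0 {2}) (l₀' H)
    t≥1 = ≥0-cong (ht ⊕ nat≥0 {1}) (l₀ t)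
    l₁ : ∀ c t r → t - + 1 - r ≡ t * (c + + 1) - (c * t + r) - + 1
    l₁ = solve-∀
    l₂ : ∀ c t r H → (t - + 1) * (H - + 2) - + 3 + r + (t - + 2) + + 2 ≡ t * (H - (c + + 1)) - (H - (c * t + r)) - + 1
    l₂ = solve-∀
    l₃ : ∀ c t r → t - + 1 - r + (t - + 2) + + 2 ≡ t * (c + + 1 + + 1) - (c * t + r) - + 1
    l₃ = solve-∀
    l₄ : ∀ c t r H → (t - + 1) * (H - + 2) - + 3 + r ≡ t * (H - (c + + 1 + + 1)) - (H - (c * t + r)) - + 1
    l₄ = solve-∀

-- If no point is beyond the line x + 2y = 4 through (4, 0) and (0, 2), the polygon is the triangle
-- of `Case4`. A point beyond it makes (2, 1) interior in addition to (1, 1), which leads to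
-- `Case5`.
simplex4 : ∀ S φ → let T = map (act φ) S in InSimplex (+ 4) T → (+ 0 , + 0) ∈ T → (+ 4 , + 0) ∈ T → (+ 0 , + 2) ∈ T →
  ¬ Case4 (Poly S) → NoCase5 S → ⊥
simplex4 S φ simplex o e q no4 no5 = go (∀∈? (λ p → 0≤? (+ 4 - proj₁ p - + 2 * proj₂ p)) T)
  where
  T = map (act φ) S
  go : (∀ p → p ∈ T → 0≤ (+ 4 - proj₁ p - + 2 * proj₂ p)) ⊎ (∃[ p ] (p ∈ T × ¬ 0≤ (+ 4 - proj₁ p - + 2 * proj₂ p))) → ⊥
  go (inj₁ all) = no4 (≃-at φ (λ { p@(x , y) i → triangle-hull (+ 4) (+ 2) x y nat≥0 nat≥0 (here refl) (there (here refl)) (there (there (here refl)))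
      (proj₁ (simplex p i)) (proj₁ (proj₂ (simplex p i))) (≥0-cong (all p i ⊕ all p i) (lem x y)) })
      (all₃ o e q))
    where
    lem : ∀ x y → + 4 - x - + 2 * y + (+ 4 - x - + 2 * y) ≡ + 4 * + 2 - + 2 * x - + 4 * y
    lem = solve-∀
  go (inj₂ (p@(x , y) , i , ¬h)) = case5-from-simplex S φ 4 (+ 1) simplex o e
      (Int-level1 T (+ 4) (+ 0) (+ 2) (+ 1) o e q nat≥0 nat≥0 nat≥0 nat≥0) int2 no5
    where
    beyond : 0≤ (- (+ 4 - x - + 2 * y) - + 1)
    beyond = ≱0⇒ ¬h
    -- (2 , 1) is the midpoint of (0 , 2) and (4 , 0), which separates the origin from p.
    int2 : Int T (+ 2 , + 1)
    int2 = Int-refute T (+ 2 , + 1) λ α β nz all → nz (conclude α β (all _ o) (all _ e) (all _ q) (all _ i))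
      where
      conclude : ∀ α β → 0≤ (α * + 0 + β * + 0 + - (α * + 2 + β * + 1)) → 0≤ (α * + 4 + β * + 0 + - (α * + 2 + β * + 1)) →
        0≤ (α * + 0 + β * + 2 + - (α * + 2 + β * + 1)) → 0≤ (α * x + β * y + - (α * + 2 + β * + 1)) → α ≡ + 0 × β ≡ + 0
      conclude α β h₁ h₂ h₃ h₄ = α≡0 , trans (trans (b1 α β) (cong₂ (λ u v → u + + 2 * v) β≡2α α≡0)) refl
        where
        l₂ : ∀ α β → α * + 4 + β * + 0 + - (α * + 2 + β * + 1) ≡ - (β - + 2 * α)
        l₂ = solve-∀
        l₃ : ∀ α β → α * + 0 + β * + 2 + - (α * + 2 + β * + 1) ≡ β - + 2 * α
        l₃ = solve-∀
        b1 : ∀ α β → β ≡ β - + 2 * α + + 2 * α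
        b1 = solve-∀
        β≡2α : β - + 2 * α ≡ + 0
        β≡2α = ≥0-antisym (≥0-cong h₃ (l₃ α β)) (≥0-cong h₂ (l₂ α β))
        α≤0 : 0≤ (- α)
        α≤0 = ≥0-cancel (+ 4) (- α) nat≥0 (≥0-cong (h₁ ⊕ nat≥0 {3}) (trans (trans (l₁ α β) (cong (λ z → + 4 * - α + + 4 - + 1 - z) β≡2α)) (l₀ (+ 4 * - α + + 4 - + 1))))
          where
          l₁ : ∀ α β → α * + 0 + β * + 0 + - (α * + 2 + β * + 1) + + 3 ≡ + 4 * - α + + 4 - + 1 - (β - + 2 * α)
          l₁ = solve-∀
          l₀ : ∀ x → x - + 0 ≡ x
          l₀ = solve-∀
        α≥0 : 0≤ α
        α≥0 = ≥0-cancel (- (+ 4 - x - + 2 * y)) α beyond (≥0-cong (h₄ ⊕ beyond)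
            (trans (l₁ α β x y) (trans (cong (λ z → (- (+ 4 - x - + 2 * y)) * α + (- (+ 4 - x - + 2 * y)) - + 1 + z * (y - + 1)) β≡2α) (l₀ ((- (+ 4 - x - + 2 * y)) * α + (- (+ 4 - x - + 2 * y)) - + 1) y))))
          where
          l₁ : ∀ α β x y → α * x + β * y + - (α * + 2 + β * + 1) + (- (+ 4 - x - + 2 * y) - + 1) ≡
            (- (+ 4 - x - + 2 * y)) * α + (- (+ 4 - x - + 2 * y)) - + 1 + (β - + 2 * α) * (y - + 1)
          l₁ = solve-∀
          l₀ : ∀ u y → u + + 0 * (y - + 1) ≡ u
          l₀ = solve-∀
        α≡0 : α ≡ + 0
        α≡0 = ≥0-antisym α≥0 α≤0

simplex3 : ∀ S φ → let T = map (act φ) S in InSimplex (+ 3) T → (+ 0 , + 0) ∈ T → (+ 3 , + 0) ∈ T → (+ 0 , + 3) ∈ T → Case3 (Poly S)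
simplex3 S φ simplex o e q = inj₁ (≃-at φ (λ { p@(x , y) i → triangle-hull (+ 3) (+ 3) x y nat≥0 nat≥0
    (here refl) (there (here refl)) (there (there (here refl)))
    (proj₁ (simplex p i)) (proj₁ (proj₂ (simplex p i))) (≥0-cong (nat≥0 {3} ⊗ proj₂ (proj₂ (simplex p i))) (lem x y)) })
    (all₃ o e q))
  where
  lem : ∀ x y → + 3 * (+ 3 - x - y) ≡ + 3 * + 3 - + 3 * x - + 3 * y
  lem = solve-∀

-- The triangle (0, 0), (3, 0), (0, 2) misses just three lattice points of 3Σ, namely (0, 3), (1, 2)
-- and (2, 1). Each of them lies in the hull of (3, 0) and any earlier one, so the first that occurs
-- determines the polygon.
simplex32 : ∀ S φ → let T = map (act φ) S in InSimplex (+ 3) T → (+ 0 , + 0) ∈ T → (+ 3 , + 0) ∈ T → (+ 0 , + 2) ∈ T → Case3 (Poly S)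
simplex32 S φ simplex o e q = go₁ ((+ 0 , + 3) ∈? T)
  where
  T = map (act φ) S
  go₁ : Dec ((+ 0 , + 3) ∈ T) → Case3 (Poly S)
  go₁ (yes i) = simplex3 S φ simplex o e i
  go₁ (no ¬3) = go₂ ((+ 1 , + 2) ∈? T)
    where
    y≤2 : ∀ p → p ∈ T → 0≤ (+ 2 - proj₂ p)
    y≤2 p@(x , y) i = go (signs (+ 2 - y))
      where
      l₁ : ∀ x y → - (+ 2 - y) - + 1 + (+ 3 - x - y) ≡ + 0 - x
      l₁ = solve-∀
      l₂ : ∀ y → - (+ 2 - y) - + 1 ≡ y - + 3
      l₂ = solve-∀
      l₃ : ∀ x y → + 3 - x - y + (x - + 0) ≡ + 3 - y
      l₃ = solve-∀
      l₄ : ∀ x → x ≡ x - + 0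
      l₄ = solve-∀
      go : 0≤ (+ 2 - y) ⊎ 0≤ (- (+ 2 - y) - + 1) → 0≤ (+ 2 - y)
      go (inj₁ h) = h
      go (inj₂ h) = ⊥-elim (¬3 (subst (_∈ T) (cong₂ _,_
        (≥0-≡ {x} {+ 0} (≥0-cong (proj₁ (simplex p i)) (l₄ x)) (≥0-cong (h ⊕ proj₂ (proj₂ (simplex p i))) (l₁ x y)))
        (≥0-≡ {y} {+ 3} (≥0-cong h (l₂ y)) (≥0-cong (proj₂ (proj₂ (simplex p i)) ⊕ ≥0-cong (proj₁ (simplex p i)) (l₄ x)) (l₃ x y)))) i))
    small : ∀ {P : Point → Set} x y → P (+ 0 , + 0) → P (+ 3 , + 0) → P (+ 0 , + 2) → 0≤ x → 0≤ y → 0≤ (+ 6 - + 2 * x - + 3 * y) → Conv P (ι (x , y))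
    small x y p₀ p₁ p₂ hx hy h = triangle-hull (+ 3) (+ 2) x y nat≥0 nat≥0 p₀ p₁ p₂ hx hy h
    go₂ : Dec ((+ 1 , + 2) ∈ T) → Case3 (Poly S)
    go₂ (yes j) = inj₂ (inj₂ (inj₂ (≃-at φ (λ { p@(x , y) i → inside x y (simplex p i) (y≤2 p i) (signs (+ 6 - + 2 * x - + 3 * y)) })
        (all₄ o e j q))))
      where
      inside : ∀ x y → 0≤ x × 0≤ y × 0≤ (+ 3 - x - y) → 0≤ (+ 2 - y) → 0≤ (+ 6 - + 2 * x - + 3 * y) ⊎ 0≤ (- (+ 6 - + 2 * x - + 3 * y) - + 1) →
        Poly (pt 0 0 ∷ pt 3 0 ∷ pt 1 2 ∷ pt 0 2 ∷ []) (ι (x , y))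
      inside x y (hx , hy , hs) h2 (inj₁ h) = small x y (here refl) (there (here refl)) (there (there (there (here refl)))) hx hy h
      inside x y (hx , hy , hs) h2 (inj₂ h) = combine {p₀ = pt 3 0} {pt 1 2} {pt 0 2} {x , y} (+ 2 - y) (+ 2 * x + + 3 * y - + 6) (+ 2 * (+ 3 - x - y))
          (there (here refl)) (there (there (here refl))) (there (there (there (here refl))))
          h2 (≥0-cong (h ⊕ nat≥0 {1}) (l₁ x y)) (nat≥0 {2} ⊗ hs) (≥0-cong (nat≥0 {1}) (l₂ x y)) (l₃ x y) (l₄ x y)
        where
        l₁ : ∀ x y → - (+ 6 - + 2 * x - + 3 * y) - + 1 + + 1 ≡ + 2 * x + + 3 * y - + 6
        l₁ = solve-∀
        l₂ : ∀ x y → + 1 ≡ + 2 - y + (+ 2 * x + + 3 * y - + 6) + + 2 * (+ 3 - x - y) - + 1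
        l₂ = solve-∀
        l₃ : ∀ x y → (+ 2 - y) * + 3 + (+ 2 * x + + 3 * y - + 6) * + 1 + + 2 * (+ 3 - x - y) * + 0 ≡ (+ 2 - y + (+ 2 * x + + 3 * y - + 6) + + 2 * (+ 3 - x - y)) * x
        l₃ = solve-∀
        l₄ : ∀ x y → (+ 2 - y) * + 0 + (+ 2 * x + + 3 * y - + 6) * + 2 + + 2 * (+ 3 - x - y) * + 2 ≡ (+ 2 - y + (+ 2 * x + + 3 * y - + 6) + + 2 * (+ 3 - x - y)) * y
        l₄ = solve-∀
    go₂ (no ¬12) = go₃ ((+ 2 , + 1) ∈? T)
      where
      x+2y≤4 : ∀ p → p ∈ T → 0≤ (+ 4 - proj₁ p - + 2 * proj₂ p)
      x+2y≤4 p@(x , y) i = go (signs (+ 4 - x - + 2 * y))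
        where
        l₁ : ∀ x y → - (+ 4 - x - + 2 * y) - + 1 + (+ 3 - x - y) ≡ y - + 2
        l₁ = solve-∀
        l₂ : ∀ x y → - (+ 4 - x - + 2 * y) - + 1 + + 2 * (+ 2 - y) ≡ x - + 1
        l₂ = solve-∀
        l₃ : ∀ x y → + 3 - x - y + (y - + 2) ≡ + 1 - x
        l₃ = solve-∀
        go : 0≤ (+ 4 - x - + 2 * y) ⊎ 0≤ (- (+ 4 - x - + 2 * y) - + 1) → 0≤ (+ 4 - x - + 2 * y)
        go (inj₁ h) = h
        go (inj₂ h) = ⊥-elim (¬12 (subst (_∈ T) (cong₂ _,_
            (≥0-≡ {x} {+ 1} (≥0-cong (h ⊕ nat≥0 {2} ⊗ y≤2 p i) (l₂ x y)) (≥0-cong (proj₂ (proj₂ (simplex p i)) ⊕ y≥2) (l₃ x y)))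
            (≥0-≡ {y} {+ 2} y≥2 (y≤2 p i))) i))
          where
          y≥2 = ≥0-cong (h ⊕ proj₂ (proj₂ (simplex p i))) (l₁ x y)
      go₃ : Dec ((+ 2 , + 1) ∈ T) → Case3 (Poly S)
      go₃ (yes j) = inj₂ (inj₂ (inj₁ (≃-at φ (λ { p@(x , y) i → inside x y (simplex p i) (x+2y≤4 p i) (signs (+ 6 - + 2 * x - + 3 * y)) })
          (all₄ o e j q))))
        where
        inside : ∀ x y → 0≤ x × 0≤ y × 0≤ (+ 3 - x - y) → 0≤ (+ 4 - x - + 2 * y) → 0≤ (+ 6 - + 2 * x - + 3 * y) ⊎ 0≤ (- (+ 6 - + 2 * x - + 3 * y) - + 1) →
          Poly (pt 0 0 ∷ pt 3 0 ∷ pt 2 1 ∷ pt 0 2 ∷ []) (ι (x , y))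
        inside x y (hx , hy , hs) h2 (inj₁ h) = small x y (here refl) (there (here refl)) (there (there (there (here refl)))) hx hy h
        inside x y (hx , hy , hs) h2 (inj₂ h) = combine {p₀ = pt 3 0} {pt 2 1} {pt 0 2} {x , y} (+ 4 - x - + 2 * y) (+ 2 * x + + 3 * y - + 6) (+ 3 - x - y)
            (there (here refl)) (there (there (here refl))) (there (there (there (here refl))))
            h2 (≥0-cong (h ⊕ nat≥0 {1}) (l₁ x y)) hs (≥0-cong (nat≥0 {0}) (l₂ x y)) (l₃ x y) (l₄ x y)
          where
          l₁ : ∀ x y → - (+ 6 - + 2 * x - + 3 * y) - + 1 + + 1 ≡ + 2 * x + + 3 * y - + 6
          l₁ = solve-∀
          l₂ : ∀ x y → + 0 ≡ + 4 - x - + 2 * y + (+ 2 * x + + 3 * y - + 6) + (+ 3 - x - y) - + 1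
          l₂ = solve-∀
          l₃ : ∀ x y → (+ 4 - x - + 2 * y) * + 3 + (+ 2 * x + + 3 * y - + 6) * + 2 + (+ 3 - x - y) * + 0 ≡ (+ 4 - x - + 2 * y + (+ 2 * x + + 3 * y - + 6) + (+ 3 - x - y)) * x
          l₃ = solve-∀
          l₄ : ∀ x y → (+ 4 - x - + 2 * y) * + 0 + (+ 2 * x + + 3 * y - + 6) * + 1 + (+ 3 - x - y) * + 2 ≡ (+ 4 - x - + 2 * y + (+ 2 * x + + 3 * y - + 6) + (+ 3 - x - y)) * y
          l₄ = solve-∀
      go₃ (no ¬21) = inj₂ (inj₁ (≃-at φ (λ { p@(x , y) i → small x y (here refl) (there (here refl)) (there (there (here refl)))
            (proj₁ (simplex p i)) (proj₁ (proj₂ (simplex p i))) (below p i (signs (+ 6 - + 2 * x - + 3 * y))) })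
          (all₃ o e q)))
        where
        below : ∀ p → p ∈ T → 0≤ (+ 6 - + 2 * proj₁ p - + 3 * proj₂ p) ⊎ 0≤ (- (+ 6 - + 2 * proj₁ p - + 3 * proj₂ p) - + 1) → 0≤ (+ 6 - + 2 * proj₁ p - + 3 * proj₂ p)
        below p i (inj₁ h) = h
        below p@(x , y) i (inj₂ h) = ⊥-elim (¬21 (subst (_∈ T) (cong₂ _,_
            (≥0-≡ {x} {+ 2} x≥2 (≥0-cong (proj₂ (proj₂ (simplex p i)) ⊕ y≥1) (l₃ x y)))
            (≥0-≡ {y} {+ 1} y≥1 y≤1)) i))
          where
          l₁ : ∀ x y → - (+ 6 - + 2 * x - + 3 * y) - + 1 + + 2 * (+ 3 - x - y) ≡ y - + 1
          l₁ = solve-∀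
          l₂ : ∀ x y → - (+ 6 - + 2 * x - + 3 * y) - + 1 + + 2 * (+ 4 - x - + 2 * y) ≡ + 1 - y
          l₂ = solve-∀
          l₃ : ∀ x y → + 3 - x - y + (y - + 1) ≡ + 2 - x
          l₃ = solve-∀
          l₅ : ∀ x y → - (+ 6 - + 2 * x - + 3 * y) - + 1 + + 3 * (+ 1 - y) + + 1 ≡ + 2 * (x - + 2) + + 2 - + 1
          l₅ = solve-∀
          y≥1 = ≥0-cong (h ⊕ nat≥0 {2} ⊗ proj₂ (proj₂ (simplex p i))) (l₁ x y)
          y≤1 = ≥0-cong (h ⊕ nat≥0 {2} ⊗ x+2y≤4 p i) (l₂ x y)
          x≥2 = ≥0-cancel (+ 2) (x - + 2) nat≥0 (≥0-cong (h ⊕ nat≥0 {3} ⊗ y≤1 ⊕ nat≥0 {1}) (l₅ x y))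

-- An interior point has height at least 1, so some generator has height y ≥ 2. For n ≥ 5, and for n
-- = 4 with y ≥ 3, this gives (y - 1)(n - 2) ≥ 3 and hence two interior points at height 1. The few
-- positions left for n = 3 and n = 4 are treated one by one, up to reflection.
exceptional : ∀ S φ n → let T = map (act φ) S in InSimplex (+ n) T → (+ 0 , + 0) ∈ T → (+ n , + 0) ∈ T →
  0≤ (+ n - + 3) → (∃[ p ] Int T p) → ¬ Case3 (Poly S) → ¬ Case4 (Poly S) → NoCase5 S → ⊥
exceptional S φ n simplex o e n≥3 (p@(px , py) , int) no3 no4 no5 = above (int (+ 0) -[1+ 0 ] (λ ()))
  where
  T = map (act φ) S
  lem : ∀ px py x y → + 0 * px + -[1+ 0 ] * py - (+ 0 * x + -[1+ 0 ] * y) - + 1 + (py - + 1) ≡ y - + 2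
  lem = solve-∀
  split : ∀ n → InSimplex (+ n) T → (+ n , + 0) ∈ T → 0≤ (+ n - + 3) → ∀ x y → (x , y) ∈ T → 0≤ (y - + 2) → ⊥
  split 0 _ _ () x y
  split 1 _ _ () x y
  split 2 _ _ () x y
  split 3 simplex e _ x y i hy = go (trichotomy (y - + 2)) (trichotomy x)
    where
    hx = proj₁ (simplex _ i)
    hs = proj₂ (proj₂ (simplex _ i))
    at : ∀ {x' y'} → x ≡ x' → y ≡ y' → (x' , y') ∈ T
    at refl refl = i
    l₁ : ∀ y → y - + 2 - + 1 ≡ y - + 3
    l₁ = solve-∀
    l₂ : ∀ x y → + 3 - x - y + (y - + 2 - + 1) ≡ - x
    l₂ = solve-∀
    l₃ : ∀ x y → + 3 - x - y + x ≡ + 3 - y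
    l₃ = solve-∀
    l₄ : ∀ x y → + 3 - x - y + (y - + 2) ≡ + 1 - x
    l₄ = solve-∀
    open Reflect S φ (+ 3)
    go : 0≤ (y - + 2 - + 1) ⊎ y - + 2 ≡ + 0 ⊎ 0≤ (- (y - + 2) - + 1) → 0≤ (x - + 1) ⊎ x ≡ + 0 ⊎ 0≤ (- x - + 1) → ⊥
    go (inj₁ h) _ = no3 (simplex3 S φ simplex o e (at (≥0-antisym hx (≥0-cong (hs ⊕ h) (l₂ x y)))
      (≥0-≡ (≥0-cong h (l₁ y)) (≥0-cong (hs ⊕ hx) (l₃ x y)))))
    go (inj₂ (inj₁ ey)) (inj₂ (inj₁ ex)) = no3 (simplex32 S φ simplex o e (at ex (ℤP.i-j≡0⇒i≡j y (+ 2) ey)))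
    go (inj₂ (inj₁ ey)) (inj₁ h) = no3 (simplex32 S φ' (reflect-simplex simplex) (reflect∈ (+ 3) (+ 0) e refl) (reflect∈ (+ 0) (+ 0) o refl)
      (reflect∈ (+ 1) (+ 2) (at (≥0-≡ h (≥0-cong (hs ⊕ hy) (l₄ x y))) (ℤP.i-j≡0⇒i≡j y (+ 2) ey)) refl))
    go _ (inj₂ (inj₂ h)) = clash hx h
    go (inj₂ (inj₂ h)) _ = clash hy h
  split 4 simplex e _ x y i hy = go (trichotomy (y - + 2)) (trichotomy (x - + 1))
    where
    hx = proj₁ (simplex _ i)
    hs = proj₂ (proj₂ (simplex _ i))
    at : ∀ {x' y'} → x ≡ x' → y ≡ y' → (x' , y') ∈ T
    at refl refl = i
    l₁ : ∀ y → (y - + 2 - + 1) + (y - + 2 - + 1) + + 1 ≡ (y - + 1) * (+ 4 - + 2) - + 3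
    l₁ = solve-∀
    l₂ : ∀ x → - (x - + 1) - + 1 ≡ - x
    l₂ = solve-∀
    l₃ : ∀ x → x - + 1 - + 1 ≡ x - + 2
    l₃ = solve-∀
    l₄ : ∀ x y → + 4 - x - y + (y - + 2) ≡ + 2 - x
    l₄ = solve-∀
    open Reflect S φ (+ 4)
    found : ∃[ i ] (Int T (i , + 1) × Int T (i + + 1 , + 1)) → ⊥
    found (i , h₁ , h₂) = case5-from-simplex S φ 4 i simplex o e h₁ h₂ no5
    go : 0≤ (y - + 2 - + 1) ⊎ y - + 2 ≡ + 0 ⊎ 0≤ (- (y - + 2) - + 1) → 0≤ (x - + 1 - + 1) ⊎ x - + 1 ≡ + 0 ⊎ 0≤ (- (x - + 1) - + 1) → ⊥
    go (inj₁ h) _ = found (two-at-level1 T (+ 4) x y o e i nat≥0 hy (≥0-cong (h ⊕ h ⊕ nat≥0 {1}) (l₁ y)))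
    go (inj₂ (inj₁ ey)) (inj₂ (inj₁ ex)) = found (+ 1 ,
      Int-level1 T (+ 4) (+ 1) (+ 2) (+ 1) o e (at (ℤP.i-j≡0⇒i≡j x (+ 1) ex) (ℤP.i-j≡0⇒i≡j y (+ 2) ey)) nat≥0 nat≥0 nat≥0 nat≥0 ,
      Int-level1 T (+ 4) (+ 1) (+ 2) (+ 2) o e (at (ℤP.i-j≡0⇒i≡j x (+ 1) ex) (ℤP.i-j≡0⇒i≡j y (+ 2) ey)) nat≥0 nat≥0 nat≥0 nat≥0)
    go (inj₂ (inj₁ ey)) (inj₂ (inj₂ h)) = simplex4 S φ simplex o e
      (at (≥0-antisym hx (≥0-cong h (l₂ x))) (ℤP.i-j≡0⇒i≡j y (+ 2) ey)) no4 no5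
    go (inj₂ (inj₁ ey)) (inj₁ h) = simplex4 S φ' (reflect-simplex simplex) (reflect∈ (+ 4) (+ 0) e refl) (reflect∈ (+ 0) (+ 0) o refl)
      (reflect∈ (+ 2) (+ 2) (at (≥0-≡ (≥0-cong h (l₃ x)) (≥0-cong (hs ⊕ hy) (l₄ x y))) (ℤP.i-j≡0⇒i≡j y (+ 2) ey)) refl) no4 no5
    go (inj₂ (inj₂ h)) _ = clash hy h
  split n@(suc (suc (suc (suc (suc k))))) simplex e n≥3 x y i hy = found
      (two-at-level1 T (+ n) x y o e i n≥3 hy (≥0-cong (hy ⊗ nat≥0 {k} ⊕ nat≥0 {3} ⊗ hy ⊕ nat≥0 {k}) (l₁ y (+ k))))
    where
    l₁ : ∀ y k → (y - + 2) * k + + 3 * (y - + 2) + k ≡ (y - + 1) * (+ 5 + k - + 2) - + 3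
    l₁ = solve-∀
    found : ∃[ i ] (Int T (i , + 1) × Int T (i + + 1 , + 1)) → ⊥
    found (i , h₁ , h₂) = case5-from-simplex S φ n i simplex o e h₁ h₂ no5
  above : ∃[ q ] (q ∈ T × 0≤ (lf (+ 0) -[1+ 0 ] p - lf (+ 0) -[1+ 0 ] q - + 1)) → ⊥
  above ((x , y) , i , h) = split n simplex e n≥3 x y i
    (≥0-cong (h ⊕ y-strict p int (λ q j → proj₁ (proj₂ (simplex q j)))) (lem px py x y))

-- Widths and forms of minimal width

-- `P` comes without a decision procedure, so a minimum is available only up to double negation;
-- this suffices because each use refutes something.
¬¬-minimum : {A : Set} (P : A → Set) (μ : A → ℕ) → ∀ a → P a →
  ((b : A) → P b → (∀ c → P c → μ b ℕ.≤ μ c) → ⊥) → ⊥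
¬¬-minimum {A} P μ a pa K = go (μ a) a ℕP.≤-refl pa
  where
  go : ∀ n a → μ a ℕ.≤ n → P a → ⊥
  go n a a≤n pa = K a pa λ c pc → check n a≤n c pc (μ a ℕP.≤? μ c)
    where
    check : ∀ n → μ a ℕ.≤ n → ∀ c → P c → Dec (μ a ℕ.≤ μ c) → μ a ℕ.≤ μ c
    check n a≤n c pc (yes h) = h
    check zero a≤n c pc (no ¬h) = ⊥-elim (¬h (ℕP.≤-trans a≤n z≤n))
    check (suc n) a≤n c pc (no ¬h) = ⊥-elim (go n c (ℕ.s≤s⁻¹ (ℕP.≤-trans (ℕP.≰⇒> ¬h) a≤n)) pc)

∣∣-mono⁻ : ∀ {x y} → 0≤ x → 0≤ y → ℤ.∣ x ∣ ℕ.≤ ℤ.∣ y ∣ → 0≤ (y - x)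
∣∣-mono⁻ {+ m} {+ n} _ _ h = ℤP.i≤j⇒0≤j-i (ℤ.+≤+ h)

module Width (S : List Point) (two : TwoDim S) where
  private
    s₀ : Point
    s₀ = proj₁ two
    s₀∈S : s₀ ∈ S
    s₀∈S = proj₁ (proj₂ (proj₂ (proj₂ two)))

  lf-neg : ∀ α β p → lf (- α) (- β) p ≡ - lf α β p
  lf-neg α β (x , y) = lem α β x y
    where
    lem : ∀ α β x y → - α * x + - β * y ≡ - (α * x + β * y)
    lem = solve-∀

  abstract
    highest : ∀ α β → ∃[ s ] (s ∈ S × (∀ t → t ∈ S → 0≤ (lf α β s - lf α β t)))
    highest α β = go (optimum (λ s t → 0≤ (lf α β s - lf α β t)) {λ _ → ⊤} (λ _ → yes tt)
        (λ {a} {b} {c} _ _ _ → ≥0-trans (lf α β a) (lf α β b) (lf α β c)) (λ a b _ _ → ≥0-total (lf α β a) (lf α β b)) S)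
      where
      go : (∀ a → a ∈ S → ¬ ⊤) ⊎ (∃[ a ] (a ∈ S × ⊤ × (∀ b → b ∈ S → ⊤ → 0≤ (lf α β a - lf α β b)))) →
        ∃[ s ] (s ∈ S × (∀ t → t ∈ S → 0≤ (lf α β s - lf α β t)))
      go (inj₁ none) = ⊥-elim (none s₀ s₀∈S tt)
      go (inj₂ (a , i , _ , h)) = a , i , λ t j → h t j tt

    lowest : ∀ α β → ∃[ s ] (s ∈ S × (∀ t → t ∈ S → 0≤ (lf α β t - lf α β s)))
    lowest α β = go (highest (- α) (- β))
      where
      lem : ∀ a b → - a - - b ≡ b - a
      lem = solve-∀
      go : ∃[ s ] (s ∈ S × (∀ t → t ∈ S → 0≤ (lf (- α) (- β) s - lf (- α) (- β) t))) → ∃[ s ] (s ∈ S × (∀ t → t ∈ S → 0≤ (lf α β t - lf α β s)))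
      go (s , i , h) = s , i , λ t j → ≥0-cong (h t j) (trans (cong₂ _-_ (lf-neg α β s) (lf-neg α β t)) (lem (lf α β s) (lf α β t)))

  hi lo : ℤ → ℤ → Point
  hi α β = proj₁ (highest α β)
  lo α β = proj₁ (lowest α β)

  hi∈ : ∀ α β → hi α β ∈ S
  hi∈ α β = proj₁ (proj₂ (highest α β))

  lo∈ : ∀ α β → lo α β ∈ S
  lo∈ α β = proj₁ (proj₂ (lowest α β))

  abstract
    width : ℤ → ℤ → ℤ
    width α β = lf α β (hi α β) - lf α β (lo α β)

    width-attained : ∀ α β → width α β ≡ lf α β (hi α β) - lf α β (lo α β)
    width-attained α β = refl

  width-upper : ∀ α β s t → s ∈ S → t ∈ S → 0≤ (width α β - (lf α β s - lf α β t))
  width-upper α β s t i j = ≥0-cong (proj₂ (proj₂ (highest α β)) s i ⊕ proj₂ (proj₂ (lowest α β)) t j)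
    (trans (lem (lf α β (hi α β)) (lf α β s) (lf α β t) (lf α β (lo α β)))
      (cong (λ w → w - (lf α β s - lf α β t)) (sym (width-attained α β))))
    where
    lem : ∀ h s t l → h - s + (t - l) ≡ h - l - (s - t)
    lem = solve-∀

  width≥0 : ∀ α β → 0≤ width α β
  width≥0 α β = ≥0-cong (proj₂ (proj₂ (highest α β)) (lo α β) (lo∈ α β)) (sym (width-attained α β))

  width-neg : ∀ α β → 0≤ (width α β - width (- α) (- β))
  width-neg α β = ≥0-cong (width-upper α β (lo (- α) (- β)) (hi (- α) (- β)) (lo∈ (- α) (- β)) (hi∈ (- α) (- β)))
    (trans (lem (width α β) (lf α β (lo (- α) (- β))) (lf α β (hi (- α) (- β))))
      (cong (λ z → width α β - z) (trans (cong₂ _-_ (sym (lf-neg α β (hi (- α) (- β)))) (sym (lf-neg α β (lo (- α) (- β))))) (sym (width-attained (- α) (- β))))))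
    where
    lem : ∀ w a b → w - (a - b) ≡ w - (- b - - a)
    lem = solve-∀

  width-positive : ∀ α β → NonZeroForm α β → 0≤ (width α β - + 1)
  width-positive α β nz = go (trichotomy (width α β)) two
    where
    go : 0≤ (width α β - + 1) ⊎ width α β ≡ + 0 ⊎ 0≤ (- width α β - + 1) → TwoDim S → 0≤ (width α β - + 1)
    go (inj₁ h) _ = h
    go (inj₂ (inj₂ h)) _ = ⊥-elim (clash (width≥0 α β) h)
    go (inj₂ (inj₁ e)) (p , q , r , ip , iq , ir , D≢0) = ⊥-elim (nz (form-vanish α β (- lf α β p) p q r D≢0
        (same p p ip ip) (same q p iq ip) (same r p ir ip)))
      where
      lem : ∀ s t → + 0 - (s - t) ≡ t + - s
      lem = solve-∀
      lem' : ∀ s t → + 0 - (s - t) ≡ - (s + - t)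
      lem' = solve-∀
      same : ∀ s t → s ∈ S → t ∈ S → lf α β s + - lf α β t ≡ + 0
      same s t i j = ≥0-antisym
        (≥0-cong (width-upper α β t s j i) (trans (cong (λ z → z - (lf α β t - lf α β s)) e) (lem (lf α β t) (lf α β s))))
        (≥0-cong (width-upper α β s t i j) (trans (cong (λ z → z - (lf α β s - lf α β t)) e) (lem' (lf α β s) (lf α β t))))

  lf-scale : ∀ g α β p → lf (g * α) (g * β) p ≡ g * lf α β p
  lf-scale g α β (x , y) = lem g α β x y
    where
    lem : ∀ g α β x y → g * α * x + g * β * y ≡ g * (α * x + β * y)
    lem = solve-∀

  -- Widths scale with the form and are positive in dimension two. Consequently a form of minimal
  -- width is primitive.
  width-shrinks : ∀ g α β → 0≤ (g - + 2) → NonZeroForm α β → ¬ 0≤ (width α β - width (g * α) (g * β))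
  width-shrinks g α β hg nz h = absurd (h ⊕ width-upper (g * α) (g * β) s t (hi∈ α β) (lo∈ α β) ⊕ hg ⊗ width-positive α β nz ⊕ hg ⊕ width-positive α β nz)
      (trans (cong (λ z → w - w' + (w' - z) + (g - + 2) * (w - + 1) + (g - + 2) + (w - + 1)) (trans (cong₂ _-_ (lf-scale g α β s) (lf-scale g α β t)) (trans (l₀ g (lf α β s) (lf α β t)) (cong (g *_) (sym (width-attained α β))))))
        (lem g w w'))
    where
    s = hi α β
    t = lo α β
    w = width α β
    w' = width (g * α) (g * β)
    l₀ : ∀ g a b → g * a - g * b ≡ g * (a - b)
    l₀ = solve-∀
    lem : ∀ g w w' → w - w' + (w' - g * w) + (g - + 2) * (w - + 1) + (g - + 2) + (w - + 1) ≡ -[1+ 0 ]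
    lem = solve-∀

coprime-form : ∀ α β → NonZeroForm α β → (∀ g α' β' → α ≡ g * α' → β ≡ g * β' → 0≤ (g - + 2) → ⊥) → Coprime ℤ.∣ α ∣ ℤ.∣ β ∣
coprime-form α β nz K {i} (i∣α , i∣β) = go i (ℤDiv.∣ᵤ⇒∣ {+ i} {α} i∣α) (ℤDiv.∣ᵤ⇒∣ {+ i} {β} i∣β)
  where
  go : ∀ i → (+ i) ℤDiv.∣ α → (+ i) ℤDiv.∣ β → i ≡ 1
  go 0 (ℤDiv.divides q e) (ℤDiv.divides q' e') = ⊥-elim (nz (trans e (ℤP.*-zeroʳ q) , trans e' (ℤP.*-zeroʳ q')))
  go 1 _ _ = refl
  go (suc (suc i)) (ℤDiv.divides q e) (ℤDiv.divides q' e') =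
    ⊥-elim (K (+ suc (suc i)) q q' (trans e (ℤP.*-comm q _)) (trans e' (ℤP.*-comm q' _)) nat≥0)

swap : Unimodular → Unimodular
swap φ = record { a = c ; b = d ; c = a ; d = b ; e = f ; f = e ; unimod = [ (λ h → inj₂ (eq h)) , (λ h → inj₁ (eq h)) ]′ unimod }
  where
  open Unimodular φ
  lem : ∀ a b c d → c * b - d * a ≡ - (a * d - b * c)
  lem = solve-∀
  eq : ∀ {t} → a * d - b * c ≡ t → c * b - d * a ≡ - t
  eq h = trans (lem a b c d) (cong -_ h)

flip-strict : ∀ u v → 0≤ (- (u - v) - + 1) → 0≤ (v - u - + 1)
flip-strict u v h = ≥0-cong h (lem u v)
  where
  lem : ∀ u v → - (u - v) - + 1 ≡ v - u - + 1
  lem = solve-∀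

-- The corner at a lowest vertex

-- S has the lattice point (0 , 0) on its lowest level x + y = 0, and (a , b) is an interior point on
-- the lowest level that meets the interior points; coordinates are those given by φ.
record Corner (S : List Point) (φ : Unimodular) (a b : ℤ) : Set where
  field
    origin : (+ 0 , + 0) ∈ map (act φ) S
    levels : ∀ s → s ∈ S → 0≤ (proj₁ (act φ s) + proj₂ (act φ s))
    point : Point
    interior : Int S point
    position : act φ point ≡ (a , b)
    a≥1 : 0≤ (a - + 1)
    b≥1 : 0≤ (b - + 1)
    lowest : ∀ r → Int S r → 0≤ (proj₁ (act φ r) + proj₂ (act φ r) - (a + b))

swap-corner : ∀ {S φ a b} → Corner S φ a b → Corner S (swap φ) b a
swap-corner {S} {φ} {a} {b} K = record
  { origin = flip (∈-map⁻ (act φ) origin)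
  ; levels = λ s i → ≥0-cong (levels s i) (ℤP.+-comm (proj₁ (act φ s)) (proj₂ (act φ s)))
  ; point = point ; interior = interior ; position = cong (λ q → proj₂ q , proj₁ q) position ; a≥1 = b≥1 ; b≥1 = a≥1
  ; lowest = λ r int → ≥0-cong (lowest r int) (lem (proj₁ (act φ r)) (proj₂ (act φ r)) a b) }
  where
  open Corner K
  lem : ∀ x y a b → x + y - (a + b) ≡ y + x - (b + a)
  lem = solve-∀
  flip : ∃[ s ] (s ∈ S × (+ 0 , + 0) ≡ act φ s) → (+ 0 , + 0) ∈ map (act (swap φ)) S
  flip (s , i , e) = subst (_∈ map (act (swap φ)) S) (sym (cong (λ q → proj₂ q , proj₁ q) e)) (∈-map⁺ (act (swap φ)) i)

module CornerFacts {S φ a b} (K : Corner S φ a b) where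
  open Corner K
  T = map (act φ) S

  int-point : Int T (a , b)
  int-point = subst (Int T) position (Int-act φ {S} {point} interior)

  low : ∀ r → Int T r → 0≤ (proj₁ r + proj₂ r - (a + b))
  low r int = subst (λ q → 0≤ (proj₁ q + proj₂ q - (a + b))) (act-inverseʳ φ r) (lowest (act (inv φ) r) (Int-act⁻ φ r int))

  level≥0 : ∀ q → q ∈ T → 0≤ (proj₁ q + proj₂ q)
  level≥0 = ∀∈map φ (λ q → 0≤ (proj₁ q + proj₂ q)) levels

  -- Otherwise (0 , 1) would be an interior point on too low a level.
  x≥0 : ∀ q → q ∈ T → 0≤ proj₁ q
  x≥0 (x , y) i = go (signs x)
    where
    l₁ : ∀ a → a - + 1 + + 1 ≡ a
    l₁ = solve-∀
    l₂ : ∀ a b x y → (a - + 1 + + 1) * (x + y + (- x - + 1)) + (- x - + 1 + + 1) * (b - + 1) ≡ a * (y - + 1) + - x * (b - + 1)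
    l₂ = solve-∀
    l₃ : ∀ a b x y → - x * a + a * x + (a * (y - + 1) + - x * (b - + 1)) * + 0 ≡ (- x + a + (a * (y - + 1) + - x * (b - + 1))) * + 0
    l₃ = solve-∀
    l₄ : ∀ a b x y → - x * b + a * y + (a * (y - + 1) + - x * (b - + 1)) * + 0 ≡ (- x + a + (a * (y - + 1) + - x * (b - + 1))) * + 1
    l₄ = solve-∀
    l₅ : ∀ a b → + 1 - (a + b) + (a - + 1) + (b - + 1) ≡ -[1+ 0 ]
    l₅ = solve-∀
    k≥0 : 0≤ (- x - + 1) → 0≤ (a * (y - + 1) + - x * (b - + 1))
    k≥0 h = ≥0-cong ((a≥1 ⊕ nat≥0 {1}) ⊗ (level≥0 (x , y) i ⊕ h) ⊕ (h ⊕ nat≥0 {1}) ⊗ b≥1) (l₂ a b x y)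
    below : 0≤ (- x - + 1) → Int T (+ 0 , + 1)
    below h = Int-combine {T} {a , b} {x , y} {+ 0 , + 0} {+ 0 , + 1} (- x) a (a * (y - + 1) + - x * (b - + 1))
      int-point (∈⇒InHull i) (∈⇒InHull origin) h (≥0-cong (a≥1 ⊕ nat≥0 {1}) (l₁ a)) (k≥0 h) (combination (l₃ a b x y) (l₄ a b x y))
    go : 0≤ x ⊎ 0≤ (- x - + 1) → 0≤ x
    go (inj₁ h) = h
    go (inj₂ h) = ⊥-elim (absurd (low (+ 0 , + 1) (below h) ⊕ a≥1 ⊕ b≥1) (l₅ a b))

  -- Otherwise (a , b − 1) would be an interior point on too low a level.
  slope : (∀ q → q ∈ T → 0≤ proj₂ q) → ∀ x y → Int T (x , y) → 0≤ (a * y - (b - + 1) * x - + 1)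
  slope y≥0 x y int = go (signs ((b - + 1) * x - a * y))
    where
    l₂ : ∀ a b x y → (b - + 1) * x - a * y + (a - + 1 + + 1) * (x + y - (a + b)) + (a - + 1 + (b - + 1) + + 1) * (- (x - a) - + 1)
      + (a - + 1) + (a - + 1) + (b - + 1) + + 1 ≡ -[1+ 0 ]
    l₂ = solve-∀
    l₃ : ∀ a b x y → a * x + ((b - + 1) * x - a * y) * a + (x - a) * + 0 ≡ (a + ((b - + 1) * x - a * y) + (x - a)) * a
    l₃ = solve-∀
    l₄ : ∀ a b x y → a * y + ((b - + 1) * x - a * y) * b + (x - a) * + 0 ≡ (a + ((b - + 1) * x - a * y) + (x - a)) * (b - + 1)
    l₄ = solve-∀
    l₅ : ∀ a b → a + (b - + 1) - (a + b) ≡ -[1+ 0 ]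
    l₅ = solve-∀
    contra : ∀ a b x y → 0≤ (a - + 1) → 0≤ (b - + 1) → 0≤ ((b - + 1) * x - a * y) → 0≤ (x + y - (a + b)) → 0≤ (- (x - a) - + 1) → ⊥
    contra a b x y ha hb h₁ h₂ h₃ = absurd (h₁ ⊕ (ha ⊕ nat≥0 {1}) ⊗ h₂ ⊕ (ha ⊕ hb ⊕ nat≥0 {1}) ⊗ h₃ ⊕ ha ⊕ ha ⊕ hb ⊕ nat≥0 {1}) (l₂ a b x y)
    go : 0≤ ((b - + 1) * x - a * y) ⊎ 0≤ (- ((b - + 1) * x - a * y) - + 1) → 0≤ (a * y - (b - + 1) * x - + 1)
    go (inj₂ h) = flip-strict ((b - + 1) * x) (a * y) h
    go (inj₁ h) = ⊥-elim (absurd (low (a , b - + 1) below) (l₅ a b))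
      where
      below : Int T (a , b - + 1)
      x≥a : 0≤ (x - a) ⊎ 0≤ (- (x - a) - + 1) → 0≤ (x - a)
      x≥a (inj₁ k) = k
      x≥a (inj₂ k) = ⊥-elim (contra a b x y a≥1 b≥1 h (low (x , y) int) k)
      below = Int-combine {T} {x , y} {a , b} {+ 0 , + 0} {a , b - + 1} a ((b - + 1) * x - a * y) (x - a)
        int (Int⇒InHull {T} {a , b} int-point) (∈⇒InHull origin) a≥1 h (x≥a (signs (x - a))) (combination (l₃ a b x y) (l₄ a b x y))

by-contradiction : ∀ x → (0≤ (- x - + 1) → ⊥) → 0≤ x
by-contradiction x h = [ (λ k → k) , (λ k → ⊥-elim (h k)) ]′ (signs x)

-- (a + b - 1) x = b x + (a - 1) x > (a - 1)(x + y) ≥ (a - 1)(a + b), whence x > a - 1.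
range-lower : ∀ a b x y → 0≤ (a - + 1) → 0≤ (b - + 1) → 0≤ (b * x - (a - + 1) * y - + 1) → 0≤ (x + y - (a + b)) → 0≤ (x - a)
range-lower a b x y ha hb h₁ h₂ = by-contradiction (x - a) λ k →
  absurd (h₁ ⊕ ha ⊗ h₂ ⊕ (ha ⊕ hb ⊕ nat≥0 {1}) ⊗ k ⊕ ha) (lem a b x y)
  where
  lem : ∀ a b x y → b * x - (a - + 1) * y - + 1 + (a - + 1) * (x + y - (a + b)) + (a - + 1 + (b - + 1) + + 1) * (- (x - a) - + 1) + (a - + 1) ≡ -[1+ 0 ]
  lem = solve-∀

-- (a + b - 1) x < a(x + y) ≤ a(a + b + d) ≤ (a + b - 1)(a + d + 1), whence x < a + d + 1. Together
-- with the lower bound this confines the interior points to d + 1 columns.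
range-upper : ∀ a b d x y → 0≤ (a - + 1) → 0≤ (b - + 1) → 0≤ d → 0≤ (a * y - (b - + 1) * x - + 1) → 0≤ (a + b + d - (x + y)) → 0≤ (a + d - x)
range-upper a b d x y ha hb hd h₁ h₂ = by-contradiction (a + d - x) λ k →
  absurd (h₁ ⊕ (ha ⊕ nat≥0 {1}) ⊗ h₂ ⊕ (ha ⊕ hb ⊕ nat≥0 {1}) ⊗ k ⊕ hb ⊗ hd ⊕ hb) (lem a b d x y)
  where
  lem : ∀ a b d x y → a * y - (b - + 1) * x - + 1 + (a - + 1 + + 1) * (a + b + d - (x + y)) + (a - + 1 + (b - + 1) + + 1) * (- (a + d - x) - + 1)
    + (b - + 1) * d + (b - + 1) ≡ -[1+ 0 ]
  lem = solve-∀

module CornerRange {S φ a b} (K : Corner S φ a b) where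
  open Corner K
  module X = CornerFacts K
  module Y = CornerFacts (swap-corner K)

  private
    unswap : ∀ q → q ∈ map (act φ) S → (proj₂ q , proj₁ q) ∈ map (act (swap φ)) S
    unswap = ∀∈map φ (λ q → (proj₂ q , proj₁ q) ∈ map (act (swap φ)) S) (λ s j → ∈-map⁺ (act (swap φ)) j)
    unswap' : ∀ q → q ∈ map (act (swap φ)) S → (proj₂ q , proj₁ q) ∈ map (act φ) S
    unswap' = ∀∈map (swap φ) (λ q → (proj₂ q , proj₁ q) ∈ map (act φ) S) (λ s j → ∈-map⁺ (act φ) j)

  y≥0 : ∀ q → q ∈ map (act φ) S → 0≤ proj₂ q
  y≥0 q i = Y.x≥0 _ (unswap q i)

  range : ∀ d r → 0≤ d → Int S r → 0≤ (a + b + d - (proj₁ (act φ r) + proj₂ (act φ r))) →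
    0≤ (proj₁ (act φ r) - a) × 0≤ (a + d - proj₁ (act φ r))
  range d r hd int hl =
      range-lower a b x y a≥1 b≥1 (Y.slope (λ q i → X.x≥0 _ (unswap' q i)) y x (Int-act (swap φ) {S} {r} int)) (lowest r int) ,
      range-upper a b d x y a≥1 b≥1 hd (X.slope y≥0 x y (Int-act φ {S} {r} int)) hl
    where
    x = proj₁ (act φ r)
    y = proj₂ (act φ r)

-- Reduction to a basis, and the contradiction at a corner

aff-lf : ∀ α β ε p → aff α β ε p ≡ lf α β p + ε
aff-lf α β ε (x , y) = refl

lf-+ : ∀ α β γ δ p → lf (α + γ) (β + δ) p ≡ lf α β p + lf γ δ p
lf-+ α β γ δ (x , y) = lem α β γ δ x y
  where
  lem : ∀ α β γ δ x y → (α + γ) * x + (β + δ) * y ≡ α * x + β * y + (γ * x + δ * y)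
  lem = solve-∀

-- f = A x + B y and B = q A + r give A (x + q y) = f − r y, of width at most (1 + r) D ≤ A D.
reduce-identity : ∀ α β γ δ g h q r → g * β - h * α ≡ + 1 → g * δ - h * γ ≡ q * (γ * β - δ * α) + r → ∀ p →
  (γ * β - δ * α) * lf (g + q * α) (h + q * β) p ≡ lf γ δ p - r * lf α β p
reduce-identity α β γ δ g h q r e eB (x , y) = trans (l₁ α β γ δ g h q x y)
  (trans (cong₂ (λ u v → u * (γ * x + δ * y) - (v - q * (γ * β - δ * α)) * (α * x + β * y)) e eB) (l₂ (q * (γ * β - δ * α)) r (γ * x + δ * y) (α * x + β * y)))
  where
  l₁ : ∀ α β γ δ g h q x y → (γ * β - δ * α) * ((g + q * α) * x + (h + q * β) * y) ≡
    (g * β - h * α) * (γ * x + δ * y) - (g * δ - h * γ - q * (γ * β - δ * α)) * (α * x + β * y)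
  l₁ = solve-∀
  l₂ : ∀ u r f z → + 1 * f - (u + r - u) * z ≡ f - r * z
  l₂ = solve-∀

reduce-bound : ∀ A D r wf wy fs ft ys yt xs xt → A * xs ≡ fs - r * ys → A * xt ≡ ft - r * yt →
  0≤ (A - + 1) → 0≤ r → 0≤ (A - + 1 - r) → 0≤ wy → 0≤ (D - wy) → 0≤ (D - wf) → 0≤ (wf - (fs - ft)) → 0≤ (wy - (yt - ys)) → 0≤ (D - (xs - xt))
reduce-bound A D r wf wy fs ft ys yt xs xt es et hA hr hr' hw hy hf h₁ h₂ = ≥0-cancel A (D - (xs - xt)) hA
  (≥0-cong ((hf ⊕ h₁) ⊕ hr ⊗ (hy ⊕ h₂) ⊕ hr' ⊗ (hy ⊕ hw) ⊕ hA)
    (trans (l₁ A D r wf wy fs ft ys yt) (trans (cong₂ (λ u v → A * D - (u - v) + A - + 1) (sym es) (sym et)) (l₂ A D xs xt))))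
  where
  l₁ : ∀ A D r wf wy fs ft ys yt → D - wf + (wf - (fs - ft)) + r * (D - wy + (wy - (yt - ys))) + (A - + 1 - r) * (D - wy + wy) + (A - + 1) ≡
    A * D - ((fs - r * ys) - (ft - r * yt)) + A - + 1
  l₁ = solve-∀
  l₂ : ∀ A D xs xt → A * D - (A * xs - A * xt) + A - + 1 ≡ A * (D - (xs - xt)) + A - + 1
  l₂ = solve-∀

module Main (S : List Point) (two : TwoDim S) where
  open Width S two

  -- The matrix of a map into D□ without its translation, which widths do not see; what remains is a
  -- finite search.
  FitRows : ℤ → Set
  FitRows D = ∃[ a ] ∃[ b ] ∃[ c ] ∃[ d ] (((a * d - b * c ≡ + 1) ⊎ (a * d - b * c ≡ -[1+ 0 ])) ×
    0≤ (D - width a b) × 0≤ (D - width c d))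

  reduced-width : ∀ A D r α β γ δ X₁ X₂ → (∀ p → A * lf X₁ X₂ p ≡ lf γ δ p - r * lf α β p) →
    0≤ (A - + 1) → 0≤ r → 0≤ (A - + 1 - r) → 0≤ (D - width α β) → 0≤ (D - width γ δ) → 0≤ (D - width X₁ X₂)
  reduced-width A D r α β γ δ X₁ X₂ identity hA hr hr' hy hf =
    ≥0-cong (reduce-bound A D r (width γ δ) (width α β) (lf γ δ s) (lf γ δ t) (lf α β s) (lf α β t) (lf X₁ X₂ s) (lf X₁ X₂ t)
      (identity s) (identity t) hA hr hr' (width≥0 α β) hy hf (width-upper γ δ s t s∈ t∈) (width-upper α β t s t∈ s∈))
      (cong (λ w → D - w) (sym (width-attained X₁ X₂)))
    where
    s = hi X₁ X₂
    t = lo X₁ X₂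
    s∈ = hi∈ X₁ X₂
    t∈ = lo∈ X₁ X₂

  -- Bézout completes the primitive form (α, β) by some (g, h) to a basis. In it (γ, δ) is A (g, h)
  -- + B (α, β) with A = γβ - δα and B = gδ - hγ; dividing B by A gives the multiple of (α, β) that
  -- has to be added to (g, h).
  reduce : ∀ D α β γ δ → Coprime ℤ.∣ α ∣ ℤ.∣ β ∣ → 0≤ (γ * β - δ * α - + 1) →
    0≤ (D - width α β) → 0≤ (D - width γ δ) → FitRows D
  reduce D α β γ δ cop hA hy hf = go (bezout α β cop)
    where
    go : ∃[ g ] ∃[ h ] g * β - h * α ≡ + 1 → FitRows D
    go (g , h , e) = go' (divide (g * δ - h * γ) (γ * β - δ * α) hA)
      where
      go' : ∃[ q ] ∃[ r ] (g * δ - h * γ ≡ q * (γ * β - δ * α) + r × 0≤ r × 0≤ (γ * β - δ * α - + 1 - r)) → FitRows D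
      go' (q , r , eB , hr , hr') = X₁ , X₂ , α , β , inj₁ (trans (l₁ g h q α β) e) , bound , hy
        where
        X₁ = g + q * α
        X₂ = h + q * β
        l₁ : ∀ g h q α β → (g + q * α) * β - (h + q * β) * α ≡ g * β - h * α
        l₁ = solve-∀
        bound : 0≤ (D - width X₁ X₂)
        bound = reduced-width (γ * β - δ * α) D r α β γ δ X₁ X₂ (reduce-identity α β γ δ g h q r e eB) hA hr hr' hy hf

  module _ (d : ℤ) (d≥0 : 0≤ d) where

    IntWidth : ℤ → ℤ → Set
    IntWidth α β = ∀ p p' → Int S p → Int S p' → 0≤ (d - (lf α β p - lf α β p'))

    module _ (no3 : ¬ Case3 (Poly S)) (no4 : ¬ Case4 (Poly S)) (no5 : NoCase5 S) (α β : ℤ) where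

      Candidate : ℤ × ℤ → Set
      Candidate (γ , δ) = γ * β - δ * α ≢ + 0 × IntWidth γ δ

      size : ℤ × ℤ → ℕ
      size (γ , δ) = ℤ.∣ width γ δ ∣

      -- A minimal candidate of width at least d + 3 forces S into a multiple of the standard triangle.
      corner-contradiction : ∀ γ δ φ a b → let module φ = Unimodular φ in Corner S φ a b →
        γ ≡ φ.a + φ.c → δ ≡ φ.b + φ.d → IntWidth γ δ →
        (∀ c → Candidate c → size (γ , δ) ℕ.≤ size c) → 0≤ (width γ δ - (d + + 3)) →
        φ.a * β - φ.b * α ≢ + 0 → ⊥
      corner-contradiction γ δ φ a b K eγ eδ iw minimal big indep = finish (≥0-nat (width≥0 γ δ))
        where
        module φ = Unimodular φ
        open Corner K
        open CornerRange K
        T = map (act φ) S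
        coord : ∀ s t → proj₁ (act φ s) + proj₂ (act φ s) - (proj₁ (act φ t) + proj₂ (act φ t)) ≡ lf γ δ s - lf γ δ t
        coord s t = trans (cong₂ (λ u v → u - v) (lev s) (lev t)) (lem (lf γ δ s) (lf γ δ t) (φ.e + φ.f))
          where
          lem : ∀ u v k → u + k - (v + k) ≡ u - v
          lem = solve-∀
          l : ∀ u v e f → u + e + (v + f) ≡ u + v + (e + f)
          l = solve-∀
          lev : ∀ s → proj₁ (act φ s) + proj₂ (act φ s) ≡ lf γ δ s + (φ.e + φ.f)
          lev s = trans (cong₂ _+_ (aff-lf φ.a φ.b φ.e s) (aff-lf φ.c φ.d φ.f s))
            (trans (l (lf φ.a φ.b s) (lf φ.c φ.d s) φ.e φ.f) (cong (_+ (φ.e + φ.f)) (trans (sym (lf-+ φ.a φ.b φ.c φ.d s)) (cong₂ (λ u v → lf u v s) (sym eγ) (sym eδ)))))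
        rangeX : ∀ r → Int S r → 0≤ (proj₁ (act φ r) - a) × 0≤ (a + d - proj₁ (act φ r))
        rangeX r int = range d r d≥0 int (≥0-cong (iw r point int interior)
          (trans (cong (λ z → d - z) (sym (coord r point))) (trans (cong (λ q → d - (proj₁ (act φ r) + proj₂ (act φ r) - (proj₁ q + proj₂ q))) position)
            (lem d (proj₁ (act φ r) + proj₂ (act φ r)) a b))))
          where
          lem : ∀ d u a b → d - (u - (a + b)) ≡ a + b + d - u
          lem = solve-∀
        X-diff : ∀ s t → proj₁ (act φ s) - proj₁ (act φ t) ≡ lf φ.a φ.b s - lf φ.a φ.b t
        X-diff s t = trans (cong₂ _-_ (aff-lf φ.a φ.b φ.e s) (aff-lf φ.a φ.b φ.e t)) (lem (lf φ.a φ.b s) (lf φ.a φ.b t) φ.e)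
          where
          lem : ∀ u v k → u + k - (v + k) ≡ u - v
          lem = solve-∀
        candidate : Candidate (φ.a , φ.b)
        candidate = indep , λ p p' int int' → ≥0-cong (proj₂ (rangeX p int) ⊕ proj₁ (rangeX p' int'))
          (trans (lem d a (proj₁ (act φ p)) (proj₁ (act φ p'))) (cong (λ z → d - z) (X-diff p p')))
          where
          lem : ∀ d a x x' → a + d - x + (x' - a) ≡ d - (x - x')
          lem = solve-∀
        H = width γ δ
        wide : 0≤ (width φ.a φ.b - H)
        wide = ∣∣-mono⁻ {H} {width φ.a φ.b} (width≥0 γ δ) (width≥0 φ.a φ.b) (minimal (φ.a , φ.b) candidate)
        xs : ∀ s → s ∈ S → 0≤ proj₁ (act φ s)
        xs s i = X.x≥0 _ (∈-map⁺ (act φ) i)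
        ys : ∀ s → s ∈ S → 0≤ proj₂ (act φ s)
        ys s i = y≥0 _ (∈-map⁺ (act φ) i)
        ss : ∀ s → s ∈ S → 0≤ (H - proj₁ (act φ s) - proj₂ (act φ s))
        ss s i = go (∈-map⁻ (act φ) origin)
          where
          lem : ∀ H x y → H - (x + y - (+ 0 + + 0)) ≡ H - x - y
          lem = solve-∀
          go : ∃[ v ] (v ∈ S × (+ 0 , + 0) ≡ act φ v) → 0≤ (H - proj₁ (act φ s) - proj₂ (act φ s))
          go (v , j , e) = ≥0-cong (width-upper γ δ s v i j) (trans (cong (λ z → H - z) (sym (coord s v)))
            (trans (cong (λ q → H - (proj₁ (act φ s) + proj₂ (act φ s) - (proj₁ q + proj₂ q))) (sym e)) (lem H (proj₁ (act φ s)) (proj₂ (act φ s)))))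
        simplex : InSimplex H T
        simplex = ∀∈map φ (λ q → 0≤ proj₁ q × 0≤ proj₂ q × 0≤ (H - proj₁ q - proj₂ q)) (λ s j → xs s j , ys s j , ss s j)
        top = hi φ.a φ.b
        bot = lo φ.a φ.b
        x₁ = proj₁ (act φ top)
        y₁ = proj₂ (act φ top)
        x₁≥H : 0≤ (x₁ - H)
        x₁≥H = bound (width φ.a φ.b) x₁ (proj₁ (act φ bot)) H (trans (width-attained φ.a φ.b) (sym (X-diff top bot))) wide (xs bot (lo∈ φ.a φ.b))
          where
          lem : ∀ x y H → x - y - H + y ≡ x - H
          lem = solve-∀
          bound : ∀ w x y H → w ≡ x - y → 0≤ (w - H) → 0≤ y → 0≤ (x - H)
          bound w x y H refl h k = ≥0-cong (h ⊕ k) (lem x y H)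
        -- In HΣ the only point with first coordinate at least H is the vertex (H, 0), the other end
        -- of the edge that starts at the origin.
        corner : act φ top ≡ (H , + 0)
        corner = cong₂ _,_ (≥0-≡ x₁≥H (≥0-cong (ss top (hi∈ φ.a φ.b) ⊕ ys top (hi∈ φ.a φ.b)) (l₁ H x₁ y₁)))
            (≥0-antisym (ys top (hi∈ φ.a φ.b)) (≥0-cong (ss top (hi∈ φ.a φ.b) ⊕ x₁≥H) (l₂ H x₁ y₁)))
          where
          l₁ : ∀ H x y → H - x - y + y ≡ H - x
          l₁ = solve-∀
          l₂ : ∀ H x y → H - x - y + (x - H) ≡ - y
          l₂ = solve-∀
        finish : ∃[ n ] H ≡ + n → ⊥
        finish (n , eH) = exceptional S φ n (subst (λ h → InSimplex h T) eH simplex) origin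
          (subst (λ h → (h , + 0) ∈ T) eH (subst (_∈ T) corner (∈-map⁺ (act φ) (hi∈ φ.a φ.b))))
          (≥0-cong (big ⊕ d≥0) (trans (lem H d) (cong (_- + 3) eH)))
          (act φ point , Int-act φ {S} {point} interior) no3 no4 no5
          where
          lem : ∀ H d → H - (d + + 3) + d ≡ H - + 3
          lem = solve-∀

      -- A form g that completes f to a basis may be changed by multiples of f. Dividing g(p) - g(v)
      -- by s₀ = f(p) - f(v) leaves 0 ≤ a < s₀, so that X = g - q f and Z = f - X take the values a
      -- and s₀ - a at `p` relative to v. Both are positive once a = 0 is excluded.
      bottom : ∀ γ δ → Coprime ℤ.∣ γ ∣ ℤ.∣ δ ∣ → Candidate (γ , δ) →
        (∀ c → Candidate c → size (γ , δ) ℕ.≤ size c) → 0≤ (width γ δ - (d + + 3)) →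
        ∀ p → Int S p → (∀ r → Int S r → 0≤ (lf γ δ r - lf γ δ p)) → 0≤ (lf γ δ p - lf γ δ (lo γ δ) - + 2) → ⊥
      bottom γ δ cop (indep , iw) minimal big p intp lowp gap = go (bezout γ δ cop)
        where
        v = lo γ δ
        s₀ = lf γ δ p - lf γ δ v
        s₀≥1 : 0≤ (s₀ - + 1)
        s₀≥1 = ≥0-cong (gap ⊕ nat≥0 {1}) (lem s₀)
          where
          lem : ∀ s → s - + 2 + + 1 ≡ s - + 1
          lem = solve-∀
        go : ∃[ g ] ∃[ h ] g * δ - h * γ ≡ + 1 → ⊥
        go (g , h , e) = go' (divide (lf g h p - lf g h v) s₀ s₀≥1)
          where
          go' : ∃[ q ] ∃[ a ] (lf g h p - lf g h v ≡ q * s₀ + a × 0≤ a × 0≤ (s₀ - + 1 - a)) → ⊥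
          go' (q , a , ea , ha , ha') = decide (trichotomy a)
            where
            X₁ = g - q * γ
            X₂ = h - q * δ
            φ : Unimodular
            φ = record { a = X₁ ; b = X₂ ; c = γ - X₁ ; d = δ - X₂ ; e = - lf X₁ X₂ v ; f = - (lf γ δ v - lf X₁ X₂ v)
                       ; unimod = inj₁ (trans (lem g h q γ δ) e) }
              where
              lem : ∀ g h q γ δ → (g - q * γ) * (δ - (h - q * δ)) - (h - q * δ) * (γ - (g - q * γ)) ≡ g * δ - h * γ
              lem = solve-∀
            T = map (act φ) S
            b = s₀ - a
            X-at : ∀ s → proj₁ (act φ s) ≡ lf X₁ X₂ s - lf X₁ X₂ v
            X-at s = aff-lf X₁ X₂ (- lf X₁ X₂ v) s
            level : ∀ s → proj₁ (act φ s) + proj₂ (act φ s) ≡ lf γ δ s - lf γ δ v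
            level (x , y) = lem X₁ X₂ γ δ x y (lf X₁ X₂ v) (lf γ δ v)
              where
              lem : ∀ X₁ X₂ γ δ x y u w → X₁ * x + X₂ * y + - u + ((γ - X₁) * x + (δ - X₂) * y + - (w - u)) ≡ γ * x + δ * y - w
              lem = solve-∀
            X-p : proj₁ (act φ p) ≡ a
            X-p = trans (X-at p) (trans (cong₂ _-_ (split p) (split v)) (trans (l₁ (lf g h p) (lf g h v) q (lf γ δ p) (lf γ δ v)) (trans (cong (λ z → z - q * s₀) ea) (l₂ (q * s₀) a))))
              where
              split : ∀ p → lf X₁ X₂ p ≡ lf g h p - q * lf γ δ p
              split (x , y) = lem g h q γ δ x y
                where
                lem : ∀ g h q γ δ x y → (g - q * γ) * x + (h - q * δ) * y ≡ g * x + h * y - q * (γ * x + δ * y)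
                lem = solve-∀
              l₁ : ∀ gp gv q fp fv → gp - q * fp - (gv - q * fv) ≡ gp - gv - q * (fp - fv)
              l₁ = solve-∀
              l₂ : ∀ u a → u + a - u ≡ a
              l₂ = solve-∀
            Z-p : proj₂ (act φ p) ≡ b
            Z-p = trans (l₁ (proj₁ (act φ p)) (proj₂ (act φ p))) (cong₂ _-_ (level p) X-p)
              where
              l₁ : ∀ x y → y ≡ x + y - x
              l₁ = solve-∀
            v-eq : act φ v ≡ (+ 0 , + 0)
            v-eq = cong₂ _,_ xv (trans (l₁ (proj₁ (act φ v)) (proj₂ (act φ v))) (trans (cong₂ _-_ (level v) xv) (l₂ (lf γ δ v))))
              where
              l₁ : ∀ x y → y ≡ x + y - x
              l₁ = solve-∀
              l₂ : ∀ x → x - x - + 0 ≡ + 0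
              l₂ = solve-∀
              xv : proj₁ (act φ v) ≡ + 0
              xv = trans (X-at v) (ℤP.+-inverseʳ (lf X₁ X₂ v))
            origin∈ : (+ 0 , + 0) ∈ T
            origin∈ = subst (_∈ T) v-eq (∈-map⁺ (act φ) (lo∈ γ δ))
            low : ∀ r → Int S r → 0≤ (proj₁ (act φ r) + proj₂ (act φ r) - s₀)
            low r int = ≥0-cong (lowp r int) (trans (l₁ (lf γ δ r) (lf γ δ p) (lf γ δ v)) (cong (_- s₀) (sym (level r))))
              where
              l₁ : ∀ r p v → r - p ≡ r - v - (p - v)
              l₁ = solve-∀
            l-s : ∀ s a → a + (s - a) ≡ s
            l-s = solve-∀
            decide : 0≤ (a - + 1) ⊎ a ≡ + 0 ⊎ 0≤ (- a - + 1) → ⊥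
            decide (inj₂ (inj₂ h)) = clash ha h
            -- For a = 0 the vector from v to `p` is s₀ times a lattice vector. As s₀ ≥ 2, the
            -- lattice point preceding `p` on that segment is not v; it is interior and one level
            -- lower, against the choice of `p`.
            decide (inj₂ (inj₁ a≡0)) = absurd (subst (λ r → 0≤ (proj₁ r + proj₂ r - s₀)) (act-inverseʳ φ (+ 0 , s₀ - + 1))
                (low (act (inv φ) (+ 0 , s₀ - + 1)) (Int-act⁻ φ _ below))) (l₁ s₀)
              where
              l₁ : ∀ s → + 0 + (s - + 1) - s ≡ -[1+ 0 ]
              l₁ = solve-∀
              l₂ : ∀ s → s - + 2 ≡ s - + 1 - + 1
              l₂ = solve-∀
              l₃ : ∀ s → (s - + 1) * + 0 + + 1 * + 0 + + 0 * + 0 ≡ (s - + 1 + + 1 + + 0) * + 0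
              l₃ = solve-∀
              l₄ : ∀ s → (s - + 1) * (s - + 0) + + 1 * + 0 + + 0 * + 0 ≡ (s - + 1 + + 1 + + 0) * (s - + 1)
              l₄ = solve-∀
              at-p : Int T (+ 0 , s₀ - + 0)
              at-p = subst (Int T) (cong₂ _,_ (trans X-p a≡0) (trans Z-p (cong (λ z → s₀ - z) a≡0))) (Int-act φ {S} {p} intp)
              below : Int T (+ 0 , s₀ - + 1)
              below = Int-combine {T} {+ 0 , s₀ - + 0} {+ 0 , + 0} {+ 0 , + 0} {+ 0 , s₀ - + 1} (s₀ - + 1) (+ 1) (+ 0) at-p
                (∈⇒InHull origin∈) (∈⇒InHull origin∈) (≥0-cong gap (l₂ s₀)) nat≥0 nat≥0 (combination (l₃ s₀) (l₄ s₀))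
            decide (inj₁ a≥1) = choose (zero? (X₁ * β - X₂ * α))
              where
              K : Corner S φ a b
              K = record
                { origin = origin∈
                ; levels = λ s i → ≥0-cong (proj₂ (proj₂ (Width.lowest S two γ δ)) s i) (sym (level s))
                ; point = p ; interior = intp ; position = cong₂ _,_ X-p Z-p ; a≥1 = a≥1 ; b≥1 = ≥0-cong ha' (l₁ s₀ a)
                ; lowest = λ r int → ≥0-cong (low r int) (cong (λ z → proj₁ (act φ r) + proj₂ (act φ r) - z) (sym (l-s s₀ a))) }
                where
                l₁ : ∀ s a → s - + 1 - a ≡ s - a - + 1
                l₁ = solve-∀
              -- The sum X + Z = f is independent of (α, β), so X or Z is; the second case is the
              -- first with the coordinates swapped.
              choose : Dec (X₁ * β - X₂ * α ≡ + 0) → ⊥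
              choose (no ind) = corner-contradiction γ δ φ a b K (sym (l-s γ X₁)) (sym (l-s δ X₂)) iw minimal big ind
              choose (yes dep) = corner-contradiction γ δ (swap φ) b a (swap-corner K) (l₁ γ X₁) (l₁ δ X₂) iw minimal big
                  (λ dep' → indep (trans (l₂ γ δ X₁ X₂ α β) (cong₂ _+_ dep dep')))
                where
                l₁ : ∀ γ x → γ ≡ γ - x + x
                l₁ = solve-∀
                l₂ : ∀ γ δ X₁ X₂ α β → γ * β - δ * α ≡ X₁ * β - X₂ * α + ((γ - X₁) * β - (δ - X₂) * α)
                l₂ = solve-∀

-- From the interior points to the whole polygon

neg-zero : ∀ {x} → - x ≡ + 0 → x ≡ + 0
neg-zero {x} e = trans (sym (ℤP.neg-involutive x)) (cong -_ e)

∣∣-mono : ∀ {x y} → 0≤ x → 0≤ y → 0≤ (y - x) → ℤ.∣ x ∣ ℕ.≤ ℤ.∣ y ∣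
∣∣-mono {+ m} {+ n} _ _ h = ℤP.drop‿+≤+ (ℤP.0≤i-j⇒j≤i h)

divided-bound : ∀ g d x → 0≤ (g - + 2) → 0≤ d → 0≤ (d - g * x) → 0≤ (d - x)
divided-bound g d x hg hd h = by-contradiction (d - x) λ k →
  absurd (h ⊕ (hg ⊕ nat≥0 {2}) ⊗ k ⊕ hg ⊗ hd ⊕ hg ⊕ hd ⊕ nat≥0 {1}) (lem g d x)
  where
  lem : ∀ g d x → d - g * x + (g - + 2 + + 2) * (- (d - x) - + 1) + (g - + 2) * d + (g - + 2) + d + + 1 ≡ -[1+ 0 ]
  lem = solve-∀

-- If the lowest interior point is at most 1 above the bottom, the highest one is at least (d + 3) -
-- d - 1 = 2 below the top.
gap-arith : ∀ p p' l h w d h' q' l' → w ≡ h - l → h' ≡ - h → q' ≡ - p' → 0≤ (- (p - l - + 2) - + 1) → 0≤ (w - (d + + 3)) →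
  0≤ (d - (p' - p)) → 0≤ (h' - l') → 0≤ (q' - l' - + 2)
gap-arith p p' l h w d h' q' l' e₁ e₂ e₃ k₁ k₂ k₃ k₄ = ≥0-cong (k₁ ⊕ k₂ ⊕ k₃ ⊕ k₄)
  (trans (cong₂ (λ w h' → - (p - l - + 2) - + 1 + (w - (d + + 3)) + (d - (p' - p)) + (h' - l')) e₁ e₂)
    (trans (lem p p' l h d l') (cong (λ q' → q' - l' - + 2) (sym e₃))))
  where
  lem : ∀ p p' l h d l' → - (p - l - + 2) - + 1 + (h - l - (d + + 3)) + (d - (p' - p)) + (- h - l') ≡ - p' - l' - + 2
  lem = solve-∀

minimal-coprime : ∀ S two α β → let open Width S two in NonZeroForm α β →
  (∀ γ δ → NonZeroForm γ δ → 0≤ (width γ δ - width α β)) → Coprime ℤ.∣ α ∣ ℤ.∣ β ∣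
minimal-coprime S two α β nz minimal = coprime-form α β nz
    λ { g α' β' refl refl hg → width-shrinks g α' β' hg (nz' g α' β' nz) (minimal α' β' (nz' g α' β' nz)) }
  where
  open Width S two
  nz' : ∀ g α' β' → NonZeroForm (g * α') (g * β') → NonZeroForm α' β'
  nz' g α' β' h (refl , refl) = h (ℤP.*-zeroʳ g , ℤP.*-zeroʳ g)

module InteriorBound (S : List Point) (two : TwoDim S) (d : ℤ) (d≥0 : 0≤ d)
  (no3 : ¬ Case3 (Poly S)) (no4 : ¬ Case4 (Poly S)) (no5 : NoCase5 S) where
  open Width S two
  open Main S two

  lf-above-lo : ∀ γ δ r → Int S r → 0≤ (lf γ δ r - lf γ δ (lo γ δ))
  lf-above-lo γ δ r int = Int⇒InHull {S} {r} int γ δ (- lf γ δ (lo γ δ)) (λ s i → proj₂ (proj₂ (lowest γ δ)) s i)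

  lo-min : ∀ γ δ t → t ∈ S → 0≤ (lf γ δ t - lf γ δ (lo γ δ))
  lo-min γ δ = proj₂ (proj₂ (lowest γ δ))

  module _ (α β : ℤ) (indep-min : ∀ γ δ → NonZeroForm γ δ → 0≤ (width γ δ - width α β)) (cop : Coprime ℤ.∣ α ∣ ℤ.∣ β ∣) where

    nonzero-of : ∀ {γ δ} → γ * β - δ * α ≢ + 0 → NonZeroForm γ δ
    nonzero-of {γ} {δ} h (refl , refl) = h (lem α β)
      where
      lem : ∀ α β → + 0 * β - + 0 * α ≡ + 0
      lem = solve-∀

    Minimal : ℤ → ℤ → Set
    Minimal γ δ = ∀ c → Candidate d d≥0 no3 no4 no5 α β c → size d d≥0 no3 no4 no5 α β (γ , δ) ℕ.≤ size d d≥0 no3 no4 no5 α β c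

    -- Dividing a candidate by g ≥ 2 keeps it independent and short on the interior points, yet
    -- lowers its width on `S`.
    candidate-coprime : ∀ γ δ → Candidate d d≥0 no3 no4 no5 α β (γ , δ) → Minimal γ δ → Coprime ℤ.∣ γ ∣ ℤ.∣ δ ∣
    candidate-coprime γ δ (indep , iw) minimal = coprime-form γ δ (nonzero-of indep) λ { g γ' δ' refl refl hg → smaller g γ' δ' indep iw minimal hg }
      where
      smaller : ∀ g γ δ → g * γ * β - g * δ * α ≢ + 0 → IntWidth d d≥0 (g * γ) (g * δ) → Minimal (g * γ) (g * δ) → 0≤ (g - + 2) → ⊥
      smaller g γ δ indep iw minimal hg = width-shrinks g γ δ hg (nonzero-of indep')
          (∣∣-mono⁻ {width (g * γ) (g * δ)} {width γ δ} (width≥0 (g * γ) (g * δ)) (width≥0 γ δ) (minimal (γ , δ) (indep' , iw')))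
        where
        lem : ∀ g γ δ α β → g * γ * β - g * δ * α ≡ g * (γ * β - δ * α)
        lem = solve-∀
        l₁ : ∀ g x y → g * x - g * y ≡ g * (x - y)
        l₁ = solve-∀
        indep' : γ * β - δ * α ≢ + 0
        indep' e = indep (trans (lem g γ δ α β) (trans (cong (g *_) e) (ℤP.*-zeroʳ g)))
        iw' : IntWidth d d≥0 γ δ
        iw' p p' i i' = divided-bound g d (lf γ δ p - lf γ δ p') hg d≥0 (≥0-cong (iw p p' i i')
          (cong (λ z → d - z) (trans (cong₂ _-_ (lf-scale g γ δ p) (lf-scale g γ δ p')) (l₁ g (lf γ δ p) (lf γ δ p')))))

    -- By minimality (α, β) is no wider than (γ, δ), hence of width at most `D` as well. `reduce`
    -- wants a positive index, which the sign of (γ, δ) can provide.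
    small : ∀ D γ δ → γ * β - δ * α ≢ + 0 → 0≤ (D - width γ δ) → FitRows D
    small D γ δ indep h = go (trichotomy (γ * β - δ * α))
      where
      l₁ : ∀ D w w' → D - w + (w - w') ≡ D - w'
      l₁ = solve-∀
      l₂ : ∀ γ δ α β → - (γ * β - δ * α) - + 1 ≡ - γ * β - - δ * α - + 1
      l₂ = solve-∀
      hy : 0≤ (D - width α β)
      hy = ≥0-cong (h ⊕ indep-min γ δ (nonzero-of indep)) (l₁ D (width γ δ) (width α β))
      go : 0≤ (γ * β - δ * α - + 1) ⊎ γ * β - δ * α ≡ + 0 ⊎ 0≤ (- (γ * β - δ * α) - + 1) → FitRows D
      go (inj₁ k) = reduce D α β γ δ cop k hy h
      go (inj₂ (inj₁ e)) = ⊥-elim (indep e)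
      go (inj₂ (inj₂ k)) = reduce D α β (- γ) (- δ) cop (≥0-cong k (l₂ γ δ α β)) hy
        (≥0-cong (h ⊕ width-neg γ δ) (l₁ D (width γ δ) (width (- γ) (- δ))))

    -- If a lowest interior point is less than two levels above the bottom, `gap-arith` finds two
    -- levels at the top. The argument is then run for the negated form, which is again a minimal
    -- candidate.
    large : ∀ γ δ → Candidate d d≥0 no3 no4 no5 α β (γ , δ) → Minimal γ δ → 0≤ (width γ δ - (d + + 3)) → (∃[ p ] Int S p) → ⊥
    large γ δ cand@(indep , iw) minimal big (p₀ , int₀) =
      ¬¬-minimum (Int S) (λ r → ℤ.∣ lf γ δ r - lf γ δ (lo γ δ) ∣) p₀ int₀ λ p intp lowp →
        split p intp (λ r intr → below γ δ r p intr intp (lowp r intr)) (signs (lf γ δ p - lf γ δ (lo γ δ) - + 2))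
      where
      lb : ∀ a b c → a - c - (b - c) ≡ a - b
      lb = solve-∀
      below : ∀ γ δ r p → Int S r → Int S p → ℤ.∣ lf γ δ p - lf γ δ (lo γ δ) ∣ ℕ.≤ ℤ.∣ lf γ δ r - lf γ δ (lo γ δ) ∣ → 0≤ (lf γ δ r - lf γ δ p)
      below γ δ r p intr intp h = ≥0-cong (∣∣-mono⁻ {lf γ δ p - lf γ δ (lo γ δ)} {lf γ δ r - lf γ δ (lo γ δ)} (lf-above-lo γ δ p intp) (lf-above-lo γ δ r intr) h) (lb (lf γ δ r) (lf γ δ p) (lf γ δ (lo γ δ)))
      cand' : Candidate d d≥0 no3 no4 no5 α β (- γ , - δ)
      cand' = (λ e → indep (neg-zero (trans (l₁ γ δ α β) e))) , λ p p' i i' → ≥0-cong (iw p' p i' i)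
          (trans (l₂ d (lf γ δ p') (lf γ δ p)) (cong (λ z → d - z) (cong₂ _-_ (sym (lf-neg γ δ p)) (sym (lf-neg γ δ p')))))
        where
        l₁ : ∀ γ δ α β → - (γ * β - δ * α) ≡ - γ * β - - δ * α
        l₁ = solve-∀
        l₂ : ∀ d a b → d - (a - b) ≡ d - (- b - - a)
        l₂ = solve-∀
      minimal' : Minimal (- γ) (- δ)
      minimal' c hc = ℕP.≤-trans (∣∣-mono {width (- γ) (- δ)} {width γ δ} (width≥0 (- γ) (- δ)) (width≥0 γ δ) (width-neg γ δ)) (minimal c hc)
      big' : 0≤ (width (- γ) (- δ) - (d + + 3))
      big' = ≥0-cong (big ⊕ subst₂ (λ u v → 0≤ (width (- γ) (- δ) - width u v)) (ℤP.neg-involutive γ) (ℤP.neg-involutive δ) (width-neg (- γ) (- δ)))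
          (l₁ (width γ δ) (width (- γ) (- δ)) (d + + 3))
        where
        l₁ : ∀ w w' t → w - t + (w' - w) ≡ w' - t
        l₁ = solve-∀
      cop' : Coprime ℤ.∣ - γ ∣ ℤ.∣ - δ ∣
      cop' = subst₂ Coprime (sym (ℤP.∣-i∣≡∣i∣ γ)) (sym (ℤP.∣-i∣≡∣i∣ δ)) (candidate-coprime γ δ cand minimal)
      gap' : ∀ p p' → Int S p → Int S p' → 0≤ (- (lf γ δ p - lf γ δ (lo γ δ) - + 2) - + 1) → 0≤ (lf (- γ) (- δ) p' - lf (- γ) (- δ) (lo (- γ) (- δ)) - + 2)
      gap' p p' intp intp' h = gap-arith (lf γ δ p) (lf γ δ p') (lf γ δ (lo γ δ)) (lf γ δ (hi γ δ)) (width γ δ) d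
          (lf (- γ) (- δ) (hi γ δ)) (lf (- γ) (- δ) p') (lf (- γ) (- δ) (lo (- γ) (- δ)))
          (width-attained γ δ) (lf-neg γ δ (hi γ δ)) (lf-neg γ δ p') h big (iw p' p intp' intp)
          (lo-min (- γ) (- δ) (hi γ δ) (hi∈ γ δ))
      split : ∀ p → Int S p → (∀ r → Int S r → 0≤ (lf γ δ r - lf γ δ p)) →
        0≤ (lf γ δ p - lf γ δ (lo γ δ) - + 2) ⊎ 0≤ (- (lf γ δ p - lf γ δ (lo γ δ) - + 2) - + 1) → ⊥
      split p intp lowp (inj₁ gap) = bottom d d≥0 no3 no4 no5 α β γ δ (candidate-coprime γ δ cand minimal) cand minimal big p intp lowp gap
      split p intp lowp (inj₂ nogap) =
        ¬¬-minimum (Int S) (λ r → ℤ.∣ lf (- γ) (- δ) r - lf (- γ) (- δ) (lo (- γ) (- δ)) ∣) p₀ int₀ λ p' intp' lowp' →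
          bottom d d≥0 no3 no4 no5 α β (- γ) (- δ) cop' cand' minimal' big' p' intp'
            (λ r intr → below (- γ) (- δ) r p' intr intp' (lowp' r intr)) (gap' p p' intp intp' nogap)

  -- The two rows of `φ` are short on the interior points and at least one is independent of (α, β),
  -- so candidates exist. A minimal candidate is either short enough for `small` or excluded by
  -- `large`.
  main : ∀ φ → let open Unimodular φ renaming (d to d') in
    IntWidth d d≥0 a b → IntWidth d d≥0 c d' → (∃[ p ] Int S p) → ¬ FitRows (d + + 2) → ⊥
  main φ iw₁ iw₂ hasInt ¬fit = ¬¬-minimum (λ y → NonZeroForm (proj₁ y) (proj₂ y)) (λ y → ℤ.∣ width (proj₁ y) (proj₂ y) ∣) (+ 1 , + 0) (λ ())
      λ { (α , β) nz minimal → outer α β nz (λ γ δ nz' → ∣∣-mono⁻ {width α β} {width γ δ} (width≥0 α β) (width≥0 γ δ) (minimal (γ , δ) nz')) }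
    where
    open Unimodular φ renaming (d to d')
    outer : ∀ α β → NonZeroForm α β → (∀ γ δ → NonZeroForm γ δ → 0≤ (width γ δ - width α β)) → ⊥
    outer α β nz minimal = start (zero? (a * β - b * α))
      where
      cop : Coprime ℤ.∣ α ∣ ℤ.∣ β ∣
      cop = minimal-coprime S two α β nz minimal
      inner : ∀ γ δ → Candidate d d≥0 no3 no4 no5 α β (γ , δ) → ⊥
      inner γ δ cand = ¬¬-minimum (Candidate d d≥0 no3 no4 no5 α β) (size d d≥0 no3 no4 no5 α β) (γ , δ) cand
          λ { (γ , δ) cand min → finish γ δ cand min (signs (d + + 2 - width γ δ)) }
        where
        l₁ : ∀ d w → - (d + + 2 - w) - + 1 ≡ w - (d + + 3)
        l₁ = solve-∀
        finish : ∀ γ δ → Candidate d d≥0 no3 no4 no5 α β (γ , δ) → Minimal α β minimal cop γ δ → 0≤ (d + + 2 - width γ δ) ⊎ 0≤ (- (d + + 2 - width γ δ) - + 1) → ⊥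
        finish γ δ cand min (inj₁ h) = ¬fit (small α β minimal cop (d + + 2) γ δ (proj₁ cand) h)
        finish γ δ cand min (inj₂ h) = large α β minimal cop γ δ cand min (≥0-cong h (l₁ d (width γ δ))) hasInt
      start : Dec (a * β - b * α ≡ + 0) → ⊥
      start (no ind) = inner a b (ind , iw₁)
      -- Were both rows dependent on (α, β), the vector (β, -α) would lie in the kernel of `φ`.
      start (yes dep) = inner c d' ((λ dep' → nz (proj₂ (both dep dep') , proj₁ (both dep dep'))) , iw₂)
        where
        l₁ : ∀ a b α β → a * β - b * α ≡ a * β + b * - α
        l₁ = solve-∀
        both : a * β - b * α ≡ + 0 → c * β - d' * α ≡ + 0 → β ≡ + 0 × α ≡ + 0
        both e₁ e₂ = go (kernel φ β (- α) (trans (sym (l₁ a b α β)) e₁) (trans (sym (l₁ c d' α β)) e₂))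
          where
          go : β ≡ + 0 × - α ≡ + 0 → β ≡ + 0 × α ≡ + 0
          go (e , e') = e , neg-zero e'

-- Polygons without interior lattice points

compose∈ : ∀ ρ φ {S q} → q ∈ map (act φ) S → act ρ q ∈ map (act (compose ρ φ)) S
compose∈ ρ φ {S} {q} i = subst (act ρ q ∈_) (sym (map-compose ρ φ S)) (∈-map⁺ (act ρ) i)

compose∀ : ∀ ρ φ {S} (Q : Point → Set) → (∀ q → q ∈ map (act φ) S → Q (act ρ q)) → ∀ q → q ∈ map (act (compose ρ φ)) S → Q q
compose∀ ρ φ {S} Q h q i = ∀∈map ρ Q h q (subst (q ∈_) (map-compose ρ φ S) i)

-- If H = 2 this is 2Σ; for H ≥ 3 the point (1 , 1) would be interior.
full-simplex : ∀ S ψ H → let T = map (act ψ) S in InSimplex H T → 0≤ (H - + 2) →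
  (+ 0 , + 0) ∈ T → (H , + 0) ∈ T → (+ 0 , H) ∈ T → (∀ r → ¬ Int T r) → ¬ Case2 (Poly S) → ⊥
full-simplex S ψ H simplex H≥2 o e q noInt no2 = go (trichotomy (H - + 2))
  where
  T = map (act ψ) S
  two : InSimplex (+ 2) T → (+ 2 , + 0) ∈ T → (+ 0 , + 2) ∈ T → Case2 (Poly S)
  two simplex e q = ≃-at ψ (λ { p@(x , y) i → triangle-hull (+ 2) (+ 2) x y nat≥0 nat≥0
      (here refl) (there (here refl)) (there (there (here refl)))
      (proj₁ (simplex p i)) (proj₁ (proj₂ (simplex p i))) (≥0-cong (nat≥0 {2} ⊗ proj₂ (proj₂ (simplex p i))) (lem x y)) })
      (all₃ o e q)
    where
    lem : ∀ x y → + 2 * (+ 2 - x - y) ≡ + 2 * + 2 - + 2 * x - + 2 * y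
    lem = solve-∀
  l₀ : ∀ H → H - + 2 + + 1 ≡ H - + 1
  l₀ = solve-∀
  l₁ : ∀ H → (H - + 1) * (H - + 1) + (H - + 1) + (H - + 1) ≡ (H - + 0) * (H - + 0) - (+ 0 - + 0) * (+ 0 - + 0) - + 1
  l₁ = solve-∀
  l₂ : ∀ H → (H - + 2) * + 0 + + 1 * H + + 1 * + 0 ≡ (H - + 2 + + 1 + + 1) * + 1
  l₂ = solve-∀
  l₃ : ∀ H → (H - + 2) * + 0 + + 1 * + 0 + + 1 * H ≡ (H - + 2 + + 1 + + 1) * + 1
  l₃ = solve-∀
  go : 0≤ (H - + 2 - + 1) ⊎ H - + 2 ≡ + 0 ⊎ 0≤ (- (H - + 2) - + 1) → ⊥
  go (inj₁ h) = noInt (+ 1 , + 1) (Int-triangle {T} {+ 0 , + 0} {H , + 0} {+ 0 , H} {+ 1 , + 1} (H - + 2) (+ 1) (+ 1)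
    (∈⇒InHull o) (∈⇒InHull e) (∈⇒InHull q) (pos⇒≢0 (≥0-cong (H≥1 ⊗ H≥1 ⊕ H≥1 ⊕ H≥1) (l₁ H))) h nat≥0 nat≥0 (combination (l₂ H) (l₃ H)))
    where
    H≥1 = ≥0-cong (H≥2 ⊕ nat≥0 {1}) (l₀ H)
  go (inj₂ (inj₁ e')) = no2 (two (subst (λ h → InSimplex h T) H≡2 simplex) (subst (λ h → (h , + 0) ∈ T) H≡2 e) (subst (λ h → (+ 0 , h) ∈ T) H≡2 q))
    where
    H≡2 : H ≡ + 2
    H≡2 = ℤP.i-j≡0⇒i≡j H (+ 2) e'
  go (inj₂ (inj₂ h)) = clash H≥2 h

-- `shear` carries the triangle 0 ≤ x ≤ y ≤ H to HΣ; `flip` carries the triangle (-2, 0), (0, 0),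
-- (2, 2) to 2Σ.
shear flip : Unimodular
shear = record { a = + 1 ; b = + 0 ; c = -[1+ 0 ] ; d = + 1 ; e = + 0 ; f = + 0 ; unimod = inj₁ refl }
flip = record { a = + 0 ; b = + 1 ; c = -[1+ 0 ] ; d = + 1 ; e = + 0 ; f = + 0 ; unimod = inj₁ refl }

shear-eq : ∀ x y → act shear (x , y) ≡ (x , y - x)
shear-eq x y = cong₂ _,_ (l₁ x y) (l₂ x y)
  where
  l₁ : ∀ x y → + 1 * x + + 0 * y + + 0 ≡ x
  l₁ = solve-∀
  l₂ : ∀ x y → -[1+ 0 ] * x + + 1 * y + + 0 ≡ y - x
  l₂ = solve-∀

flip-eq : ∀ x y → act flip (x , y) ≡ (y , y - x)
flip-eq x y = cong₂ _,_ (l₁ x y) (l₂ x y)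
  where
  l₁ : ∀ x y → + 0 * x + + 1 * y + + 0 ≡ y
  l₁ = solve-∀
  l₂ : ∀ x y → -[1+ 0 ] * x + + 1 * y + + 0 ≡ y - x
  l₂ = solve-∀

Wide : List Point → ℤ → Set
Wide T H = ∀ α β → NonZeroForm α β → ∃[ s ] ∃[ t ] (s ∈ T × t ∈ T × 0≤ (lf α β s - lf α β t - H))

-- A line through (1 , 1) supporting the five points would be trivial.
no-support : ∀ α β j x₀ y₀ x s t H → 0≤ (y₀ - + 1) → 0≤ ((j + + 1) * y₀ - (x₀ + j) - + 1) → 0≤ (s - + 1) → 0≤ (x - s - + 1) → 0≤ (H - + 2) →
  0≤ (α * + 0 + β * + 0 + - (α * + 1 + β * + 1)) → 0≤ (α * - j + β * + 0 + - (α * + 1 + β * + 1)) →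
  0≤ (α * x₀ + β * y₀ + - (α * + 1 + β * + 1)) → 0≤ (α * x + β * s + - (α * + 1 + β * + 1)) →
  0≤ (α * t + β * H + - (α * + 1 + β * + 1)) → α ≡ + 0 × β ≡ + 0
no-support α β j x₀ y₀ x s t H hy₀ hm hs hx hH ho hv hq₀ hq ht = α≡0 , ≥0-antisym β≥0 β≤0
  where
  l₁ : ∀ α β j x₀ y₀ → (y₀ - + 1) * (α * - j + β * + 0 + - (α * + 1 + β * + 1)) + (α * x₀ + β * y₀ + - (α * + 1 + β * + 1)) + ((j + + 1) * y₀ - (x₀ + j) - + 1)
    ≡ ((j + + 1) * y₀ - (x₀ + j)) * - α + ((j + + 1) * y₀ - (x₀ + j)) - + 1
  l₁ = solve-∀
  l₂ : ∀ α β x s → (s - + 1) * (α * + 0 + β * + 0 + - (α * + 1 + β * + 1)) + (α * x + β * s + - (α * + 1 + β * + 1)) + (x - s - + 1) ≡ (x - s) * α + (x - s) - + 1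
  l₂ = solve-∀
  α≡0 : α ≡ + 0
  α≡0 = ≥0-antisym (≥0-cancel (x - s) α hx (≥0-cong (hs ⊗ ho ⊕ hq ⊕ hx) (l₂ α β x s)))
    (≥0-cancel ((j + + 1) * y₀ - (x₀ + j)) (- α) hm (≥0-cong (hy₀ ⊗ hv ⊕ hq₀ ⊕ hm) (l₁ α β j x₀ y₀)))
  l₃ : ∀ α β → α * + 0 + β * + 0 + - (α * + 1 + β * + 1) ≡ - β - α
  l₃ = solve-∀
  l₄ : ∀ β → - β - + 0 ≡ - β
  l₄ = solve-∀
  β≤0 : 0≤ (- β)
  β≤0 = ≥0-cong ho (trans (l₃ α β) (trans (cong (λ a → - β - a) α≡0) (l₄ β)))
  l₅ : ∀ α β t H → α * t + β * H + - (α * + 1 + β * + 1) + (H - + 2) ≡ (H - + 1) * β + (H - + 1) - + 1 + α * (t - + 1)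
  l₅ = solve-∀
  l₆ : ∀ u v → u + + 0 * v ≡ u
  l₆ = solve-∀
  l₇ : ∀ H → H - + 2 ≡ H - + 1 - + 1
  l₇ = solve-∀
  β≥0 : 0≤ β
  β≥0 = ≥0-cancel (H - + 1) β (≥0-cong hH (l₇ H)) (≥0-cong (ht ⊕ hH)
    (trans (l₅ α β t H) (trans (cong (λ a → (H - + 1) * β + (H - + 1) - + 1 + a * (t - + 1)) α≡0) (l₆ ((H - + 1) * β + (H - + 1) - + 1) (t - + 1)))))

-- For j = 1 the polygon of `tall` lies in the strip 0 ≤ y - x ≤ 1, so the form y - x is narrower
-- than the minimal width H ≥ 2.
narrow-strip : ∀ x₁ y₁ x₂ y₂ H → 0≤ (-[1+ 0 ] * x₁ + + 1 * y₁ - (-[1+ 0 ] * x₂ + + 1 * y₂) - H) → 0≤ (y₂ - x₂) → 0≤ (x₁ + + 1 - + 1 * y₁) → 0≤ (H - + 2) → ⊥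
narrow-strip x₁ y₁ x₂ y₂ H h₁ h₂ h₃ h₄ = absurd (h₁ ⊕ h₂ ⊕ h₃ ⊕ h₄) (l₁ x₁ y₁ x₂ y₂ H)
  where
  l₁ : ∀ x₁ y₁ x₂ y₂ H → -[1+ 0 ] * x₁ + + 1 * y₁ - (-[1+ 0 ] * x₂ + + 1 * y₂) - H + (y₂ - x₂) + (x₁ + + 1 - + 1 * y₁) + (H - + 2) ≡ -[1+ 0 ]
  l₁ = solve-∀

-- Lattice-free polygons of lattice width at least 2, normalised: the lowest edge is [−j , 0] × {0}
-- and the section at height 1 lies in [0 , 1] × {1}.
tall : ∀ S φ j H x₀ y₀ t → let T = map (act φ) S in 0≤ (H - + 2) → 0≤ j →
  (+ 0 , + 0) ∈ T → (- j , + 0) ∈ T → (x₀ , y₀) ∈ T → 0≤ (y₀ - + 1) → 0≤ ((j + + 1) * y₀ - (x₀ + j) - + 1) → (t , H) ∈ T →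
  (∀ q → q ∈ T → 0≤ proj₂ q × 0≤ (H - proj₂ q)) →
  (∀ q → q ∈ T → 0≤ (proj₂ q - + 1) → 0≤ (proj₁ q + j - j * proj₂ q)) →
  (∀ q → q ∈ T → proj₂ q ≡ + 0 → 0≤ (proj₁ q + j) × 0≤ (- proj₁ q)) →
  Wide T H → (∀ φ r → ¬ Int (map (act φ) S) r) → ¬ Case2 (Poly S) → ⊥
tall S φ j H x₀ y₀ t H≥2 j≥0 o v' q₀ hy₀ hm top levels left bottom wide noInt no2 = cases (trichotomy j) (trichotomy (j - + 1))
  where
  T = map (act φ) S
  below-diagonal : ∀ q → q ∈ T → 0≤ (proj₂ q - proj₁ q)
  below-diagonal (x , s) i = go (trichotomy s)
    where
    l₁ : ∀ x s → - (s - x) - + 1 ≡ x - s - + 1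
    l₁ = solve-∀
    l₂ : ∀ x → - x ≡ + 0 - x
    l₂ = solve-∀
    go : 0≤ (s - + 1) ⊎ s ≡ + 0 ⊎ 0≤ (- s - + 1) → 0≤ (s - x)
    go (inj₁ hs) = by-contradiction (s - x) λ k → noInt φ (+ 1 , + 1) (Int-refute T (+ 1 , + 1) λ α β nz all →
      nz (no-support α β j x₀ y₀ x s t H hy₀ hm hs (≥0-cong k (l₁ x s)) H≥2 (all _ o) (all _ v') (all _ q₀) (all _ i) (all _ top)))
    go (inj₂ (inj₁ e)) = ≥0-cong (proj₂ (bottom _ i e)) (trans (l₂ x) (cong (_- x) (sym e)))
    go (inj₂ (inj₂ h)) = ⊥-elim (clash (proj₁ (levels _ i)) h)
  left≥ : ∀ k → 0≤ (j - k) → 0≤ (k - j) → ∀ q → q ∈ T → 0≤ (proj₁ q + k - k * proj₂ q)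
  left≥ k h h' q@(x , y) i = subst (λ k → 0≤ (x + k - k * y)) (≥0-≡ h h') (go (trichotomy y))
    where
    l₁ : ∀ x j → x + j ≡ x + j - j * + 0
    l₁ = solve-∀
    go : 0≤ (y - + 1) ⊎ y ≡ + 0 ⊎ 0≤ (- y - + 1) → 0≤ (x + j - j * y)
    go (inj₁ hy) = left q i hy
    go (inj₂ (inj₁ e)) = ≥0-cong (proj₁ (bottom q i e)) (trans (l₁ x j) (cong (λ z → x + j - j * z) (sym e)))
    go (inj₂ (inj₂ h)) = ⊥-elim (clash (proj₁ (levels _ i)) h)
  -- The polygon lies in 0 ≤ x ≤ y ≤ H. Since x and y - x have width at least H, the vertices (H, H)
  -- and (0, H) occur, and `shear` turns the polygon into HΣ.
  case-0 : j ≡ + 0 → ⊥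
  case-0 refl = go (wide (+ 1) (+ 0) (λ ())) (wide -[1+ 0 ] (+ 1) (λ ()))
    where
    ψ = compose shear φ
    x≥0 : ∀ q → q ∈ T → 0≤ proj₁ q
    x≥0 q@(x , y) i = ≥0-cong (left≥ (+ 0) nat≥0 nat≥0 q i) (lem x y)
      where
      lem : ∀ x y → x + + 0 - + 0 * y ≡ x
      lem = solve-∀
    simplex : InSimplex H (map (act ψ) S)
    simplex = compose∀ shear φ (λ q → 0≤ proj₁ q × 0≤ proj₂ q × 0≤ (H - proj₁ q - proj₂ q))
      λ { q@(x , y) i → subst (λ q → 0≤ proj₁ q × 0≤ proj₂ q × 0≤ (H - proj₁ q - proj₂ q)) (sym (shear-eq x y))
        (x≥0 q i , below-diagonal q i , ≥0-cong (proj₂ (levels q i)) (lem H x y)) }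
      where
      lem : ∀ H x y → H - y ≡ H - x - (y - x)
      lem = solve-∀
    go : ∃[ s ] ∃[ t ] (s ∈ T × t ∈ T × 0≤ (lf (+ 1) (+ 0) s - lf (+ 1) (+ 0) t - H)) →
         ∃[ s ] ∃[ t ] (s ∈ T × t ∈ T × 0≤ (lf -[1+ 0 ] (+ 1) s - lf -[1+ 0 ] (+ 1) t - H)) → ⊥
    go ((x₁ , y₁) , (x₂ , y₂) , i₁ , i₂ , h) ((x₃ , y₃) , (x₄ , y₄) , i₃ , i₄ , h') =
        full-simplex S ψ H simplex H≥2 (at (compose∈ shear φ o) refl) (at (compose∈ shear φ i₁) c₁) (at (compose∈ shear φ i₃) c₂) (noInt ψ) no2
      where
      at : ∀ {p q} → p ∈ map (act ψ) S → p ≡ q → q ∈ map (act ψ) S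
      at i refl = i
      l₁ : ∀ H x₁ y₁ x₂ y₂ → + 1 * x₁ + + 0 * y₁ - (+ 1 * x₂ + + 0 * y₂) - H + x₂ ≡ x₁ - H
      l₁ = solve-∀
      l₂ : ∀ H x y → H - y + (y - x) ≡ H - x
      l₂ = solve-∀
      l₃ : ∀ H x y → H - y + (x - H) ≡ - (y - x)
      l₃ = solve-∀
      x₁≥H : 0≤ (x₁ - H)
      x₁≥H = ≥0-cong (h ⊕ x≥0 _ i₂) (l₁ H x₁ y₁ x₂ y₂)
      c₁ : act shear (x₁ , y₁) ≡ (H , + 0)
      c₁ = trans (shear-eq x₁ y₁) (cong₂ _,_ (≥0-≡ x₁≥H (≥0-cong (proj₂ (levels _ i₁) ⊕ below-diagonal _ i₁) (l₂ H x₁ y₁)))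
        (≥0-antisym (below-diagonal _ i₁) (≥0-cong (proj₂ (levels _ i₁) ⊕ x₁≥H) (l₃ H x₁ y₁))))
      l₄ : ∀ H x₃ y₃ x₄ y₄ → -[1+ 0 ] * x₃ + + 1 * y₃ - (-[1+ 0 ] * x₄ + + 1 * y₄) - H + (y₄ - x₄) ≡ y₃ - x₃ - H
      l₄ = solve-∀
      l₅ : ∀ H x y → H - y + (y - x - H) ≡ - x
      l₅ = solve-∀
      l₆ : ∀ H x y → H - y + x ≡ H - (y - x)
      l₆ = solve-∀
      z₃≥H : 0≤ (y₃ - x₃ - H)
      z₃≥H = ≥0-cong (h' ⊕ below-diagonal _ i₄) (l₄ H x₃ y₃ x₄ y₄)
      c₂ : act shear (x₃ , y₃) ≡ (+ 0 , H)
      c₂ = trans (shear-eq x₃ y₃) (cong₂ _,_ (≥0-antisym (x≥0 _ i₃) (≥0-cong (proj₂ (levels _ i₃) ⊕ z₃≥H) (l₅ H x₃ y₃)))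
        (≥0-≡ z₃≥H (≥0-cong (proj₂ (levels _ i₃) ⊕ x≥0 _ i₃) (l₆ H x₃ y₃))))
  case-1 : j - + 1 ≡ + 0 → ⊥
  case-1 e = go (wide -[1+ 0 ] (+ 1) (λ ()))
    where
    l₃ : ∀ j → - (j - + 1) ≡ + 1 - j
    l₃ = solve-∀
    go : ∃[ s ] ∃[ t ] (s ∈ T × t ∈ T × 0≤ (lf -[1+ 0 ] (+ 1) s - lf -[1+ 0 ] (+ 1) t - H)) → ⊥
    go ((x₁ , y₁) , (x₂ , y₂) , i₁ , i₂ , h) = narrow-strip x₁ y₁ x₂ y₂ H h (below-diagonal (x₂ , y₂) i₂)
      (left≥ (+ 1) (≡⇒≥0 e) (≥0-cong (≡⇒≥0 (cong -_ e)) (l₃ j)) (x₁ , y₁) i₁) H≥2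
  -- The top point satisfies j(H - 1) ≤ t ≤ H, which for j, H ≥ 2 leaves only j = H = t = 2.
  case-2 : 0≤ (j - + 1 - + 1) → ⊥
  case-2 j≥2 = full-simplex S ψ (+ 2) simplex nat≥0 (at (compose∈ flip φ o) refl)
      (at (compose∈ flip φ top) (trans (flip-eq t H) (cong₂ _,_ H≡2 (trans (cong₂ _-_ H≡2 t≡2) refl))))
      (at (compose∈ flip φ v') (trans (flip-eq (- j) (+ 0)) (cong (λ z → + 0 , + 0 - - z) j≡2))) (noInt ψ) no2
    where
    ψ = compose flip φ
    at : ∀ {p q} → p ∈ map (act ψ) S → p ≡ q → q ∈ map (act ψ) S
    at i refl = i
    l₀ : ∀ H → H - + 2 + + 1 ≡ H - + 1
    l₀ = solve-∀
    l₁ : ∀ j H t → t + j - j * H + (H - t) + (j - + 1 - + 1) * (H - + 2) + (j - + 1 - + 1) ≡ + 2 - H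
    l₁ = solve-∀
    l₂ : ∀ j H t → t + j - j * H + (H - t) + (j - + 1 - + 1) * (H - + 2) + (H - + 2) ≡ + 2 - j
    l₂ = solve-∀
    l₃ : ∀ j → j - + 1 - + 1 ≡ j - + 2
    l₃ = solve-∀
    tl : 0≤ (t + j - j * H)
    tl = left _ top (≥0-cong (H≥2 ⊕ nat≥0 {1}) (l₀ H))
    H≡2 : H ≡ + 2
    H≡2 = ≥0-≡ H≥2 (≥0-cong (tl ⊕ below-diagonal _ top ⊕ j≥2 ⊗ H≥2 ⊕ j≥2) (l₁ j H t))
    j≡2 : j ≡ + 2
    j≡2 = ≥0-≡ (≥0-cong j≥2 (l₃ j)) (≥0-cong (tl ⊕ below-diagonal _ top ⊕ j≥2 ⊗ H≥2 ⊕ H≥2) (l₂ j H t))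
    l₄ : ∀ t → t + + 2 - + 2 * + 2 ≡ t - + 2
    l₄ = solve-∀
    t≡2 : t ≡ + 2
    t≡2 = ≥0-≡ (≥0-cong tl (trans (cong₂ (λ j H → t + j - j * H) j≡2 H≡2) (l₄ t)))
      (≥0-cong (below-diagonal _ top) (cong (_- t) H≡2))
    simplex : InSimplex (+ 2) (map (act ψ) S)
    simplex = compose∀ flip φ (λ q → 0≤ proj₁ q × 0≤ proj₂ q × 0≤ (+ 2 - proj₁ q - proj₂ q))
      λ { q@(x , y) i → subst (λ q → 0≤ proj₁ q × 0≤ proj₂ q × 0≤ (+ 2 - proj₁ q - proj₂ q)) (sym (flip-eq x y))
        (proj₁ (levels q i) , below-diagonal q i , ≥0-cong (left≥ (+ 2) (≥0-cong j≥2 (l₃ j)) (≡⇒≥0 (trans (cong (λ z → + 2 - z) j≡2) refl)) q i) (lem x y)) }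
      where
      lem : ∀ x y → x + + 2 - + 2 * y ≡ + 2 - y - (y - x)
      lem = solve-∀
  cases : 0≤ (j - + 1) ⊎ j ≡ + 0 ⊎ 0≤ (- j - + 1) → 0≤ (j - + 1 - + 1) ⊎ j - + 1 ≡ + 0 ⊎ 0≤ (- (j - + 1) - + 1) → ⊥
  cases (inj₂ (inj₁ e)) _ = case-0 e
  cases (inj₂ (inj₂ h)) _ = clash j≥0 h
  cases (inj₁ _) (inj₁ h) = case-2 h
  cases (inj₁ _) (inj₂ (inj₁ e)) = case-1 e
  cases (inj₁ k) (inj₂ (inj₂ h)) = clash k h

fit-box : ∀ S two φ D → (∀ s → s ∈ S → InBox D (act φ s)) → Main.FitRows S two D
fit-box S two φ D h = a , b , c , d , unimod ,
    bound a b e (λ s i → proj₁ (h s i)) (λ s i → proj₁ (proj₂ (h s i))) ,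
    bound c d f (λ s i → proj₁ (proj₂ (proj₂ (h s i)))) (λ s i → proj₂ (proj₂ (proj₂ (h s i))))
  where
  open Unimodular φ
  open Width S two
  lem : ∀ D s t e → D - (s + e) + (t + e) ≡ D - (s - t)
  lem = solve-∀
  bound : ∀ α β ε → (∀ s → s ∈ S → 0≤ aff α β ε s) → (∀ s → s ∈ S → 0≤ (D - aff α β ε s)) → 0≤ (D - width α β)
  bound α β ε l u = ≥0-cong (u (hi α β) (hi∈ α β) ⊕ l (lo α β) (lo∈ α β))
    (trans (lem D (lf α β (hi α β)) (lf α β (lo α β)) ε) (cong (λ w → D - w) (sym (width-attained α β))))

skew : ℤ → ℤ → Unimodular
skew p q = record { a = + 1 ; b = - q ; c = + 0 ; d = + 1 ; e = - p ; f = + 0 ; unimod = inj₁ (lem q) }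
  where
  lem : ∀ q → + 1 * + 1 - - q * + 0 ≡ + 1
  lem = solve-∀

skew-eq : ∀ p q x y → act (skew p q) (x , y) ≡ (x - p - q * y , y)
skew-eq p q x y = cong₂ _,_ (l₁ p q x y) (l₂ x y)
  where
  l₁ : ∀ p q x y → + 1 * x + - q * y + - p ≡ x - p - q * y
  l₁ = solve-∀
  l₂ : ∀ x y → + 0 * x + + 1 * y + + 0 ≡ y
  l₂ = solve-∀

NoCase1 : List Point → Set
NoCase1 S = (a b : ℕ) → ¬ Case1 (Poly S) a b

OnLevel : ℤ → ℤ → ℤ → Point → Set
OnLevel h l r q = proj₂ q ≡ h × 0≤ (proj₁ q - l) × 0≤ (r - proj₁ q)

segment-hull : ∀ {P : Point → Set} a x y → 0≤ x → 0≤ (a - x) → P (+ 0 , y) → P (a , y) → Conv P (ι (x , y))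
segment-hull {P} a x y hx hax p₀ p₁ = go (trichotomy a)
  where
  l₁ : ∀ a x → a - + 1 ≡ a - x + x + + 0 - + 1
  l₁ = solve-∀
  l₂ : ∀ a x → (a - x) * + 0 + x * a + + 0 * + 0 ≡ (a - x + x + + 0) * x
  l₂ = solve-∀
  l₃ : ∀ a x y → (a - x) * y + x * y + + 0 * y ≡ (a - x + x + + 0) * y
  l₃ = solve-∀
  l₄ : ∀ x → + 0 - x ≡ - x
  l₄ = solve-∀
  go : 0≤ (a - + 1) ⊎ a ≡ + 0 ⊎ 0≤ (- a - + 1) → Conv P (ι (x , y))
  go (inj₁ h) = combine {P} {+ 0 , y} {a , y} {+ 0 , y} {x , y} (a - x) x (+ 0) p₀ p₁ p₀ hax hx nat≥0 (≥0-cong h (l₁ a x)) (l₂ a x) (l₃ a x y)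
  go (inj₂ (inj₁ e)) = subst (λ z → Conv P (ι (z , y))) (sym (≥0-antisym hx (≥0-cong hax (trans (cong (_- x) e) (l₄ x))))) (hull-generator (+ 0 , y) p₀)
  go (inj₂ (inj₂ h)) = ⊥-elim (absurd (h ⊕ hax ⊕ hx) (lem a x))
    where
    lem : ∀ a x → - a - + 1 + (a - x) + x ≡ -[1+ 0 ]
    lem = solve-∀

-- A skew map moves the left ends of both rows to x = 0 and preserves heights. If the lower row, the
-- longer one, has length at least 2, the result is `Case1`; otherwise both rows fit into □.
strip : ∀ S two φ l₀ r₀ l₁ r₁ → let T = map (act φ) S in
  (l₀ , + 0) ∈ T → (r₀ , + 0) ∈ T → (l₁ , + 1) ∈ T → (r₁ , + 1) ∈ T →
  (∀ q → q ∈ T → OnLevel (+ 0) l₀ r₀ q ⊎ OnLevel (+ 1) l₁ r₁ q) →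
  0≤ (r₀ - l₀ - (r₁ - l₁)) → NoCase1 S → ¬ Main.FitRows S two (+ 1) → ⊥
strip S two φ l₀ r₀ l₁ r₁ i₀ j₀ i₁ j₁ levels wider no1 nofit = go (signs (a - + 2))
  where
  a = r₀ - l₀
  b = r₁ - l₁
  ρ = skew l₀ (l₁ - l₀)
  ψ = compose ρ φ
  T' = map (act ψ) S
  Position : Point → Set
  Position q = (proj₂ q ≡ + 0 × 0≤ proj₁ q × 0≤ (a - proj₁ q)) ⊎ (proj₂ q ≡ + 1 × 0≤ proj₁ q × 0≤ (b - proj₁ q))
  at : ∀ {p q} → p ∈ T' → p ≡ q → q ∈ T'
  at i refl = i
  m₁ : ∀ l₀ l₁ → l₀ - l₀ - (l₁ - l₀) * + 0 ≡ + 0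
  m₁ = solve-∀
  m₂ : ∀ r₀ l₀ l₁ → r₀ - l₀ - (l₁ - l₀) * + 0 ≡ r₀ - l₀
  m₂ = solve-∀
  m₃ : ∀ l₀ l₁ → l₁ - l₀ - (l₁ - l₀) * + 1 ≡ + 0
  m₃ = solve-∀
  m₄ : ∀ r₁ l₀ l₁ → r₁ - l₀ - (l₁ - l₀) * + 1 ≡ r₁ - l₁
  m₄ = solve-∀
  c₀₀ : (+ 0 , + 0) ∈ T'
  c₀₀ = at (compose∈ ρ φ i₀) (trans (skew-eq l₀ (l₁ - l₀) l₀ (+ 0)) (cong (_, + 0) (m₁ l₀ l₁)))
  ca₀ : (a , + 0) ∈ T'
  ca₀ = at (compose∈ ρ φ j₀) (trans (skew-eq l₀ (l₁ - l₀) r₀ (+ 0)) (cong (_, + 0) (m₂ r₀ l₀ l₁)))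
  c₀₁ : (+ 0 , + 1) ∈ T'
  c₀₁ = at (compose∈ ρ φ i₁) (trans (skew-eq l₀ (l₁ - l₀) l₁ (+ 1)) (cong (_, + 1) (m₃ l₀ l₁)))
  cb₁ : (b , + 1) ∈ T'
  cb₁ = at (compose∈ ρ φ j₁) (trans (skew-eq l₀ (l₁ - l₀) r₁ (+ 1)) (cong (_, + 1) (m₄ r₁ l₀ l₁)))
  n₁ : ∀ x l₀ l₁ → x - l₀ ≡ x - l₀ - (l₁ - l₀) * + 0
  n₁ = solve-∀
  n₂ : ∀ x l₀ l₁ r₀ → r₀ - x ≡ r₀ - l₀ - (x - l₀ - (l₁ - l₀) * + 0)
  n₂ = solve-∀
  n₃ : ∀ x l₀ l₁ → x - l₁ ≡ x - l₀ - (l₁ - l₀) * + 1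
  n₃ = solve-∀
  n₄ : ∀ x l₀ l₁ r₁ → r₁ - x ≡ r₁ - l₁ - (x - l₀ - (l₁ - l₀) * + 1)
  n₄ = solve-∀
  position : ∀ q → q ∈ T' → Position q
  position = compose∀ ρ φ Position λ { (x , y) i → subst Position (sym (skew-eq l₀ (l₁ - l₀) x y)) (from x y (levels _ i)) }
    where
    from : ∀ x y → OnLevel (+ 0) l₀ r₀ (x , y) ⊎ OnLevel (+ 1) l₁ r₁ (x , y) → Position (x - l₀ - (l₁ - l₀) * y , y)
    from x y (inj₁ (refl , h , k)) = inj₁ (refl , ≥0-cong h (n₁ x l₀ l₁) , ≥0-cong k (n₂ x l₀ l₁ r₀))
    from x y (inj₂ (refl , h , k)) = inj₂ (refl , ≥0-cong h (n₃ x l₀ l₁) , ≥0-cong k (n₄ x l₀ l₁ r₁))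
  b≥0 : 0≤ b
  b≥0 = from (position _ cb₁)
    where
    from : Position (b , + 1) → 0≤ b
    from (inj₁ (() , _))
    from (inj₂ (_ , h , _)) = h
  go : 0≤ (a - + 2) ⊎ 0≤ (- (a - + 2) - + 1) → ⊥
  go (inj₁ h) = naturals (≥0-nat a≥0) (≥0-nat b≥0)
    where
    a≥0 : 0≤ a
    a≥0 = ≥0-cong (h ⊕ nat≥0 {2}) (lem a)
      where
      lem : ∀ a → a - + 2 + + 2 ≡ a
      lem = solve-∀
    naturals : ∃[ m ] a ≡ + m → ∃[ k ] b ≡ + k → ⊥
    naturals (m , ea) (k , eb) = no1 m k
        ( ℤP.drop‿+≤+ (ℤP.0≤i-j⇒j≤i (≥0-cong h (cong (_- + 2) ea)))
        , ℤP.drop‿+≤+ (ℤP.0≤i-j⇒j≤i (≥0-cong wider (cong₂ _-_ ea eb)))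
        , ≃-at ψ (λ q i → inside q (position q i)) (all₄ c₀₀ (subst (λ z → (z , + 0) ∈ T') ea ca₀) c₀₁ (subst (λ z → (z , + 1) ∈ T') eb cb₁)))
      where
      inside : ∀ q → Position q → Poly (pt 0 0 ∷ pt m 0 ∷ pt 0 1 ∷ pt k 1 ∷ []) (ι q)
      inside (x , _) (inj₁ (refl , hx , hax)) = segment-hull (+ m) x (+ 0) hx (≥0-cong hax (cong (_- x) ea)) (here refl) (there (here refl))
      inside (x , _) (inj₂ (refl , hx , hbx)) = segment-hull (+ k) x (+ 1) hx (≥0-cong hbx (cong (_- x) eb)) (there (there (here refl))) (there (there (there (here refl))))
  go (inj₂ h) = nofit (fit-box S two ψ (+ 1) λ s i → inside (act ψ s) (position _ (∈-map⁺ (act ψ) i)))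
    where
    p₁ : ∀ a x → - (a - + 2) - + 1 + (a - x) ≡ + 1 - x
    p₁ = solve-∀
    p₂ : ∀ a b x → - (a - + 2) - + 1 + (a - b) + (b - x) ≡ + 1 - x
    p₂ = solve-∀
    inside : ∀ q → Position q → InBox (+ 1) q
    inside (x , _) (inj₁ (refl , hx , hax)) = hx , ≥0-cong (h ⊕ hax) (p₁ a x) , nat≥0 , nat≥0
    inside (x , _) (inj₂ (refl , hx , hbx)) = hx , ≥0-cong (h ⊕ wider ⊕ hbx) (p₂ a b x) , nat≥0 , nat≥0

upside-down : Unimodular
upside-down = record { a = + 1 ; b = + 0 ; c = + 0 ; d = -[1+ 0 ] ; e = + 0 ; f = + 1 ; unimod = inj₂ refl }

upside-down-eq : ∀ x y → act upside-down (x , y) ≡ (x , + 1 - y)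
upside-down-eq x y = cong₂ _,_ (l₁ x y) (l₂ x y)
  where
  l₁ : ∀ x y → + 1 * x + + 0 * y + + 0 ≡ x
  l₁ = solve-∀
  l₂ : ∀ x y → + 0 * x + -[1+ 0 ] * y + + 1 ≡ + 1 - y
  l₂ = solve-∀

level-ends : ∀ T h q → q ∈ T → proj₂ q ≡ h →
  ∃[ l ] ∃[ r ] ((l , h) ∈ T × (r , h) ∈ T × (∀ q → q ∈ T → proj₂ q ≡ h → 0≤ (proj₁ q - l) × 0≤ (r - proj₁ q)))
level-ends T h q₀ i₀ e₀ = go
    (optimum (λ p q → 0≤ (proj₁ q - proj₁ p)) (λ q → proj₂ q ℤP.≟ h) (λ {a} {b} {c} _ _ _ h k → ≥0-trans (proj₁ c) (proj₁ b) (proj₁ a) k h) (λ a b _ _ → ≥0-total (proj₁ b) (proj₁ a)) T)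
    (optimum (λ p q → 0≤ (proj₁ p - proj₁ q)) (λ q → proj₂ q ℤP.≟ h) (λ {a} {b} {c} _ _ _ → ≥0-trans (proj₁ a) (proj₁ b) (proj₁ c)) (λ a b _ _ → ≥0-total (proj₁ a) (proj₁ b)) T)
  where
  go : (∀ a → a ∈ T → ¬ proj₂ a ≡ h) ⊎ (∃[ a ] (a ∈ T × proj₂ a ≡ h × (∀ b → b ∈ T → proj₂ b ≡ h → 0≤ (proj₁ b - proj₁ a)))) →
       (∀ a → a ∈ T → ¬ proj₂ a ≡ h) ⊎ (∃[ a ] (a ∈ T × proj₂ a ≡ h × (∀ b → b ∈ T → proj₂ b ≡ h → 0≤ (proj₁ a - proj₁ b)))) →
    ∃[ l ] ∃[ r ] ((l , h) ∈ T × (r , h) ∈ T × (∀ q → q ∈ T → proj₂ q ≡ h → 0≤ (proj₁ q - l) × 0≤ (r - proj₁ q)))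
  go (inj₁ none) _ = ⊥-elim (none q₀ i₀ e₀)
  go (inj₂ _) (inj₁ none) = ⊥-elim (none q₀ i₀ e₀)
  go (inj₂ ((l , _) , il , refl , hl)) (inj₂ ((r , _) , ir , refl , hr)) = l , r , il , ir , λ q i e → hl q i e , hr q i e

-- Compares the slopes (x - l)/y with denominators multiplied out; positive heights are what makes
-- this transitive.
slope-trans : ∀ l ax ay bx by cx cy → 0≤ (ay - + 1) → 0≤ (by - + 1) → 0≤ (cy - + 1) →
  0≤ ((bx - l) * ay - (ax - l) * by) → 0≤ ((cx - l) * by - (bx - l) * cy) → 0≤ ((cx - l) * ay - (ax - l) * cy)
slope-trans l ax ay bx by cx cy ha hb hc h k = ≥0-cancel by ((cx - l) * ay - (ax - l) * cy) hb
  (≥0-cong ((ha ⊕ nat≥0 {1}) ⊗ k ⊕ (hc ⊕ nat≥0 {1}) ⊗ h ⊕ hb) (lem l ax ay bx by cx cy))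
  where
  lem : ∀ l ax ay bx by cx cy → (ay - + 1 + + 1) * ((cx - l) * by - (bx - l) * cy) + (cy - + 1 + + 1) * ((bx - l) * ay - (ax - l) * by) + (by - + 1)
    ≡ by * ((cx - l) * ay - (ax - l) * cy) + by - + 1
  lem = solve-∀

-- `k` bounds from below the least slope (x₀ - l)/y₀ seen from the left end of the lowest edge, so
-- it bounds the slope of every point above that edge.
slope-floor : ∀ l x₀ y₀ x y k r → 0≤ (y₀ - + 1) → 0≤ (y - + 1) → 0≤ r → x₀ - l ≡ k * y₀ + r → 0≤ ((x - l) * y₀ - (x₀ - l) * y) → 0≤ (x - l - k * y)
slope-floor l x₀ y₀ x y k r hy₀ hy hr e h = ≥0-cancel y₀ (x - l - k * y) hy₀
  (≥0-cong (h ⊕ hr ⊗ (hy ⊕ nat≥0 {1}) ⊕ hy₀) (trans (cong (λ z → (x - l) * y₀ - z * y + r * (y - + 1 + + 1) + (y₀ - + 1)) e) (lem l y₀ x y k r)))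
  where
  lem : ∀ l y₀ x y k r → (x - l) * y₀ - (k * y₀ + r) * y + r * (y - + 1 + + 1) + (y₀ - + 1) ≡ y₀ * (x - l - k * y) + y₀ - + 1
  lem = solve-∀

-- The left-hand side of the polygon is given by the least slope seen from (l, 0); let k be its
-- integral part. The map x ↦ x - r - (k - (r - l)) y sends (r, 0) to the origin, and the left-hand
-- side then meets height 1 in the interval [0, 1), as `tall` requires.
normalise-tall : ∀ S φ H l r t → let T = map (act φ) S in 0≤ (H - + 2) →
  (l , + 0) ∈ T → (r , + 0) ∈ T → (t , H) ∈ T →
  (∀ q → q ∈ T → 0≤ proj₂ q × 0≤ (H - proj₂ q)) →
  (∀ q → q ∈ T → proj₂ q ≡ + 0 → 0≤ (proj₁ q - l) × 0≤ (r - proj₁ q)) →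
  (∀ φ → Wide (map (act φ) S) H) → (∀ φ r → ¬ Int (map (act φ) S) r) → ¬ Case2 (Poly S) → ⊥
normalise-tall S φ H l r t H≥2 il ir it levels bottom wide noInt no2 =
    go (optimum (λ p q → 0≤ ((proj₁ q - l) * proj₂ p - (proj₁ p - l) * proj₂ q)) (λ q → 0≤? (proj₂ q - + 1))
      (λ {a} {b} {c} pa pb pc → slope-trans l (proj₁ a) (proj₂ a) (proj₁ b) (proj₂ b) (proj₁ c) (proj₂ c) pa pb pc)
      (λ a b _ _ → ≥0-total ((proj₁ b - l) * proj₂ a) ((proj₁ a - l) * proj₂ b)) T)
  where
  T = map (act φ) S
  Steep : Point → Set
  Steep q₀ = ∀ q → q ∈ T → 0≤ (proj₂ q - + 1) → 0≤ ((proj₁ q - l) * proj₂ q₀ - (proj₁ q₀ - l) * proj₂ q)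
  go : (∀ a → a ∈ T → ¬ 0≤ (proj₂ a - + 1)) ⊎ (∃[ a ] (a ∈ T × 0≤ (proj₂ a - + 1) × Steep a)) → ⊥
  go (inj₁ none) = none (t , H) it (≥0-cong (H≥2 ⊕ nat≥0 {1}) (lem H))
    where
    lem : ∀ H → H - + 2 + + 1 ≡ H - + 1
    lem = solve-∀
  go (inj₂ ((x₀ , y₀) , i₀ , hy₀ , steep)) = go' (divide (x₀ - l) y₀ hy₀)
    where
    go' : ∃[ k ] ∃[ s ] (x₀ - l ≡ k * y₀ + s × 0≤ s × 0≤ (y₀ - + 1 - s)) → ⊥
    go' (k , s , es , hs , hs') = tall S ψ j H (x₀ - r - q * y₀) y₀ (t - r - q * H) H≥2 (proj₂ (bottom _ il refl))
        (at (compose∈ ρ φ ir) (trans (skew-eq r q r (+ 0)) (cong (_, + 0) (n₁ r q))))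
        (at (compose∈ ρ φ il) (trans (skew-eq r q l (+ 0)) (cong (_, + 0) (n₂ l r q))))
        (at (compose∈ ρ φ i₀) (skew-eq r q x₀ y₀)) hy₀ (≥0-cong hs' (trans (cong (λ z → y₀ - + 1 - z) s≡) (n₃ l r x₀ y₀ k)))
        (at (compose∈ ρ φ it) (skew-eq r q t H))
        (compose∀ ρ φ _ λ { p@(x , y) i → subst (λ p → 0≤ proj₂ p × 0≤ (H - proj₂ p)) (sym (skew-eq r q x y)) (levels p i) })
        (compose∀ ρ φ _ λ { p@(x , y) i → subst (λ p → 0≤ (proj₂ p - + 1) → 0≤ (proj₁ p + j - j * proj₂ p)) (sym (skew-eq r q x y))
          λ hy → ≥0-cong (slope-floor l x₀ y₀ x y k s hy₀ hy hs es (steep p i hy)) (n₄ l r x y k) })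
        (compose∀ ρ φ _ λ { p@(x , y) i → subst (λ p → proj₂ p ≡ + 0 → 0≤ (proj₁ p + j) × 0≤ (- proj₁ p)) (sym (skew-eq r q x y))
          λ e → ≥0-cong (proj₁ (bottom p i e)) (trans (n₅ l r x q) (cong (λ z → x - r - q * z + j) (sym e))) ,
                ≥0-cong (proj₂ (bottom p i e)) (trans (n₆ r x q) (cong (λ z → - (x - r - q * z)) (sym e))) })
        (wide ψ) noInt no2
      where
      j = r - l
      q = k - (r - l)
      ρ = skew r q
      ψ = compose ρ φ
      at : ∀ {p q} → p ∈ map (act ψ) S → p ≡ q → q ∈ map (act ψ) S
      at i refl = i
      s≡ : s ≡ x₀ - l - k * y₀
      s≡ = trans (n₀ (k * y₀) s) (cong (_- k * y₀) (sym es))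
        where
        n₀ : ∀ u s → s ≡ u + s - u
        n₀ = solve-∀
      n₁ : ∀ r q → r - r - q * + 0 ≡ + 0
      n₁ = solve-∀
      n₂ : ∀ l r q → l - r - q * + 0 ≡ - (r - l)
      n₂ = solve-∀
      n₃ : ∀ l r x₀ y₀ k → y₀ - + 1 - (x₀ - l - k * y₀) ≡ (r - l + + 1) * y₀ - (x₀ - r - (k - (r - l)) * y₀ + (r - l)) - + 1
      n₃ = solve-∀
      n₄ : ∀ l r x y k → x - l - k * y ≡ x - r - (k - (r - l)) * y + (r - l) - (r - l) * y
      n₄ = solve-∀
      n₅ : ∀ l r x q → x - l ≡ x - r - q * + 0 + (r - l)
      n₅ = solve-∀
      n₆ : ∀ r x q → r - x ≡ - (x - r - q * + 0)
      n₆ = solve-∀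

module Empty (S : List Point) (two : TwoDim S) (noInt : ∀ p → ¬ Int S p) (no1 : NoCase1 S) (no2 : ¬ Case2 (Poly S))
  (nofit : ¬ Main.FitRows S two (+ 1)) where
  open Width S two

  no-Int : ∀ φ r → ¬ Int (map (act φ) S) r
  no-Int φ r int = noInt (act (inv φ) r) (Int-act⁻ φ r int)

  -- Pulling back along a unimodular map sends nonzero forms to nonzero forms, so a bound on all
  -- widths holds in all coordinates.
  wide-all : ∀ H → (∀ α β → NonZeroForm α β → 0≤ (width α β - H)) → ∀ φ → Wide (map (act φ) S) H
  wide-all H minimal φ α β nz = act φ s , act φ t , ∈-map⁺ (act φ) (hi∈ α' β') , ∈-map⁺ (act φ) (lo∈ α' β') ,
      ≥0-cong (minimal α' β' (pullback-nonzero φ α β nz)) (cong (_- H)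
        (trans (width-attained α' β') (trans (lem (lf α' β' s) (lf α' β' t) (α * e + β * f)) (cong₂ _-_ (sym (lf-act φ α β s)) (sym (lf-act φ α β t))))))
    where
    open Unimodular φ
    α' = α * a + β * c
    β' = α * b + β * d
    s = hi α' β'
    t = lo α' β'
    lem : ∀ s t k → s - t ≡ s + k - (t + k)
    lem = solve-∀

  with-direction : ∀ α β → NonZeroForm α β → Coprime ℤ.∣ α ∣ ℤ.∣ β ∣ → (∀ γ δ → NonZeroForm γ δ → 0≤ (width γ δ - width α β)) → ⊥
  with-direction α β nz cop minimal = go (bezout α β cop)
    where
    H = width α β
    v = lo α β
    go : ∃[ g ] ∃[ h ] g * β - h * α ≡ + 1 → ⊥
    go (g , h , e) = split (trichotomy (H - + 1))
      where
      φ : Unimodular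
      φ = record { a = g ; b = h ; c = α ; d = β ; e = + 0 ; f = - lf α β v ; unimod = inj₁ e }
      T = map (act φ) S
      y-at : ∀ s → proj₂ (act φ s) ≡ lf α β s - lf α β v
      y-at s = aff-lf α β (- lf α β v) s
      levels : ∀ q → q ∈ T → 0≤ proj₂ q × 0≤ (H - proj₂ q)
      levels = ∀∈map φ (λ q → 0≤ proj₂ q × 0≤ (H - proj₂ q)) λ s j →
        ≥0-cong (proj₂ (proj₂ (lowest α β)) s j) (sym (y-at s)) ,
        ≥0-cong (width-upper α β s v j (lo∈ α β)) (cong (λ z → H - z) (sym (y-at s)))
      v-level : proj₂ (act φ v) ≡ + 0
      v-level = trans (y-at v) (ℤP.+-inverseʳ (lf α β v))
      top-level : proj₂ (act φ (hi α β)) ≡ H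
      top-level = trans (y-at (hi α β)) (sym (width-attained α β))
      ends₀ = level-ends T (+ 0) (act φ v) (∈-map⁺ (act φ) (lo∈ α β)) v-level
      flat : ∀ H → H ≡ + 1 → (∀ q → q ∈ T → 0≤ proj₂ q × 0≤ (H - proj₂ q)) → proj₂ (act φ (hi α β)) ≡ H → ⊥
      flat _ refl levels top = from ends₀ (level-ends T (+ 1) (act φ (hi α β)) (∈-map⁺ (act φ) (hi∈ α β)) top)
        where
        from : ∃[ l ] ∃[ r ] ((l , + 0) ∈ T × (r , + 0) ∈ T × (∀ q → q ∈ T → proj₂ q ≡ + 0 → 0≤ (proj₁ q - l) × 0≤ (r - proj₁ q))) →
               ∃[ l ] ∃[ r ] ((l , + 1) ∈ T × (r , + 1) ∈ T × (∀ q → q ∈ T → proj₂ q ≡ + 1 → 0≤ (proj₁ q - l) × 0≤ (r - proj₁ q))) → ⊥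
        from (l₀ , r₀ , i₀ , j₀ , b₀) (l₁ , r₁ , i₁ , j₁ , b₁) = compare (signs (r₀ - l₀ - (r₁ - l₁)))
          where
          place : ∀ q → q ∈ T → OnLevel (+ 0) l₀ r₀ q ⊎ OnLevel (+ 1) l₁ r₁ q
          place q@(x , y) i = pick (trichotomy y)
            where
            pick : 0≤ (y - + 1) ⊎ y ≡ + 0 ⊎ 0≤ (- y - + 1) → OnLevel (+ 0) l₀ r₀ q ⊎ OnLevel (+ 1) l₁ r₁ q
            pick (inj₂ (inj₁ ey)) = inj₁ (ey , b₀ q i ey)
            pick (inj₁ hy) = inj₂ (≥0-≡ hy (proj₂ (levels q i)) , b₁ q i (≥0-≡ hy (proj₂ (levels q i))))
            pick (inj₂ (inj₂ hy)) = ⊥-elim (clash (proj₁ (levels q i)) hy)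
          -- `strip` wants the longer row at the bottom, so the polygon is turned over if necessary.
          compare : 0≤ (r₀ - l₀ - (r₁ - l₁)) ⊎ 0≤ (- (r₀ - l₀ - (r₁ - l₁)) - + 1) → ⊥
          compare (inj₁ h) = strip S two φ l₀ r₀ l₁ r₁ i₀ j₀ i₁ j₁ place h no1 nofit
          compare (inj₂ h) = strip S two (compose upside-down φ) l₁ r₁ l₀ r₀ (up i₁) (up j₁) (up i₀) (up j₀)
              (compose∀ upside-down φ _ λ { q@(x , y) i → subst (λ q → OnLevel (+ 0) l₁ r₁ q ⊎ OnLevel (+ 1) l₀ r₀ q) (sym (upside-down-eq x y)) (turn x y (place q i)) })
              (≥0-cong (h ⊕ nat≥0 {1}) (m₂ (r₀ - l₀) (r₁ - l₁))) no1 nofit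
            where
            m₂ : ∀ a b → - (a - b) - + 1 + + 1 ≡ b - a
            m₂ = solve-∀
            up : ∀ {x y} → (x , y) ∈ T → (x , + 1 - y) ∈ map (act (compose upside-down φ)) S
            up {x} {y} i = subst (_∈ map (act (compose upside-down φ)) S) (upside-down-eq x y) (compose∈ upside-down φ i)
            turn : ∀ x y → OnLevel (+ 0) l₀ r₀ (x , y) ⊎ OnLevel (+ 1) l₁ r₁ (x , y) → OnLevel (+ 0) l₁ r₁ (x , + 1 - y) ⊎ OnLevel (+ 1) l₀ r₀ (x , + 1 - y)
            turn x y (inj₁ (refl , hs)) = inj₂ (refl , hs)
            turn x y (inj₂ (refl , hs)) = inj₁ (refl , hs)
      high : 0≤ (H - + 2) → ⊥
      high h≥2 = from ends₀
        where
        from : ∃[ l ] ∃[ r ] ((l , + 0) ∈ T × (r , + 0) ∈ T × (∀ q → q ∈ T → proj₂ q ≡ + 0 → 0≤ (proj₁ q - l) × 0≤ (r - proj₁ q))) → ⊥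
        from (l , r , i , j , b) = normalise-tall S φ H l r (proj₁ (act φ (hi α β))) h≥2 i j
          (subst (λ y → (proj₁ (act φ (hi α β)) , y) ∈ T) top-level (∈-map⁺ (act φ) (hi∈ α β))) levels b (wide-all H minimal) no-Int no2
      split : 0≤ (H - + 1 - + 1) ⊎ H - + 1 ≡ + 0 ⊎ 0≤ (- (H - + 1) - + 1) → ⊥
      split (inj₁ h) = high (≥0-cong h (m₁ H))
        where
        m₁ : ∀ H → H - + 1 - + 1 ≡ H - + 2
        m₁ = solve-∀
      split (inj₂ (inj₁ e)) = flat H (ℤP.i-j≡0⇒i≡j H (+ 1) e) levels top-level
      split (inj₂ (inj₂ h)) = clash (width-positive α β nz) h

  empty : ⊥
  empty = ¬¬-minimum (λ y → NonZeroForm (proj₁ y) (proj₂ y)) (λ y → ℤ.∣ width (proj₁ y) (proj₂ y) ∣) (+ 1 , + 0) (λ ())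
      λ { (α , β) nz minimal → outer α β nz (λ γ δ nz' → ∣∣-mono⁻ {width α β} {width γ δ} (width≥0 α β) (width≥0 γ δ) (minimal (γ , δ) nz')) }
    where
    outer : ∀ α β → NonZeroForm α β → (∀ γ δ → NonZeroForm γ δ → 0≤ (width γ δ - width α β)) → ⊥
    outer α β nz minimal = with-direction α β nz (minimal-coprime S two α β nz minimal) minimal

-- Decidability of fitting

module Fitting (S : List Point) (two : TwoDim S) where
  open Width S two
  open Main S two using (FitRows)

  fits⇒rows : ∀ n → FitsIn (Poly S) n → FitRows (+ n)
  fits⇒rows n fit = fit-box S two (proj₁ fit) (+ n) (λ s i → fits-elim {Poly S} {n} fit s (hull-generator s i))

  rows⇒box : ∀ D → FitRows D → ∃[ φ ] (∀ s → s ∈ S → InBox D (act φ s))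
  rows⇒box D (a , b , c , d , det1 , h₁ , h₂) =
      record { a = a ; b = b ; c = c ; d = d ; e = - lf a b (lo a b) ; f = - lf c d (lo c d) ; unimod = det1 } ,
      λ s i → proj₂ (proj₂ (lowest a b)) s i , upper a b h₁ s i , proj₂ (proj₂ (lowest c d)) s i , upper c d h₂ s i
    where
    lem : ∀ D w s t → D - w + (w - (s - t)) ≡ D - (s + - t)
    lem = solve-∀
    upper : ∀ α β → 0≤ (D - width α β) → ∀ s → s ∈ S → 0≤ (D - (lf α β s + - lf α β (lo α β)))
    upper α β h s i = ≥0-cong (h ⊕ width-upper α β s (lo α β) i (lo∈ α β)) (lem D (width α β) (lf α β s) (lf α β (lo α β)))

  rows⇒fits : ∀ n → FitRows (+ n) → FitsIn (Poly S) n
  rows⇒fits n rows = fits-intro (proj₁ box) n (proj₂ box)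
    where
    box = rows⇒box (+ n) rows

∃ℤ? : {P : ℤ → Set} → Decidable P → ∀ B → (∀ z → P z → ℤ.∣ z ∣ ℕ.≤ B) → Dec (∃[ z ] P z)
∃ℤ? {P} P? B bound = map′ to from (ℕP.anyUpTo? (λ n → P? (+ n) ⊎-dec P? (- (+ n))) (suc B))
  where
  to : ∃[ n ] (n ℕ.< suc B × (P (+ n) ⊎ P (- (+ n)))) → ∃[ z ] P z
  to (n , _ , inj₁ p) = + n , p
  to (n , _ , inj₂ p) = - (+ n) , p
  from : ∃[ z ] P z → ∃[ n ] (n ℕ.< suc B × (P (+ n) ⊎ P (- (+ n))))
  from (z , p) = ℤ.∣ z ∣ , s≤s (bound z p) , choose (∣∣-cases z)
    where
    choose : (z ≡ + ℤ.∣ z ∣) ⊎ (z ≡ - (+ ℤ.∣ z ∣)) → P (+ ℤ.∣ z ∣) ⊎ P (- (+ ℤ.∣ z ∣))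
    choose (inj₁ e) = inj₁ (subst P e p)
    choose (inj₂ e) = inj₂ (subst P e p)

interval-abs : ∀ x l h → 0≤ (x - l) → 0≤ (h - x) → ℤ.∣ x ∣ ℕ.≤ ℤ.∣ l ∣ ℕ.+ ℤ.∣ h ∣
interval-abs x l h hl hh = go x l h (ℤP.0≤i-j⇒j≤i {x} {l} hl) (ℤP.0≤i-j⇒j≤i {h} {x} hh)
  where
  go : ∀ x l h → l ℤ.≤ x → x ℤ.≤ h → ℤ.∣ x ∣ ℕ.≤ ℤ.∣ l ∣ ℕ.+ ℤ.∣ h ∣
  go (+ n) l (+ m) _ (ℤ.+≤+ n≤m) = ℕP.≤-trans n≤m (ℕP.m≤n+m m ℤ.∣ l ∣)
  go -[1+ n ] -[1+ m ] h (ℤ.-≤- n≤m) _ = ℕP.≤-trans (s≤s n≤m) (ℕP.m≤m+n (suc m) ℤ.∣ h ∣)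

-- Cramer's rule bounds the coefficients of a form of width at most D.
coefficient-bound : ∀ α D w u v x y → w ≢ + 0 → α * w ≡ u * x - v * y → 0≤ (D - u) → 0≤ (u + D) → 0≤ (D - v) → 0≤ (v + D) →
  ℤ.∣ α ∣ ℕ.≤ (ℤ.∣ D ∣ ℕ.+ ℤ.∣ D ∣) ℕ.* (ℤ.∣ x ∣ ℕ.+ ℤ.∣ y ∣)
coefficient-bound α D w u v x y w≢0 e u≤ u≥ v≤ v≥ = begin
  ℤ.∣ α ∣                                     ≡⟨ ℕP.*-identityʳ ℤ.∣ α ∣ ⟨
  ℤ.∣ α ∣ ℕ.* 1                               ≤⟨ ℕP.*-monoʳ-≤ ℤ.∣ α ∣ (ℕP.n≢0⇒n>0 (λ z → w≢0 (ℤP.∣i∣≡0⇒i≡0 z))) ⟩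
  ℤ.∣ α ∣ ℕ.* ℤ.∣ w ∣                         ≡⟨ ℤP.abs-* α w ⟨
  ℤ.∣ α * w ∣                                 ≡⟨ cong ℤ.∣_∣ e ⟩
  ℤ.∣ u * x - v * y ∣                         ≤⟨ ℤP.∣i-j∣≤∣i∣+∣j∣ (u * x) (v * y) ⟩
  ℤ.∣ u * x ∣ ℕ.+ ℤ.∣ v * y ∣                 ≡⟨ cong₂ ℕ._+_ (ℤP.abs-* u x) (ℤP.abs-* v y) ⟩
  ℤ.∣ u ∣ ℕ.* ℤ.∣ x ∣ ℕ.+ ℤ.∣ v ∣ ℕ.* ℤ.∣ y ∣ ≤⟨ ℕP.+-mono-≤ (ℕP.*-monoˡ-≤ ℤ.∣ x ∣ (bound u u≤ u≥)) (ℕP.*-monoˡ-≤ ℤ.∣ y ∣ (bound v v≤ v≥)) ⟩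
  DD ℕ.* ℤ.∣ x ∣ ℕ.+ DD ℕ.* ℤ.∣ y ∣           ≡⟨ ℕP.*-distribˡ-+ DD ℤ.∣ x ∣ ℤ.∣ y ∣ ⟨
  DD ℕ.* (ℤ.∣ x ∣ ℕ.+ ℤ.∣ y ∣)                ∎
  where
  open ℕP.≤-Reasoning
  DD = ℤ.∣ D ∣ ℕ.+ ℤ.∣ D ∣
  lem : ∀ u D → u + D ≡ u - - D
  lem = solve-∀
  bound : ∀ u → 0≤ (D - u) → 0≤ (u + D) → ℤ.∣ u ∣ ℕ.≤ DD
  bound u h k = subst (λ z → ℤ.∣ u ∣ ℕ.≤ z ℕ.+ ℤ.∣ D ∣) (ℤP.∣-i∣≡∣i∣ D) (interval-abs u (- D) D (≥0-cong k (lem u D)) h)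

module Decide (S : List Point) (two : TwoDim S) where
  open Width S two
  open Main S two using (FitRows)

  coefficient-bounds : ∀ D → ∃[ B ] (∀ α β → 0≤ (D - width α β) → ℤ.∣ α ∣ ℕ.≤ B × ℤ.∣ β ∣ ℕ.≤ B)
  coefficient-bounds D = go two
    where
    go : TwoDim S → ∃[ B ] (∀ α β → 0≤ (D - width α β) → ℤ.∣ α ∣ ℕ.≤ B × ℤ.∣ β ∣ ℕ.≤ B)
    go (p@(px , py) , q@(qx , qy) , r@(rx , ry) , ip , iq , ir , D≢0) = B₁ ℕ.+ B₂ , λ α β h →
        ℕP.≤-trans (coefficient-bound α D (det p q r) (lf α β q - lf α β p) (lf α β r - lf α β p) (ry - py) (qy - py) D≢0 (l₁ α β px py qx qy rx ry)
          (up α β h q p iq ip) (dn α β h q p iq ip) (up α β h r p ir ip) (dn α β h r p ir ip)) (ℕP.m≤m+n B₁ B₂) ,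
        ℕP.≤-trans (coefficient-bound β D (det p q r) (lf α β r - lf α β p) (lf α β q - lf α β p) (qx - px) (rx - px) D≢0 (l₂ α β px py qx qy rx ry)
          (up α β h r p ir ip) (dn α β h r p ir ip) (up α β h q p iq ip) (dn α β h q p iq ip)) (ℕP.m≤n+m B₂ B₁)
      where
      B₁ = (ℤ.∣ D ∣ ℕ.+ ℤ.∣ D ∣) ℕ.* (ℤ.∣ ry - py ∣ ℕ.+ ℤ.∣ qy - py ∣)
      B₂ = (ℤ.∣ D ∣ ℕ.+ ℤ.∣ D ∣) ℕ.* (ℤ.∣ qx - px ∣ ℕ.+ ℤ.∣ rx - px ∣)
      l₁ : ∀ α β px py qx qy rx ry → α * ((qx - px) * (ry - py) - (qy - py) * (rx - px)) ≡
        (α * qx + β * qy - (α * px + β * py)) * (ry - py) - (α * rx + β * ry - (α * px + β * py)) * (qy - py)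
      l₁ = solve-∀
      l₂ : ∀ α β px py qx qy rx ry → β * ((qx - px) * (ry - py) - (qy - py) * (rx - px)) ≡
        (α * rx + β * ry - (α * px + β * py)) * (qx - px) - (α * qx + β * qy - (α * px + β * py)) * (rx - px)
      l₂ = solve-∀
      m₁ : ∀ D w x → D - w + (w - x) ≡ D - x
      m₁ = solve-∀
      m₂ : ∀ D w s t → D - w + (w - (t - s)) ≡ s - t + D
      m₂ = solve-∀
      up : ∀ α β → 0≤ (D - width α β) → ∀ s t → s ∈ S → t ∈ S → 0≤ (D - (lf α β s - lf α β t))
      up α β h s t i j = ≥0-cong (h ⊕ width-upper α β s t i j) (m₁ D (width α β) (lf α β s - lf α β t))
      dn : ∀ α β → 0≤ (D - width α β) → ∀ s t → s ∈ S → t ∈ S → 0≤ (lf α β s - lf α β t + D)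
      dn α β h s t i j = ≥0-cong (h ⊕ width-upper α β t s j i) (m₂ D (width α β) (lf α β s) (lf α β t))

  -- Forms of width at most `D` on a two-dimensional set have bounded coefficients, so the four
  -- entries range over a finite box. This is how refutations turn into actual fits and a least size
  -- is found.
  fitRows? : ∀ D → Dec (FitRows D)
  fitRows? D = ∃ℤ? (λ a → ∃ℤ? (λ b → ∃ℤ? (λ c → ∃ℤ? (λ d →
      ((a * d - b * c ℤP.≟ + 1) ⊎-dec (a * d - b * c ℤP.≟ -[1+ 0 ])) ×-dec 0≤? (D - width a b) ×-dec 0≤? (D - width c d))
      B (λ { d (_ , _ , h) → proj₂ (bnd c d h) }))
      B (λ { c (d , _ , _ , h) → proj₁ (bnd c d h) }))
      B (λ { b (c , d , _ , h , _) → proj₂ (bnd a b h) }))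
      B (λ { a (b , c , d , _ , h , _) → proj₁ (bnd a b h) })
    where
    B = proj₁ (coefficient-bounds D)
    bnd = proj₂ (coefficient-bounds D)

  -- Interior points lie in the bounding box of `S`. The distinction between empty and non-empty
  -- Δ⁽¹⁾ rests on this search.
  Int-exists? : Dec (∃[ p ] Int S p)
  Int-exists? = map′ (λ { (x , y , int) → (x , y) , int }) (λ { ((x , y) , int) → x , y , int })
    (∃ℤ? (λ x → ∃ℤ? (λ y → Int? S (x , y)) By (λ y int → y-bound x y int)) Bx (λ { x (y , int) → x-bound x y int }))
    where
    neg-form : ∀ α β t x y → - α * x + - β * y + t ≡ t - (α * x + β * y)
    neg-form = solve-∀
    within : ∀ α β p → Int S p → 0≤ (lf α β p - lf α β (lo α β)) × 0≤ (lf α β (hi α β) - lf α β p)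
    within α β p@(x , y) int = Int⇒InHull {S} {p} int α β (- lf α β (lo α β)) (proj₂ (proj₂ (lowest α β))) ,
      ≥0-cong (Int⇒InHull {S} {p} int (- α) (- β) (lf α β (hi α β))
        (λ { s@(x , y) i → ≥0-cong (proj₂ (proj₂ (highest α β)) s i) (sym (neg-form α β (lf α β (hi α β)) x y)) })) (neg-form α β (lf α β (hi α β)) x y)
    Bx = ℤ.∣ lf (+ 1) (+ 0) (lo (+ 1) (+ 0)) ∣ ℕ.+ ℤ.∣ lf (+ 1) (+ 0) (hi (+ 1) (+ 0)) ∣
    By = ℤ.∣ lf (+ 0) (+ 1) (lo (+ 0) (+ 1)) ∣ ℕ.+ ℤ.∣ lf (+ 0) (+ 1) (hi (+ 0) (+ 1)) ∣
    lx : ∀ x y → + 1 * x + + 0 * y ≡ x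
    lx = solve-∀
    ly : ∀ x y → + 0 * x + + 1 * y ≡ y
    ly = solve-∀
    x-bound : ∀ x y → Int S (x , y) → ℤ.∣ x ∣ ℕ.≤ Bx
    x-bound x y int = subst (λ z → ℤ.∣ z ∣ ℕ.≤ Bx) (lx x y)
      (interval-abs (lf (+ 1) (+ 0) (x , y)) (lf (+ 1) (+ 0) (lo (+ 1) (+ 0))) (lf (+ 1) (+ 0) (hi (+ 1) (+ 0))) (proj₁ (within (+ 1) (+ 0) (x , y) int)) (proj₂ (within (+ 1) (+ 0) (x , y) int)))
    y-bound : ∀ x y → Int S (x , y) → ℤ.∣ y ∣ ℕ.≤ By
    y-bound x y int = subst (λ z → ℤ.∣ z ∣ ℕ.≤ By) (ly x y)
      (interval-abs (lf (+ 0) (+ 1) (x , y)) (lf (+ 0) (+ 1) (lo (+ 0) (+ 1))) (lf (+ 0) (+ 1) (hi (+ 0) (+ 1))) (proj₁ (within (+ 0) (+ 1) (x , y) int)) (proj₂ (within (+ 0) (+ 1) (x , y) int)))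

least : {P : ℕ → Set} → Decidable P → ∀ n → P n → ∃[ m ] (P m × (∀ k → k ℕ.< m → ¬ P k))
least {P} P? n pn = go n n ℕP.≤-refl pn
  where
  go : ∀ fuel n → n ℕ.≤ fuel → P n → ∃[ m ] (P m × (∀ k → k ℕ.< m → ¬ P k))
  go fuel n n≤ pn with ℕP.anyUpTo? P? n
  go fuel n n≤ pn | no none = n , pn , λ k k<n pk → none (k , k<n , pk)
  go (suc fuel) n n≤ pn | yes (k , k<n , pk) = go fuel k (ℕ.s≤s⁻¹ (ℕP.≤-trans k<n n≤)) pk
  go zero zero n≤ pn | yes (k , () , pk)

-- The general formula

-- The interior lattice points of a polygon in [0, d + 2]² lie in [1, d + 1]², which this shift
-- moves to [0, d]².
interior-shift : Unimodular → Unimodular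
interior-shift φ = record { a = a ; b = b ; c = c ; d = d ; e = e - + 1 ; f = f - + 1 ; unimod = unimod }
  where open Unimodular φ

shift-aff : ∀ α β ε p → aff α β (ε - + 1) p ≡ aff α β ε p - + 1
shift-aff α β ε (x , y) = lem α β ε x y
  where
  lem : ∀ α β ε x y → α * x + β * y + (ε - + 1) ≡ α * x + β * y + ε - + 1
  lem = solve-∀

shift-box : ∀ φ D p → let (x , y) = act φ p in 0≤ (x - + 1) → 0≤ (D + + 1 - x) → 0≤ (y - + 1) → 0≤ (D + + 1 - y) →
  InBox D (act (interior-shift φ) p)
shift-box φ D p h₁ h₂ h₃ h₄ = ≥0-cong h₁ (sym ex) , ≥0-cong h₂ (trans (lem D x) (cong (λ z → D - z) (sym ex))) ,
    ≥0-cong h₃ (sym ey) , ≥0-cong h₄ (trans (lem D y) (cong (λ z → D - z) (sym ey)))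
  where
  open Unimodular φ
  x = proj₁ (act φ p)
  y = proj₂ (act φ p)
  ex : proj₁ (act (interior-shift φ) p) ≡ x - + 1
  ex = shift-aff a b e p
  ey : proj₂ (act (interior-shift φ) p) ≡ y - + 1
  ey = shift-aff c d f p
  lem : ∀ D x → D + + 1 - x ≡ D - (x - + 1)
  lem = solve-∀

no-Int⇒empty : ∀ S → (∀ p → ¬ Int S p) → ¬ NonEmpty (IntHull (Poly S))
no-Int⇒empty S noInt (q , [] , _ , e , _) = ℚP.1≢0 (sym e)
no-Int⇒empty S noInt (q , (w , p) ∷ c , (_ , hp) All.∷ _ , _) = noInt p (interior⇒Int {S} {p} hp)

Int⇒nonempty : ∀ S p → Int S p → NonEmpty (IntHull (Poly S))
Int⇒nonempty S p int = ι p , hull-generator p (Int⇒interior {S} {p} int)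

module General (S : List Point) (two : TwoDim S) (no1 : NoCase1 S) (no2 : ¬ Case2 (Poly S)) (no3 : ¬ Case3 (Poly S))
  (no4 : ¬ Case4 (Poly S)) (no5 : NoCase5 S) where
  open Width S two
  open Main S two using (FitRows; IntWidth)
  open Fitting S two
  open Decide S two

  nonempty : NonEmpty (Poly S)
  nonempty = ι (lo (+ 1) (+ 0)) , hull-generator (lo (+ 1) (+ 0)) (lo∈ (+ 1) (+ 0))

  not-0 : ¬ FitRows (+ 0)
  not-0 (a , b , c , d , det1 , h , _) = absurd (h ⊕ width-positive a b nz) (lem (width a b))
    where
    lem : ∀ w → + 0 - w + (w - + 1) ≡ -[1+ 0 ]
    lem = solve-∀
    z : ∀ c d → + 0 * d - + 0 * c ≡ + 0
    z = solve-∀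
    0≢1 : + 0 ≢ + 1
    0≢1 ()
    0≢-1 : + 0 ≢ -[1+ 0 ]
    0≢-1 ()
    nz : NonZeroForm a b
    nz (refl , refl) = [ (λ e → 0≢1 (trans (sym (z c d)) e)) , (λ e → 0≢-1 (trans (sym (z c d)) e)) ]′ det1

  Conclusion : Set
  Conclusion = ∃[ n ] (IsLS (IntHull (Poly S)) n × IsLS (Poly S) (n + + 2))

  without-interior : ¬ (∃[ p ] Int S p) → Conclusion
  without-interior none = -[1+ 0 ] , inj₁ (no-Int⇒empty S (λ p int → none (p , int)) , refl) ,
      inj₂ (1 , refl , nonempty , rows⇒fits 1 (fits1 (fitRows? (+ 1))) , smaller)
    where
    fits1 : Dec (FitRows (+ 1)) → FitRows (+ 1)
    fits1 (yes h) = h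
    fits1 (no nofit) = ⊥-elim (Empty.empty S two (λ p int → none (p , int)) no1 no2 nofit)
    smaller : ∀ d' → d' ℕ.< 1 → ¬ FitsIn (Poly S) d'
    smaller zero _ fit = not-0 (fits⇒rows 0 fit)
    smaller (suc _) (s≤s ())

  some-fit : ∃[ n ] FitRows (+ n)
  some-fit = go (≥0-nat D≥0)
    where
    w₁ = width (+ 1) (+ 0)
    w₂ = width (+ 0) (+ 1)
    D≥0 : 0≤ (w₁ + w₂)
    D≥0 = width≥0 (+ 1) (+ 0) ⊕ width≥0 (+ 0) (+ 1)
    l₁ : ∀ w₁ w₂ → w₂ ≡ w₁ + w₂ - w₁
    l₁ = solve-∀
    l₂ : ∀ w₁ w₂ → w₁ ≡ w₁ + w₂ - w₂
    l₂ = solve-∀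
    go : ∃[ n ] w₁ + w₂ ≡ + n → ∃[ n ] FitRows (+ n)
    go (n , e) = n , + 1 , + 0 , + 0 , + 1 , inj₁ refl ,
      ≥0-cong (width≥0 (+ 0) (+ 1)) (trans (l₁ w₁ w₂) (cong (_- w₁) e)) , ≥0-cong (width≥0 (+ 1) (+ 0)) (trans (l₂ w₁ w₂) (cong (_- w₂) e))

  -- Let N be the least size for Δ. The interior points lie in [1, N - 1]², so N ≥ 2 and Δ⁽¹⁾ fits
  -- in size N - 2. If it fitted in a smaller d', `InteriorBound.main` would contradict the fact
  -- that Δ does not fit in d' + 2 < N.
  with-interior : (∃[ p ] Int S p) → Conclusion
  with-interior (p , int) = go (least (λ n → fitRows? (+ n)) (proj₁ some-fit) (proj₂ some-fit))
    where
    go : ∃[ N ] (FitRows (+ N) × (∀ k → k ℕ.< N → ¬ FitRows (+ k))) → Conclusion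
    go (N , fitN , minN) = inside (rows⇒box (+ N) fitN)
      where
      inside : ∃[ φ ] (∀ s → s ∈ S → InBox (+ N) (act φ s)) → Conclusion
      inside (φ , box) = size N minN refl (low p int)
        where
        module φ = Unimodular φ
        lower : ∀ α β ε → NonZeroForm α β → (∀ s → s ∈ S → 0≤ aff α β ε s) → ∀ p → Int S p → 0≤ (aff α β ε p - + 1)
        lower α β ε nz h p int = Int-strict {S} {p} int α β ε nz h
        neg-aff : ∀ α β ε D p → aff (- α) (- β) (D - ε) p ≡ D - aff α β ε p
        neg-aff α β ε D (x , y) = lem α β ε D x y
          where
          lem : ∀ α β ε D x y → - α * x + - β * y + (D - ε) ≡ D - (α * x + β * y + ε)
          lem = solve-∀
        upper : ∀ α β ε → NonZeroForm α β → (∀ s → s ∈ S → 0≤ (+ N - aff α β ε s)) → ∀ p → Int S p → 0≤ (+ N - aff α β ε p - + 1)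
        upper α β ε nz h p int = ≥0-cong (Int-strict {S} {p} int (- α) (- β) (+ N - ε) (λ { (e₁ , e₂) → nz (neg-zero e₁ , neg-zero e₂) })
          (λ s i → ≥0-cong (h s i) (sym (neg-aff α β ε (+ N) s)))) (cong (_- + 1) (neg-aff α β ε (+ N) p))
        row₁ : NonZeroForm φ.a φ.b
        row₁ (e₁ , e₂) = pullback-nonzero φ (+ 1) (+ 0) (λ ()) (trans (l φ.a φ.c) e₁ , trans (l φ.b φ.d) e₂)
          where
          l : ∀ a c → + 1 * a + + 0 * c ≡ a
          l = solve-∀
        row₂ : NonZeroForm φ.c φ.d
        row₂ (e₁ , e₂) = pullback-nonzero φ (+ 0) (+ 1) (λ ()) (trans (l φ.a φ.c) e₁ , trans (l φ.b φ.d) e₂)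
          where
          l : ∀ a c → + 0 * a + + 1 * c ≡ c
          l = solve-∀
        low : ∀ p → Int S p → 0≤ (proj₁ (act φ p) - + 1) × 0≤ (+ N - proj₁ (act φ p) - + 1) × 0≤ (proj₂ (act φ p) - + 1) × 0≤ (+ N - proj₂ (act φ p) - + 1)
        low p int = lower φ.a φ.b φ.e row₁ (λ s i → proj₁ (box s i)) p int , upper φ.a φ.b φ.e row₁ (λ s i → proj₁ (proj₂ (box s i))) p int ,
          lower φ.c φ.d φ.f row₂ (λ s i → proj₁ (proj₂ (proj₂ (box s i)))) p int , upper φ.c φ.d φ.f row₂ (λ s i → proj₂ (proj₂ (proj₂ (box s i)))) p int
        size : ∀ M → (∀ k → k ℕ.< M → ¬ FitRows (+ k)) → M ≡ N →
          0≤ (proj₁ (act φ p) - + 1) × 0≤ (+ N - proj₁ (act φ p) - + 1) × 0≤ (proj₂ (act φ p) - + 1) × 0≤ (+ N - proj₂ (act φ p) - + 1) → Conclusion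
        size 0 _ refl (h , k , _) = ⊥-elim (absurd (h ⊕ k ⊕ nat≥0 {1}) (lem (proj₁ (act φ p))))
          where
          lem : ∀ x → x - + 1 + (+ 0 - x - + 1) + + 1 ≡ -[1+ 0 ]
          lem = solve-∀
        size 1 _ refl (h , k , _) = ⊥-elim (absurd (h ⊕ k) (lem (proj₁ (act φ p))))
          where
          lem : ∀ x → x - + 1 + (+ 1 - x - + 1) ≡ -[1+ 0 ]
          lem = solve-∀
        size (suc (suc d)) minN refl _ = + d ,
            inj₂ (d , refl , Int⇒nonempty S p int , fits-intro (interior-shift φ) d inner , minimal) ,
            inj₂ (d ℕ.+ 2 , refl , nonempty , subst (FitsIn (Poly S)) (ℕP.+-comm 2 d) (rows⇒fits (suc (suc d)) fitN) ,
              λ d' d'< fit → minN d' (subst (d' ℕ.<_) (ℕP.+-comm d 2) d'<) (fits⇒rows d' fit))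
          where
          l₁ : ∀ d x → + 2 + d - x - + 1 ≡ d + + 1 - x
          l₁ = solve-∀
          inner : ∀ r → InteriorPt (Poly S) r → InBox (+ d) (act (interior-shift φ) r)
          inner r hr = from (low r (interior⇒Int {S} {r} hr))
            where
            from : 0≤ (proj₁ (act φ r) - + 1) × 0≤ (+ N - proj₁ (act φ r) - + 1) × 0≤ (proj₂ (act φ r) - + 1) × 0≤ (+ N - proj₂ (act φ r) - + 1) → InBox (+ d) (act (interior-shift φ) r)
            from (h₁ , h₂ , h₃ , h₄) = shift-box φ (+ d) r h₁ (≥0-cong h₂ (l₁ (+ d) (proj₁ (act φ r)))) h₃ (≥0-cong h₄ (l₁ (+ d) (proj₂ (act φ r))))
          minimal : ∀ d' → d' ℕ.< d → ¬ FitsIn (IntHull (Poly S)) d'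
          minimal d' d'<d fit@(ψ , _) = InteriorBound.main S two (+ d') nat≥0 no3 no4 no5 ψ
              (rows ψ.a ψ.b ψ.e (λ p b → proj₁ b) (λ p b → proj₁ (proj₂ b))) (rows ψ.c ψ.d ψ.f (λ p b → proj₁ (proj₂ (proj₂ b))) (λ p b → proj₂ (proj₂ (proj₂ b))))
              (p , int) (subst (λ k → ¬ FitRows (+ k)) (ℕP.+-comm 2 d') (minN (2 ℕ.+ d') (s≤s (s≤s d'<d))))
            where
            module ψ = Unimodular ψ
            boxed : ∀ p → Int S p → InBox (+ d') (act ψ p)
            boxed p int = fits-elim {IntHull (Poly S)} {d'} fit p (hull-generator p (Int⇒interior {S} {p} int))
            lem : ∀ D s t e → D - (s + e) + (t + e) ≡ D - (s - t)
            lem = solve-∀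
            rows : ∀ α β ε → (∀ p → InBox (+ d') (act ψ p) → 0≤ aff α β ε p) → (∀ p → InBox (+ d') (act ψ p) → 0≤ (+ d' - aff α β ε p)) → IntWidth (+ d') nat≥0 α β
            rows α β ε l u p p' i i' = ≥0-cong (u p (boxed p i) ⊕ l p' (boxed p' i')) (lem (+ d') (lf α β p) (lf α β p') ε)

  conclusion : Conclusion
  conclusion = go Int-exists?
    where
    go : Dec (∃[ p ] Int S p) → Conclusion
    go (yes h) = with-interior h
    go (no none) = without-interior none

-- Values in the first four situations

InHull-act : ∀ φ {S p} → InHull S p → InHull (map (act φ) S) (act φ p)
InHull-act φ {S} {p} h α β ε all = ≥0-cong (h (α * a + β * c) (α * b + β * d) (α * e + β * f + ε)
    (λ s i → ≥0-cong (all (act φ s) (∈-map⁺ (act φ) i)) (sym (aff-act α β ε φ s)))) (aff-act α β ε φ p)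
  where open Unimodular φ

grid-not-fits : ∀ {X} φ x y k → X (ι (act (inv φ) (x , y))) → X (ι (act (inv φ) (x + + k , y))) → ∀ d → d ℕ.< k → ¬ FitsIn X d
grid-not-fits {X} φ x y k hu hv = not-fits {X} (act (inv φ) (x , y)) (a , c) k hu
    (subst (λ p → X (ι p)) (cong₂ _,_ (lem a b e x y (+ k)) (lem c d f x y (+ k))) hv) w≢0
  where
  open Unimodular (inv φ)
  lem : ∀ a b e x y k → a * (x + k) + b * y + e ≡ a * x + b * y + e + k * a
  lem = solve-∀
  w≢0 : (a , c) ≢ (+ 0 , + 0)
  w≢0 eq = pullback-nonzero (transpose (inv φ)) (+ 1) (+ 0) (λ ()) (trans (l a b) (cong proj₁ eq) , trans (l c d) (cong proj₂ eq))
    where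
    l : ∀ a b → + 1 * a + + 0 * b ≡ a
    l = solve-∀

-- Only the hulls of `T` and `T'` are known to agree. Inequalities valid on `T'` therefore pass to
-- `T`, and points of `T'` are used as points of the hull of `T`, not as members of the list.
module Equivalent (S T' : List Point) (eqv : Poly S ≃ Poly T') where
  φ : Unimodular
  φ = proj₁ eqv
  T : List Point
  T = map (act φ) S

  valid : ∀ α β ε → (∀ t → t ∈ T' → 0≤ aff α β ε t) → ∀ q → q ∈ T → 0≤ aff α β ε q
  valid α β ε h = ∀∈map φ (λ q → 0≤ aff α β ε q) (λ s j → hull-≥0 α β ε h {act φ s} (≃-image eqv s j))

  x≥0 : (∀ t → t ∈ T' → 0≤ aff (+ 1) (+ 0) (+ 0) t) → ∀ q → q ∈ T → 0≤ proj₁ q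
  x≥0 h q@(x , y) i = ≥0-cong (valid (+ 1) (+ 0) (+ 0) h q i) (lem x y)
    where
    lem : ∀ x y → + 1 * x + + 0 * y + + 0 ≡ x
    lem = solve-∀

  y≥0 : (∀ t → t ∈ T' → 0≤ aff (+ 0) (+ 1) (+ 0) t) → ∀ q → q ∈ T → 0≤ proj₂ q
  y≥0 h q@(x , y) i = ≥0-cong (valid (+ 0) (+ 1) (+ 0) h q i) (lem x y)
    where
    lem : ∀ x y → + 0 * x + + 1 * y + + 0 ≡ y
    lem = solve-∀

  vertex : ∀ t → t ∈ T' → InHull T t
  vertex t i = subst (InHull T) (act-inverseʳ φ t) (InHull-act φ {S} {act (inv φ) t} (poly⇒InHull {S} {act (inv φ) t} (≃-preimage eqv t i)))

  noInt : (∀ q → ¬ Int T q) → ∀ p → ¬ Int S p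
  noInt h p int = h (act φ p) (Int-act φ {S} {p} int)

  -- The box gives the upper bound; the segment from (0, 0) to (k, 0), with its k + 1 lattice
  -- points, gives the lower one.
  lattice-size : ∀ k → (∀ q → q ∈ T → InBox (+ k) q) → pt 0 0 ∈ T' → pt k 0 ∈ T' → IsLS (Poly S) (+ k)
  lattice-size k box i j = inj₂ (k , refl , (_ , ≃-preimage eqv (pt 0 0) i) , fits-intro φ k (λ s i → box _ (∈-map⁺ (act φ) i)) ,
    grid-not-fits {Poly S} φ (+ 0) (+ 0) k (≃-preimage eqv (pt 0 0) i) (≃-preimage eqv (pt k 0) j))

  empty-interior : (∀ q → ¬ Int T q) → IsLS (IntHull (Poly S)) -[1+ 0 ]
  empty-interior h = inj₁ (no-Int⇒empty S (noInt h) , refl)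

  single-interior : Int T (+ 1 , + 1) → (∀ q → Int T q → q ≡ (+ 1 , + 1)) → IsLS (IntHull (Poly S)) (+ 0)
  single-interior int unique = inj₂ (0 , refl , Int⇒nonempty S _ (Int-act⁻ φ (+ 1 , + 1) int) ,
      fits-intro (interior-shift φ) 0 (λ p hp → boxed p (unique (act φ p) (Int-act φ {S} {p} (interior⇒Int {S} {p} hp)))) , λ _ ())
    where
    boxed : ∀ p → act φ p ≡ (+ 1 , + 1) → InBox (+ 0) (act (interior-shift φ) p)
    boxed p e = shift-box φ (+ 0) p (subst (λ q → 0≤ (proj₁ q - + 1)) (sym e) nat≥0) (subst (λ q → 0≤ (+ 0 + + 1 - proj₁ q)) (sym e) nat≥0)
      (subst (λ q → 0≤ (proj₂ q - + 1)) (sym e) nat≥0) (subst (λ q → 0≤ (+ 0 + + 1 - proj₂ q)) (sym e) nat≥0)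

case1 : ∀ S a b → Case1 (Poly S) a b → IsLS (IntHull (Poly S)) -[1+ 0 ] × IsLS (Poly S) (+ a)
case1 S a b (2≤a , b≤a , eqv) = empty-interior nowhere , lattice-size a box (here refl) (there (here refl))
  where
  open Equivalent S (pt 0 0 ∷ pt a 0 ∷ pt 0 1 ∷ pt b 1 ∷ []) eqv
  l₁ : ∀ x y → + 0 * x + -[1+ 0 ] * y + + 1 ≡ + 1 - y
  l₁ = solve-∀
  l₂ : ∀ a x y → -[1+ 0 ] * x + + 0 * y + a ≡ a - x
  l₂ = solve-∀
  l₃ : ∀ x → + 1 * x + + 0 * + 1 + + 0 ≡ x
  l₃ = solve-∀
  l₄ : ∀ x → + 1 * x + + 0 * + 0 + + 0 ≡ x
  l₄ = solve-∀
  xs = x≥0 (all₄ nat≥0 (≥0-cong (nat≥0 {a}) (sym (l₄ (+ a)))) nat≥0 (≥0-cong (nat≥0 {b}) (sym (l₃ (+ b)))))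
  l₅ : ∀ x → + 0 * x + + 1 * + 0 + + 0 ≡ + 0
  l₅ = solve-∀
  l₆ : ∀ x → + 0 * x + + 1 * + 1 + + 0 ≡ + 1
  l₆ = solve-∀
  ys = y≥0 (all₄ nat≥0 (≡⇒≥0 (l₅ (+ a))) nat≥0 (≥0-cong (nat≥0 {1}) (sym (l₆ (+ b)))))
  y≤1 : ∀ q → q ∈ T → 0≤ (+ 1 - proj₂ q)
  y≤1 q@(x , y) i = ≥0-cong (valid (+ 0) -[1+ 0 ] (+ 1) (all₄ nat≥0 (≥0-cong (nat≥0 {1}) (sym (l₁ (+ a) (+ 0)))) nat≥0 (≥0-cong (nat≥0 {0}) (sym (l₁ (+ b) (+ 1))))) q i) (l₁ x y)
  x≤a : ∀ q → q ∈ T → 0≤ (+ a - proj₁ q)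
  x≤a q@(x , y) i = ≥0-cong (valid -[1+ 0 ] (+ 0) (+ a) (all₄
      (≥0-cong (nat≥0 {a}) (sym (trans (l₂ (+ a) (+ 0) (+ 0)) (m₁ (+ a)))))
      (≡⇒≥0 (trans (l₂ (+ a) (+ a) (+ 0)) (ℤP.+-inverseʳ (+ a))))
      (≥0-cong (nat≥0 {a}) (sym (trans (l₂ (+ a) (+ 0) (+ 1)) (m₁ (+ a)))))
      (≥0-cong (ℤP.i≤j⇒0≤j-i (ℤ.+≤+ b≤a)) (sym (l₂ (+ a) (+ b) (+ 1))))) q i) (l₂ (+ a) x y)
    where
    m₁ : ∀ a → a - + 0 ≡ a
    m₁ = solve-∀
  box : ∀ q → q ∈ T → InBox (+ a) q
  box q@(x , y) i = xs q i , x≤a q i , ys q i , ≥0-cong (y≤1 q i ⊕ ℤP.i≤j⇒0≤j-i (ℤ.+≤+ 2≤a) ⊕ nat≥0 {1}) (m₁ (+ a) y)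
    where
    m₁ : ∀ a y → + 1 - y + (a - + 2) + + 1 ≡ a - y
    m₁ = solve-∀
  nowhere : ∀ q → ¬ Int T q
  nowhere q@(x , y) int = absurd (y-strict q int ys ⊕ Int-strict {T} {q} int (+ 0) -[1+ 0 ] (+ 1) (λ ()) (λ { q@(x , y) i → ≥0-cong (y≤1 q i) (sym (l₁ x y)) })) (m₁ x y)
    where
    m₁ : ∀ x y → y - + 1 + (+ 0 * x + -[1+ 0 ] * y + + 1 - + 1) ≡ -[1+ 0 ]
    m₁ = solve-∀

simplex-box : ∀ H T → InSimplex H T → ∀ q → q ∈ T → InBox H q
simplex-box H T simplex q@(x , y) i = proj₁ (simplex q i) , ≥0-cong (proj₂ (proj₂ (simplex q i)) ⊕ proj₁ (proj₂ (simplex q i))) (l₁ H x y) ,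
    proj₁ (proj₂ (simplex q i)) , ≥0-cong (proj₂ (proj₂ (simplex q i)) ⊕ proj₁ (simplex q i)) (l₂ H x y)
  where
  l₁ : ∀ H x y → H - x - y + y ≡ H - x
  l₁ = solve-∀
  l₂ : ∀ H x y → H - x - y + x ≡ H - y
  l₂ = solve-∀

equivalent-simplex : ∀ S T' (eqv : Poly S ≃ Poly T') H → (∀ t → t ∈ T' → 0≤ aff (+ 1) (+ 0) (+ 0) t) → (∀ t → t ∈ T' → 0≤ aff (+ 0) (+ 1) (+ 0) t) →
  (∀ t → t ∈ T' → 0≤ aff -[1+ 0 ] -[1+ 0 ] H t) → InSimplex H (Equivalent.T S T' eqv)
equivalent-simplex S T' eqv H hx hy hs q@(x , y) i = x≥0 hx q i , y≥0 hy q i , ≥0-cong (valid -[1+ 0 ] -[1+ 0 ] H hs q i) (lem H x y)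
  where
  open Equivalent S T' eqv
  lem : ∀ H x y → -[1+ 0 ] * x + -[1+ 0 ] * y + H ≡ H - x - y
  lem = solve-∀

case2 : ∀ S → Case2 (Poly S) → IsLS (IntHull (Poly S)) -[1+ 0 ] × IsLS (Poly S) (+ 2)
case2 S eqv = empty-interior nowhere , lattice-size 2 (simplex-box (+ 2) T simplex) (here refl) (there (here refl))
  where
  open Equivalent S (pt 0 0 ∷ pt 2 0 ∷ pt 0 2 ∷ []) eqv
  simplex : InSimplex (+ 2) T
  simplex = equivalent-simplex S _ eqv (+ 2) (all₃ nat≥0 nat≥0 nat≥0) (all₃ nat≥0 nat≥0 nat≥0) (all₃ nat≥0 nat≥0 nat≥0)
  nowhere : ∀ q → ¬ Int T q
  nowhere q@(x , y) int = absurd (x-strict q int (λ q i → proj₁ (simplex q i)) ⊕ y-strict q int (λ q i → proj₁ (proj₂ (simplex q i)))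
      ⊕ sum-strict (+ 2) q int (λ q i → proj₂ (proj₂ (simplex q i)))) (lem x y)
    where
    lem : ∀ x y → x - + 1 + (y - + 1) + (+ 2 - x - y - + 1) ≡ -[1+ 0 ]
    lem = solve-∀

-- Interior points satisfy x, y ≥ 1 and x + y ≤ 2, which leaves only (1, 1).
case3-of : ∀ S T' → (eqv : Poly S ≃ Poly T') → InSimplex (+ 3) (Equivalent.T S T' eqv) → Int (Equivalent.T S T' eqv) (+ 1 , + 1) →
  pt 0 0 ∈ T' → pt 3 0 ∈ T' → IsLS (IntHull (Poly S)) (+ 0) × IsLS (Poly S) (+ 3)
case3-of S T' eqv simplex int i j = single-interior int unique , lattice-size 3 (simplex-box (+ 3) T simplex) i j
  where
  open Equivalent S T' eqv
  unique : ∀ q → Int T q → q ≡ (+ 1 , + 1)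
  unique q@(x , y) int = cong₂ _,_ (≥0-≡ hx (≥0-cong (hs ⊕ hy) (l₁ x y))) (≥0-≡ hy (≥0-cong (hs ⊕ hx) (l₂ x y)))
    where
    hx = x-strict q int (λ q i → proj₁ (simplex q i))
    hy = y-strict q int (λ q i → proj₁ (proj₂ (simplex q i)))
    hs = sum-strict (+ 3) q int (λ q i → proj₂ (proj₂ (simplex q i)))
    l₁ : ∀ x y → + 3 - x - y - + 1 + (y - + 1) ≡ + 1 - x
    l₁ = solve-∀
    l₂ : ∀ x y → + 3 - x - y - + 1 + (x - + 1) ≡ + 1 - y
    l₂ = solve-∀

case3 : ∀ S → Case3 (Poly S) → IsLS (IntHull (Poly S)) (+ 0) × IsLS (Poly S) (+ 3)
case3 S (inj₁ eqv) = case3-of S T' eqv (equivalent-simplex S T' eqv (+ 3) (all₃ nat≥0 nat≥0 nat≥0) (all₃ nat≥0 nat≥0 nat≥0) (all₃ nat≥0 nat≥0 nat≥0))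
    (Int-triangle {T} {pt 0 0} {pt 3 0} {pt 0 3} {pt 1 1} (+ 1) (+ 1) (+ 1) (vertex _ (here refl)) (vertex _ (there (here refl))) (vertex _ (there (there (here refl))))
      (λ ()) nat≥0 nat≥0 nat≥0 (combination refl refl)) (here refl) (there (here refl))
  where
  T' = pt 0 0 ∷ pt 3 0 ∷ pt 0 3 ∷ []
  open Equivalent S T' eqv
case3 S (inj₂ (inj₁ eqv)) = case3-of S T' eqv (equivalent-simplex S T' eqv (+ 3) (all₃ nat≥0 nat≥0 nat≥0) (all₃ nat≥0 nat≥0 nat≥0) (all₃ nat≥0 nat≥0 nat≥0))
    (Int-triangle {T} {pt 0 0} {pt 3 0} {pt 0 2} {pt 1 1} (+ 1) (+ 2) (+ 3) (vertex _ (here refl)) (vertex _ (there (here refl))) (vertex _ (there (there (here refl))))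
      (λ ()) nat≥0 nat≥0 nat≥0 (combination refl refl)) (here refl) (there (here refl))
  where
  T' = pt 0 0 ∷ pt 3 0 ∷ pt 0 2 ∷ []
  open Equivalent S T' eqv
case3 S (inj₂ (inj₂ (inj₁ eqv))) = case3-of S T' eqv (equivalent-simplex S T' eqv (+ 3) (all₄ nat≥0 nat≥0 nat≥0 nat≥0) (all₄ nat≥0 nat≥0 nat≥0 nat≥0) (all₄ nat≥0 nat≥0 nat≥0 nat≥0))
    (Int-triangle {T} {pt 0 0} {pt 3 0} {pt 0 2} {pt 1 1} (+ 1) (+ 2) (+ 3) (vertex _ (here refl)) (vertex _ (there (here refl))) (vertex _ (there (there (there (here refl)))))
      (λ ()) nat≥0 nat≥0 nat≥0 (combination refl refl)) (here refl) (there (here refl))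
  where
  T' = pt 0 0 ∷ pt 3 0 ∷ pt 2 1 ∷ pt 0 2 ∷ []
  open Equivalent S T' eqv
case3 S (inj₂ (inj₂ (inj₂ eqv))) = case3-of S T' eqv (equivalent-simplex S T' eqv (+ 3) (all₄ nat≥0 nat≥0 nat≥0 nat≥0) (all₄ nat≥0 nat≥0 nat≥0 nat≥0) (all₄ nat≥0 nat≥0 nat≥0 nat≥0))
    (Int-triangle {T} {pt 0 0} {pt 3 0} {pt 0 2} {pt 1 1} (+ 1) (+ 2) (+ 3) (vertex _ (here refl)) (vertex _ (there (here refl))) (vertex _ (there (there (there (here refl)))))
      (λ ()) nat≥0 nat≥0 nat≥0 (combination refl refl)) (here refl) (there (here refl))
  where
  T' = pt 0 0 ∷ pt 3 0 ∷ pt 1 2 ∷ pt 0 2 ∷ []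
  open Equivalent S T' eqv

-- As 4Σ has three interior lattice points, the sharper inequality x + 2y ≤ 4 is used to single out
-- (1, 1).
case4 : ∀ S → Case4 (Poly S) → IsLS (IntHull (Poly S)) (+ 0) × IsLS (Poly S) (+ 4)
case4 S eqv = single-interior
    (Int-triangle {T} {pt 0 0} {pt 4 0} {pt 0 2} {pt 1 1} (+ 1) (+ 1) (+ 2) (vertex _ (here refl)) (vertex _ (there (here refl))) (vertex _ (there (there (here refl))))
      (λ ()) nat≥0 nat≥0 nat≥0 (combination refl refl)) unique ,
    lattice-size 4 (simplex-box (+ 4) T simplex) (here refl) (there (here refl))
  where
  open Equivalent S (pt 0 0 ∷ pt 4 0 ∷ pt 0 2 ∷ []) eqv
  simplex : InSimplex (+ 4) T
  simplex = equivalent-simplex S _ eqv (+ 4) (all₃ nat≥0 nat≥0 nat≥0) (all₃ nat≥0 nat≥0 nat≥0) (all₃ nat≥0 nat≥0 nat≥0)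
  unique : ∀ q → Int T q → q ≡ (+ 1 , + 1)
  unique q@(x , y) int = cong₂ _,_ (≥0-≡ hx (≥0-cong (hs ⊕ hy ⊕ hy) (l₁ x y))) (≥0-≡ hy (≥0-cancel (+ 2) (+ 1 - y) nat≥0 (≥0-cong (hs ⊕ hx ⊕ nat≥0 {1}) (l₂ x y))))
    where
    hx = x-strict q int (λ q i → proj₁ (simplex q i))
    hy = y-strict q int (λ q i → proj₁ (proj₂ (simplex q i)))
    hs : 0≤ (-[1+ 0 ] * x + -[1+ 1 ] * y + + 4 - + 1)
    hs = Int-strict {T} {q} int -[1+ 0 ] -[1+ 1 ] (+ 4) (λ ()) (valid -[1+ 0 ] -[1+ 1 ] (+ 4) (all₃ nat≥0 nat≥0 nat≥0))
    l₁ : ∀ x y → -[1+ 0 ] * x + -[1+ 1 ] * y + + 4 - + 1 + (y - + 1) + (y - + 1) ≡ + 1 - x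
    l₁ = solve-∀
    l₂ : ∀ x y → -[1+ 0 ] * x + -[1+ 1 ] * y + + 4 - + 1 + (x - + 1) + + 1 ≡ + 2 * (+ 1 - y) + + 2 - + 1
    l₂ = solve-∀

-- Counting lattice points, and the values in the situation of two parallel edges

remove : {A : Set} {x : A} {ys : List A} → x ∈ ys →
  ∃[ zs ] (length ys ≡ suc (length zs) × (∀ z → z ∈ ys → z ≢ x → z ∈ zs))
remove {ys = y ∷ ys} (here refl) = ys , refl , λ { z (here refl) z≢x → ⊥-elim (z≢x refl) ; z (there i) _ → i }
remove {ys = y ∷ ys} (there i) = go (remove i)
  where
  go : ∃[ zs ] (length ys ≡ suc (length zs) × (∀ z → z ∈ ys → z ≢ _ → z ∈ zs)) →
    ∃[ zs ] (suc (length ys) ≡ suc (length zs) × (∀ z → z ∈ y ∷ ys → z ≢ _ → z ∈ zs))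
  go (zs , e , h) = y ∷ zs , cong suc e , λ { z (here refl) _ → here refl ; z (there j) z≢x → there (h z j z≢x) }

unique-length : {A : Set} {xs ys : List A} → Unique xs → (∀ z → z ∈ xs → z ∈ ys) → length xs ℕ.≤ length ys
unique-length {xs = []} _ _ = z≤n
unique-length {xs = x ∷ xs} {ys} (x∉ AllPairs.∷ uniq) sub = go (remove (sub x (here refl)))
  where
  go : ∃[ zs ] (length ys ≡ suc (length zs) × (∀ z → z ∈ ys → z ≢ x → z ∈ zs)) → suc (length xs) ℕ.≤ length ys
  go (zs , e , h) = subst (suc (length xs) ℕ.≤_) (sym e)
    (s≤s (unique-length uniq (λ z i → h z (sub z (there i)) (λ z≡x → All.lookup x∉ i (sym z≡x)))))

-- The counts in `Case5` come with lists of their own. Comparison with the explicit list on a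
-- horizontal segment identifies each count with the length plus 1.
count-unique : ∀ {X k k'} → LatticeCount X k → LatticeCount X k' → k ≡ k'
count-unique (L , uL , refl , hL) (M , uM , refl , hM) = ℕP.≤-antisym
  (unique-length uL (λ z i → Equivalence.from (hM z) (Equivalence.to (hL z) i)))
  (unique-length uM (λ z i → Equivalence.from (hL z) (Equivalence.to (hM z) i)))

count-swap : ∀ {u v k} → LatticeCount (Seg u v) k → LatticeCount (Seg v u) k
count-swap {u} {v} (L , uL , len , h) = L , uL , len , λ p → mk⇔
    (λ i → hull-mono swap₂ {ι p} (Equivalence.to (h p) i)) (λ hp → Equivalence.from (h p) (hull-mono swap₂ {ι p} hp))
  where
  swap₂ : ∀ {a b : Point} p → p ∈ a ∷ b ∷ [] → p ∈ b ∷ a ∷ []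
  swap₂ p (here refl) = there (here refl)
  swap₂ p (there (here refl)) = here refl

-- If x < 0 occurred, (0 , 1) would be interior, being a combination of (1 , 1), that point and the origin.
left-side : ∀ T → InHull T (+ 0 , + 0) → Int T (+ 1 , + 1) → ¬ Int T (+ 0 , + 1) → (∀ q → q ∈ T → 0≤ proj₂ q) →
  (∀ q → q ∈ T → proj₂ q ≡ + 0 → 0≤ proj₁ q) → ∀ q → q ∈ T → 0≤ proj₁ q
left-side T o int no-int ys bottom q@(x , y) i = go (trichotomy y)
  where
  l₁ : ∀ x y → - x * + 1 + + 1 * x + (y - + 1) * + 0 ≡ (- x + + 1 + (y - + 1)) * + 0
  l₁ = solve-∀
  l₂ : ∀ x y → - x * + 1 + + 1 * y + (y - + 1) * + 0 ≡ (- x + + 1 + (y - + 1)) * + 1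
  l₂ = solve-∀
  go : 0≤ (y - + 1) ⊎ y ≡ + 0 ⊎ 0≤ (- y - + 1) → 0≤ x
  go (inj₁ hy) = by-contradiction x λ hx → no-int (Int-combine {T} {+ 1 , + 1} {x , y} {+ 0 , + 0} {+ 0 , + 1} (- x) (+ 1) (y - + 1)
    int (∈⇒InHull i) o hx nat≥0 hy (combination (l₁ x y) (l₂ x y)))
  go (inj₂ (inj₁ e)) = bottom q i e
  go (inj₂ (inj₂ h)) = ⊥-elim (clash (ys q i) h)

-- Turns the right-hand side of the polygon into its left-hand side, so that `left-side` serves
-- both. For m = ℓ - n - 2 it exchanges (0, 0) with (ℓ, 0) and (1, 1) with (n + 1, 1).
mirror : ℤ → ℤ → Unimodular
mirror ℓ m = record { a = -[1+ 0 ] ; b = - m ; c = + 0 ; d = + 1 ; e = ℓ ; f = + 0 ; unimod = inj₂ (lem m) }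
  where
  lem : ∀ m → -[1+ 0 ] * + 1 - - m * + 0 ≡ -[1+ 0 ]
  lem = solve-∀

mirror-eq : ∀ ℓ m x y → act (mirror ℓ m) (x , y) ≡ (ℓ - x - m * y , y)
mirror-eq ℓ m x y = cong₂ _,_ (l₁ ℓ m x y) (l₂ x y)
  where
  l₁ : ∀ ℓ m x y → -[1+ 0 ] * x + - m * y + ℓ ≡ ℓ - x - m * y
  l₁ = solve-∀
  l₂ : ∀ x y → + 0 * x + + 1 * y + + 0 ≡ y
  l₂ = solve-∀

-- No interior point at height 1 is outside 1 ≤ x ≤ n + 1, so `left-side` and its mirror image give
-- x ≥ 0 and x + m y ≤ ℓ on Δ. The gap of 3 makes m ≥ 1, which confines Δ to ℓ□ and its interior
-- points to [1, n + 1]². The rows of ℓ + 1 and n + 1 lattice points supply the lower bounds.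
case5-normalised : ∀ S ψ u v u' v' ℓ n → Poly S (ι u) → Poly S (ι v) → Int S u' → Int S v' →
  act ψ u ≡ (+ 0 , + 0) → act ψ v ≡ (+ ℓ , + 0) → act ψ u' ≡ (+ 1 , + 1) → act ψ v' ≡ (+ n + + 1 , + 1) →
  (∀ s → s ∈ S → 0≤ proj₂ (act ψ s)) →
  (∀ s → s ∈ S → proj₂ (act ψ s) ≡ + 0 → 0≤ proj₁ (act ψ s) × 0≤ (+ ℓ - proj₁ (act ψ s))) →
  (∀ p → Int S p → proj₂ (act ψ p) ≡ + 1 → 0≤ (proj₁ (act ψ p) - + 1) × 0≤ (+ n + + 1 - proj₁ (act ψ p))) →
  0≤ (+ ℓ - + n - + 3) → IsLS (IntHull (Poly S)) (+ n) × IsLS (Poly S) (+ ℓ)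
case5-normalised S ψ u v u' v' ℓ n hu hv intu' intv' eu ev eu' ev' ys₀ bottom₀ level₀ big =
    inj₂ (n , refl , Int⇒nonempty S u' intu' , fits-intro (interior-shift ψ) n inner ,
      grid-not-fits {IntHull (Poly S)} ψ (+ 1) (+ 1) n (at-int u' (+ 1 , + 1) eu' intu') (at-int v' (+ 1 + + n , + 1) (trans ev' (cong (_, + 1) (ℤP.+-comm (+ n) (+ 1)))) intv')) ,
    inj₂ (ℓ , refl , (ι u , hu) , fits-intro ψ ℓ outer ,
      grid-not-fits {Poly S} ψ (+ 0) (+ 0) ℓ (at-poly u (+ 0 , + 0) eu hu) (at-poly v (+ 0 + + ℓ , + 0) (trans ev (cong (_, + 0) (sym (ℤP.+-identityˡ (+ ℓ))))) hv))
  where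
  T = map (act ψ) S
  -- The line x + m y = ℓ joins (ℓ, 0) to (n + 2, 1), the lattice point just to the right of the
  -- last interior point at height 1.
  m = + ℓ - + n - + 2
  χ = compose (mirror (+ ℓ) m) ψ
  T₂ = map (act χ) S
  m≥1 : 0≤ (m - + 1)
  m≥1 = ≥0-cong big (lem (+ ℓ) (+ n))
    where
    lem : ∀ ℓ n → ℓ - n - + 3 ≡ ℓ - n - + 2 - + 1
    lem = solve-∀
  at-poly : ∀ p q → act ψ p ≡ q → Poly S (ι p) → Poly S (ι (act (inv ψ) q))
  at-poly p q e h = subst (λ r → Poly S (ι r)) (trans (sym (act-inverseˡ ψ p)) (cong (act (inv ψ)) e)) h
  at-int : ∀ p q → act ψ p ≡ q → Int S p → IntHull (Poly S) (ι (act (inv ψ) q))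
  at-int p q e h = subst (λ r → IntHull (Poly S) (ι r)) (trans (sym (act-inverseˡ ψ p)) (cong (act (inv ψ)) e)) (hull-generator p (Int⇒interior {S} {p} h))
  ys = ∀∈map ψ (λ q → 0≤ proj₂ q) ys₀
  bottom = ∀∈map ψ (λ q → proj₂ q ≡ + 0 → 0≤ proj₁ q × 0≤ (+ ℓ - proj₁ q)) bottom₀
  level : ∀ q → Int T q → proj₂ q ≡ + 1 → 0≤ (proj₁ q - + 1) × 0≤ (+ n + + 1 - proj₁ q)
  level q int = subst (λ q → proj₂ q ≡ + 1 → 0≤ (proj₁ q - + 1) × 0≤ (+ n + + 1 - proj₁ q)) (act-inverseʳ ψ q) (level₀ (act (inv ψ) q) (Int-act⁻ ψ q int))
  xs : ∀ q → q ∈ T → 0≤ proj₁ q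
  xs = left-side T (subst (InHull T) eu (InHull-act ψ {S} {u} (poly⇒InHull {S} {u} hu)))
    (subst (Int T) eu' (Int-act ψ {S} {u'} intu')) (λ int → ¬≤-1 (proj₁ (level (+ 0 , + 1) int refl))) ys (λ q i e → proj₁ (bottom q i e))
  χ-at : ∀ p {x y} → act ψ p ≡ (x , y) → act χ p ≡ (+ ℓ - x - m * y , y)
  χ-at p {x} {y} e = trans (act-compose (mirror (+ ℓ) m) ψ p) (trans (cong (act (mirror (+ ℓ) m)) e) (mirror-eq (+ ℓ) m x y))
  ends : ∀ p q x y → act ψ p ≡ (x , y) → (+ ℓ - x - m * y , y) ≡ q → act χ p ≡ q
  ends p q x y e e' = trans (χ-at p e) e'
  k₁ : ∀ ℓ n → ℓ - ℓ - (ℓ - n - + 2) * + 0 ≡ + 0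
  k₁ = solve-∀
  k₂ : ∀ ℓ n → ℓ - (n + + 1) - (ℓ - n - + 2) * + 1 ≡ + 1
  k₂ = solve-∀
  xs₂ : ∀ q → q ∈ T₂ → 0≤ proj₁ q
  xs₂ = left-side T₂ (subst (InHull T₂) (ends v (+ 0 , + 0) (+ ℓ) (+ 0) ev (cong (_, + 0) (k₁ (+ ℓ) (+ n)))) (InHull-act χ {S} {v} (poly⇒InHull {S} {v} hv)))
      (subst (Int T₂) (ends v' (+ 1 , + 1) (+ n + + 1) (+ 1) ev' (cong (_, + 1) (k₂ (+ ℓ) (+ n)))) (Int-act χ {S} {v'} intv'))
      no-int
      (compose∀ (mirror (+ ℓ) m) ψ _ λ { q@(x , y) i → subst (λ q → 0≤ proj₂ q) (sym (mirror-eq (+ ℓ) m x y)) (ys q i) })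
      (compose∀ (mirror (+ ℓ) m) ψ _ λ { q@(x , y) i → subst (λ q → proj₂ q ≡ + 0 → 0≤ proj₁ q) (sym (mirror-eq (+ ℓ) m x y))
        (λ e → ≥0-cong (proj₂ (bottom q i e)) (trans (k₃ (+ ℓ) x m) (cong (λ z → + ℓ - x - m * z) (sym e)))) })
    where
    k₃ : ∀ ℓ x m → ℓ - x ≡ ℓ - x - m * + 0
    k₃ = solve-∀
    k₄ : ∀ ℓ n x → n + + 1 - x + - (ℓ - x - (ℓ - n - + 2) * + 1) ≡ -[1+ 0 ]
    k₄ = solve-∀
    no-int : ¬ Int T₂ (+ 0 , + 1)
    no-int int = contra (proj₁ (act ψ r)) (cong proj₁ eq) (proj₂ (level₀ r intr y≡1))
      where
      r = act (inv χ) (+ 0 , + 1)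
      intr : Int S r
      intr = Int-act⁻ χ (+ 0 , + 1) int
      coords : act χ r ≡ (+ ℓ - proj₁ (act ψ r) - m * proj₂ (act ψ r) , proj₂ (act ψ r))
      coords = χ-at r refl
      y≡1 : proj₂ (act ψ r) ≡ + 1
      y≡1 = cong proj₂ (trans (sym coords) (act-inverseʳ χ (+ 0 , + 1)))
      eq : (+ ℓ - proj₁ (act ψ r) - m * + 1 , + 1) ≡ (+ 0 , + 1)
      eq = trans (cong (λ y → + ℓ - proj₁ (act ψ r) - m * y , y) (sym y≡1)) (trans (sym coords) (act-inverseʳ χ (+ 0 , + 1)))
      contra : ∀ x → + ℓ - x - m * + 1 ≡ + 0 → 0≤ (+ n + + 1 - x) → ⊥
      contra x e h = absurd (h ⊕ ≡⇒≥0 (cong -_ e)) (k₄ (+ ℓ) (+ n) x)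
  right : ∀ q → q ∈ T → 0≤ (+ ℓ - proj₁ q - m * proj₂ q)
  right q@(x , y) i = subst (λ q → 0≤ proj₁ q) (mirror-eq (+ ℓ) m x y) (xs₂ _ (compose∈ (mirror (+ ℓ) m) ψ i))
  outer : ∀ s → s ∈ S → InBox (+ ℓ) (act ψ s)
  outer s i = box (act ψ s) (∈-map⁺ (act ψ) i)
    where
    o₁ : ∀ ℓ x y m → ℓ - x - m * y + (m - + 1) * y + y ≡ ℓ - x
    o₁ = solve-∀
    o₂ : ∀ ℓ x y m → ℓ - x - m * y + x + (m - + 1) * y ≡ ℓ - y
    o₂ = solve-∀
    box : ∀ q → q ∈ T → InBox (+ ℓ) q
    box q@(x , y) j = xs q j , ≥0-cong (right q j ⊕ m≥1 ⊗ ys q j ⊕ ys q j) (o₁ (+ ℓ) x y m) , ys q j , ≥0-cong (right q j ⊕ xs q j ⊕ m≥1 ⊗ ys q j) (o₂ (+ ℓ) x y m)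
  inner : ∀ p → InteriorPt (Poly S) p → InBox (+ n) (act (interior-shift ψ) p)
  inner p hp = shift-box ψ (+ n) p (x-strict q int xs) (≥0-cong (hr ⊕ m≥1 ⊗ hy ⊕ hy) (o₁ (+ ℓ) (+ n) x y)) hy
      (≥0-cong (hr ⊕ x-strict q int xs ⊕ m≥1 ⊗ hy) (o₂ (+ ℓ) (+ n) x y))
    where
    q = act ψ p
    x = proj₁ q
    y = proj₂ q
    int : Int T q
    int = Int-act ψ {S} {p} (interior⇒Int {S} {p} hp)
    hy : 0≤ (y - + 1)
    hy = y-strict q int ys
    f₁ : ∀ ℓ m x y → -[1+ 0 ] * x + - m * y + ℓ ≡ ℓ - x - m * y
    f₁ = solve-∀
    hr : 0≤ (+ ℓ - x - m * y - + 1)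
    hr = ≥0-cong (Int-strict {T} {q} int -[1+ 0 ] (- m) (+ ℓ) (λ ()) (λ { q@(x , y) i → ≥0-cong (right q i) (sym (f₁ (+ ℓ) m x y)) })) (cong (_- + 1) (f₁ (+ ℓ) m x y))
    o₁ : ∀ ℓ n x y → ℓ - x - (ℓ - n - + 2) * y - + 1 + (ℓ - n - + 2 - + 1) * (y - + 1) + (y - + 1) ≡ n + + 1 - x
    o₁ = solve-∀
    o₂ : ∀ ℓ n x y → ℓ - x - (ℓ - n - + 2) * y - + 1 + (x - + 1) + (ℓ - n - + 2 - + 1) * (y - + 1) ≡ n + + 1 - y
    o₂ = solve-∀

record Oriented (S : List Point) (φ : Unimodular) (u v u' v' : Point) (ℓ i j : ℤ) : Set where
  field
    u∈ : Poly S (ι u)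
    v∈ : Poly S (ι v)
    int-u' : Int S u'
    int-v' : Int S v'
    at-u : act φ u ≡ (+ 0 , + 0)
    at-v : act φ v ≡ (ℓ , + 0)
    at-u' : act φ u' ≡ (i , + 1)
    at-v' : act φ v' ≡ (j , + 1)
    above : ∀ s → s ∈ S → 0≤ proj₂ (act φ s)
    face : ∀ s → s ∈ S → proj₂ (act φ s) ≡ + 0 → Seg u v (ι s)
    face' : ∀ p → Int S p → proj₂ (act φ p) ≡ + 1 → Seg u' v' (ι p)

segment-at : ∀ φ l m h (l≤m : 0≤ (m - l)) u v → act φ u ≡ (l , h) → act φ v ≡ (m , h) →
  (∀ p → Seg u v (ι p) → proj₂ (act φ p) ≡ h × 0≤ (proj₁ (act φ p) - l) × 0≤ (m - proj₁ (act φ p))) ×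
  (∀ k → + k ≡ m - l + + 1 → LatticeCount (Seg u v) k)
segment-at φ l m h l≤m u v eu ev =
    (λ p hp → L.segment-coordinates p (subst₂ (λ a b → Seg a b (ι p)) (at u eu) (at v ev) hp)) ,
    (λ k ek → subst₂ (λ a b → LatticeCount (Seg a b) k) (sym (at u eu)) (sym (at v ev)) (L.segment-count k ek))
  where
  module L = LatticeSegment φ l m h l≤m
  at : ∀ p {q} → act φ p ≡ q → p ≡ act (inv φ) q
  at p e = trans (sym (act-inverseˡ φ p)) (cong (act (inv φ)) e)

case5-oriented : ∀ S φ u v u' v' ℓ i j k k' → Oriented S φ u v u' v' ℓ i j → 0≤ ℓ → 0≤ (j - i) →
  LatticeCount (Seg u v) k → LatticeCount (Seg u' v') k' → k' ℕ.+ 3 ℕ.≤ k →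
  IsLS (IntHull (Poly S)) (+ k' - + 1) × IsLS (Poly S) (+ k - + 1)
case5-oriented S φ u v u' v' ℓ i j k k' O ℓ≥0 i≤j ck ck' big = naturals (≥0-nat ℓ≥0) (≥0-nat i≤j)
  where
  open Oriented O
  minus0 : ∀ x → x - + 0 ≡ x
  minus0 = solve-∀
  bottom-seg = segment-at φ (+ 0) ℓ (+ 0) (≥0-cong ℓ≥0 (sym (minus0 ℓ))) u v at-u at-v
  top-seg = segment-at φ i j (+ 1) i≤j u' v' at-u' at-v'
  naturals : ∃[ l ] ℓ ≡ + l → ∃[ n ] j - i ≡ + n → IsLS (IntHull (Poly S)) (+ k' - + 1) × IsLS (Poly S) (+ k - + 1)
  naturals (l , el) (n , en) = subst₂ (λ a b → IsLS (IntHull (Poly S)) a × IsLS (Poly S) b) (pred k' n k'≡) (pred k l k≡)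
      (case5-normalised S ψ u v u' v' l n u∈ v∈ int-u' int-v' (ends u at-u (cong (_, + 0) (q₁ i)))
        (ends v at-v (cong (_, + 0) (trans (q₂ ℓ i) el))) (ends u' at-u' (cong (_, + 1) (q₃ i)))
        (ends v' at-v' (cong (_, + 1) (trans (q₄ i j) (cong (_+ + 1) en))))
        (λ s m → subst (0≤_) (sym (y-at s)) (above s m)) bottoms tops (≥0-cong (ℤP.i≤j⇒0≤j-i (ℤ.+≤+ big)) (trans (cong₂ (λ a b → + a - (+ b + + 3)) k≡ k'≡) (q₅ (+ l) (+ n)))))
    where
    -- Fixes the bottom row and moves the left end of the upper row from `i` to 1.
    ρ = skew (+ 0) (i - + 1)
    ψ = compose ρ φ
    k≡ : k ≡ suc l
    k≡ = count-unique {Seg u v} ck (proj₂ bottom-seg (suc l) (trans (q (+ l)) (cong (λ z → z - + 0 + + 1) (sym el))))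
      where
      q : ∀ l → + 1 + l ≡ l - + 0 + + 1
      q = solve-∀
    k'≡ : k' ≡ suc n
    k'≡ = count-unique {Seg u' v'} ck' (proj₂ top-seg (suc n) (trans (q (+ n)) (cong (_+ + 1) (sym en))))
      where
      q : ∀ l → + 1 + l ≡ l + + 1
      q = solve-∀
    pred : ∀ k l → k ≡ suc l → + l ≡ + k - + 1
    pred _ l refl = q (+ l)
      where
      q : ∀ l → l ≡ + 1 + l - + 1
      q = solve-∀
    ψ-at : ∀ p {x y} → act φ p ≡ (x , y) → act ψ p ≡ (x - + 0 - (i - + 1) * y , y)
    ψ-at p {x} {y} e = trans (act-compose ρ φ p) (trans (cong (act ρ) e) (skew-eq (+ 0) (i - + 1) x y))
    ends : ∀ p {x y q} → act φ p ≡ (x , y) → (x - + 0 - (i - + 1) * y , y) ≡ q → act ψ p ≡ q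
    ends p e e' = trans (ψ-at p e) e'
    y-at : ∀ p → proj₂ (act ψ p) ≡ proj₂ (act φ p)
    y-at p = cong proj₂ (ψ-at p refl)
    x-at : ∀ p → proj₁ (act ψ p) ≡ proj₁ (act φ p) - + 0 - (i - + 1) * proj₂ (act φ p)
    x-at p = cong proj₁ (ψ-at p refl)
    q₁ : ∀ i → + 0 - + 0 - (i - + 1) * + 0 ≡ + 0
    q₁ = solve-∀
    q₂ : ∀ ℓ i → ℓ - + 0 - (i - + 1) * + 0 ≡ ℓ
    q₂ = solve-∀
    q₃ : ∀ i → i - + 0 - (i - + 1) * + 1 ≡ + 1
    q₃ = solve-∀
    q₄ : ∀ i j → j - + 0 - (i - + 1) * + 1 ≡ j - i + + 1
    q₄ = solve-∀
    q₅ : ∀ l n → + 1 + l - (+ 1 + n + + 3) ≡ l - n - + 3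
    q₅ = solve-∀
    bottoms : ∀ s → s ∈ S → proj₂ (act ψ s) ≡ + 0 → 0≤ proj₁ (act ψ s) × 0≤ (+ l - proj₁ (act ψ s))
    bottoms s m e = from (proj₁ bottom-seg s (face s m ey))
      where
      ey : proj₂ (act φ s) ≡ + 0
      ey = trans (sym (y-at s)) e
      ex : proj₁ (act ψ s) ≡ proj₁ (act φ s)
      ex = trans (x-at s) (trans (cong (λ y → proj₁ (act φ s) - + 0 - (i - + 1) * y) ey) (q₂ (proj₁ (act φ s)) i))
      from : proj₂ (act φ s) ≡ + 0 × 0≤ (proj₁ (act φ s) - + 0) × 0≤ (ℓ - proj₁ (act φ s)) → 0≤ proj₁ (act ψ s) × 0≤ (+ l - proj₁ (act ψ s))
      from (_ , h₁ , h₂) = ≥0-cong h₁ (trans (minus0 (proj₁ (act φ s))) (sym ex)) , ≥0-cong h₂ (cong₂ _-_ el (sym ex))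
    tops : ∀ p → Int S p → proj₂ (act ψ p) ≡ + 1 → 0≤ (proj₁ (act ψ p) - + 1) × 0≤ (+ n + + 1 - proj₁ (act ψ p))
    tops p int e = from (proj₁ top-seg p (face' p int ey))
      where
      ey : proj₂ (act φ p) ≡ + 1
      ey = trans (sym (y-at p)) e
      ex : proj₁ (act ψ p) ≡ proj₁ (act φ p) - i + + 1
      ex = trans (x-at p) (trans (cong (λ y → proj₁ (act φ p) - + 0 - (i - + 1) * y) ey) (q₄ i (proj₁ (act φ p))))
      r₁ : ∀ x i → x - i ≡ x - i + + 1 - + 1
      r₁ = solve-∀
      r₂ : ∀ x i j → j - x ≡ j - i + + 1 - (x - i + + 1)
      r₂ = solve-∀
      from : proj₂ (act φ p) ≡ + 1 × 0≤ (proj₁ (act φ p) - i) × 0≤ (j - proj₁ (act φ p)) → 0≤ (proj₁ (act ψ p) - + 1) × 0≤ (+ n + + 1 - proj₁ (act ψ p))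
      from (_ , h₁ , h₂) = ≥0-cong h₁ (trans (r₁ (proj₁ (act φ p)) i) (cong (_- + 1) (sym ex))) ,
        ≥0-cong h₂ (trans (r₂ (proj₁ (act φ p)) i j) (cong₂ (λ a b → a + + 1 - b) en (sym ex)))

-- A form supporting `S` at `p` is, relative to its value there, at least 1 on all interior lattice
-- points, hence on their hull; at `p` itself it would be 0.
IntHull⇒Int : ∀ {S} p → IntHull (Poly S) (ι p) → Int S p
IntHull⇒Int {S} p hp = Int-refute S p λ α β nz all → absurd
    (hull-≥0 α β (- lf α β p - + 1) (λ r hr → ≥0-cong (Int-strict {S} {r} (interior⇒Int {S} {r} hr) α β (- lf α β p) nz all) (l₁ (lf α β r) (lf α β p))) {p} hp)
    (l₂ (lf α β p))
  where
  l₁ : ∀ r p → r + - p - + 1 ≡ r + (- p - + 1)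
  l₁ = solve-∀
  l₂ : ∀ p → p + (- p - + 1) ≡ -[1+ 0 ]
  l₂ = solve-∀

lin-ι : ∀ α β p → lin α β (ι p) ≡ toℚ (lf α β p)
lin-ι α β (x , y) = sym (trans (toℚ-+ (α * x) (β * y)) (cong₂ ℚ._+_ (toℚ-* α x) (toℚ-* β y)))

-- Both forms vanish on v - u ≠ 0, so their determinant is zero. As (A, B) is primitive with Bézout
-- pair (g, h), the factor is the integer gβ - hα.
proportional : ∀ α β A B g h u v → u ≢ v → g * B - h * A ≡ + 1 → lf α β u ≡ lf α β v → lf A B u ≡ lf A B v →
  ∀ p → lf α β p ≡ (g * β - h * α) * lf A B p
proportional α β A B g h u@(ux , uy) v@(vx , vy) u≢v e eα eA (x , y) =
    trans (k₁ (α * x + β * y)) (trans (cong (_* (α * x + β * y)) (sym e)) (trans (k₂ α β A B g h x y)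
      (trans (cong (λ z → (g * β - h * α) * (A * x + B * y) + z * (g * x + h * y)) D≡0) (k₃ ((g * β - h * α) * (A * x + B * y)) (g * x + h * y)))))
  where
  k₁ : ∀ w → w ≡ + 1 * w
  k₁ = solve-∀
  k₂ : ∀ α β A B g h x y → (g * B - h * A) * (α * x + β * y) ≡ (g * β - h * α) * (A * x + B * y) + (α * B - β * A) * (g * x + h * y)
  k₂ = solve-∀
  k₃ : ∀ w t → w + + 0 * t ≡ w
  k₃ = solve-∀
  k₄ : ∀ α β A B ux uy vx vy → (α * B - β * A) * (vx - ux) ≡ B * ((α * vx + β * vy) - (α * ux + β * uy)) - β * ((A * vx + B * vy) - (A * ux + B * uy))
  k₄ = solve-∀
  k₅ : ∀ α β A B ux uy vx vy → (α * B - β * A) * (vy - uy) ≡ α * ((A * vx + B * vy) - (A * ux + B * uy)) - A * ((α * vx + β * vy) - (α * ux + β * uy))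
  k₅ = solve-∀
  k₆ : ∀ B β s t → B * (s - s) - β * (t - t) ≡ + 0
  k₆ = solve-∀
  D₁ : (α * B - β * A) * (vx - ux) ≡ + 0
  D₁ = trans (k₄ α β A B ux uy vx vy) (trans (cong₂ (λ s t → B * (s - (α * ux + β * uy)) - β * (t - (A * ux + B * uy))) (sym eα) (sym eA)) (k₆ B β (α * ux + β * uy) (A * ux + B * uy)))
  D₂ : (α * B - β * A) * (vy - uy) ≡ + 0
  D₂ = trans (k₅ α β A B ux uy vx vy) (trans (cong₂ (λ s t → α * (t - (A * ux + B * uy)) - A * (s - (α * ux + β * uy))) (sym eα) (sym eA)) (k₆ α A (A * ux + B * uy) (α * ux + β * uy)))
  D≡0 : α * B - β * A ≡ + 0
  D≡0 = go (ℤP.i*j≡0⇒i≡0∨j≡0 (α * B - β * A) D₁) (ℤP.i*j≡0⇒i≡0∨j≡0 (α * B - β * A) D₂)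
    where
    go : α * B - β * A ≡ + 0 ⊎ vx - ux ≡ + 0 → α * B - β * A ≡ + 0 ⊎ vy - uy ≡ + 0 → α * B - β * A ≡ + 0
    go (inj₁ d) _ = d
    go (inj₂ _) (inj₁ d) = d
    go (inj₂ w₁) (inj₂ w₂) = ⊥-elim (u≢v (sym (cong₂ _,_ (ℤP.i-j≡0⇒i≡j vx ux w₁) (ℤP.i-j≡0⇒i≡j vy uy w₂))))

module ParallelEdges (S : List Point) (u v u' v' : Point) (k k' : ℕ) (u≢v : u ≢ v) (hu : Poly S (ι u)) (hv : Poly S (ι v))
  (int-u' : Int S u') (int-v' : Int S v') (ck : LatticeCount (Seg u v) k) (ck' : LatticeCount (Seg u' v') k') (big : k' ℕ.+ 3 ℕ.≤ k) where

  Result : Set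
  Result = IsLS (IntHull (Poly S)) (+ k' - + 1) × IsLS (Poly S) (+ k - + 1)

  module _ (A B : ℤ) (above : ∀ s → s ∈ S → 0≤ (lf A B s + - lf A B u)) (eu : lf A B v + - lf A B u ≡ + 0)
    (eu' : lf A B u' + - lf A B u ≡ + 1) (ev' : lf A B v' + - lf A B u ≡ + 1)
    (face : ∀ s → s ∈ S → lf A B s + - lf A B u ≡ + 0 → Seg u v (ι s))
    (face' : ∀ p → Int S p → lf A B p + - lf A B u ≡ + 1 → Seg u' v' (ι p)) where

    -- The two edges may be directed oppositely; the ends of the upper one are exchanged if they are
    -- in the wrong order.
    with-rows : ∀ g h → (g * B - h * A ≡ + 1) ⊎ (g * B - h * A ≡ -[1+ 0 ]) → 0≤ (lf g h v + - lf g h u) → Result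
    with-rows g h det1 ℓ≥0 = orient (signs (j - i))
      where
      φ : Unimodular
      φ = record { a = g ; b = h ; c = A ; d = B ; e = - lf g h u ; f = - lf A B u ; unimod = det1 }
      ℓ = lf g h v + - lf g h u
      i = lf g h u' + - lf g h u
      j = lf g h v' + - lf g h u
      turn : ∀ i j → - (j - i) - + 1 + + 1 ≡ i - j
      turn = solve-∀
      orient : 0≤ (j - i) ⊎ 0≤ (- (j - i) - + 1) → Result
      orient (inj₁ i≤j) = case5-oriented S φ u v u' v' ℓ i j k k' (record
        { u∈ = hu ; v∈ = hv ; int-u' = int-u' ; int-v' = int-v'
        ; at-u = cong₂ _,_ (ℤP.+-inverseʳ (lf g h u)) (ℤP.+-inverseʳ (lf A B u)) ; at-v = cong (ℓ ,_) eu
        ; at-u' = cong (i ,_) eu' ; at-v' = cong (j ,_) ev' ; above = above ; face = face ; face' = face' }) ℓ≥0 i≤j ck ck' big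
      orient (inj₂ j<i) = case5-oriented S φ u v v' u' ℓ j i k k' (record
        { u∈ = hu ; v∈ = hv ; int-u' = int-v' ; int-v' = int-u'
        ; at-u = cong₂ _,_ (ℤP.+-inverseʳ (lf g h u)) (ℤP.+-inverseʳ (lf A B u)) ; at-v = cong (ℓ ,_) eu
        ; at-u' = cong (j ,_) ev' ; at-v' = cong (i ,_) eu' ; above = above ; face = face
        ; face' = λ p int e → hull-mono swap₂ {ι p} (face' p int e) }) ℓ≥0 (≥0-cong (j<i ⊕ nat≥0 {1}) (turn i j)) ck (count-swap ck') big
        where
        swap₂ : ∀ {a b : Point} p → p ∈ a ∷ b ∷ [] → p ∈ b ∷ a ∷ []
        swap₂ p (here refl) = there (here refl)
        swap₂ p (there (here refl)) = here refl

    with-bezout : ∀ g h → g * B - h * A ≡ + 1 → Result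
    with-bezout g h e = go (signs (lf g h v + - lf g h u))
      where
      k₁ : ∀ g h A B → - g * B - - h * A ≡ - (g * B - h * A)
      k₁ = solve-∀
      k₂ : ∀ g h vx vy ux uy → - (g * vx + h * vy + - (g * ux + h * uy)) - + 1 + + 1 ≡ - g * vx + - h * vy + - (- g * ux + - h * uy)
      k₂ = solve-∀
      go : 0≤ (lf g h v + - lf g h u) ⊎ 0≤ (- (lf g h v + - lf g h u) - + 1) → Result
      go (inj₁ h≥) = with-rows g h (inj₁ e) h≥
      go (inj₂ h<) = with-rows (- g) (- h) (inj₂ (trans (k₁ g h A B) (cong -_ e)))
        (≥0-cong (h< ⊕ nat≥0 {1}) (k₂ g h (proj₁ v) (proj₂ v) (proj₁ u) (proj₂ u)))

  module _ (α β α₂ β₂ : ℤ) (maximal : ∀ s → s ∈ S → 0≤ (lf α β u - lf α β s))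
    (face : ∀ s → s ∈ S → lf α β s ≡ lf α β u → Seg u v (ι s)) (face' : ∀ p → Int S p → lf α₂ β₂ p ≡ lf α₂ β₂ u' → Seg u' v' (ι p)) where

    -- The edge maximises (α, β) = c (A, B) with c < 0, so (A, B) is minimal on it. The interior
    -- point `u'` lies strictly above, which decides that the second line is at distance +1 and not
    -- -1.
    signed : ∀ A B g h c c₂ → g * B - h * A ≡ + 1 → NonZeroForm A B → (∀ p → lf α β p ≡ c * lf A B p) → (∀ p → lf α₂ β₂ p ≡ c₂ * lf A B p) → 0≤ (- c - + 1) →
      lf A B u ≡ lf A B v → lf A B u' ≡ lf A B v' → ℤ.∣ lf A B u - lf A B u' ∣ ≡ 1 → Result
    signed A B g h c c₂ e nz prop prop₂ hc euv eu'v' dist = with-bezout A B above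
        (trans (cong (λ z → z + - lf A B u) (sym euv)) (ℤP.+-inverseʳ (lf A B u))) y-u' (trans (cong (λ z → z + - lf A B u) (sym eu'v')) y-u')
        (λ s i e₀ → face s i (trans (prop s) (trans (cong (c *_) (back (lf A B s) (lf A B u) e₀)) (sym (prop u)))))
        (λ p int e₁ → face' p int (trans (prop₂ p) (trans (cong (c₂ *_) (same (lf A B p) (lf A B u') (lf A B u) e₁ y-u')) (sym (prop₂ u')))))
        g h e
      where
      k₁ : ∀ c u s → c * u - c * s + (- c - + 1) ≡ - c * (s + - u) + - c - + 1
      k₁ = solve-∀
      above : ∀ s → s ∈ S → 0≤ (lf A B s + - lf A B u)
      above s i = ≥0-cancel (- c) (lf A B s + - lf A B u) hc (≥0-cong (maximal s i ⊕ hc)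
        (trans (cong₂ (λ a b → a - b + (- c - + 1)) (prop u) (prop s)) (k₁ c (lf A B u) (lf A B s))))
      back : ∀ s u → s + - u ≡ + 0 → s ≡ u
      back s u = ℤP.i-j≡0⇒i≡j s u
      k₂ : ∀ p u → p ≡ p + - u + u
      k₂ = solve-∀
      same : ∀ p q u → p + - u ≡ + 1 → q + - u ≡ + 1 → p ≡ q
      same p q u e₁ e₂ = trans (k₂ p u) (trans (cong (_+ u) (trans e₁ (sym e₂))) (sym (k₂ q u)))
      inside : 0≤ (lf A B u' + - lf A B u - + 1)
      inside = Int-strict {S} {u'} int-u' A B (- lf A B u) nz above
      one : ∀ x y → ℤ.∣ x - y ∣ ≡ 1 → 0≤ (y + - x - + 1) → y + - x ≡ + 1
      one x y d h = go (∣∣-cases (x - y))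
        where
        k₃ : ∀ x y → y + - x ≡ - (x - y)
        k₃ = solve-∀
        k₄ : ∀ x y → y + - x - + 1 + (x - y) ≡ -[1+ 0 ]
        k₄ = solve-∀
        go : (x - y ≡ + ℤ.∣ x - y ∣) ⊎ (x - y ≡ - (+ ℤ.∣ x - y ∣)) → y + - x ≡ + 1
        go (inj₁ e) = ⊥-elim (absurd (h ⊕ ≥0-cong (nat≥0 {ℤ.∣ x - y ∣}) (sym e)) (k₄ x y))
        go (inj₂ e) = trans (k₃ x y) (cong -_ (trans e (cong (λ n → - (+ n)) d)))
      y-u' : lf A B u' + - lf A B u ≡ + 1
      y-u' = one (lf A B u) (lf A B u') dist inside

case5 : ∀ S u v u' v' k k' → Case5 (Poly S) u v u' v' k k' →
  IsLS (IntHull (Poly S)) (+ k' - + 1) × IsLS (Poly S) (+ k - + 1)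
case5 S u v u' v' k k' ((u≢v , hu , hv , α , β , nz , elin , max , face) , (u'≢v' , hu' , hv' , α₂ , β₂ , _ , elin₂ , _ , face₂) , _ ,
    (A , B , γ , γ' , cop , eu , ev , eu' , ev' , dist) , ck , ck' , big) = go (bezout A B cop)
  where
  int : ∀ p → IntHull (Poly S) (ι p) → Int S p
  int p = IntHull⇒Int {S} p
  module C = ParallelEdges S u v u' v' k k' u≢v hu hv (int u' hu') (int v' hv') ck ck' big
  maximal : ∀ s → s ∈ S → 0≤ (lf α β u - lf α β s)
  maximal s i = ℤP.i≤j⇒0≤j-i (toℚ-cancel {lf α β s} {lf α β u} (subst₂ ℚ._≤_ (lin-ι α β s) (lin-ι α β u) (max (ι s) (hull-generator s i))))
  on-face : ∀ s → s ∈ S → lf α β s ≡ lf α β u → Seg u v (ι s)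
  on-face s i e = face (ι s) (hull-generator s i) (trans (lin-ι α β s) (trans (cong toℚ e) (sym (lin-ι α β u))))
  on-face' : ∀ p → Int S p → lf α₂ β₂ p ≡ lf α₂ β₂ u' → Seg u' v' (ι p)
  on-face' p intp e = face₂ (ι p) (hull-generator p (Int⇒interior {S} {p} intp)) (trans (lin-ι α₂ β₂ p) (trans (cong toℚ e) (sym (lin-ι α₂ β₂ u'))))
  euv : lf A B u ≡ lf A B v
  euv = trans eu (sym ev)
  eu'v' : lf A B u' ≡ lf A B v'
  eu'v' = trans eu' (sym ev')
  d₁ : ℤ.∣ lf A B u - lf A B u' ∣ ≡ 1
  d₁ = trans (cong₂ (λ a b → ℤ.∣ a - b ∣) eu eu') dist
  go : ∃[ g ] ∃[ h ] g * B - h * A ≡ + 1 → IsLS (IntHull (Poly S)) (+ k' - + 1) × IsLS (Poly S) (+ k - + 1)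
  go (g , h , e) = sign (trichotomy c)
    where
    c = g * β - h * α
    c₂ = g * β₂ - h * α₂
    prop : ∀ p → lf α β p ≡ c * lf A B p
    prop = proportional α β A B g h u v u≢v e (toℚ-injective (trans (sym (lin-ι α β u)) (trans elin (lin-ι α β v)))) euv
    prop₂ : ∀ p → lf α₂ β₂ p ≡ c₂ * lf A B p
    prop₂ = proportional α₂ β₂ A B g h u' v' u'≢v' e (toℚ-injective (trans (sym (lin-ι α₂ β₂ u')) (trans elin₂ (lin-ι α₂ β₂ v')))) eu'v'
    0≢1 : + 0 ≢ + 1
    0≢1 ()
    z : ∀ g h → g * + 0 - h * + 0 ≡ + 0
    z = solve-∀
    nzAB : NonZeroForm A B
    nzAB (refl , refl) = 0≢1 (trans (sym (z g h)) e)
    neg : ∀ p → lf (- A) (- B) p ≡ - lf A B p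
    neg (x , y) = lem A B x y
      where
      lem : ∀ A B x y → - A * x + - B * y ≡ - (A * x + B * y)
      lem = solve-∀
    negneg : ∀ c w → c * w ≡ - c * - w
    negneg = solve-∀
    prop⁻ : ∀ {α β} c → (∀ p → lf α β p ≡ c * lf A B p) → ∀ p → lf α β p ≡ - c * lf (- A) (- B) p
    prop⁻ c pr p = trans (pr p) (trans (negneg c (lf A B p)) (cong (- c *_) (sym (neg p))))
    w₁ : ∀ g h A B → - g * - B - - h * - A ≡ g * B - h * A
    w₁ = solve-∀
    w₂ : ∀ a b → - a - - b ≡ - (a - b)
    w₂ = solve-∀
    w₃ : ∀ c → c - + 1 ≡ - - c - + 1
    w₃ = solve-∀
    lx : ∀ a b → a * + 1 + b * + 0 ≡ a
    lx = solve-∀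
    ly : ∀ a b → a * + 0 + b * + 1 ≡ b
    ly = solve-∀
    -- The equation of the supporting line is given only up to sign; it is negated where necessary
    -- to make it minimal on the edge. A factor c = 0 would make (α, β) the zero form.
    sign : 0≤ (c - + 1) ⊎ c ≡ + 0 ⊎ 0≤ (- c - + 1) → IsLS (IntHull (Poly S)) (+ k' - + 1) × IsLS (Poly S) (+ k - + 1)
    sign (inj₂ (inj₂ hc)) = C.signed α β α₂ β₂ maximal on-face on-face' A B g h c c₂ e nzAB prop prop₂ hc euv eu'v' d₁
    sign (inj₂ (inj₁ c≡0)) = ⊥-elim (nz (trans (sym (lx α β)) (vanish (+ 1 , + 0)) , trans (sym (ly α β)) (vanish (+ 0 , + 1))))
      where
      vanish : ∀ p → lf α β p ≡ + 0
      vanish p = trans (prop p) (trans (cong (_* lf A B p) c≡0) (ℤP.*-zeroˡ (lf A B p)))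
    sign (inj₁ hc) = C.signed α β α₂ β₂ maximal on-face on-face' (- A) (- B) (- g) (- h) (- c) (- c₂) (trans (w₁ g h A B) e)
      (λ { (e₁ , e₂) → nzAB (neg-zero e₁ , neg-zero e₂) }) (prop⁻ {α} {β} c prop) (prop⁻ {α₂} {β₂} c₂ prop₂) (≥0-cong hc (w₃ c))
      (trans (neg u) (trans (cong -_ euv) (sym (neg v)))) (trans (neg u') (trans (cong -_ eu'v') (sym (neg v'))))
      (trans (cong ℤ.∣_∣ (trans (cong₂ _-_ (neg u) (neg u')) (w₂ (lf A B u) (lf A B u')))) (trans (ℤP.∣-i∣≡∣i∣ (lf A B u - lf A B u')) d₁))

theorem4 : (S : List Point) → TwoDim S →
    ((a b : ℕ) → Case1 (Poly S) a b →
    IsLS (IntHull (Poly S)) -[1+ 0 ] × IsLS (Poly S) (+ a))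
    × (Case2 (Poly S) → IsLS (IntHull (Poly S)) -[1+ 0 ] × IsLS (Poly S) (+ 2))
    × (Case3 (Poly S) → IsLS (IntHull (Poly S)) (+ 0) × IsLS (Poly S) (+ 3))
    × (Case4 (Poly S) → IsLS (IntHull (Poly S)) (+ 0) × IsLS (Poly S) (+ 4))
    × ((u v u' v' : Point) (k k' : ℕ) → Case5 (Poly S) u v u' v' k k' →
    IsLS (IntHull (Poly S)) (+ k' ℤ.- + 1) × IsLS (Poly S) (+ k ℤ.- + 1))
    × (((a b : ℕ) → ¬ Case1 (Poly S) a b) → ¬ Case2 (Poly S) → ¬ Case3 (Poly S)
    → ¬ Case4 (Poly S)
    → ((u v u' v' : Point) (k k' : ℕ) → ¬ Case5 (Poly S) u v u' v' k k')
    → ∃[ n ] (IsLS (IntHull (Poly S)) n × IsLS (Poly S) (n ℤ.+ + 2)))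
theorem4 S two = case1 S , case2 S , case3 S , case4 S , case5 S ,
  λ no1 no2 no3 no4 no5 → General.conclusion S two no1 no2 no3 no4 no5
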